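{- Let $m$ and $n$ be positive integers and let $\kappa=2m+2n+2$. Then, as formal power series in $q$, \begin{align*} \sum_{\substack{\lambda \\ \lambda_1\leq m}} q^{|\lambda|} P_{2\lambda}\big(1,q,q^2,\dots;q^{2n}\big) &=\frac{(q^2;q^2)_{\infty}(q^{\kappa/2};q^{\kappa/2})_{\infty} (q^{\kappa};q^{\kappa})_{\infty}^{n-1}}{(q;q)_{\infty}^{n+1}} \prod_{i=1}^n \theta\big(q^i;q^{\kappa/2}\big) \prod_{1\leq i<j\leq n} \theta\big(q^{j-i},q^{i+j};q^{\kappa}\big)\\ &=\frac{(q^{\kappa};q^{\kappa})_{\infty}^m}{(q;q)_{\infty}^m} \prod_{i=1}^m \theta\big(q^{i+1};q^{\kappa}\big) \prod_{1\leq i<j\leq m} \theta\big(q^{j-i},q^{i+j+1};q^{\kappa}\big), \end{align*} where the sum runs over all integer partitions $\lambda$ (including the empty partition) with largest part $\lambda_1\le m$.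
   Context: For a partition $\lambda=(\lambda_1,\lambda_2,\dots)$, $|\lambda|=\lambda_1+\lambda_2+\cdots$, $2\lambda=(2\lambda_1,2\lambda_2,\dots)$, $l(\lambda)$ is the number of positive parts, and $m_i=m_i(\lambda)$ is the multiplicity of parts equal to $i$. Notation: $(a;q)_k=(1-a)(1-aq)\cdots(1-aq^{k-1})$ for $k\in\{0,1,2,\dots\}\cup\{\infty\}$; $\theta(a;q)=(a;q)_\infty(q/a;q)_\infty$ and $\theta(a_1,\dots,a_k;q)=\theta(a_1;q)\cdots\theta(a_k;q)$. The Hall–Littlewood polynomial in $N$ variables $x=(x_1,\dots,x_N)$ with parameter $t$ is $P_\lambda(x;t)=\frac{1}{v_\lambda(t)}\sum_{w\in S_N} w\Big(x_1^{\lambda_1}\cdots x_N^{\lambda_N}\prod_{i<j}\frac{x_i-tx_j}{x_i-x_j}\Big)$ for $l(\lambda)\le N$, where $S_N$ permutes the variables and $v_\lambda(t)=\prod_{i=0}^N (t;t)_{m_i}/(1-t)^{m_i}$ with $m_0=N-l(\lambda)$; $P_\lambda(x;t)=0$ if $l(\lambda)>N$. These are stable under setting $x_N=0$ and so define symmetric functions $P_\lambda(x;t)$ in infinitely many variables; $P_\lambda(1,q,q^2,\dots;t)$ denotes the specialisation $x_i=q^{i-1}$ ($i\ge1$), a formal power series in $q$. -}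

module Defs where

open import Data.Nat as ℕ using (ℕ; zero; suc; _∸_; _⊓_; _⊔_; _<ᵇ_; _≡ᵇ_)
open import Data.Integer as ℤ using (ℤ; +_; -_; _+_; _*_; _-_)
open import Data.List using (List; []; _∷_; map; foldr; upTo; concatMap; length; replicate; _++_; zipWith)
open import Data.Bool using (Bool; true; false; if_then_else_)
open import Data.Product using (_×_; _,_)
open import Relation.Binary.PropositionalEquality using (_≡_)

-- Formal power series  f = Σ_k f k · q^k

Series : Set
Series = ℕ → ℤ

_≈S_ : Series → Series → Set
f ≈S g = ∀ k → f k ≡ g k

sumℤ : List ℤ → ℤ
sumℤ = foldr _+_ (+ 0)

sumℕ : List ℕ → ℕ
sumℕ = foldr ℕ._+_ 0

0S : Series
0S _ = + 0

1S : Series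
1S zero = + 1
1S (suc _) = + 0

mono : ℕ → Series
mono e k = if e ≡ᵇ k then + 1 else + 0

infixl 6 _⊕_ _⊖_
infixl 7 _⊗_ _⊘_

_⊕_ : Series → Series → Series
(f ⊕ g) k = f k + g k

_⊖_ : Series → Series → Series
(f ⊖ g) k = f k - g k

_⊗_ : Series → Series → Series
(f ⊗ g) k = sumℤ (map (λ i → f i * g (k ∸ i)) (upTo (suc k)))

sumS : List Series → Series
sumS = foldr _⊕_ 0S

prodS : List Series → Series
prodS = foldr _⊗_ 1S

powS : Series → ℕ → Series
powS f zero = 1S
powS f (suc k) = f ⊗ powS f k

-- Multiplicative inverse of a series whose constant term is a unit
-- (+1 or -1) of ℤ; only ever applied to such series below.
-- invRev f n = (g n , g (n-1) , … , g 0) where g = f⁻¹.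
private
  dot : Series → ℕ → List ℤ → ℤ
  dot f j [] = + 0
  dot f j (x ∷ xs) = f (suc j) * x + dot f (suc j) xs

  invRev : Series → ℕ → List ℤ
  invRev f zero = f 0 ∷ []
  invRev f (suc n) = (- (f 0 * dot f 0 r)) ∷ r
    where r = invRev f n

  hd : List ℤ → ℤ
  hd [] = + 0
  hd (x ∷ _) = x

invS : Series → Series
invS f n = hd (invRev f n)

_⊘_ : Series → Series → Series
f ⊘ g = f ⊗ invS g

from1 : ℕ → List ℕ
from1 n = map suc (upTo n)

pochFin : ℕ → ℕ → ℕ → Series
pochFin c d k = prodS (map (λ j → 1S ⊖ mono (c ℕ.+ j ℕ.* d)) (upTo k))

-- (q^c ; q^d)_∞ as a formal power series (q-adic limit): for c, d ≥ 1
-- the factors with index j ≥ N+1 are ≡ 1 mod q^(N+1), so the N-th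
-- coefficient is that of the partial product over j ≤ N.
pochInf : ℕ → ℕ → Series
pochInf c d N = pochFin c d (suc N) N

-- θ(q^a ; q^d) = (q^a;q^d)_∞ (q^d/q^a;q^d)_∞   (used with 0 < a < d)
theta : ℕ → ℕ → Series
theta a d = pochInf a d ⊗ pochInf (d ∸ a) d

insertions : ℕ → List ℕ → List (List ℕ)
insertions x [] = (x ∷ []) ∷ []
insertions x (y ∷ ys) = (x ∷ y ∷ ys) ∷ map (y ∷_) (insertions x ys)

perms : List ℕ → List (List ℕ)
perms [] = [] ∷ []
perms (x ∷ xs) = concatMap (insertions x) (perms xs)

count : ℕ → List ℕ → ℕ
count i [] = 0
count i (x ∷ xs) = (if i ≡ᵇ x then 1 else 0) ℕ.+ count i xs

maxL : List ℕ → ℕ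
maxL = foldr _⊔_ 0

-- Hall–Littlewood polynomial P_μ(x_1,…,x_M ; t) evaluated at
-- x_i = q^(i-1) and t = q^e, as a formal power series in q.
-- A permutation w ∈ S_M is the list (w(1)-1, …, w(M)-1), so that
-- w(x_i) = x_{w(i)} = q^(w(i)-1).

-- (x_{wi} - t x_{wj}) / (x_{wi} - x_{wj}) with x_{wi} = q^a, x_{wj} = q^b,
-- t = q^e, a ≠ b;  the common factor q^(min a b) is cancelled, after
-- which the denominator has constant term ±1.
hlFactor : ℕ → ℕ → ℕ → Series
hlFactor e a b = (mono (a ∸ s) ⊖ mono ((b ℕ.+ e) ∸ s)) ⊘ (mono (a ∸ s) ⊖ mono (b ∸ s))
  where s = a ⊓ b

hlProd : ℕ → List ℕ → Series
hlProd e [] = 1S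
hlProd e (a ∷ ws) = prodS (map (hlFactor e a) ws) ⊗ hlProd e ws

-- w( x_1^{μ_1} ⋯ x_M^{μ_M} ∏_{i<j} (x_i - t x_j)/(x_i - x_j) )
hlTerm : ℕ → List ℕ → List ℕ → Series
hlTerm e μpad w = mono (sumℕ (zipWith ℕ._*_ μpad w)) ⊗ hlProd e w

-- v_μ(t) = ∏_{i ≥ 0} (t;t)_{m_i} / (1-t)^{m_i}, m_0 = M - l(μ)
vFactor : ℕ → List ℕ → Series
vFactor e μpad =
  prodS (map (λ i → pochFin e e (count i μpad) ⊘ powS (1S ⊖ mono e) (count i μpad))
             (upTo (suc (maxL μpad))))

-- P_μ(1, q, …, q^(M-1) ; q^e), μ a partition given as the list of its
-- positive parts; zero if l(μ) > M.
HL : ℕ → ℕ → List ℕ → Series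
HL M e μ =
  if M <ᵇ length μ then 0S
  else sumS (map (hlTerm e μpad) (perms (upTo M))) ⊘ vFactor e μpad
  where μpad = μ ++ replicate (M ∸ length μ) 0

-- P_μ(1, q, q², … ; q^e): by stability, its coefficient of q^N equals the
-- coefficient of q^N in P_μ(1, q, …, q^N ; q^e) (variables x_i, i > N+1,
-- only contribute to degrees > N).
HLspec : ℕ → List ℕ → Series
HLspec e μ N = HL (suc N) e μ N

-- partitions of s with all parts ≤ m, as weakly decreasing lists of
-- positive parts (fuel argument ≥ s)
partsF : ℕ → ℕ → ℕ → List (List ℕ)
partsF _ _ zero = [] ∷ []
partsF zero _ (suc _) = []
partsF (suc f) m (suc s) =
  concatMap (λ k → map (k ∷_) (partsF f k (suc s ∸ k))) (from1 (m ⊓ suc s))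

partitionsBounded : ℕ → ℕ → List (List ℕ)
partitionsBounded m s = partsF s m s

double : List ℕ → List ℕ
double = map (2 ℕ.*_)

-- Σ_{λ, λ_1 ≤ m} q^{|λ|} P_{2λ}(1,q,q²,…; q^{2n});  the coefficient of q^N
-- only involves partitions with |λ| ≤ N.
LHS : ℕ → ℕ → Series
LHS m n N =
  sumℤ (concatMap (λ s → map (λ lam → (mono s ⊗ HLspec (2 ℕ.* n) (double lam)) N)
                              (partitionsBounded m s))
                  (upTo (suc N)))

pairs : ℕ → List (ℕ × ℕ)
pairs n = concatMap (λ j → map (λ i → (i , j)) (from1 (j ∸ 1))) (from1 n)

kappa : ℕ → ℕ → ℕ
kappa m n = 2 ℕ.* m ℕ.+ 2 ℕ.* n ℕ.+ 2

RHS1 : ℕ → ℕ → Series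
RHS1 m n =
  (pochInf 2 2 ⊗ pochInf h h ⊗ powS (pochInf κ κ) (n ∸ 1)
     ⊗ prodS (map (λ i → theta i h) (from1 n))
     ⊗ prodS (map (λ { (i , j) → theta (j ∸ i) κ ⊗ theta (i ℕ.+ j) κ }) (pairs n)))
  ⊘ powS (pochInf 1 1) (suc n)
  where
    κ = kappa m n
    h = m ℕ.+ n ℕ.+ 1

RHS2 : ℕ → ℕ → Series
RHS2 m n =
  (powS (pochInf κ κ) m ⊘ powS (pochInf 1 1) m)
     ⊗ prodS (map (λ i → theta (suc i) κ) (from1 m))
     ⊗ prodS (map (λ { (i , j) → theta (j ∸ i) κ ⊗ theta (suc (i ℕ.+ j)) κ }) (pairs m))
  where
    κ = kappa m n

-- Put t = q^(2n).  Splitting off the variables that carry the largest parts turns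
-- the sum of the P_2λ over λ₁ ≤ m, in finitely many variables, into a recursion on m.
-- It is solved by a sum over the replacements of variables x by 1/x (a bounded
-- Littlewood identity), which rests on a summation over all choices of signs,
-- proved by regarding both sides as polynomials in an auxiliary variable.
--
-- For the variables q^(i + 1/2), i < 2nL, these and their inverses form n chains of
-- ratio t and length 2L.  The weight vanishes if neighbours in a chain are inverted
-- in the wrong order, so only cuts of the chains survive, and the sum over them is an
-- n × n determinant by a Weyl denominator formula.  A second system of chains, with
-- ratio q^κ and a weight that the same summation evaluates in closed form, gives the
-- transposed determinant in the limit L → ∞.  This yields the first product.
--
-- The second product follows by induction from (m , n + 1) to (m + 1 , n), starting
-- at m = 0, where the sum is 1.  As κ does not change, both products are multiplied
-- by the same factor: (q; q)_∞ is the product of (q^a; q^κ)_∞ over 1 ≤ a ≤ κ.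

module Submission where

open import Algebra.Bundles using (CommutativeRing)
open import Data.Bool using (Bool; true; false; not; _xor_; if_then_else_)
import Data.Bool.Properties as Boolₚ
open import Data.Empty using (⊥; ⊥-elim)
open import Data.Fin using (Fin)
open import Data.Integer as ℤ using (ℤ; 0ℤ; +_; 1ℤ; ∣_∣; -[1+_])
import Data.Integer.Properties as ℤₚ
open import Data.Integer.Tactic.RingSolver using () renaming (solve-∀ to ℤ-ring)
open import Data.List as List using (List; []; _∷_; _++_; length; map; upTo; applyUpTo; replicate; concatMap; zipWith)
open import Data.List.Membership.Propositional using (_∈_)
open import Data.List.Membership.Propositional.Properties using (∈-++⁺ʳ; ∈-map⁻; ∈-upTo⁺; ∈-∃++)
import Data.List.Properties as Listₚ
open import Data.List.Relation.Binary.Permutation.Propositional as Perm using (_↭_; prep; swap; ↭-trans; ↭-sym; ↭-reflexive)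
open import Data.List.Relation.Binary.Permutation.Propositional.Properties as Permₚ using (All-resp-↭; shift; ↭-length)
open import Data.List.Relation.Unary.All as All using (All; []; _∷_)
import Data.List.Relation.Unary.All.Properties as Allₚ
open import Data.List.Relation.Unary.AllPairs using (AllPairs; []; _∷_)
import Data.List.Relation.Unary.AllPairs.Properties as AllPairsₚ
open import Data.List.Relation.Unary.Any using (here; there)
open import Data.List.Relation.Unary.Unique.Propositional.Properties using (upTo⁺)
open import Data.Nat as ℕ using (ℕ; zero; suc; _≤_; _<_; s≤s; z≤n; _∸_; _⊔_; _⊓_; _≡ᵇ_)
open import Data.Nat.Properties as ℕₚ using (*-mono-≤; *-monoʳ-≤; *-monoˡ-≤; *-suc; +-mono-<; +-mono-<-≤; +-mono-≤; +-monoʳ-≤; +-monoˡ-<; +-monoˡ-≤; +-suc; +-∸-assoc; <-cmp; <-irrefl; <-trans; <-≤-trans; <⇒≤; m+[n∸m]≡n; m+n∸m≡n; m+n∸n≡m; m<n⇒0<n∸m; m<n⇒m<1+n; m∸n+n≡m; m∸n≤m; m≤m+n; m≤m⊔n; m≤n+m; m≤n⇒m∸n≡0; m≤n⇒m≤1+n; m≤n⇒m⊓n≡m; m≤n⊔m; m≥n⇒m⊓n≡n; m⊓n≤m; m⊓n≤n; m⊔n≤o⇒m≤o; m⊔n≤o⇒n≤o; n∸n≡0; n≤1+n; n≮0; suc-injective; ≤-<-trans; ≤-pred; ≤-refl; ≤-reflexive; ≤-total; ≤-trans; ≤∧≢⇒<; ≮⇒≥)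
open import Data.Nat.Tactic.RingSolver using () renaming (solve-∀ to ℕ-ring)
open import Data.Product using (_×_; _,_; proj₁; proj₂; Σ; ∃)
open import Data.Sum using (inj₁; inj₂; _⊎_)
open import Data.Unit using (⊤)
open import Data.Vec as Vec using (Vec; []; _∷_)
import Data.Vec.Properties as Vecₚ
open import Function using (_∘_)
open import Level using (0ℓ)
open import Relation.Binary.Definitions using (tri<; tri≈; tri>)
open import Relation.Binary.PropositionalEquality as ≡ using (cong; cong₂; subst; _≢_; _≡_)
open import Relation.Nullary using (Dec; yes; no)
import Defs
import Relation.Binary.Reasoning.Setoid as SetoidReasoning
import Algebra.Properties.CommutativeSemigroup

-- Homogeneity turns q^|λ| P_2λ(1, q, q^2, ...) into P_2λ(q^(1/2), q^(3/2), ...); inverting the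
-- first half of each chain gives exactly these variables. Products of weights along a chain
-- telescope, so a cut enters only through the midpoint of its gap, and the midpoints enter through
-- a Weyl denominator with factors E (-a) - E a. Hence E a is a square root of X a, and q = E 4.
--
-- The determinant is not evaluated directly. Its entries tend to theta series with exponents
-- 8νν′r^2 + 4(νy ± ν′c)r ± cy, c being the column; up to the sign of r these are symmetric under
-- exchanging (ν, y) with (ν′, c). The second system is made for the exchanged data: starting points
-- 2, 4, ..., 2n, columns 1, 3, ..., 2n - 1, and the numerator (1 + X)(1 + q^h X), h = κ/2, for
-- which the sign sum is a product.
--
-- Before the limit everything is algebra in a commutative ring where the E a and the 1 - X a with a
-- ≠ 0 are invertible and doubling is injective. Cancellation hypotheses therefore replace a field.

module Base where

 -- Rings with formal exponentials and a valuation

 record ExpRing : Set₁ where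
  field
   commRing : CommutativeRing 0ℓ 0ℓ
  open CommutativeRing commRing public hiding (zero; ring)
  field
   E   : ℤ → Carrier
   E-0 : E 0ℤ ≈ 1#
   E-+ : ∀ a b → E (a ℤ.+ b) ≈ E a * E b
  module ≈-Reasoning = SetoidReasoning setoid
  open Algebra.Properties.CommutativeSemigroup +-commutativeSemigroup public using () renaming (interchange to +-interchange)
  open Algebra.Properties.CommutativeSemigroup *-commutativeSemigroup public using () renaming (interchange to *-interchange; x∙yz≈y∙xz to x*yz≈y*xz; xy∙z≈xz∙y to xy*z≈xz*y)

 -- With q = E 4, the variable indexed by a ∈ ℤ is X a = q^(a/2); j a is the
 -- inverse of u a = 1 - X a, with junk value at a = 0.
 record QRing : Set₁ where
  field
   Λ : ExpRing
  open ExpRing Λ public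
  u : ℤ → Carrier
  u a = 1# - E (a ℤ.+ a)
  field
   j   : ℤ → Carrier
   u*j : ∀ {a} → a ≢ 0ℤ → u a * j a ≈ 1#
   2-cancel : ∀ {x} → x + x ≈ 0# → x ≈ 0#

 -- Val k x says that x lies in E k times the subring of integral elements.
 record LRing : Set₁ where
  field
   qRing : QRing
  open QRing qRing public
  field
   Val       : ℤ → Carrier → Set
   Val-≈     : ∀ {k x y} → x ≈ y → Val k x → Val k y
   Val-0     : ∀ k → Val k 0#
   Val-+     : ∀ {k x y} → Val k x → Val k y → Val k (x + y)
   Val-neg   : ∀ {k x} → Val k x → Val k (- x)
   Val-*     : ∀ {k l x y} → Val k x → Val l y → Val (k ℤ.+ l) (x * y)
   Val-E     : ∀ a → Val a (E a)
   Val-j     : ∀ {a} → + 1 ℤ.≤ a → Val 0ℤ (j a)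
   Val-≤     : ∀ {k l x} → k ℤ.≤ l → Val l x → Val k x
   separated : ∀ {x} → (∀ (k : ℕ) → Val (+ k) x) → x ≈ 0#

-- A ring solver with symbolic exponents

module Solver where

 open Base

 infixl 6 _:+_ _:-_ _⊞_ _⊟_
 infixl 7 _:*_
 infix  8 :-_ ⊟_
 infix  4 _:=_

 data Lin (m : ℕ) : Set where
  ivar : Fin m → Lin m
  icon : ℤ → Lin m
  _⊞_  : Lin m → Lin m → Lin m
  ⊟_   : Lin m → Lin m

 _⊟_ : ∀ {m} → Lin m → Lin m → Lin m
 a ⊟ b = a ⊞ (⊟ b)

 data Expr (n m : ℕ) : Set where
  var  : Fin n → Expr n m
  :0 :1 : Expr n m
  :E   : Lin m → Expr n m
  _:+_ _:*_ : Expr n m → Expr n m → Expr n m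
  :-_  : Expr n m → Expr n m

 _:-_ : ∀ {n m} → Expr n m → Expr n m → Expr n m
 a :- b = a :+ (:- b)

 :s :u :X : ∀ {n m} → Lin m → Expr n m
 :s a = :E (⊟ a) :- :E a
 :X a = :E (a ⊞ a)
 :u a = :1 :- :X a

 record Eqn (n m : ℕ) : Set where
  constructor _:=_
  field lhs rhs : Expr n m

 private
  LinNF : ℕ → Set
  LinNF m = ℤ × Vec ℤ m

  Mono : ℕ → ℕ → Set
  Mono n m = Vec ℕ n × LinNF m

  Poly : ℕ → ℕ → Set
  Poly n m = List (Bool × Mono n m)

  unit : ∀ {m} → Fin m → Vec ℤ m
  unit Fin.zero    = 1ℤ ∷ Vec.replicate _ 0ℤ
  unit (Fin.suc i) = 0ℤ ∷ unit i

  unitℕ : ∀ {m} → Fin m → Vec ℕ m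
  unitℕ Fin.zero    = 1 ∷ Vec.replicate _ 0
  unitℕ (Fin.suc i) = 0 ∷ unitℕ i

  linNF : ∀ {m} → Lin m → LinNF m
  linNF (ivar i) = 0ℤ , unit i
  linNF (icon c) = c , Vec.replicate _ 0ℤ
  linNF (a ⊞ b)  with linNF a | linNF b
  ... | c , v | d , w = c ℤ.+ d , Vec.zipWith ℤ._+_ v w
  linNF (⊟ a)    with linNF a
  ... | c , v = ℤ.- c , Vec.map ℤ.-_ v

  _≟M_ : ∀ {n m} (a b : Mono n m) → Dec (a ≡ b)
  (k , c , v) ≟M (k′ , c′ , v′) with Vecₚ.≡-dec ℕ._≟_ k k′ | c ℤ.≟ c′ | Vecₚ.≡-dec ℤ._≟_ v v′
  ... | yes ≡.refl | yes ≡.refl | yes ≡.refl = yes ≡.refl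
  ... | no ¬p | _ | _ = no λ { ≡.refl → ¬p ≡.refl }
  ... | yes _ | no ¬p | _ = no λ { ≡.refl → ¬p ≡.refl }
  ... | yes _ | yes _ | no ¬p = no λ { ≡.refl → ¬p ≡.refl }

  -- Integer coefficients are kept in unary: equal signed monomials are stored as adjacent copies,
  -- and a copy of the opposite sign cancels one of them.
  ins : ∀ {n m} → Bool → Mono n m → Poly n m → Poly n m
  ins s μ [] = (s , μ) ∷ []
  ins s μ ((s′ , μ′) ∷ p) with μ ≟M μ′ | s Boolₚ.≟ s′
  ... | yes _ | no _  = p
  ... | yes _ | yes _ = (s , μ) ∷ (s′ , μ′) ∷ p
  ... | no _  | _     = (s′ , μ′) ∷ ins s μ p

  add : ∀ {n m} → Poly n m → Poly n m → Poly n m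
  add [] q = q
  add ((s , μ) ∷ p) q = ins s μ (add p q)

  neg : ∀ {n m} → Poly n m → Poly n m
  neg = List.map λ { (s , μ) → not s , μ }

  mulM : ∀ {n m} → Mono n m → Mono n m → Mono n m
  mulM (k , c , v) (k′ , c′ , v′) = Vec.zipWith ℕ._+_ k k′ , c ℤ.+ c′ , Vec.zipWith ℤ._+_ v v′

  scale : ∀ {n m} → Bool → Mono n m → Poly n m → Poly n m
  scale s μ [] = []
  scale s μ ((s′ , μ′) ∷ p) = (s xor s′ , mulM μ μ′) ∷ scale s μ p

  mul : ∀ {n m} → Poly n m → Poly n m → Poly n m
  mul [] q = []
  mul ((s , μ) ∷ p) q = add (scale s μ q) (mul p q)

  one : ∀ {n m} → Mono n m
  one = Vec.replicate _ 0 , 0ℤ , Vec.replicate _ 0ℤ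

  norm : ∀ {n m} → Expr n m → Poly n m
  norm (var i)  = (false , unitℕ i , 0ℤ , Vec.replicate _ 0ℤ) ∷ []
  norm :0       = []
  norm :1       = (false , one) ∷ []
  norm (:E a)   = (false , Vec.replicate _ 0 , linNF a) ∷ []
  norm (a :+ b) = add (norm a) (norm b)
  norm (a :* b) = mul (norm a) (norm b)
  norm (:- a)   = neg (norm a)

 Curried : ℕ → Set → Set → Set
 Curried zero    A B = B
 Curried (suc n) A B = A → Curried n A B

 uncur : ∀ {A B} n → Curried n A B → Vec A n → B
 uncur zero    f []       = f
 uncur (suc n) f (x ∷ xs) = uncur n (f x) xs

 ∀ⁿ : ∀ {A : Set} n → (Vec A n → Set) → Set
 ∀ⁿ zero    P = P []
 ∀ⁿ (suc n) P = ∀ x → ∀ⁿ n λ xs → P (x ∷ xs)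

 curⁿ : ∀ {A : Set} n {P : Vec A n → Set} → (∀ xs → P xs) → ∀ⁿ n P
 curⁿ zero    f = f []
 curⁿ (suc n) f = λ x → curⁿ n λ xs → f (x ∷ xs)

 module _ (Λ : ExpRing) where
  open ExpRing Λ
  open ≈-Reasoning
  open import Algebra.Properties.Ring (CommutativeRing.ring commRing) using (-‿distribˡ-*; -‿distribʳ-*; -‿involutive; -‿+-comm; -0#≈0#)

  E-≡ : ∀ {a b} → a ≡ b → E a ≈ E b
  E-≡ ≡.refl = refl

  ⟦_⟧L : ∀ {m} → Lin m → Vec ℤ m → ℤ
  ⟦ ivar i ⟧L σ = Vec.lookup σ i
  ⟦ icon c ⟧L σ = c
  ⟦ a ⊞ b ⟧L σ  = ⟦ a ⟧L σ ℤ.+ ⟦ b ⟧L σ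
  ⟦ ⊟ a ⟧L σ    = ℤ.- ⟦ a ⟧L σ

  ⟦_⟧ : ∀ {n m} → Expr n m → Vec Carrier n → Vec ℤ m → Carrier
  ⟦ var i ⟧ ρ σ  = Vec.lookup ρ i
  ⟦ :0 ⟧ ρ σ     = 0#
  ⟦ :1 ⟧ ρ σ     = 1#
  ⟦ :E a ⟧ ρ σ   = E (⟦ a ⟧L σ)
  ⟦ a :+ b ⟧ ρ σ = ⟦ a ⟧ ρ σ + ⟦ b ⟧ ρ σ
  ⟦ a :* b ⟧ ρ σ = ⟦ a ⟧ ρ σ * ⟦ b ⟧ ρ σ
  ⟦ :- a ⟧ ρ σ   = - ⟦ a ⟧ ρ σ

  private
   dotℤ : ∀ {m} → Vec ℤ m → Vec ℤ m → ℤ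
   dotℤ [] [] = 0ℤ
   dotℤ (k ∷ v) (x ∷ σ) = k ℤ.* x ℤ.+ dotℤ v σ

   dot-0 : ∀ {m} (σ : Vec ℤ m) → dotℤ (Vec.replicate m 0ℤ) σ ≡ 0ℤ
   dot-0 [] = ≡.refl
   dot-0 (x ∷ σ) = cong₂ ℤ._+_ (ℤₚ.*-zeroˡ x) (dot-0 σ)

   dot-unit : ∀ {m} i (σ : Vec ℤ m) → dotℤ (unit i) σ ≡ Vec.lookup σ i
   dot-unit Fin.zero (x ∷ σ) = ≡.trans (cong₂ ℤ._+_ (ℤₚ.*-identityˡ x) (dot-0 σ)) (ℤₚ.+-identityʳ x)
   dot-unit (Fin.suc i) (x ∷ σ) = ≡.trans (cong₂ ℤ._+_ (ℤₚ.*-zeroˡ x) (dot-unit i σ)) (ℤₚ.+-identityˡ _)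

   lem₁ : ∀ k l x d e → (k ℤ.+ l) ℤ.* x ℤ.+ (d ℤ.+ e) ≡ (k ℤ.* x ℤ.+ d) ℤ.+ (l ℤ.* x ℤ.+ e)
   lem₁ = ℤ-ring

   lem₂ : ∀ k x d → (ℤ.- k) ℤ.* x ℤ.+ (ℤ.- d) ≡ ℤ.- (k ℤ.* x ℤ.+ d)
   lem₂ = ℤ-ring

   lem₃ : ∀ a b c d → (a ℤ.+ b) ℤ.+ (c ℤ.+ d) ≡ (a ℤ.+ c) ℤ.+ (b ℤ.+ d)
   lem₃ = ℤ-ring

   dot-+ : ∀ {m} (v w σ : Vec ℤ m) → dotℤ (Vec.zipWith ℤ._+_ v w) σ ≡ dotℤ v σ ℤ.+ dotℤ w σ
   dot-+ [] [] [] = ≡.refl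
   dot-+ (k ∷ v) (l ∷ w) (x ∷ σ) =
    ≡.trans (cong (ℤ._+_ ((k ℤ.+ l) ℤ.* x)) (dot-+ v w σ)) (lem₁ k l x (dotℤ v σ) (dotℤ w σ))

   dot-neg : ∀ {m} (v σ : Vec ℤ m) → dotℤ (Vec.map ℤ.-_ v) σ ≡ ℤ.- dotℤ v σ
   dot-neg [] [] = ≡.refl
   dot-neg (k ∷ v) (x ∷ σ) = ≡.trans (cong (ℤ._+_ ((ℤ.- k) ℤ.* x)) (dot-neg v σ)) (lem₂ k x (dotℤ v σ))

   ⟦_⟧LN : ∀ {m} → LinNF m → Vec ℤ m → ℤ
   ⟦ c , v ⟧LN σ = c ℤ.+ dotℤ v σ

   linNF-ok : ∀ {m} (a : Lin m) σ → ⟦ linNF a ⟧LN σ ≡ ⟦ a ⟧L σ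
   linNF-ok (ivar i) σ = ≡.trans (ℤₚ.+-identityˡ _) (dot-unit i σ)
   linNF-ok (icon c) σ = ≡.trans (cong (ℤ._+_ c) (dot-0 σ)) (ℤₚ.+-identityʳ c)
   linNF-ok (a ⊞ b) σ with linNF a | linNF b | linNF-ok a σ | linNF-ok b σ
   ... | c , v | d , w | p | q = ≡.trans (cong (ℤ._+_ (c ℤ.+ d)) (dot-+ v w σ))
       (≡.trans (lem₃ c d _ _) (cong₂ ℤ._+_ p q))
   linNF-ok (⊟ a) σ with linNF a | linNF-ok a σ
   ... | c , v | p = ≡.trans (cong (ℤ._+_ (ℤ.- c)) (dot-neg v σ))
       (≡.trans (≡.sym (ℤₚ.neg-distrib-+ c _)) (cong ℤ.-_ p))

   pow : Carrier → ℕ → Carrier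
   pow x zero = 1#
   pow x (suc k) = x * pow x k

   pow-+ : ∀ x k l → pow x (k ℕ.+ l) ≈ pow x k * pow x l
   pow-+ x zero l = sym (*-identityˡ _)
   pow-+ x (suc k) l = trans (*-congˡ (pow-+ x k l)) (sym (*-assoc _ _ _))

   pows : ∀ {n} → Vec ℕ n → Vec Carrier n → Carrier
   pows [] [] = 1#
   pows (k ∷ ks) (x ∷ ρ) = pow x k * pows ks ρ

   swap4 : ∀ a b c d → (a * b) * (c * d) ≈ (a * c) * (b * d)
   swap4 a b c d = begin
    (a * b) * (c * d) ≈⟨ *-assoc a b _ ⟩
    a * (b * (c * d)) ≈⟨ *-congˡ (sym (*-assoc b c d)) ⟩
    a * ((b * c) * d) ≈⟨ *-congˡ (*-congʳ (*-comm b c)) ⟩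
    a * ((c * b) * d) ≈⟨ *-congˡ (*-assoc c b d) ⟩
    a * (c * (b * d)) ≈⟨ sym (*-assoc a c _) ⟩
    (a * c) * (b * d) ∎

   pows-+ : ∀ {n} (k l : Vec ℕ n) ρ → pows (Vec.zipWith ℕ._+_ k l) ρ ≈ pows k ρ * pows l ρ
   pows-+ [] [] [] = sym (*-identityˡ _)
   pows-+ (k ∷ ks) (l ∷ ls) (x ∷ ρ) = trans (*-cong (pow-+ x k l) (pows-+ ks ls ρ)) (swap4 _ _ _ _)

   pows-0 : ∀ {n} (ρ : Vec Carrier n) → pows (Vec.replicate n 0) ρ ≈ 1#
   pows-0 [] = refl
   pows-0 (x ∷ ρ) = trans (*-identityˡ _) (pows-0 ρ)

   pows-unit : ∀ {n} i (ρ : Vec Carrier n) → pows (unitℕ i) ρ ≈ Vec.lookup ρ i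
   pows-unit Fin.zero (x ∷ ρ) = trans (*-cong (*-identityʳ x) (pows-0 ρ)) (*-identityʳ x)
   pows-unit (Fin.suc i) (x ∷ ρ) = trans (*-identityˡ _) (pows-unit i ρ)

   module _ {n m} (ρ : Vec Carrier n) (σ : Vec ℤ m) where
    ⟦_⟧M : Mono n m → Carrier
    ⟦ k , a ⟧M = pows k ρ * E (⟦ a ⟧LN σ)

    sg : Bool → Carrier → Carrier
    sg false x = x
    sg true  x = - x

    sg-cong : ∀ s {x y} → x ≈ y → sg s x ≈ sg s y
    sg-cong false p = p
    sg-cong true  p = -‿cong p

    ⟦_⟧P : Poly n m → Carrier
    ⟦ [] ⟧P = 0#
    ⟦ (s , μ) ∷ p ⟧P = sg s ⟦ μ ⟧M + ⟦ p ⟧P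

    sg-not : ∀ s x → sg (not s) x ≈ - sg s x
    sg-not false x = refl
    sg-not true  x = sym (-‿involutive x)

    opp : ∀ s s′ x → (s ≡ s′ → ⊥) → sg s x + sg s′ x ≈ 0#
    opp false false x d = ⊥-elim (d ≡.refl)
    opp false true  x d = -‿inverseʳ x
    opp true  false x d = -‿inverseˡ x
    opp true  true  x d = ⊥-elim (d ≡.refl)

    ins-ok : ∀ s μ p → ⟦ ins s μ p ⟧P ≈ sg s ⟦ μ ⟧M + ⟦ p ⟧P
    ins-ok s μ [] = refl
    ins-ok s μ ((s′ , μ′) ∷ p) with μ ≟M μ′ | s Boolₚ.≟ s′
    ... | yes ≡.refl | no ¬q = sym (trans (sym (+-assoc _ _ _)) (trans (+-congʳ (opp s s′ ⟦ μ ⟧M ¬q)) (+-identityˡ _)))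
    ... | yes _ | yes _ = refl
    ... | no _  | _     = trans (+-congˡ (ins-ok s μ p)) (trans (sym (+-assoc _ _ _))
               (trans (+-congʳ (+-comm _ _)) (+-assoc _ _ _)))

    add-ok : ∀ p q → ⟦ add p q ⟧P ≈ ⟦ p ⟧P + ⟦ q ⟧P
    add-ok [] q = sym (+-identityˡ _)
    add-ok ((s , μ) ∷ p) q = trans (ins-ok s μ (add p q)) (trans (+-congˡ (add-ok p q)) (sym (+-assoc _ _ _)))

    neg-ok : ∀ p → ⟦ neg p ⟧P ≈ - ⟦ p ⟧P
    neg-ok [] = sym -0#≈0#
    neg-ok ((s , μ) ∷ p) = trans (+-cong (sg-not s ⟦ μ ⟧M) (neg-ok p)) (-‿+-comm _ _)

    sg-xor : ∀ s s′ x y → sg (s xor s′) (x * y) ≈ sg s x * sg s′ y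
    sg-xor false s′ x y = sg-r s′
     where
     sg-r : ∀ t → sg t (x * y) ≈ x * sg t y
     sg-r false = refl
     sg-r true  = -‿distribʳ-* x y
    sg-xor true false x y = -‿distribˡ-* x y
    sg-xor true true  x y = sym (trans (sym (-‿distribˡ-* x (- y)))
     (trans (-‿cong (sym (-‿distribʳ-* x y))) (-‿involutive _)))

    mulM-ok : ∀ μ ν → ⟦ mulM μ ν ⟧M ≈ ⟦ μ ⟧M * ⟦ ν ⟧M
    mulM-ok (k , c , v) (l , d , w) = trans (*-cong (pows-+ k l ρ)
     (trans (E-≡ (≡.trans (cong (ℤ._+_ (c ℤ.+ d)) (dot-+ v w σ)) (lem₃ c d _ _))) (E-+ _ _))) (swap4 _ _ _ _)

    scale-ok : ∀ s μ p → ⟦ scale s μ p ⟧P ≈ sg s ⟦ μ ⟧M * ⟦ p ⟧P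
    scale-ok s μ [] = sym (zeroʳ _)
    scale-ok s μ ((s′ , μ′) ∷ p) = trans
     (+-cong (trans (sg-cong (s xor s′) (mulM-ok μ μ′)) (sg-xor s s′ _ _)) (scale-ok s μ p))
     (sym (distribˡ _ _ _))

    mul-ok : ∀ p q → ⟦ mul p q ⟧P ≈ ⟦ p ⟧P * ⟦ q ⟧P
    mul-ok [] q = sym (zeroˡ _)
    mul-ok ((s , μ) ∷ p) q = trans (add-ok (scale s μ q) (mul p q))
     (trans (+-cong (scale-ok s μ q) (mul-ok p q)) (sym (distribʳ _ _ _)))

    E-one : E (⟦ 0ℤ , Vec.replicate _ 0ℤ ⟧LN σ) ≈ 1#
    E-one = trans (E-≡ (≡.trans (ℤₚ.+-identityˡ _) (dot-0 σ))) E-0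

    norm-ok : ∀ e → ⟦ norm e ⟧P ≈ ⟦ e ⟧ ρ σ
    norm-ok (var i)  = trans (+-identityʳ _) (trans (*-cong (pows-unit i ρ) E-one) (*-identityʳ _))
    norm-ok :0       = refl
    norm-ok :1       = trans (+-identityʳ _) (trans (*-cong (pows-0 ρ) E-one) (*-identityʳ _))
    norm-ok (:E a)   = trans (+-identityʳ _) (trans (*-cong (pows-0 ρ) (E-≡ (linNF-ok a σ))) (*-identityˡ _))
    norm-ok (a :+ b) = trans (add-ok (norm a) (norm b)) (+-cong (norm-ok a) (norm-ok b))
    norm-ok (a :* b) = trans (mul-ok (norm a) (norm b)) (*-cong (norm-ok a) (norm-ok b))
    norm-ok (:- a)   = trans (neg-ok (norm a)) (-‿cong (norm-ok a))

  -- Reduces to the unit type when normalisation leaves nothing, so that the implicit argument of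
  -- `solve` is filled by eta and a false identity is rejected by the type checker.
  Null : ∀ {A : Set} → List A → Set
  Null []      = ⊤
  Null (_ ∷ _) = ⊥

  null⇒≡ : ∀ {A : Set} {l : List A} → Null l → l ≡ []
  null⇒≡ {l = []} _ = ≡.refl

  solve : ∀ n m (f : Curried n (Expr n m) (Curried m (Lin m) (Eqn n m))) →
      let e = uncur m (uncur n f (Vec.map var (Vec.allFin n))) (Vec.map ivar (Vec.allFin m)) in
      {_ : Null (norm (Eqn.lhs e :- Eqn.rhs e))} →
      ∀ⁿ n λ ρ → ∀ⁿ m λ σ → ⟦ Eqn.lhs e ⟧ ρ σ ≈ ⟦ Eqn.rhs e ⟧ ρ σ
  solve n m f {null} = curⁿ n λ ρ → curⁿ m λ σ → main ρ σ
   where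
   e = uncur m (uncur n f (Vec.map var (Vec.allFin n))) (Vec.map ivar (Vec.allFin m))
   main : ∀ ρ σ → ⟦ Eqn.lhs e ⟧ ρ σ ≈ ⟦ Eqn.rhs e ⟧ ρ σ
   main ρ σ = begin
    ⟦ Eqn.lhs e ⟧ ρ σ
     ≈⟨ sym (+-identityʳ _) ⟩
    ⟦ Eqn.lhs e ⟧ ρ σ + 0#
     ≈⟨ +-congˡ (sym (-‿inverseˡ _)) ⟩
    ⟦ Eqn.lhs e ⟧ ρ σ + (- ⟦ Eqn.rhs e ⟧ ρ σ + ⟦ Eqn.rhs e ⟧ ρ σ)
     ≈⟨ sym (+-assoc _ _ _) ⟩
    ⟦ Eqn.lhs e :- Eqn.rhs e ⟧ ρ σ + ⟦ Eqn.rhs e ⟧ ρ σ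
     ≈⟨ +-congʳ (trans (sym (norm-ok ρ σ (Eqn.lhs e :- Eqn.rhs e))) (reflexive (cong (⟦_⟧P ρ σ) (null⇒≡ null)))) ⟩
    0# + ⟦ Eqn.rhs e ⟧ ρ σ
     ≈⟨ +-identityˡ _ ⟩
    ⟦ Eqn.rhs e ⟧ ρ σ ∎

-- Polynomial functions and their roots

module Interp where

 open Base
 open Solver

 module _ (Λ : ExpRing) where
  open ExpRing Λ
  open ≈-Reasoning

  -- f is a polynomial function of degree at most n whose coefficient at yⁿ is c.
  IsPoly : ℕ → (Carrier → Carrier) → Carrier → Set
  IsPoly zero    f c = ∀ y → f y ≈ c
  IsPoly (suc n) f c = Σ Carrier λ a → Σ (Carrier → Carrier) λ g → IsPoly n g c × (∀ y → f y ≈ a + y * g y)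

  poly-ext : ∀ n {f f′ c c′} → (∀ y → f y ≈ f′ y) → c ≈ c′ → IsPoly n f c → IsPoly n f′ c′
  poly-ext zero    e e′ p y = trans (sym (e y)) (trans (p y) e′)
  poly-ext (suc n) e e′ (a , g , pg , h) = a , g , poly-ext n (λ _ → refl) e′ pg , λ y → trans (sym (e y)) (h y)

  poly-+ : ∀ n {f f′ c c′} → IsPoly n f c → IsPoly n f′ c′ → IsPoly n (λ y → f y + f′ y) (c + c′)
  poly-+ zero    p q y = +-cong (p y) (q y)
  poly-+ (suc n) (a , g , pg , h) (a′ , g′ , pg′ , h′) = a + a′ , _ , poly-+ n pg pg′ , λ y →
   trans (+-cong (h y) (h′ y))
    (solve Λ 5 0 (λ a y g a′ g′ → (a :+ y :* g) :+ (a′ :+ y :* g′) := (a :+ a′) :+ y :* (g :+ g′)) a y (g y) a′ (g′ y))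

  poly-* : ∀ n {f c} k → IsPoly n f c → IsPoly n (λ y → k * f y) (k * c)
  poly-* zero    k p y = *-congˡ (p y)
  poly-* (suc n) k (a , g , pg , h) = k * a , _ , poly-* n k pg , λ y → trans (*-congˡ (h y))
    (solve Λ 4 0 (λ k a y g → k :* (a :+ y :* g) := k :* a :+ y :* (k :* g)) k a y (g y))

  poly-const : ∀ n {f c} k → IsPoly (suc n) f c → IsPoly (suc n) (λ y → k + f y) c
  poly-const n k (a , g , pg , h) = k + a , g , pg , λ y → trans (+-congˡ (h y)) (sym (+-assoc _ _ _))

  poly-lin : ∀ n {f c} k l → IsPoly n f c → IsPoly (suc n) (λ y → (k + l * y) * f y) (l * c)
  poly-lin zero {f} {c} k l p = k * c , _ , (λ y → refl) , λ y → trans (*-congˡ (p y))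
    (solve Λ 4 0 (λ k l c y → (k :+ l :* y) :* c := k :* c :+ y :* (l :* c)) k l c y)
  poly-lin (suc n) k l (a , g , pg , h) = k * a , _ , poly-const n (l * a) (poly-lin n k l pg) , λ y → trans (*-congˡ (h y))
    (solve Λ 5 0 (λ k l a y g → (k :+ l :* y) :* (a :+ y :* g) := k :* a :+ y :* (l :* a :+ (k :+ l :* y) :* g)) k l a y (g y))

  poly-lift : ∀ n {f c} → IsPoly n f c → IsPoly (suc n) f 0#
  poly-lift zero {f} {c} p = c , (λ _ → 0#) , (λ _ → refl) , λ y → trans (p y)
    (solve Λ 2 0 (λ c y → c := c :+ y :* :0) c y)
  poly-lift (suc n) (a , g , pg , h) = a , g , poly-lift n pg , h

  -- Follows the Horner form: if d is the quotient belonging to g, then g + r d is the one belonging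
  -- to a + y g, and the top coefficient is unchanged.
  divided-difference : ∀ n {f c} r → IsPoly (suc n) f c →
   Σ (Carrier → Carrier) λ g → IsPoly n g c × (∀ y → f y - f r ≈ (y - r) * g y)
  divided-difference zero {f} {c} r (a , g , pg , h) = (λ _ → c) , (λ _ → refl) , λ y →
   trans (+-cong (trans (h y) (+-congˡ (*-congˡ (pg y)))) (-‿cong (trans (h r) (+-congˡ (*-congˡ (pg r))))))
    (solve Λ 4 0 (λ a c y r → (a :+ y :* c) :- (a :+ r :* c) := (y :- r) :* c) a c y r)
  divided-difference (suc n) {f} {c} r (a , g , pg , h) with divided-difference n r pg
  ... | d , pd , e = (λ y → g y + r * d y) ,
   poly-ext (suc n) (λ _ → refl) (trans (+-congˡ (zeroʳ r)) (+-identityʳ c)) (poly-+ (suc n) pg (poly-* (suc n) r (poly-lift n pd))) , λ y →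
   begin
    f y - f r ≈⟨ +-cong (h y) (-‿cong (h r)) ⟩
    (a + y * g y) - (a + r * g r)
     ≈⟨ solve Λ 5 0 (λ a y r gy gr → (a :+ y :* gy) :- (a :+ r :* gr) := (y :- r) :* gy :+ r :* (gy :- gr)) a y r (g y) (g r) ⟩
    (y - r) * g y + r * (g y - g r) ≈⟨ +-congˡ (*-congˡ (e y)) ⟩
    (y - r) * g y + r * ((y - r) * d y)
     ≈⟨ solve Λ 4 0 (λ y r gy d → (y :- r) :* gy :+ r :* ((y :- r) :* d) := (y :- r) :* (gy :+ r :* d)) y r (g y) (d y) ⟩
    (y - r) * (g y + r * d y) ∎

  -- Local substitute for the absence of zero divisors.
  Cancellable : Carrier → Set
  Cancellable d = ∀ {x} → d * x ≈ 0# → x ≈ 0#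

  Separated : Carrier → Carrier → Set
  Separated r r′ = Cancellable (r′ - r)

  -- One root is divided out at a time; separation from it carries the other roots over to the
  -- quotient. The cofactor stays existential: the point is the factor c, which forces f to vanish
  -- once c does.
  factorization : ∀ {f c} rs → IsPoly (length rs) f c → AllPairs Separated rs → All (λ r → f r ≈ 0#) rs →
   Σ (List Carrier → Carrier → Carrier) λ Π → ∀ y → f y ≈ c * Π rs y
  factorization [] p [] [] = (λ _ _ → 1#) , λ y → trans (p y) (sym (*-identityʳ _))
  factorization {f} {c} (r ∷ rs) p (s ∷ ss) (v ∷ vs) with divided-difference (length rs) r p
  ... | g , pg , e = let Π , h = factorization rs pg ss (All.map (λ { {r′} (s , v′) → s (vanish r′ v′) }) (All.zip (s , vs))) in
   (λ _ y → (y - r) * Π rs y) , λ y → trans (fy y) (trans (*-congˡ (h y))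
    (x*yz≈y*xz (y - r) c (Π rs y)))
   where
   fy : ∀ y → f y ≈ (y - r) * g y
   fy y = trans (trans (sym (+-identityʳ _)) (+-congˡ (trans (sym (solve Λ 0 0 (:- :0 := :0))) (-‿cong (sym v))))) (e y)
   vanish : ∀ r′ → f r′ ≈ 0# → (r′ - r) * g r′ ≈ 0#
   vanish r′ v′ = trans (sym (fy r′)) v′

  poly-zero : ∀ {f c} rs → IsPoly (length rs) f c → c ≈ 0# → AllPairs Separated rs → All (λ r → f r ≈ 0#) rs → ∀ y → f y ≈ 0#
  poly-zero rs p c0 s v y = let Π , h = factorization rs p s v in trans (h y) (trans (*-congʳ c0) (zeroˡ _))

-- Sums over choices of signs, and the weights

module Signs where

 open Base
 open Solver

 data Signed : List ℤ → List ℤ → Set where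
  []  : Signed [] []
  pos : ∀ {x l xs} → Signed l xs → Signed (x ∷ l) (x ∷ xs)
  neg : ∀ {x l xs} → Signed l xs → Signed (ℤ.- x ∷ l) (x ∷ xs)

 Double≢0 : ℤ → Set
 Double≢0 x = x ℤ.+ x ≢ 0ℤ

 ≢0-from-double : ∀ {x} → Double≢0 x → x ≢ 0ℤ
 ≢0-from-double d ≡.refl = d ≡.refl

 neg≢0 : ∀ {x} → x ≢ 0ℤ → ℤ.- x ≢ 0ℤ
 neg≢0 {x} d e = d (≡.trans (≡.sym (ℤₚ.neg-involutive x)) (cong ℤ.-_ e))

 record Apart (x z : ℤ) : Set where
  constructor apart
  field
   sum≢0  : x ℤ.+ z ≢ 0ℤ
   diff≢0 : ℤ.- x ℤ.+ z ≢ 0ℤ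

 private
  e₁ : ∀ x z → ℤ.- (x ℤ.+ z) ≡ ℤ.- x ℤ.+ ℤ.- z
  e₁ = ℤₚ.neg-distrib-+
  e₂ : ∀ x z → ℤ.- (ℤ.- x ℤ.+ z) ≡ x ℤ.+ ℤ.- z
  e₂ = ℤ-ring
  e₃ : ∀ x z → ℤ.- (ℤ.- x ℤ.+ z) ≡ ℤ.- z ℤ.+ x
  e₃ = ℤ-ring

 Apart-negʳ : ∀ {x z} → Apart x z → Apart x (ℤ.- z)
 Apart-negʳ {x} {z} (apart p q) = apart (λ e → neg≢0 q (≡.trans (e₂ x z) e)) (λ e → neg≢0 p (≡.trans (e₁ x z) e))

 Apart-negˡ : ∀ {x z} → Apart x z → Apart (ℤ.- x) z
 Apart-negˡ {x} {z} (apart p q) = apart q λ e → p (≡.trans (cong (ℤ._+ z) (≡.sym (ℤₚ.neg-involutive x))) e)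

 Apart-sym : ∀ {x z} → Apart x z → Apart z x
 Apart-sym {x} {z} (apart p q) = apart (λ e → p (≡.trans (ℤₚ.+-comm x z) e)) (λ e → neg≢0 q (≡.trans (e₃ x z) e))

 AllPairs-↭ : ∀ {xs ys} → xs ↭ ys → AllPairs Apart xs → AllPairs Apart ys
 AllPairs-↭ Perm.refl p = p
 AllPairs-↭ (prep x r) (a ∷ p) = All-resp-↭ {P = Apart x} r a ∷ AllPairs-↭ r p
 AllPairs-↭ (swap x y r) ((xy ∷ a) ∷ b ∷ p) = (Apart-sym {x} {y} xy ∷ All-resp-↭ {P = Apart y} r b) ∷ All-resp-↭ {P = Apart x} r a ∷ AllPairs-↭ r p
 AllPairs-↭ (Perm.trans r s) p = AllPairs-↭ s (AllPairs-↭ r p)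

 Good : List ℤ → Set
 Good xs = All Double≢0 xs × AllPairs Apart xs

 Good-↭ : ∀ {xs ys} → xs ↭ ys → Good xs → Good ys
 Good-↭ r (p , q) = All-resp-↭ {P = Double≢0} r p , AllPairs-↭ r q

 Signed-All-Apart : ∀ {x l xs} → Signed l xs → All (Apart x) xs → All (Apart x) l
 Signed-All-Apart [] [] = []
 Signed-All-Apart (pos s) (p ∷ ps) = p ∷ Signed-All-Apart s ps
 Signed-All-Apart {x} (neg {z} s) (p ∷ ps) = Apart-negʳ p ∷ Signed-All-Apart s ps

 Signed-Good : ∀ {l xs} → Signed l xs → Good xs → Good l
 Signed-Good [] g = g
 Signed-Good (pos s) (d ∷ ds , a ∷ as) =
  let ds′ , as′ = Signed-Good s (ds , as) in d ∷ ds′ , Signed-All-Apart s a ∷ as′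
 Signed-Good (neg {x} s) (d ∷ ds , a ∷ as) =
  let ds′ , as′ = Signed-Good s (ds , as) in
  (λ e → neg≢0 d (≡.trans (e₁ x x) e)) ∷ ds′ , All.map Apart-negˡ (Signed-All-Apart s a) ∷ as′

 module SignSum (Λ : ExpRing) where
  open ExpRing Λ

  signSum : (List ℤ → Carrier) → List ℤ → Carrier
  signSum F []       = F []
  signSum F (x ∷ xs) = signSum (λ l → F (x ∷ l)) xs + signSum (λ l → F (ℤ.- x ∷ l)) xs

  signSum-cong : ∀ {F G} xs → (∀ {l} → Signed l xs → F l ≈ G l) → signSum F xs ≈ signSum G xs
  signSum-cong []       h = h []
  signSum-cong (x ∷ xs) h = +-cong (signSum-cong xs λ s → h (pos s)) (signSum-cong xs λ s → h (neg s))

  signSum-+ : ∀ F G xs → signSum (λ l → F l + G l) xs ≈ signSum F xs + signSum G xs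
  signSum-+ F G []       = refl
  signSum-+ F G (x ∷ xs) = trans (+-cong (signSum-+ _ _ xs) (signSum-+ _ _ xs))
   (+-interchange _ _ _ _)

  signSum-* : ∀ k F xs → signSum (λ l → k * F l) xs ≈ k * signSum F xs
  signSum-* k F []       = refl
  signSum-* k F (x ∷ xs) = trans (+-cong (signSum-* k _ xs) (signSum-* k _ xs)) (sym (distribˡ _ _ _))

  signSum-0 : ∀ {F} xs → (∀ {l} → Signed l xs → F l ≈ 0#) → signSum F xs ≈ 0#
  signSum-0 []       h = h []
  signSum-0 (x ∷ xs) h = trans (+-cong (signSum-0 xs λ s → h (pos s)) (signSum-0 xs λ s → h (neg s))) (+-identityˡ _)

  Symmetric : (List ℤ → Carrier) → Set
  Symmetric F = ∀ {l l′} → l ↭ l′ → F l ≈ F l′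

  signSum-↭ : ∀ {F xs ys} → Symmetric F → xs ↭ ys → signSum F xs ≈ signSum F ys
  signSum-↭ S Perm.refl = refl
  signSum-↭ S (prep x r) = +-cong (signSum-↭ (λ p → S (prep x p)) r) (signSum-↭ (λ p → S (prep _ p)) r)
  signSum-↭ {F} {x ∷ y ∷ xs} {.y ∷ .x ∷ ys} S (swap x y r) = trans
   (+-interchange _ _ _ _)
   (+-cong (+-cong (h x y) (h (ℤ.- x) y)) (+-cong (h x (ℤ.- y)) (h (ℤ.- x) (ℤ.- y))))
   where
   h : ∀ a b → signSum (λ l → F (a ∷ b ∷ l)) xs ≈ signSum (λ l → F (b ∷ a ∷ l)) ys
   h a b = trans (signSum-cong xs λ _ → S (swap a b Perm.refl)) (signSum-↭ (λ p → S (prep _ (prep _ p))) r)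
  signSum-↭ S (Perm.trans r s) = trans (signSum-↭ S r) (signSum-↭ S s)

  signSum-neg : ∀ F x xs → signSum F (ℤ.- x ∷ xs) ≈ signSum F (x ∷ xs)
  signSum-neg F x xs = trans (+-congˡ (reflexive (cong (λ y → signSum (λ l → F (y ∷ l)) xs) (ℤₚ.neg-involutive x)))) (+-comm _ _)

  signSum-++ : ∀ F xs ys → signSum F (xs ++ ys) ≈ signSum (λ l → signSum (λ l′ → F (l ++ l′)) ys) xs
  signSum-++ F []       ys = refl
  signSum-++ F (x ∷ xs) ys = +-cong (signSum-++ _ xs ys) (signSum-++ _ xs ys)

 module Weights (Q : QRing) (T : ℤ) where
  open QRing Q

  j-unique : ∀ {a x} → a ≢ 0ℤ → u a * x ≈ 1# → x ≈ j a
  j-unique {a} {x} d e = trans (trans (sym (*-identityˡ x)) (*-congʳ (sym (u*j d))))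
   (trans (xy*z≈xz*y (u a) (j a) x) (trans (*-congʳ e) (*-identityˡ _)))

  j-neg : ∀ {a} → a ≢ 0ℤ → j (ℤ.- a) ≈ - (E (a ℤ.+ a) * j a)
  j-neg {a} d = sym (j-unique (neg≢0 d) (trans
   (solve Λ 1 1 (λ j a → :u (⊟ a) :* :- (:X a :* j) := :u a :* j) (j a) a) (u*j d)))

  -- t = E (T + T): w a b = (1 - t X_a X_b) / (1 - X_a X_b).
  w : ℤ → ℤ → Carrier
  w a b = u (a ℤ.+ b ℤ.+ T) * j (a ℤ.+ b)

  w-comm : ∀ a b → w a b ≈ w b a
  w-comm a b = reflexive (cong (λ c → u (c ℤ.+ T) * j c) (ℤₚ.+-comm a b))

  prodOver : (ℤ → Carrier) → List ℤ → Carrier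
  prodOver f []       = 1#
  prodOver f (z ∷ zs) = f z * prodOver f zs

  prodOver-cong : ∀ {f g} l → (∀ z → f z ≈ g z) → prodOver f l ≈ prodOver g l
  prodOver-cong []      h = refl
  prodOver-cong (z ∷ l) h = *-cong (h z) (prodOver-cong l h)

  prodOver-↭ : ∀ f {l l′} → l ↭ l′ → prodOver f l ≈ prodOver f l′
  prodOver-↭ f Perm.refl = refl
  prodOver-↭ f (prep x r) = *-congˡ (prodOver-↭ f r)
  prodOver-↭ f (swap x y r) = trans (*-congˡ (*-congˡ (prodOver-↭ f r)))
   (x*yz≈y*xz _ _ _)
  prodOver-↭ f (Perm.trans r s) = trans (prodOver-↭ f r) (prodOver-↭ f s)

  prodOver-++ : ∀ f xs ys → prodOver f (xs ++ ys) ≈ prodOver f xs * prodOver f ys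
  prodOver-++ f []       ys = sym (*-identityˡ _)
  prodOver-++ f (x ∷ xs) ys = trans (*-congˡ (prodOver-++ f xs ys)) (sym (*-assoc _ _ _))

  prodOver-* : ∀ f g l → prodOver (λ z → f z * g z) l ≈ prodOver f l * prodOver g l
  prodOver-* f g []      = sym (*-identityˡ _)
  prodOver-* f g (z ∷ l) = trans (*-congˡ (prodOver-* f g l))
   (*-interchange _ _ _ _)

  W : ℤ → List ℤ → Carrier
  W x = prodOver (w x)

  -- ∏ g(x)/(1 - X_x²) ∏_{i<j} w(x_i, x_j)
  module Density (g : ℤ → Carrier) where
   one : ℤ → Carrier
   one x = g x * j (x ℤ.+ x)

   c : List ℤ → Carrier
   c []       = 1#
   c (x ∷ xs) = one x * W x xs * c xs

   c-↭ : ∀ {l l′} → l ↭ l′ → c l ≈ c l′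
   c-↭ Perm.refl = refl
   c-↭ (prep x r) = *-cong (*-congˡ (prodOver-↭ (w x) r)) (c-↭ r)
   c-↭ {x ∷ y ∷ l} {.y ∷ .x ∷ l′} (swap x y r) = trans
    (*-cong (*-congˡ (*-cong (w-comm x y) (prodOver-↭ (w x) r))) (*-cong (*-congˡ (prodOver-↭ (w y) r)) (c-↭ r)))
    (solve Λ 6 0 (λ a b c d e f → a :* (b :* c) :* (d :* e :* f) := d :* (b :* e) :* (a :* c :* f))
     (one x) (w y x) (W x l′) (one y) (W y l′) (c l′))
   c-↭ (Perm.trans r s) = trans (c-↭ r) (c-↭ s)

   c-++ : ∀ l l′ → c (l ++ l′) ≈ c l * prodOver (λ a → W a l′) l * c l′
   c-++ [] l′ = solve Λ 1 0 (λ c → c := :1 :* :1 :* c) _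
   c-++ (x ∷ l) l′ = trans (*-cong (*-congˡ (prodOver-++ (w x) l l′)) (c-++ l l′))
    (solve Λ 6 0 (λ o w w′ c p c′ → o :* (w :* w′) :* (c :* p :* c′) := o :* w :* c :* (w′ :* p) :* c′) _ _ _ _ _ _)

-- The sign summation in closed form

module JSum where

 open Base
 open Solver
 open Interp
 open Signs

 module _ (Q : QRing) (T : ℤ) where
  open QRing Q
  open SignSum Λ
  open Weights Q T
  open ≈-Reasoning

  private
   t : Carrier
   t = E (T ℤ.+ T)

   X : ℤ → Carrier
   X x = E (x ℤ.+ x)

   cancel-unit : ∀ {d} e → d * e ≈ 1# → Cancellable Λ d
   cancel-unit {d} e h {x} p = begin
    x           ≈⟨ sym (*-identityˡ x) ⟩
    1# * x      ≈⟨ *-congʳ (sym h) ⟩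
    d * e * x   ≈⟨ solve Λ 3 0 (λ d e x → d :* e :* x := e :* (d :* x)) d e x ⟩
    e * (d * x) ≈⟨ *-congˡ p ⟩
    e * 0#      ≈⟨ zeroʳ e ⟩
    0#          ∎

   cancel-cong : ∀ {d d′} → d ≈ d′ → Cancellable Λ d → Cancellable Λ d′
   cancel-cong e h p = h (trans (*-congʳ e) p)

   cancel-* : ∀ {d d′} → Cancellable Λ d → Cancellable Λ d′ → Cancellable Λ (d * d′)
   cancel-* h h′ p = h′ (h (trans (sym (*-assoc _ _ _)) p))

   cancel-u : ∀ {a} → a ≢ 0ℤ → Cancellable Λ (u a)
   cancel-u {a} d = cancel-unit (j a) (u*j d)

   separated-X : ∀ {a b} → ℤ.- b ℤ.+ a ≢ 0ℤ → Separated Λ (X a) (X b)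
   separated-X {a} {b} d = cancel-unit (j (ℤ.- b ℤ.+ a) * X (ℤ.- b)) (trans
    (solve Λ 1 2 (λ j a b → (:X b :- :X a) :* (j :* :X (⊟ b)) := :u (⊟ b ⊞ a) :* j) (j (ℤ.- b ℤ.+ a)) a b) (u*j d))

   roots : List ℤ → List Carrier
   roots []       = []
   roots (x ∷ xs) = X x ∷ X (ℤ.- x) ∷ roots xs

   deg : List ℤ → ℕ
   deg xs = length (roots xs)

   deg-signed : ∀ {l xs} → Signed l xs → deg l ≡ deg xs
   deg-signed []      = ≡.refl
   deg-signed (pos s) = cong (λ n → suc (suc n)) (deg-signed s)
   deg-signed (neg s) = cong (λ n → suc (suc n)) (deg-signed s)

   separated₁ : ∀ {x xs} → All (Apart x) xs → All (Separated Λ (X x)) (roots xs)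
   separated₁ [] = []
   separated₁ {x} {z ∷ _} (a ∷ as) =
    separated-X {x} {z} (Apart.diff≢0 (Apart-sym a)) ∷
    separated-X {x} {ℤ.- z} (λ e → Apart.sum≢0 (Apart-sym a) (≡.trans (cong (ℤ._+ x) (≡.sym (ℤₚ.neg-involutive z))) e)) ∷ separated₁ as

   separated : ∀ {xs} → Good xs → AllPairs (Separated Λ) (roots xs)
   separated {[]} _ = []
   separated {x ∷ xs} (d ∷ ds , a ∷ as) =
    (separated-X {x} {ℤ.- x} (λ e → d (≡.trans (cong (ℤ._+ x) (≡.sym (ℤₚ.neg-involutive x))) e)) ∷ separated₁ a) ∷
    separated₁ (All.map Apart-negˡ a) ∷ separated (ds , as)

   ±1-separated : ∀ {x} → Double≢0 x → Separated Λ 1# (X x) × Separated Λ (- 1#) (X x)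
   ±1-separated {x} d =
    cancel-unit (- j x) (trans (solve Λ 1 1 (λ j x → (:X x :- :1) :* :- j := :u x :* j) (j x) x) (u*j (≢0-from-double d))) ,
    cancel-unit (u x * j (x ℤ.+ x)) (trans (solve Λ 1 1 (λ j x → (:X x :- (:- :1)) :* (:u x :* j) := :u (x ⊞ x) :* j) (j (x ℤ.+ x)) x) (u*j d))

   Double≢0-neg : ∀ {x} → Double≢0 x → Double≢0 (ℤ.- x)
   Double≢0-neg {x} d e = neg≢0 d (≡.trans (ℤₚ.neg-distrib-+ x x) e)

   ±1-separated-roots : ∀ {xs} → All Double≢0 xs → All (Separated Λ 1#) (roots xs) × All (Separated Λ (- 1#)) (roots xs)
   ±1-separated-roots [] = [] , []
   ±1-separated-roots {x ∷ xs} (d ∷ ds) =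
    let p , q = ±1-separated {x} d ; p′ , q′ = ±1-separated {ℤ.- x} (Double≢0-neg {x} d) ; ps , qs = ±1-separated-roots ds in
    p ∷ p′ ∷ ps , q ∷ q′ ∷ qs

   -1-separated-1 : Separated Λ 1# (- 1#)
   -1-separated-1 {x} p = 2-cancel (begin
    x + x               ≈⟨ solve Λ 1 0 (λ x → x :+ x := :- ((:- :1 :- :1) :* x)) x ⟩
    - ((- 1# - 1#) * x) ≈⟨ -‿cong p ⟩
    - 0#                ≈⟨ solve Λ 0 0 (:- :0 := :0) ⟩
    0#                  ∎)

   prod-poly : ∀ (a b k m : ℤ → Carrier) l →
    IsPoly Λ (deg l) (λ y → prodOver (λ z → (a z + b z * y) * (k z + m z * y)) l) (prodOver (λ z → b z * m z) l)
   prod-poly a b k m []      = λ _ → refl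
   prod-poly a b k m (z ∷ l) = poly-ext Λ (deg (z ∷ l)) (λ y → sym (*-assoc _ _ _)) (sym (*-assoc _ _ _))
    (poly-lin Λ (suc (deg l)) (a z) (b z) (poly-lin Λ (deg l) (k z) (m z) (prod-poly a b k m l)))

   quad-poly : ∀ n (a b k : Carrier) {f c} → IsPoly Λ n f c → IsPoly Λ (suc (suc n)) (λ y → (a + b * y + k * (y * y)) * f y) (k * c)
   quad-poly n a b k {f} {c} p = poly-ext Λ (suc (suc n))
    (λ y → solve Λ 5 0 (λ a b k y f → a :* f :+ ((:0 :+ b :* y) :* f :+ (:0 :+ k :* y) :* ((:0 :+ :1 :* y) :* f)) := (a :+ b :* y :+ k :* (y :* y)) :* f) a b k y (f y))
    (solve Λ 2 0 (λ k c → :0 :+ (:0 :+ k :* (:1 :* c)) := k :* c) k c)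
    (poly-+ Λ (suc (suc n)) (poly-ext Λ (suc (suc n)) (λ _ → refl) (zeroʳ a) (poly-* Λ (suc (suc n)) a (poly-lift Λ (suc n) (poly-lift Λ n p))))
     (poly-+ Λ (suc (suc n)) (poly-lift Λ (suc n) (poly-lin Λ n 0# b p)) (poly-lin Λ (suc n) 0# k (poly-lin Λ n 0# 1# p))))

   signSum-poly : ∀ n (F : Carrier → List ℤ → Carrier) top xs →
    (∀ {l} → Signed l xs → IsPoly Λ n (λ y → F y l) (top l)) → IsPoly Λ n (λ y → signSum (F y) xs) (signSum top xs)
   signSum-poly n F top []       h = h []
   signSum-poly n F top (x ∷ xs) h = poly-+ Λ n
    (signSum-poly n (λ y l → F y (x ∷ l)) _ xs λ s → h (pos s)) (signSum-poly n (λ y l → F y (ℤ.- x ∷ l)) _ xs λ s → h (neg s))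

   -- p⁺ and p⁻ are w(y, z) and w(-y, z) with the denominators (1 - YZ)(1 - Y/Z) cleared.
   p⁺ p⁻ d : Carrier → ℤ → Carrier
   p⁺ y z = (1# + - (t * X z) * y) * (1# + - X (ℤ.- z) * y)
   p⁻ y z = (t + - X (ℤ.- z) * y) * (1# + - X z * y)
   d  y z = (1# + - X z * y) * (1# + - X (ℤ.- z) * y)

   P⁺ P⁻ D : Carrier → List ℤ → Carrier
   P⁺ y = prodOver (p⁺ y)
   P⁻ y = prodOver (p⁻ y)
   D  y = prodOver (d y)

   D-signed : ∀ y {l xs} → Signed l xs → D y l ≈ D y xs
   D-signed y [] = refl
   D-signed y (pos s) = *-congˡ (D-signed y s)
   D-signed y (neg {x} s) = *-cong (solve Λ 1 1
    (λ y x → (:1 :+ :- :X (⊟ x) :* y) :* (:1 :+ :- :X (⊟ ⊟ x) :* y) := (:1 :+ :- :X x :* y) :* (:1 :+ :- :X (⊟ x) :* y)) y x) (D-signed y s)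

  tpow : List ℤ → Carrier
  tpow []      = 1#
  tpow (_ ∷ l) = t * tpow l

  module _ (g₀ g₁ g₂ : Carrier) where
   γ : ℤ → Carrier
   γ x = g₀ + g₁ * X x + g₂ * (X x * X x)

   open Density γ

   -- The product of g₀ - g₂ t^i for i below the length; this is the value of the sum of `c` over
   -- all signs.
   J : List ℤ → Carrier
   J []       = 1#
   J (_ ∷ xs) = (g₀ - g₂ * tpow xs) * J xs

   private
    Γ⁺ Γ⁻ : Carrier → Carrier
    Γ⁺ y = g₀ + g₁ * y + g₂ * (y * y)
    Γ⁻ y = g₂ + g₁ * y + g₀ * (y * y)

    -- What the two signs of one further variable y contribute next to the signed list l, with the
    -- denominators 1 - y² and `D y l` cleared.
    B : Carrier → List ℤ → Carrier
    B y l = Γ⁺ y * P⁺ y l + - 1# * (Γ⁻ y * P⁻ y l)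

    -- The cleared difference of the two sides for one further variable y; `0ℤ` stands for it, as
    -- `J` depends only on the length. The known zeros 1, -1 and X x, X (-x) for x in `xs` are only
    -- as many as the degree bound, so the top coefficient must vanish too. That it does is the
    -- identity for `xs` itself, which makes the proof an induction.
    f : List ℤ → Carrier → Carrier
    f xs y = signSum (λ l → c l * B y l) xs + - J (0ℤ ∷ xs) * ((1# + 1# * y) * ((1# + - 1# * y) * D y xs))

    top : List ℤ → Carrier
    top l = c l * (g₂ * tpow l + - 1# * g₀)

    top-P⁺ : ∀ l → prodOver (λ z → - (t * X z) * - X (ℤ.- z)) l ≈ tpow l
    top-P⁺ [] = refl
    top-P⁺ (z ∷ l) = *-cong (solve Λ 1 1 (λ t z → :- (t :* :X z) :* :- :X (⊟ z) := t) t z) (top-P⁺ l)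

    top-D : ∀ l → prodOver (λ z → - X z * - X (ℤ.- z)) l ≈ 1#
    top-D [] = refl
    top-D (z ∷ l) = trans (*-cong (solve Λ 0 1 (λ z → :- :X z :* :- :X (⊟ z) := :1) z) (top-D l)) (*-identityˡ _)

    top-P⁻ : ∀ l → prodOver (λ z → - X (ℤ.- z) * - X z) l ≈ 1#
    top-P⁻ [] = refl
    top-P⁻ (z ∷ l) = trans (*-cong (solve Λ 0 1 (λ z → :- :X (⊟ z) :* :- :X z := :1) z) (top-P⁻ l)) (*-identityˡ _)

    f-poly : ∀ xs → IsPoly Λ (suc (suc (deg xs))) (f xs) (signSum top xs + J (0ℤ ∷ xs))
    f-poly xs = poly-+ Λ (suc (suc (deg xs)))
     (signSum-poly _ (λ y l → c l * B y l) top xs λ {l} s → subst (λ n → IsPoly Λ (suc (suc n)) (λ y → c l * B y l) (top l)) (deg-signed s)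
      (poly-* Λ (suc (suc (deg l))) (c l) (poly-+ Λ (suc (suc (deg l)))
       (quad-poly (deg l) g₀ g₁ g₂ (poly-ext Λ (deg l) (λ _ → refl) (top-P⁺ l) (prod-poly (λ _ → 1#) _ (λ _ → 1#) _ l)))
       (poly-* Λ (suc (suc (deg l))) (- 1#) (poly-ext Λ (suc (suc (deg l))) (λ _ → refl) (*-identityʳ g₀)
        (quad-poly (deg l) g₂ g₁ g₀ (poly-ext Λ (deg l) (λ _ → refl) (top-P⁻ l) (prod-poly (λ _ → t) _ (λ _ → 1#) _ l))))))))
     (poly-ext Λ (suc (suc (deg xs))) (λ _ → refl) (solve Λ 1 0 (λ k → :- k :* (:1 :* (:- :1 :* :1)) := k) _)
      (poly-* Λ (suc (suc (deg xs))) (- J (0ℤ ∷ xs)) (poly-lin Λ (suc (deg xs)) 1# 1# (poly-lin Λ (deg xs) 1# (- 1#)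
       (poly-ext Λ (deg xs) (λ _ → refl) (top-D xs) (prod-poly (λ _ → 1#) _ (λ _ → 1#) _ xs))))))

    f-top : ∀ xs → signSum c xs ≈ J xs → signSum top xs + J (0ℤ ∷ xs) ≈ 0#
    f-top xs IH = begin
     signSum top xs + J (0ℤ ∷ xs)
      ≈⟨ +-congʳ (trans (signSum-cong xs λ {l} s → trans (*-congˡ (+-congʳ (*-congˡ (tp s)))) (*-comm _ _)) (trans (signSum-* _ c xs) (*-congˡ IH))) ⟩
     (g₂ * tpow xs + - 1# * g₀) * J xs + (g₀ - g₂ * tpow xs) * J xs
      ≈⟨ solve Λ 4 0 (λ g₀ g₂ t j → (g₂ :* t :+ :- :1 :* g₀) :* j :+ (g₀ :- g₂ :* t) :* j := :0) g₀ g₂ (tpow xs) (J xs) ⟩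
     0# ∎
     where
     tp : ∀ {l xs} → Signed l xs → tpow l ≈ tpow xs
     tp [] = refl
     tp (pos s) = *-congˡ (tp s)
     tp (neg s) = *-congˡ (tp s)

    -- At Y = ±1 the two products agree factor by factor.
    P-at-1 : ∀ {e} → e * e ≈ 1# → ∀ l → P⁺ e l ≈ P⁻ e l
    P-at-1 h [] = refl
    P-at-1 {e} h (z ∷ l) = *-cong (begin
     (1# + - (t * X z) * e) * (1# + - X (ℤ.- z) * e)
      ≈⟨ solve Λ 2 1 (λ t e z → (:1 :+ :- (t :* :X z) :* e) :* (:1 :+ :- :X (⊟ z) :* e) :=
        :1 :+ t :* (e :* e) :- t :* :X z :* e :- :X (⊟ z) :* e) t e z ⟩
     1# + t * (e * e) - t * X z * e - X (ℤ.- z) * e ≈⟨ +-congʳ (+-congʳ (+-cong (sym h) (*-congˡ h))) ⟩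
     e * e + t * 1# - t * X z * e - X (ℤ.- z) * e
      ≈⟨ solve Λ 2 1 (λ t e z → (e :* e) :+ t :* :1 :- t :* :X z :* e :- :X (⊟ z) :* e :=
        (t :+ :- :X (⊟ z) :* e) :* (:1 :+ :- :X z :* e)) t e z ⟩
     (t + - X (ℤ.- z) * e) * (1# + - X z * e) ∎) (P-at-1 h l)

    f-at-1 : ∀ {e} → e * e ≈ 1# → ∀ xs → f xs e ≈ 0#
    f-at-1 {e} h xs = trans (+-cong
     (signSum-0 xs λ {l} s → trans (*-congˡ (trans (+-cong (*-cong Γ-eq (P-at-1 h l)) refl)
      (solve Λ 1 0 (λ a → a :+ :- :1 :* a := :0) _))) (zeroʳ _))
     (trans (solve Λ 3 0 (λ k e d → :- k :* ((:1 :+ :1 :* e) :* ((:1 :+ :- :1 :* e) :* d)) := :- k :* ((:1 :- e :* e) :* d)) _ _ _)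
      (trans (*-congˡ (*-congʳ (+-congˡ (-‿cong h)))) (solve Λ 2 0 (λ k d → :- k :* ((:1 :- :1) :* d) := :0) _ _))))
     (+-identityˡ _)
     where
     Γ-eq : Γ⁺ e ≈ Γ⁻ e
     Γ-eq = trans (+-congˡ (*-congˡ h)) (trans (solve Λ 4 0 (λ a b k e → a :+ b :* e :+ k :* :1 := k :+ b :* e :+ a :* :1) g₀ g₁ g₂ e)
      (+-congˡ (*-congˡ (sym h))))

    w-pos : ∀ {y z} → Apart y z → w y z * d (X y) z ≈ p⁺ (X y) z
    w-pos {y} {z} a = trans (solve Λ 1 3 (λ j T y z →
       :u (y ⊞ z ⊞ T) :* j :* ((:1 :+ :- :X z :* :X y) :* (:1 :+ :- :X (⊟ z) :* :X y)) :=
       (:u (y ⊞ z) :* j) :* ((:1 :+ :- (:X T :* :X z) :* :X y) :* (:1 :+ :- :X (⊟ z) :* :X y))) (j (y ℤ.+ z)) T y z)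
      (trans (*-congʳ (u*j (Apart.sum≢0 a))) (*-identityˡ _))

    w-neg : ∀ {y z} → Apart y z → w (ℤ.- y) z * d (X y) z ≈ p⁻ (X y) z
    w-neg {y} {z} a = trans (solve Λ 1 3 (λ j T y z →
       :u (⊟ y ⊞ z ⊞ T) :* j :* ((:1 :+ :- :X z :* :X y) :* (:1 :+ :- :X (⊟ z) :* :X y)) :=
       (:u (⊟ y ⊞ z) :* j) :* ((:X T :+ :- :X (⊟ z) :* :X y) :* (:1 :+ :- :X z :* :X y))) (j (ℤ.- y ℤ.+ z)) T y z)
      (trans (*-congʳ (u*j (Apart.diff≢0 a))) (*-identityˡ _))

    W-pos : ∀ {y l} → All (Apart y) l → W y l * D (X y) l ≈ P⁺ (X y) l
    W-pos [] = *-identityˡ _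
    W-pos (a ∷ as) = trans (*-interchange _ _ _ _) (*-cong (w-pos a) (W-pos as))

    W-neg : ∀ {y l} → All (Apart y) l → W (ℤ.- y) l * D (X y) l ≈ P⁻ (X y) l
    W-neg [] = *-identityˡ _
    W-neg (a ∷ as) = trans (*-interchange _ _ _ _) (*-cong (w-neg a) (W-neg as))

    one-neg : ∀ {x} → Double≢0 x → one (ℤ.- x) ≈ - (Γ⁻ (X x) * j (x ℤ.+ x))
    one-neg {x} d = begin
     γ (ℤ.- x) * j (ℤ.- x ℤ.+ ℤ.- x)
      ≈⟨ *-congˡ (trans (reflexive (cong j (≡.sym (ℤₚ.neg-distrib-+ x x)))) (j-neg d)) ⟩
     γ (ℤ.- x) * - (E (x ℤ.+ x ℤ.+ (x ℤ.+ x)) * j (x ℤ.+ x))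
      ≈⟨ solve Λ 4 1 (λ a b c j x → (a :+ b :* :X (⊟ x) :+ c :* (:X (⊟ x) :* :X (⊟ x))) :* :- (:X (x ⊞ x) :* j) :=
        :- ((c :+ b :* :X x :+ a :* (:X x :* :X x)) :* j)) g₀ g₁ g₂ (j (x ℤ.+ x)) x ⟩
     - (Γ⁻ (X x) * j (x ℤ.+ x)) ∎

    -- At y = X x the choices x and -x cancel in pairs: after `D` is inserted both equal the same
    -- product of W x and W (-x). The subtracted term dies because `D` contains 1 - X x X (-x).
    f-at-head : ∀ {x xs} → Double≢0 x → All (Apart x) xs → f (x ∷ xs) (X x) ≈ 0#
    f-at-head {x} {xs} dx ax = trans (+-cong
     (trans (sym (signSum-+ _ _ xs)) (signSum-0 xs λ {l} s → begin
      one x * W x l * c l * B (X x) (x ∷ l) + one (ℤ.- x) * W (ℤ.- x) l * c l * B (X x) (ℤ.- x ∷ l)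
       ≈⟨ +-congˡ (*-congʳ (*-congʳ (*-congʳ (one-neg {x} dx)))) ⟩
      Γ⁺ (X x) * j (x ℤ.+ x) * W x l * c l * B (X x) (x ∷ l) + - (Γ⁻ (X x) * j (x ℤ.+ x)) * W (ℤ.- x) l * c l * B (X x) (ℤ.- x ∷ l)
       ≈⟨ solve Λ 9 1 (λ g h j w w′ c p p′ t x →
         g :* j :* w :* c :* (g :* (((:1 :+ :- (t :* :X x) :* :X x) :* (:1 :+ :- :X (⊟ x) :* :X x)) :* p)
           :+ :- :1 :* (h :* (((t :+ :- :X (⊟ x) :* :X x) :* (:1 :+ :- :X x :* :X x)) :* p′)))
         :+ :- (h :* j) :* w′ :* c :* (g :* (((:1 :+ :- (t :* :X (⊟ x)) :* :X x) :* (:1 :+ :- :X (⊟ ⊟ x) :* :X x)) :* p)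
           :+ :- :1 :* (h :* (((t :+ :- :X (⊟ ⊟ x) :* :X x) :* (:1 :+ :- :X (⊟ x) :* :X x)) :* p′)))
         := g :* h :* j :* c :* (:1 :- t) :* (:1 :- :X x :* :X x) :* (w :* p′ :- w′ :* p))
         (Γ⁺ (X x)) (Γ⁻ (X x)) (j (x ℤ.+ x)) (W x l) (W (ℤ.- x) l) (c l) (P⁺ (X x) l) (P⁻ (X x) l) t x ⟩
      _ * (W x l * P⁻ (X x) l - W (ℤ.- x) l * P⁺ (X x) l)
       ≈⟨ *-congˡ (+-cong (*-congˡ (sym (W-neg (Signed-All-Apart s ax)))) (-‿cong (*-congˡ (sym (W-pos (Signed-All-Apart s ax)))))) ⟩
      _ * (W x l * (W (ℤ.- x) l * D (X x) l) - W (ℤ.- x) l * (W x l * D (X x) l))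
       ≈⟨ solve Λ 4 0 (λ k w w′ d → k :* (w :* (w′ :* d) :- w′ :* (w :* d)) := :0) _ _ _ _ ⟩
      0# ∎))
     (solve Λ 2 1 (λ k d x → :- k :* ((:1 :+ :1 :* :X x) :* ((:1 :+ :- :1 :* :X x) :* (((:1 :+ :- :X x :* :X x) :* (:1 :+ :- :X (⊟ x) :* :X x)) :* d)))
      := :0) _ _ x)) (+-identityˡ _)

    B-↭ : ∀ y {l l′} → l ↭ l′ → B y l ≈ B y l′
    B-↭ y r = +-cong (*-congˡ (prodOver-↭ (p⁺ y) r)) (*-congˡ (*-congˡ (prodOver-↭ (p⁻ y) r)))

    J-length : ∀ {xs ys} → length xs ≡ length ys → J xs ≈ J ys × tpow xs ≈ tpow ys
    J-length {[]} {[]} e = refl , refl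
    J-length {x ∷ xs} {y ∷ ys} e = let p , q = J-length {xs} {ys} (suc-injective e) in
     *-cong (+-congˡ (-‿cong (*-congˡ q))) p , *-congˡ q
     where import Data.Nat.Properties as ℕₚ

    f-↭ : ∀ {xs ys} y → xs ↭ ys → f xs y ≈ f ys y
    f-↭ {xs} {ys} y r = +-cong (signSum-↭ (λ p → *-cong (c-↭ p) (B-↭ y p)) r)
     (*-cong (-‿cong (proj₁ (J-length {0ℤ ∷ xs} {0ℤ ∷ ys} (cong suc (↭-length r))))) (*-congˡ (*-congˡ (prodOver-↭ (d y) r))))

    -- Gives the zero at X (-x) from the one at X x.
    f-neg : ∀ {x xs} y → f (ℤ.- x ∷ xs) y ≈ f (x ∷ xs) y
    f-neg {x} {xs} y = +-cong (signSum-neg (λ l → c l * B y l) x xs) (*-congˡ (*-congˡ (*-congˡ (D-signed y (neg {x} (self xs))))))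
     where
     self : ∀ xs → Signed xs xs
     self [] = []
     self (x ∷ xs) = pos (self xs)

    f-at-roots : ∀ pre xs → Good (pre ++ xs) → All (λ r → f (pre ++ xs) r ≈ 0#) (roots xs)
    f-at-roots pre [] g = []
    f-at-roots pre (x ∷ xs) g with Good-↭ (shift x pre xs) g
    ... | d ∷ ds , a ∷ as =
     trans (f-↭ (X x) (shift x pre xs)) (f-at-head d a) ∷
     trans (f-↭ (X (ℤ.- x)) (shift x pre xs)) (trans (sym (f-neg {x} {pre ++ xs} (X (ℤ.- x)))) (f-at-head (Double≢0-neg {x} d) (All.map Apart-negˡ a))) ∷
     All.map (trans (reflexive-f (assoc x pre xs) _))
      (f-at-roots (pre ++ x ∷ []) xs (subst Good (assoc x pre xs) g))
     where
     assoc : ∀ x (pre xs : List ℤ) → pre ++ x ∷ xs ≡ (pre ++ x ∷ []) ++ xs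
     assoc x []        xs = ≡.refl
     assoc x (y ∷ pre) xs = cong (y ∷_) (assoc x pre xs)
     reflexive-f : ∀ {xs ys} → xs ≡ ys → ∀ r → f xs r ≈ f ys r
     reflexive-f ≡.refl r = refl

    f-zero : ∀ xs → Good xs → signSum c xs ≈ J xs → ∀ y → f xs y ≈ 0#
    f-zero xs g@(ds , _) IH = let p , q = ±1-separated-roots ds in
     poly-zero Λ (1# ∷ - 1# ∷ roots xs) (f-poly xs) (f-top xs IH)
      ((-1-separated-1 ∷ p) ∷ q ∷ separated g)
      (f-at-1 (*-identityˡ 1#) xs ∷ f-at-1 (solve Λ 0 0 (:- :1 :* :- :1 := :1)) xs ∷ f-at-roots [] xs g)

    cancel-D : ∀ {y xs} → All (Apart y) xs → Cancellable Λ (D (X y) xs)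
    cancel-D [] = cancel-unit 1# (*-identityˡ _)
    cancel-D {y} {z ∷ _} (a ∷ as) = cancel-* (cancel-cong (solve Λ 0 2 (λ y z → :u (y ⊞ z) :* (:- :X (y ⊟ z) :* :u (⊟ y ⊞ z)) :=
      (:1 :+ :- :X z :* :X y) :* (:1 :+ :- :X (⊟ z) :* :X y)) y z)
     (cancel-* (cancel-u (Apart.sum≢0 a)) (cancel-* (cancel-unit (- X (z ℤ.- y)) (solve Λ 0 2 (λ y z → :- :X (y ⊟ z) :* :- :X (z ⊟ y) := :1) y z))
      (cancel-u (Apart.diff≢0 a))))) (cancel-D as)

   -- Induction on the number of variables: the polynomial for `xs` vanishes identically, and its
   -- value at the new variable is the claim multiplied by u (y + y) and `D`, both cancellable.
   signSum-c : ∀ xs → Good xs → signSum c xs ≈ J xs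
   signSum-c [] g = refl
   signSum-c (y ∷ xs) (dy ∷ ds , ay ∷ as) = begin
    signSum c (y ∷ xs)                   ≈⟨ solve Λ 2 0 (λ a b → a := (a :- b) :+ b) _ (J (y ∷ xs)) ⟩
    (signSum c (y ∷ xs) - J (y ∷ xs)) + J (y ∷ xs)
     ≈⟨ +-congʳ (cancel-* (cancel-u dy) (cancel-D ay) diff) ⟩
    0# + J (y ∷ xs)                      ≈⟨ +-identityˡ _ ⟩
    J (y ∷ xs)                           ∎
    where
    term : ∀ {l} → Signed l xs → c (y ∷ l) + c (ℤ.- y ∷ l) ≈ j (y ℤ.+ y) * (c l * (Γ⁺ (X y) * W y l + - 1# * (Γ⁻ (X y) * W (ℤ.- y) l)))
    term {l} s = trans (+-congˡ (*-congʳ (*-congʳ (one-neg {y} dy))))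
     (solve Λ 6 0 (λ g h j w w′ c → g :* j :* w :* c :+ :- (h :* j) :* w′ :* c := j :* (c :* (g :* w :+ :- :1 :* (h :* w′)))) _ _ _ _ _ _)

    S : Carrier
    S = signSum (λ l → c l * (Γ⁺ (X y) * W y l + - 1# * (Γ⁻ (X y) * W (ℤ.- y) l))) xs

    S-D : D (X y) xs * S ≈ signSum (λ l → c l * B (X y) l) xs
    S-D = trans (sym (signSum-* _ _ xs)) (signSum-cong xs λ {l} s → trans (*-congʳ (sym (D-signed (X y) s))) (trans
     (solve Λ 6 0 (λ d c g w h w′ → d :* (c :* (g :* w :+ :- :1 :* (h :* w′))) := c :* (g :* (w :* d) :+ :- :1 :* (h :* (w′ :* d)))) _ _ _ _ _ _)
     (*-congˡ (+-cong (*-congˡ (W-pos (Signed-All-Apart s ay))) (*-congˡ (*-congˡ (W-neg (Signed-All-Apart s ay))))))))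

    diff : u (y ℤ.+ y) * D (X y) xs * (signSum c (y ∷ xs) - J (y ∷ xs)) ≈ 0#
    diff = begin
     u (y ℤ.+ y) * D (X y) xs * (signSum c (y ∷ xs) - J (y ∷ xs))
      ≈⟨ *-congˡ (+-congʳ (trans (sym (signSum-+ _ _ xs)) (trans (signSum-cong xs term) (signSum-* _ _ xs)))) ⟩
     u (y ℤ.+ y) * D (X y) xs * (j (y ℤ.+ y) * S - J (y ∷ xs))
      ≈⟨ solve Λ 5 0 (λ u d j s k → u :* d :* (j :* s :- k) := (u :* j) :* (d :* s) :- u :* (d :* k)) _ _ _ _ _ ⟩
     (u (y ℤ.+ y) * j (y ℤ.+ y)) * (D (X y) xs * S) - u (y ℤ.+ y) * (D (X y) xs * J (y ∷ xs))
      ≈⟨ +-congʳ (trans (*-cong (u*j dy) S-D) (*-identityˡ _)) ⟩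
     signSum (λ l → c l * B (X y) l) xs - u (y ℤ.+ y) * (D (X y) xs * J (y ∷ xs))
      ≈⟨ +-congˡ (solve Λ 2 1 (λ d k y → :- (:u (y ⊞ y) :* (d :* k)) := :- k :* ((:1 :+ :1 :* :X y) :* ((:1 :+ :- :1 :* :X y) :* d))) _ _ y) ⟩
     f xs (X y)
      ≈⟨ f-zero xs (ds , as) (signSum-c xs (ds , as)) (X y) ⟩
     0# ∎

-- Sums over splittings of a list

module Split where

 open Base
 open Solver

 data Split {A : Set} : List A → List A → List A → Set where
  []    : Split [] [] []
  left  : ∀ {x S W V} → Split S W V → Split (x ∷ S) W (x ∷ V)
  right : ∀ {x S W V} → Split S W V → Split S (x ∷ W) (x ∷ V)

 module _ {A : Set} {P : A → Set} where
  Split-Allˡ : ∀ {S W V} → Split S W V → All P V → All P S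
  Split-Allˡ [] [] = []
  Split-Allˡ (left s) (p ∷ ps) = p ∷ Split-Allˡ s ps
  Split-Allˡ (right s) (p ∷ ps) = Split-Allˡ s ps

  Split-Allʳ : ∀ {S W V} → Split S W V → All P V → All P W
  Split-Allʳ [] [] = []
  Split-Allʳ (left s) (p ∷ ps) = Split-Allʳ s ps
  Split-Allʳ (right s) (p ∷ ps) = p ∷ Split-Allʳ s ps

 Split-length : ∀ {A : Set} {S W V : List A} → Split S W V → length S ℕ.+ length W ≡ length V
 Split-length [] = ≡.refl
 Split-length (left s) = cong suc (Split-length s)
 Split-length {S = S} {x ∷ W} (right s) = ≡.trans (+-suc (length S) (length W)) (cong suc (Split-length s))

 module SplitSum (Λ : ExpRing) {A : Set} where
  open ExpRing Λ

  splitSum : (List A → List A → Carrier) → List A → Carrier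
  splitSum G []       = G [] []
  splitSum G (x ∷ xs) = splitSum (λ S W → G (x ∷ S) W) xs + splitSum (λ S W → G S (x ∷ W)) xs

  splitSum-cong : ∀ {G H} xs → (∀ {S W} → Split S W xs → G S W ≈ H S W) → splitSum G xs ≈ splitSum H xs
  splitSum-cong []       h = h []
  splitSum-cong (x ∷ xs) h = +-cong (splitSum-cong xs λ s → h (left s)) (splitSum-cong xs λ s → h (right s))

  splitSum-+ : ∀ G H xs → splitSum (λ S W → G S W + H S W) xs ≈ splitSum G xs + splitSum H xs
  splitSum-+ G H []       = refl
  splitSum-+ G H (x ∷ xs) = trans (+-cong (splitSum-+ _ _ xs) (splitSum-+ _ _ xs)) (+-interchange _ _ _ _)

  splitSum-* : ∀ k G xs → splitSum (λ S W → k * G S W) xs ≈ k * splitSum G xs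
  splitSum-* k G []       = refl
  splitSum-* k G (x ∷ xs) = trans (+-cong (splitSum-* k _ xs) (splitSum-* k _ xs)) (sym (distribˡ _ _ _))

  -- Both sides run over the splittings of V into three sublists.
  splitSum-assoc : ∀ (H : List A → List A → List A → Carrier) V →
   splitSum (λ R V′ → splitSum (λ S W → H R S W) V′) V ≈ splitSum (λ U W → splitSum (λ R S → H R S W) U) V
  splitSum-assoc H [] = refl
  splitSum-assoc H (x ∷ V) = trans
   (+-cong (splitSum-assoc (λ R S W → H (x ∷ R) S W) V)
    (trans (splitSum-+ _ _ V) (+-cong (splitSum-assoc (λ R S W → H R (x ∷ S) W) V) (splitSum-assoc (λ R S W → H R S (x ∷ W)) V))))
   (trans (sym (+-assoc _ _ _)) (+-congʳ (sym (splitSum-+ _ _ V))))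

  private
   proper : (List A → List A → Carrier) → List A → Carrier
   proper G []       = 0#
   proper G (x ∷ xs) = proper (λ S W → G (x ∷ S) W) xs + splitSum (λ S W → G S (x ∷ W)) xs

   split-proper : ∀ G xs → splitSum G xs ≈ G xs [] + proper G xs
   split-proper G []       = sym (+-identityʳ _)
   split-proper G (x ∷ xs) = trans (+-congʳ (split-proper _ xs)) (+-assoc _ _ _)

   proper-cong : ∀ {G H} xs → (∀ {S W} → Split S W xs → length S < length xs → G S W ≈ H S W) → proper G xs ≈ proper H xs
   proper-cong []       h = refl
   proper-cong (x ∷ xs) h = +-cong (proper-cong xs λ s l → h (left s) (s≤s l))
    (splitSum-cong xs λ {S} {W} s → h (right s) (s≤s (subst (length S ≤_) (Split-length s) (m≤m+n _ _))))

  -- Triangularity: in an equation between two sums over splittings, all terms but the one with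
  -- everything on the left are known to agree. This allows induction on the length.
  splitSum-top : ∀ {G H} xs → splitSum G xs ≈ splitSum H xs →
   (∀ {S W} → Split S W xs → length S < length xs → G S W ≈ H S W) → G xs [] ≈ H xs []
  splitSum-top {G} {H} xs e h = trans (cancel (G xs []) (proper G xs))
   (trans (+-cong (trans (sym (split-proper G xs)) (trans e (split-proper H xs))) (-‿cong (proper-cong xs h))) (sym (cancel (H xs []) (proper H xs))))
   where
   cancel : ∀ a b → a ≈ (a + b) - b
   cancel = solve Λ 2 0 (λ a b → a := (a :+ b) :- b)

-- The bounded Littlewood identity

module Littlewood where

 open Base
 open Solver
 open Signs
 open Split
 open JSum

 times : ℕ → ℤ → ℤ
 times zero    x = 0ℤ
 times (suc m) x = x ℤ.+ times m x

 Good-tail : ∀ {x xs} → Good (x ∷ xs) → Good xs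
 Good-tail (d ∷ ds , a ∷ as) = ds , as

 Split-Goodˡ : ∀ {S W V} → Split S W V → Good V → Good S
 Split-Goodˡ [] g = g
 Split-Goodˡ (left s) (d ∷ ds , a ∷ as) = let ds′ , as′ = Split-Goodˡ s (ds , as) in d ∷ ds′ , Split-Allˡ s a ∷ as′
 Split-Goodˡ (right s) g = Split-Goodˡ s (Good-tail g)

 Split-Goodʳ : ∀ {S W V} → Split S W V → Good V → Good W
 Split-Goodʳ [] g = g
 Split-Goodʳ (right s) (d ∷ ds , a ∷ as) = let ds′ , as′ = Split-Goodʳ s (ds , as) in d ∷ ds′ , Split-Allʳ s a ∷ as′
 Split-Goodʳ (left s) g = Split-Goodʳ s (Good-tail g)

 module _ (Q : QRing) (T : ℤ) where
  open QRing Q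
  open SignSum Λ
  open SplitSum Λ {ℤ}
  open Weights Q T
  open ≈-Reasoning

  c-scale : ∀ (h g : ℤ → Carrier) l → Density.c (λ z → h z * g z) l ≈ prodOver h l * Density.c g l
  c-scale h g [] = sym (*-identityˡ _)
  c-scale h g (z ∷ l) = trans (*-congˡ (c-scale h g l))
   (solve Λ 6 0 (λ h g j w p c → (h :* g) :* j :* w :* (p :* c) := (h :* p) :* (g :* j :* w :* c)) _ _ _ _ _ _)

  prodOver-Split : ∀ f {S W V} → Split S W V → prodOver f V ≈ prodOver f S * prodOver f W
  prodOver-Split f [] = sym (*-identityˡ _)
  prodOver-Split f (left s) = trans (*-congˡ (prodOver-Split f s)) (sym (*-assoc _ _ _))
  prodOver-Split f (right s) = trans (*-congˡ (prodOver-Split f s)) (x*yz≈y*xz _ _ _)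

  negs : List ℤ → List ℤ
  negs = map (λ x → ℤ.- x)

  prodOver-negs : ∀ f S → prodOver f (negs S) ≈ prodOver (λ x → f (ℤ.- x)) S
  prodOver-negs f []      = refl
  prodOver-negs f (x ∷ S) = *-congˡ (prodOver-negs f S)

  splitSum-signSum : ∀ {F} V → Symmetric F → splitSum (λ S W → F (negs S ++ W)) V ≈ signSum F V
  splitSum-signSum [] S = refl
  splitSum-signSum {F} (x ∷ V) S = trans (+-comm _ _) (+-cong
   (trans (splitSum-cong V λ {S′} {W} _ → S (shift x (negs S′) W)) (splitSum-signSum V λ p → S (prep _ p)))
   (splitSum-signSum V λ p → S (prep _ p)))

  -- A S W = ∏ (X_a - t X_b) / (X_a - X_b) over a ∈ S, b ∈ W.
  A : List ℤ → List ℤ → Carrier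
  A S V = prodOver (λ a → W (ℤ.- a) V) S

  -- The generating function of P_2λ over λ₁ ≤ m, in the recursive form that
  -- splits off the set S of the variables carrying the largest parts.
  F : ℕ → List ℤ → Carrier
  F zero    V = 1#
  F (suc m) V = splitSum (λ S V′ → prodOver (λ x → E (times (suc m) (x ℤ.+ x ℤ.+ (x ℤ.+ x)))) S * A S V′ * F m V′) V

  private
   open Density (λ _ → 1#)

   cs : List ℤ → List ℤ → Carrier
   cs S V = c (negs S ++ V)

   cs≈ : ∀ S V → cs S V ≈ c (negs S) * A S V * c V
   cs≈ S V = trans (c-++ (negs S) V) (*-congʳ (*-congˡ (prodOver-negs (λ a → W a V) S)))

   A-Split : ∀ R {S W V} → Split S W V → A R V ≈ A R S * A R W
   A-Split [] s = sym (*-identityˡ _)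
   A-Split (a ∷ R) s = trans (*-cong (prodOver-Split (w (ℤ.- a)) s) (A-Split R s))
    (*-interchange _ _ _ _)

   X⁻² : List ℤ → Carrier
   X⁻² = prodOver (λ x → E (ℤ.- (x ℤ.+ x ℤ.+ (x ℤ.+ x))))

   -- The sum that arises when m is raised by one. Of the elements finally inverted, R carries the
   -- new largest part and S was already inverted in the formula for m; X⁻² corrects the power on S.
   Ψ : List ℤ → Carrier
   Ψ = splitSum (λ R S → A R S * (X⁻² S * c (negs S)))

   J-one : ∀ V → J Q T 1# 0# 0# V ≈ 1#
   J-one [] = refl
   J-one (_ ∷ V) = trans (*-congˡ (J-one V)) (solve Λ 1 0 (λ t → (:1 :- :0 :* t) :* :1 := :1) _)

   J-δ : ∀ x V → J Q T 0# 1# 0# (x ∷ V) ≈ 0#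
   J-δ x V = solve Λ 2 0 (λ t j → (:0 :- :0 :* t) :* j := :0) _ _

   c-ext : ∀ {g g′ : ℤ → Carrier} → (∀ z → g z ≈ g′ z) → ∀ l → Density.c g l ≈ Density.c g′ l
   c-ext h [] = refl
   c-ext h (z ∷ l) = *-cong (*-congʳ (*-congʳ (h z))) (c-ext h l)

   Σcs≈1 : ∀ V → Good V → splitSum cs V ≈ 1#
   Σcs≈1 V g = trans (splitSum-signSum V c-↭) (trans (signSum-cong V λ {l} _ →
     c-ext (λ z → solve Λ 0 1 (λ z → :1 := :1 :+ :0 :* :X z :+ :0 :* (:X z :* :X z)) z) l)
    (trans (signSum-c Q T 1# 0# 0# V g) (J-one V)))

   -- ∏ X_z over the signed list is X⁻¹V ∏_S X⁻²; this brings J with numerator X to bear.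
   scaled : ∀ {S W V} → Split S W V → X⁻² S * cs S W ≈ prodOver (λ x → E (ℤ.- (x ℤ.+ x))) V * Density.c (γ Q T 0# 1# 0#) (negs S ++ W)
   scaled {S} {W} {V} s = sym (begin
    prodOver (λ x → E (ℤ.- (x ℤ.+ x))) V * Density.c (γ Q T 0# 1# 0#) (negs S ++ W)
     ≈⟨ *-cong (prodOver-Split _ s) (trans (c-ext (λ z → solve Λ 0 1 (λ z → :0 :+ :1 :* :X z :+ :0 :* (:X z :* :X z) := :X z :* :1) z) (negs S ++ W))
       (c-scale (λ z → E (z ℤ.+ z)) (λ _ → 1#) (negs S ++ W))) ⟩
    (prodOver (λ x → E (ℤ.- (x ℤ.+ x))) S * prodOver (λ x → E (ℤ.- (x ℤ.+ x))) W) * (prodOver (λ z → E (z ℤ.+ z)) (negs S ++ W) * cs S W)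
     ≈⟨ *-congˡ (*-congʳ (trans (prodOver-++ _ (negs S) W) (*-congʳ (prodOver-negs _ S)))) ⟩
    (prodOver (λ x → E (ℤ.- (x ℤ.+ x))) S * prodOver (λ x → E (ℤ.- (x ℤ.+ x))) W) * (prodOver (λ z → E (ℤ.- z ℤ.+ ℤ.- z)) S * prodOver (λ z → E (z ℤ.+ z)) W * cs S W)
     ≈⟨ solve Λ 5 0 (λ a b c d e → (a :* b) :* (c :* d :* e) := (a :* c) :* (b :* d) :* e) _ _ _ _ _ ⟩
    (prodOver (λ x → E (ℤ.- (x ℤ.+ x))) S * prodOver (λ z → E (ℤ.- z ℤ.+ ℤ.- z)) S) * (prodOver (λ x → E (ℤ.- (x ℤ.+ x))) W * prodOver (λ z → E (z ℤ.+ z)) W) * cs S W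
     ≈⟨ *-congʳ (*-cong
       (trans (sym (prodOver-* _ _ S)) (prodOver-cong S λ x → solve Λ 0 1 (λ x → :E (⊟ (x ⊞ x)) :* :E (⊟ x ⊞ ⊟ x) := :E (⊟ (x ⊞ x ⊞ (x ⊞ x)))) x))
       (trans (sym (prodOver-* _ _ W)) (trans (prodOver-cong W λ x → solve Λ 0 1 (λ x → :E (⊟ (x ⊞ x)) :* :E (x ⊞ x) := :1) x) (ones W)))) ⟩
    X⁻² S * 1# * cs S W
     ≈⟨ *-congʳ (*-identityʳ _) ⟩
    X⁻² S * cs S W ∎)
    where
    ones : ∀ l → prodOver (λ _ → 1#) l ≈ 1#
    ones [] = refl
    ones (_ ∷ l) = trans (*-identityˡ _) (ones l)

   ΣX⁻²cs≈0 : ∀ x V → Good (x ∷ V) → splitSum (λ S W → X⁻² S * cs S W) (x ∷ V) ≈ 0#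
   ΣX⁻²cs≈0 x V g = begin
    splitSum (λ S W → X⁻² S * cs S W) (x ∷ V) ≈⟨ splitSum-cong (x ∷ V) scaled ⟩
    splitSum (λ S W → X⁻¹V * Density.c (γ Q T 0# 1# 0#) (negs S ++ W)) (x ∷ V) ≈⟨ splitSum-* X⁻¹V (λ S W → Density.c (γ Q T 0# 1# 0#) (negs S ++ W)) (x ∷ V) ⟩
    X⁻¹V * splitSum (λ S W → Density.c (γ Q T 0# 1# 0#) (negs S ++ W)) (x ∷ V)
     ≈⟨ *-congˡ (trans (splitSum-signSum (x ∷ V) (Density.c-↭ (γ Q T 0# 1# 0#))) (trans (signSum-c Q T 0# 1# 0# (x ∷ V) g) (J-δ x V))) ⟩
    X⁻¹V * 0# ≈⟨ zeroʳ _ ⟩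
    0# ∎
    where
    X⁻¹V : Carrier
    X⁻¹V = prodOver (λ x → E (ℤ.- (x ℤ.+ x))) (x ∷ V)

   only-left : ∀ {G} V → (∀ {S x W} → Split S (x ∷ W) V → G S (x ∷ W) ≈ 0#) → splitSum G V ≈ G V []
   only-left [] h = refl
   only-left {G} (x ∷ V) h = trans (+-cong (only-left V λ s → h (left s)) (trans (splitSum-cong V λ s → h (right s)) (zeros V))) (+-identityʳ _)
    where
    zeros : ∀ V → splitSum (λ _ _ → 0#) V ≈ 0#
    zeros [] = refl
    zeros (_ ∷ V) = trans (+-cong (zeros V) (zeros V)) (+-identityˡ _)

   A-[] : ∀ V → A V [] ≈ 1#
   A-[] [] = refl
   A-[] (_ ∷ V) = trans (*-identityˡ _) (A-[] V)

   combine : ∀ V → splitSum (λ R V′ → A R V′ * splitSum (λ S W → X⁻² S * cs S W) V′) V ≈ splitSum (λ U W → A U W * c W * Ψ U) V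
   combine V = begin
    splitSum (λ R V′ → A R V′ * splitSum (λ S W → X⁻² S * cs S W) V′) V
     ≈⟨ (splitSum-cong V λ {R} {V′} _ → trans (sym (splitSum-* _ _ V′)) (splitSum-cong V′ λ {S} {W} s →
       trans (*-cong (A-Split R s) (*-congˡ (cs≈ S W)))
        (solve Λ 6 0 (λ a b x c d e → (a :* b) :* (x :* (c :* d :* e)) := (b :* d) :* e :* (a :* (x :* c)))
         (A R S) (A R W) (X⁻² S) (c (negs S)) (A S W) (c W)))) ⟩
    splitSum (λ R V′ → splitSum (λ S W → (A R W * A S W) * c W * (A R S * (X⁻² S * c (negs S)))) V′) V
     ≈⟨ splitSum-assoc _ V ⟩
    splitSum (λ U W → splitSum (λ R S → (A R W * A S W) * c W * (A R S * (X⁻² S * c (negs S)))) U) V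
     ≈⟨ (splitSum-cong V λ {U} {W} _ → trans (splitSum-cong U λ s → *-congʳ (*-congʳ (sym (prodOver-Split _ s)))) (splitSum-* _ _ U)) ⟩
    splitSum (λ U W → A U W * c W * Ψ U) V ∎

   -- Regrouped by R, the inner sum is a sign sum with numerator X, which is 0 unless no variable is
   -- left. Only R = V contributes.
   ΣΨ≈1 : ∀ V → Good V → splitSum (λ U W → A U W * c W * Ψ U) V ≈ 1#
   ΣΨ≈1 V g = begin
    splitSum (λ U W → A U W * c W * Ψ U) V
     ≈⟨ sym (combine V) ⟩
    splitSum (λ R V′ → A R V′ * splitSum (λ S W → X⁻² S * cs S W) V′) V
     ≈⟨ only-left V (λ {S} {x} {W} s → trans (*-congˡ (ΣX⁻²cs≈0 x W (Split-Goodʳ s g))) (zeroʳ _)) ⟩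
    A V [] * (1# * 1#)
     ≈⟨ trans (*-cong (A-[] V) (*-identityˡ 1#)) (*-identityˡ 1#) ⟩
    1# ∎

   -- `ΣΨ≈1` and `Σcs≈1` expand 1 with the same coefficients A U W * c W. By induction the terms
   -- with U shorter than V agree, hence so do those with U = V.
   Ψ≈ : ∀ n V → length V ℕ.≤ n → Good V → Ψ V ≈ c (negs V)
   Ψ≈ n V len g = trans (sym (unit V (Ψ V))) (trans
    (splitSum-top V (trans (ΣΨ≈1 V g) (trans (sym (Σcs≈1 V g)) (splitSum-cong V λ {S} {W} _ →
      trans (cs≈ S W) (solve Λ 3 0 (λ a b c → a :* b :* c := b :* c :* a) _ _ _))))
     (below n len))
    (unit V (c (negs V))))
    where
    unit : ∀ V k → A V [] * c [] * k ≈ k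
    unit V k = trans (*-congʳ (trans (*-identityʳ _) (A-[] V))) (*-identityˡ k)
    below : ∀ n → length V ℕ.≤ n → ∀ {S W} → Split S W V → length S < length V → A S W * c W * Ψ S ≈ A S W * c W * c (negs S)
    below zero    len s l = ⊥-elim (n≮0 (≤-trans l len))
     where import Data.Empty
    below (suc n) len {S} s l = *-congˡ (Ψ≈ n S (≤-pred (≤-trans l len)) (Split-Goodˡ s g))

   X^ : ℕ → List ℤ → Carrier
   X^ m = prodOver (λ x → E (times m (x ℤ.+ x ℤ.+ (x ℤ.+ x))))

   -- Inserting the formula for m into the recursion gives a sum over splittings into R, S, W. For
   -- fixed union U of R and S the inner sum is `Ψ U`, and `Ψ≈` turns it into the inverted density.
   F≈split : ∀ m V → Good V → F m V ≈ splitSum (λ S W → X^ m S * cs S W) V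
   F≈split zero V g = sym (trans (splitSum-cong V λ {S} _ → trans (*-congʳ (X^0 S)) (*-identityˡ _)) (Σcs≈1 V g))
    where
    X^0 : ∀ S → X^ zero S ≈ 1#
    X^0 [] = refl
    X^0 (_ ∷ S) = trans (*-cong E-0 (X^0 S)) (*-identityˡ _)
   F≈split (suc m) V g = begin
    splitSum (λ R V′ → X^ (suc m) R * A R V′ * F m V′) V
     ≈⟨ (splitSum-cong V λ {R} {V′} r → trans (*-congˡ (F≈split m V′ (Split-Goodʳ r g))) (trans (sym (splitSum-* _ _ V′)) (splitSum-cong V′ λ {S} {W} s →
       trans (*-cong (*-congˡ (A-Split R s)) (*-cong (X^-lower S) (cs≈ S W)))
        (solve Λ 8 0 (λ r s a b x c d e → r :* (a :* b) :* ((s :* x) :* (c :* d :* e)) := (r :* s) :* ((b :* d) :* e) :* (a :* (x :* c)))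
         (X^ (suc m) R) (X^ (suc m) S) (A R S) (A R W) (X⁻² S) (c (negs S)) (A S W) (c W))))) ⟩
    splitSum (λ R V′ → splitSum (λ S W → (X^ (suc m) R * X^ (suc m) S) * ((A R W * A S W) * c W) * (A R S * (X⁻² S * c (negs S)))) V′) V
     ≈⟨ splitSum-assoc _ V ⟩
    splitSum (λ U W → splitSum (λ R S → (X^ (suc m) R * X^ (suc m) S) * ((A R W * A S W) * c W) * (A R S * (X⁻² S * c (negs S)))) U) V
     ≈⟨ (splitSum-cong V λ {U} {W} v → trans (splitSum-cong U λ s → *-congʳ (*-cong (sym (prodOver-Split _ s)) (*-congʳ (sym (prodOver-Split _ s)))))
       (trans (splitSum-* _ _ U) (trans (*-congˡ (Ψ≈ (length U) U ≤-refl (Split-Goodˡ v g)))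
        (trans (solve Λ 4 0 (λ x a c d → x :* (a :* c) :* d := x :* (d :* a :* c)) _ _ _ _) (*-congˡ (sym (cs≈ U W))))))) ⟩
    splitSum (λ U W → X^ (suc m) U * cs U W) V ∎
    where
    X^-lower : ∀ S → X^ m S ≈ X^ (suc m) S * X⁻² S
    X^-lower S = trans (prodOver-cong S λ x → solve Λ 0 2 (λ k x → :E k := :E (x ⊞ x ⊞ (x ⊞ x) ⊞ k) :* :E (⊟ (x ⊞ x ⊞ (x ⊞ x)))) (times m (x ℤ.+ x ℤ.+ (x ℤ.+ x))) x) (prodOver-* _ _ S)

  -- Taking out X^m for every variable leaves X_z^(-m) for each element z of the signed list, so the
  -- power of the inverted elements becomes a numerator of the density.
  F≈signSum : ∀ m V → Good V → F m V ≈ prodOver (λ x → E (times m (x ℤ.+ x))) V * signSum (Density.c (λ z → E (ℤ.- times m (z ℤ.+ z)))) V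
  F≈signSum m V g = begin
   F m V ≈⟨ F≈split m V g ⟩
   splitSum (λ S W → X^ m S * cs S W) V ≈⟨ splitSum-cong V rescale ⟩
   splitSum (λ S W → prodOver up V * Density.c down (negs S ++ W)) V ≈⟨ splitSum-* _ _ V ⟩
   prodOver up V * splitSum (λ S W → Density.c down (negs S ++ W)) V ≈⟨ *-congˡ (splitSum-signSum V (Density.c-↭ _)) ⟩
   prodOver up V * signSum (Density.c down) V ∎
   where
   up down : ℤ → Carrier
   up x = E (times m (x ℤ.+ x))
   down z = E (ℤ.- times m (z ℤ.+ z))

   times-neg : ∀ m x → times m (ℤ.- x) ≡ ℤ.- times m x
   times-neg zero x = ≡.refl
   times-neg (suc m) x = ≡.trans (cong (ℤ._+_ (ℤ.- x)) (times-neg m x)) (≡.sym (ℤₚ.neg-distrib-+ x (times m x)))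

   times-+ : ∀ m x y → times m (x ℤ.+ y) ≡ times m x ℤ.+ times m y
   times-+ zero x y = ≡.refl
   times-+ (suc m) x y = ≡.trans (cong (ℤ._+_ (x ℤ.+ y)) (times-+ m x y)) (lem x y (times m x) (times m y))
    where
    lem : ∀ a b c d → (a ℤ.+ b) ℤ.+ (c ℤ.+ d) ≡ (a ℤ.+ c) ℤ.+ (b ℤ.+ d)
    lem = ℤ-ring
     where import Data.Integer.Tactic.RingSolver as ℤ-Solver

   ones : ∀ l → prodOver (λ x → up x * down x) l ≈ 1#
   ones [] = refl
   ones (x ∷ l) = trans (*-cong (solve Λ 0 1 (λ a → :E a :* :E (⊟ a) := :1) (times m (x ℤ.+ x))) (ones l)) (*-identityˡ _)

   down-neg : ∀ x → up x * down (ℤ.- x) ≈ E (times m (x ℤ.+ x ℤ.+ (x ℤ.+ x)))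
   down-neg x = trans (*-congˡ (E-≡′ (≡.trans (cong (λ x → ℤ.- x) (≡.trans (cong (times m) (≡.sym (ℤₚ.neg-distrib-+ x x))) (times-neg m (x ℤ.+ x)))) (ℤₚ.neg-involutive _))))
    (trans (sym (E-+ _ _)) (E-≡′ (≡.sym (times-+ m (x ℤ.+ x) (x ℤ.+ x)))))
    where
    E-≡′ : ∀ {a b} → a ≡ b → E a ≈ E b
    E-≡′ ≡.refl = refl

   rescale : ∀ {S W} → Split S W V → X^ m S * cs S W ≈ prodOver up V * Density.c down (negs S ++ W)
   rescale {S} {W} s = sym (begin
    prodOver up V * Density.c down (negs S ++ W)
     ≈⟨ *-cong (prodOver-Split up s) (trans (c-ext (λ z → sym (*-identityʳ _)) (negs S ++ W)) (trans (c-scale down (λ _ → 1#) (negs S ++ W))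
       (*-congʳ (trans (prodOver-++ down (negs S) W) (*-congʳ (prodOver-negs down S)))))) ⟩
    (prodOver up S * prodOver up W) * ((prodOver (λ x → down (ℤ.- x)) S * prodOver down W) * cs S W)
     ≈⟨ solve Λ 5 0 (λ a b c d e → (a :* b) :* ((c :* d) :* e) := (a :* c) :* (b :* d) :* e) _ _ _ _ _ ⟩
    (prodOver up S * prodOver (λ x → down (ℤ.- x)) S) * (prodOver up W * prodOver down W) * cs S W
     ≈⟨ *-congʳ (*-cong (trans (sym (prodOver-* _ _ S)) (prodOver-cong S down-neg)) (trans (sym (prodOver-* _ _ W)) (ones W))) ⟩
    X^ m S * 1# * cs S W ≈⟨ *-congʳ (*-identityʳ _) ⟩
    X^ m S * cs S W ∎)

-- Chains of ratio t and the weights of cuts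

module Chains where

 open Base
 open Solver
 open Signs
 open Littlewood using (times)

 times-+ : ∀ m n x → times (m ℕ.+ n) x ≡ times m x ℤ.+ times n x
 times-+ zero n x = ≡.sym (ℤₚ.+-identityˡ _)
 times-+ (suc m) n x = ≡.trans (cong (ℤ._+_ x) (times-+ m n x)) (≡.sym (ℤₚ.+-assoc x _ _))

 4× : ℤ → ℤ
 4× x = x ℤ.+ x ℤ.+ (x ℤ.+ x)

 module SumN (Λ : ExpRing) where
  open ExpRing Λ

  sumN : ℕ → (ℕ → Carrier) → Carrier
  sumN zero    h = h 0
  sumN (suc n) h = h 0 + sumN n (λ k → h (suc k))

  sumN-cong : ∀ {h h′} n → (∀ k → k ≤ n → h k ≈ h′ k) → sumN n h ≈ sumN n h′
  sumN-cong zero e = e 0 z≤n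
  sumN-cong (suc n) e = +-cong (e 0 z≤n) (sumN-cong n λ k l → e (suc k) (s≤s l))

  sumN-+ : ∀ n h h′ → sumN n (λ k → h k + h′ k) ≈ sumN n h + sumN n h′
  sumN-+ zero h h′ = refl
  sumN-+ (suc n) h h′ = trans (+-congˡ (sumN-+ n _ _))
   (+-interchange _ _ _ _)

  sumN-* : ∀ n k h → sumN n (λ i → k * h i) ≈ k * sumN n h
  sumN-* zero k h = refl
  sumN-* (suc n) k h = trans (+-congˡ (sumN-* n k _)) (sym (distribˡ _ _ _))

 module _ (Q : QRing) (H : ℤ) (L : ℕ) where
  open QRing Q
  open SignSum Λ
  open SumN Λ
  open ≈-Reasoning

  T : ℤ
  T = H ℤ.+ H

  TL : ℤ
  TL = times L T

  open Weights Q T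

  s : ℤ → Carrier
  s a = E (ℤ.- a) - E a

  at : ℤ → ℕ → ℤ
  at x zero    = x
  at x (suc p) = at (x ℤ.+ T) p

  ascend : ℤ → ℕ → List ℤ
  ascend x zero    = []
  ascend x (suc l) = x ∷ ascend (x ℤ.+ T) l

  descend : ℤ → ℕ → List ℤ
  descend x zero    = []
  descend x (suc p) = ℤ.- x ∷ descend (x ℤ.+ T) p

  -- the chain x, x + T, … of p + l terms with the signs of the first p terms changed
  cut : ℤ → ℕ → ℕ → List ℤ
  cut x zero    l = ascend x l
  cut x (suc p) l = ℤ.- x ∷ cut (x ℤ.+ T) p l

  at≡ : ∀ x p → at x p ≡ x ℤ.+ times p T
  at≡ x zero = ≡.sym (ℤₚ.+-identityʳ x)
  at≡ x (suc p) = ≡.trans (at≡ (x ℤ.+ T) p) (ℤₚ.+-assoc x T _)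

  cut≡ : ∀ x p l → cut x p l ≡ descend x p ++ ascend (at x p) l
  cut≡ x zero l = ≡.refl
  cut≡ x (suc p) l = cong (_ ∷_) (cut≡ (x ℤ.+ T) p l)

  cut-suc≡ : ∀ x p l → cut x (suc p) l ≡ descend x p ++ ℤ.- at x p ∷ ascend (at x p ℤ.+ T) l
  cut-suc≡ x zero l = ≡.refl
  cut-suc≡ x (suc p) l = cong (_ ∷_) (cut-suc≡ (x ℤ.+ T) p l)

  -- Collapse of a sum over signs along a chain: w(a, -(a + T)) = 0.

  Vanishing : (List ℤ → Carrier) → Set
  Vanishing F = ∀ l a l′ → F (l ++ a ∷ ℤ.- (a ℤ.+ T) ∷ l′) ≈ 0#

  Vanishing-∷ : ∀ F a → Vanishing F → Vanishing (λ l → F (a ∷ l))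
  Vanishing-∷ F a v l = v (a ∷ l)

  private
   -- Once an element keeps its sign, changing that of its successor gives 0, so the rest of the
   -- chain is fixed.
   after-plus : ∀ F → Vanishing F → ∀ x l → signSum (λ k → F (x ∷ k)) (ascend (x ℤ.+ T) l) ≈ F (x ∷ ascend (x ℤ.+ T) l)
   after-plus F v x zero = refl
   after-plus F v x (suc l) = trans (+-cong (after-plus (λ k → F (x ∷ k)) (Vanishing-∷ F x v) (x ℤ.+ T) l) (signSum-0 (ascend (x ℤ.+ T ℤ.+ T) l) λ {k} _ → v [] x k)) (+-identityʳ _)

  signSum-chain : ∀ F → Vanishing F → ∀ x l → signSum F (ascend x l) ≈ sumN l (λ p → F (cut x p (l ∸ p)))
  signSum-chain F v x zero = refl
  signSum-chain F v x (suc l) = +-cong (after-plus F v x l) (signSum-chain (λ k → F (ℤ.- x ∷ k)) (Vanishing-∷ F (ℤ.- x) v) (x ℤ.+ T) l)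

  -- Centres the chain: its 2L terms are y + H + kT with -L ≤ k < L.
  base : ℤ → ℤ
  base y = y ℤ.- TL ℤ.+ H

  -- The midpoint of the gap at the cut: before the change of signs, the neighbouring elements are Y
  -- - H and Y + H.
  Y : ℤ → ℕ → ℤ
  Y y p = y ℤ.- TL ℤ.+ times p T

  chains : List ℤ → List ℤ
  chains []       = []
  chains (y ∷ ys) = ascend (base y) (L ℕ.+ L) ++ chains ys

  Config : Set
  Config = List (ℤ × ℕ)

  cutOf : ℤ → ℕ → List ℤ
  cutOf y p = cut (base y) p (L ℕ.+ L ∸ p)

  Xs : Config → List ℤ
  Xs []              = []
  Xs ((y , p) ∷ cfg) = cutOf y p ++ Xs cfg

  Ys : Config → List ℤ
  Ys = map λ { (y , p) → Y y p }

  ys-of : Config → List ℤ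
  ys-of = map proj₁

  cutSum : (Config → Carrier) → List ℤ → Carrier
  cutSum G []       = G []
  cutSum G (y ∷ ys) = sumN (L ℕ.+ L) (λ p → cutSum (λ cfg → G ((y , p) ∷ cfg)) ys)

  Valid : Config → Set
  Valid = All λ yp → proj₂ yp ≤ L ℕ.+ L

  cutSum-cong : ∀ {G G′} ys → (∀ cfg → Valid cfg → ys-of cfg ≡ ys → G cfg ≈ G′ cfg) → cutSum G ys ≈ cutSum G′ ys
  cutSum-cong [] h = h [] [] ≡.refl
  cutSum-cong (y ∷ ys) h = sumN-cong (L ℕ.+ L) λ p p≤ → cutSum-cong ys λ cfg v e → h _ (p≤ ∷ v) (cong (y ∷_) e)

  cutSum-* : ∀ k G ys → cutSum (λ cfg → k * G cfg) ys ≈ k * cutSum G ys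
  cutSum-* k G [] = refl
  cutSum-* k G (y ∷ ys) = trans (sumN-cong (L ℕ.+ L) λ p _ → cutSum-* k _ ys) (sumN-* (L ℕ.+ L) k _)

  signSum-chains : ∀ {F} → Vanishing F → ∀ ys → signSum F (chains ys) ≈ cutSum (λ cfg → F (Xs cfg)) ys
  signSum-chains v [] = refl
  signSum-chains {F} v (y ∷ ys) = begin
   signSum F (ascend (base y) (L ℕ.+ L) ++ chains ys)
    ≈⟨ signSum-++ F (ascend (base y) (L ℕ.+ L)) (chains ys) ⟩
   signSum (λ l → signSum (λ l′ → F (l ++ l′)) (chains ys)) (ascend (base y) (L ℕ.+ L))
    ≈⟨ signSum-chain _ (λ l a l′ → signSum-0 (chains ys) λ {k} _ →
      trans (reflexive (cong F (Listₚ.++-assoc l (a ∷ ℤ.- (a ℤ.+ T) ∷ l′) k))) (v l a (l′ ++ k))) (base y) (L ℕ.+ L) ⟩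
   sumN (L ℕ.+ L) (λ p → signSum (λ l′ → F (cutOf y p ++ l′)) (chains ys))
    ≈⟨ (sumN-cong (L ℕ.+ L) λ p _ → signSum-chains (λ l a l′ →
      trans (reflexive (cong F (≡.sym (Listₚ.++-assoc (cutOf y p) l _)))) (v (cutOf y p ++ l) a l′)) ys) ⟩
   sumN (L ℕ.+ L) (λ p → cutSum (λ cfg → F (cutOf y p ++ Xs cfg)) ys) ∎

  private
   Signed-++ : ∀ {l l′ xs xs′} → Signed l xs → Signed l′ xs′ → Signed (l ++ l′) (xs ++ xs′)
   Signed-++ [] t = t
   Signed-++ (pos r) t = pos (Signed-++ r t)
   Signed-++ (neg r) t = neg (Signed-++ r t)

   Signed-ascend : ∀ x l → Signed (ascend x l) (ascend x l)
   Signed-ascend x zero = []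
   Signed-ascend x (suc l) = pos (Signed-ascend (x ℤ.+ T) l)

   Signed-cut : ∀ x p n → p ≤ n → Signed (cut x p (n ∸ p)) (ascend x n)
   Signed-cut x zero n z≤n = Signed-ascend x n
   Signed-cut x (suc p) (suc n) (s≤s l) = neg (Signed-cut (x ℤ.+ T) p n l)

  Signed-Xs : ∀ cfg → Valid cfg → Signed (Xs cfg) (chains (ys-of cfg))
  Signed-Xs [] [] = []
  Signed-Xs ((y , p) ∷ cfg) (p≤ ∷ v) = Signed-++ (Signed-cut (base y) p (L ℕ.+ L) p≤) (Signed-Xs cfg v)

  NonZeroSums : ℤ → List ℤ → Set
  NonZeroSums ξ = All λ z → ξ ℤ.+ z ≢ 0ℤ

  private
   u-≡ : ∀ {a b} → a ≡ b → u a ≈ u b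
   u-≡ ≡.refl = refl

   w*u : ∀ ξ z → ξ ℤ.+ z ≢ 0ℤ → w ξ z * u (ξ ℤ.+ z) ≈ u (ξ ℤ.+ z ℤ.+ T)
   w*u ξ z d = trans (solve Λ 3 0 (λ a b c → a :* b :* c := a :* (c :* b)) _ _ _) (trans (*-congˡ (u*j d)) (*-identityʳ _))

  -- Telescopes, because the numerator of each weight is the denominator of the next.
  W-ascend : ∀ ξ a l → NonZeroSums ξ (ascend a l) → W ξ (ascend a l) * u (ξ ℤ.+ a) ≈ u (ξ ℤ.+ at a l)
  W-ascend ξ a zero [] = *-identityˡ _
  W-ascend ξ a (suc l) (d ∷ ds) = begin
   w ξ a * W ξ (ascend (a ℤ.+ T) l) * u (ξ ℤ.+ a) ≈⟨ solve Λ 3 0 (λ a b c → a :* b :* c := b :* (a :* c)) _ _ _ ⟩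
   W ξ (ascend (a ℤ.+ T) l) * (w ξ a * u (ξ ℤ.+ a)) ≈⟨ *-congˡ (trans (w*u ξ a d) (u-≡ (ℤₚ.+-assoc ξ a T))) ⟩
   W ξ (ascend (a ℤ.+ T) l) * u (ξ ℤ.+ (a ℤ.+ T)) ≈⟨ W-ascend ξ (a ℤ.+ T) l ds ⟩
   u (ξ ℤ.+ at (a ℤ.+ T) l) ∎

  W-descend : ∀ ξ a p → NonZeroSums ξ (descend a p) → W ξ (descend a p) * u (ξ ℤ.- at a p ℤ.+ T) ≈ u (ξ ℤ.- a ℤ.+ T)
  W-descend ξ a zero [] = *-identityˡ _
  W-descend ξ a (suc p) (d ∷ ds) = begin
   w ξ (ℤ.- a) * W ξ (descend (a ℤ.+ T) p) * u (ξ ℤ.- at (a ℤ.+ T) p ℤ.+ T) ≈⟨ *-assoc _ _ _ ⟩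
   w ξ (ℤ.- a) * (W ξ (descend (a ℤ.+ T) p) * u (ξ ℤ.- at (a ℤ.+ T) p ℤ.+ T)) ≈⟨ *-congˡ (trans (W-descend ξ (a ℤ.+ T) p ds) (u-≡ (lem ξ a T))) ⟩
   w ξ (ℤ.- a) * u (ξ ℤ.+ ℤ.- a) ≈⟨ w*u ξ (ℤ.- a) d ⟩
   u (ξ ℤ.- a ℤ.+ T) ∎
   where
   lem : ∀ ξ a T → ξ ℤ.- (a ℤ.+ T) ℤ.+ T ≡ ξ ℤ.+ ℤ.- a
   lem = ℤ-ring

  private
   rem≡ : ∀ {p} → p ≤ L ℕ.+ L → times p T ℤ.+ times (L ℕ.+ L ∸ p) T ≡ TL ℤ.+ TL
   rem≡ {p} p≤ = ≡.trans (≡.sym (times-+ p (L ℕ.+ L ∸ p) T)) (≡.trans (cong (λ k → times k T) (m+[n∸m]≡n p≤)) (times-+ L L T))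

   at-base : ∀ y p → at (base y) p ≡ Y y p ℤ.+ H
   at-base y p = ≡.trans (at≡ (base y) p) (lem y TL H (times p T))
    where
    lem : ∀ y a h p → y ℤ.- a ℤ.+ h ℤ.+ p ≡ y ℤ.- a ℤ.+ p ℤ.+ h
    lem = ℤ-ring

  den num : ℤ → ℤ → Carrier
  den ξ b = u (ξ ℤ.+ H ℤ.- b) * u (ξ ℤ.+ H ℤ.+ b)
  num ξ b = u (ξ ℤ.+ H ℤ.+ TL ℤ.- b) * u (ξ ℤ.+ H ℤ.+ TL ℤ.+ b)

  -- Both halves of the chain telescope. The inner ends give `den`, the only trace of the cut; the
  -- outer ends give `num`, which depends on the chain alone.
  W-cutOf : ∀ ξ b p → p ≤ L ℕ.+ L → NonZeroSums ξ (cutOf b p) → W ξ (cutOf b p) * den ξ (Y b p) ≈ num ξ b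
  W-cutOf ξ b p p≤ d = begin
   W ξ (cutOf b p) * den ξ (Y b p)
    ≈⟨ *-cong (trans (reflexive (cong (W ξ) (cut≡ (base b) p r))) (prodOver-++ (w ξ) (descend (base b) p) _))
      (*-cong (u-≡ (≡.trans (lem₁ ξ H (Y b p)) (cong (λ z → ξ ℤ.- z ℤ.+ T) (≡.sym (at-base b p)))))
       (u-≡ (≡.trans (lem₂ ξ H (Y b p)) (cong (ℤ._+_ ξ) (≡.sym (at-base b p)))))) ⟩
   (W ξ (descend (base b) p) * W ξ (ascend x r)) * (u (ξ ℤ.- x ℤ.+ T) * u (ξ ℤ.+ x))
    ≈⟨ *-interchange _ _ _ _ ⟩
   (W ξ (descend (base b) p) * u (ξ ℤ.- x ℤ.+ T)) * (W ξ (ascend x r) * u (ξ ℤ.+ x))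
    ≈⟨ *-cong (W-descend ξ (base b) p (proj₁ d′)) (W-ascend ξ x r (proj₂ d′)) ⟩
   u (ξ ℤ.- base b ℤ.+ T) * u (ξ ℤ.+ at x r)
    ≈⟨ *-cong (u-≡ (lem₃ ξ H TL b)) (u-≡ (≡.trans (cong (ℤ._+_ ξ) end) (lem₄ ξ H TL b))) ⟩
   num ξ b ∎
   where
   r : ℕ
   r = L ℕ.+ L ∸ p
   x : ℤ
   x = at (base b) p
   d′ = Allₚ.++⁻ (descend (base b) p) (subst (NonZeroSums ξ) (cut≡ (base b) p r) d)
   end : at x r ≡ b ℤ.- TL ℤ.+ H ℤ.+ (TL ℤ.+ TL)
   end = ≡.trans (at≡ x r) (≡.trans (cong (ℤ._+ times r T) (at≡ (base b) p)) (≡.trans (ℤₚ.+-assoc (base b) _ _) (cong (ℤ._+_ (base b)) (rem≡ p≤))))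
   lem₁ : ∀ ξ H Y → ξ ℤ.+ H ℤ.- Y ≡ ξ ℤ.- (Y ℤ.+ H) ℤ.+ (H ℤ.+ H)
   lem₁ = ℤ-ring
   lem₂ : ∀ ξ H Y → ξ ℤ.+ H ℤ.+ Y ≡ ξ ℤ.+ (Y ℤ.+ H)
   lem₂ = ℤ-ring
   lem₃ : ∀ ξ H TL b → ξ ℤ.- (b ℤ.- TL ℤ.+ H) ℤ.+ (H ℤ.+ H) ≡ ξ ℤ.+ H ℤ.+ TL ℤ.- b
   lem₃ = ℤ-ring
   lem₄ : ∀ ξ H TL b → ξ ℤ.+ (b ℤ.- TL ℤ.+ H ℤ.+ (TL ℤ.+ TL)) ≡ ξ ℤ.+ H ℤ.+ TL ℤ.+ b
   lem₄ = ℤ-ring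

  W-Xs : ∀ ξ cfg → Valid cfg → NonZeroSums ξ (Xs cfg) → W ξ (Xs cfg) * prodOver (den ξ) (Ys cfg) ≈ prodOver (num ξ) (ys-of cfg)
  W-Xs ξ [] [] d = *-identityˡ _
  W-Xs ξ ((y , p) ∷ cfg) (p≤ ∷ v) d = let d₁ , d₂ = Allₚ.++⁻ (cutOf y p) d in
   trans (*-congʳ (prodOver-++ (w ξ) (cutOf y p) _)) (trans (*-interchange _ _ _ _)
    (*-cong (W-cutOf ξ y p p≤ d₁) (W-Xs ξ cfg v d₂)))

  module Move (g f₁ : ℤ → Carrier) (ν : ℕ) where
   open Density g

   V : ℤ → List ℤ → Carrier
   V a = prodOver (λ b → s (a ℤ.+ b) * s (a ℤ.- b))

   -- The Weyl denominator of type C when f₁ a = s (a + a) and of type B when f₁ a = s a; both cases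
   -- are used.
   Δ : List ℤ → Carrier
   Δ []      = 1#
   Δ (a ∷ l) = f₁ a * V a l * Δ l

   c-Vanishing : Vanishing c
   c-Vanishing [] a l′ = trans (*-congʳ (*-congˡ (*-congʳ (*-congʳ
    (solve Λ 0 2 (λ a T → :u (a ⊞ ⊟ (a ⊞ T) ⊞ T) := :0) a T)))))
    (solve Λ 4 0 (λ o j w c → o :* (:0 :* j :* w) :* c := :0) _ _ _ _)
   c-Vanishing (x ∷ l) a l′ = trans (*-congˡ (c-Vanishing l a l′)) (zeroʳ _)

   signs : List ℤ → Carrier
   signs []      = 1#
   signs (_ ∷ l) = - signs l

   Δ-shift : ∀ pre a post → Δ (pre ++ a ∷ post) ≈ signs pre * (f₁ a * V a (pre ++ post)) * Δ (pre ++ post)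
   Δ-shift [] a post = *-congʳ (sym (*-identityˡ _))
   Δ-shift (b ∷ pre) a post = trans (*-cong (*-congˡ (prodOver-↭ (λ z → s (b ℤ.+ z) * s (b ℤ.- z)) (shift a pre post))) (Δ-shift pre a post))
    (solve Λ 6 2 (λ fb vb σ fa va δ a b → fb :* (:s (b ⊞ a) :* :s (b ⊟ a) :* vb) :* (σ :* (fa :* va) :* δ) :=
      :- σ :* (fa :* (:s (a ⊞ b) :* :s (a ⊟ b) :* va)) :* (fb :* vb :* δ))
     (f₁ b) (V b (pre ++ post)) (signs pre) (f₁ a) (V a (pre ++ post)) (Δ (pre ++ post)) a b)

   -- g absorbs what remains of the weights after the products over all other elements are taken out.
   Compatible : ℕ → Set
   Compatible n = ∀ Y → g (ℤ.- (Y ℤ.+ H)) * f₁ Y * s (Y ℤ.+ T ℤ.+ (Y ℤ.+ T)) * E (times (suc n) (4× (Y ℤ.+ H)))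
             ≈ g (Y ℤ.+ H) * f₁ (Y ℤ.+ T) * s (Y ℤ.+ Y) * E (times ν (4× (Y ℤ.+ H)))

   private
    -- The factors left by the other chains at the moved element and at its inverse differ exactly
    -- as the Weyl denominator does when the midpoint goes from y to y + T. The monomials, one for
    -- each other chain, feed the exponent in `Compatible`.
    den-V : ∀ y l → prodOver (den (y ℤ.+ H)) l * V y l ≈ prodOver (den (ℤ.- (y ℤ.+ H))) l * V (y ℤ.+ T) l * E (times (length l) (4× (y ℤ.+ H)))
    den-V y [] = trans (*-identityˡ _) (sym (trans (*-cong (*-identityˡ _) E-0) (*-identityˡ _)))
    den-V y (b ∷ l) = begin
     (den (y ℤ.+ H) b * prodOver (den (y ℤ.+ H)) l) * (s (y ℤ.+ b) * s (y ℤ.- b) * V y l)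
      ≈⟨ *-interchange _ _ _ _ ⟩
     (den (y ℤ.+ H) b * (s (y ℤ.+ b) * s (y ℤ.- b))) * (prodOver (den (y ℤ.+ H)) l * V y l)
      ≈⟨ *-cong (solve Λ 0 3 (λ y H b → (:u (y ⊞ H ⊞ H ⊟ b) :* :u (y ⊞ H ⊞ H ⊞ b)) :* (:s (y ⊞ b) :* :s (y ⊟ b))
        := (:u (⊟ (y ⊞ H) ⊞ H ⊟ b) :* :u (⊟ (y ⊞ H) ⊞ H ⊞ b)) :* (:s (y ⊞ (H ⊞ H) ⊞ b) :* :s (y ⊞ (H ⊞ H) ⊟ b)) :* :E (y ⊞ H ⊞ (y ⊞ H) ⊞ (y ⊞ H ⊞ (y ⊞ H)))) y H b)
       (den-V y l) ⟩
     (den (ℤ.- (y ℤ.+ H)) b * (s (y ℤ.+ T ℤ.+ b) * s (y ℤ.+ T ℤ.- b)) * E (4× (y ℤ.+ H))) * (prodOver (den (ℤ.- (y ℤ.+ H))) l * V (y ℤ.+ T) l * E (times (length l) (4× (y ℤ.+ H))))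
      ≈⟨ solve Λ 4 2 (λ a b c d e f → (a :* b :* :E e) :* (c :* d :* :E f) := (a :* c) :* (b :* d) :* :E (e ⊞ f)) _ _ _ _ _ _ ⟩
     _ ∎

    -- the same chain contributes like a chain of its own, with the two vanishing differences replaced by T
    self : ∀ ξ y p → suc p ≤ L ℕ.+ L → ∀ {x} → x ≡ at (base y) p →
     NonZeroSums ξ (descend (base y) p) → NonZeroSums ξ (ascend (x ℤ.+ T) (L ℕ.+ L ∸ suc p)) →
     W ξ (descend (base y) p) * W ξ (ascend (x ℤ.+ T) (L ℕ.+ L ∸ suc p)) * (u (ξ ℤ.- x ℤ.+ T) * u (ξ ℤ.+ x ℤ.+ T)) ≈ num ξ y
    self ξ y p p< {x} ≡.refl d d′ = begin
     W ξ (descend (base y) p) * W ξ (ascend (x ℤ.+ T) l) * (u (ξ ℤ.- x ℤ.+ T) * u (ξ ℤ.+ x ℤ.+ T))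
      ≈⟨ *-interchange _ _ _ _ ⟩
     (W ξ (descend (base y) p) * u (ξ ℤ.- x ℤ.+ T)) * (W ξ (ascend (x ℤ.+ T) l) * u (ξ ℤ.+ x ℤ.+ T))
      ≈⟨ *-cong (W-descend ξ (base y) p d) (trans (*-congˡ (u-≡ (ℤₚ.+-assoc ξ x T))) (W-ascend ξ (x ℤ.+ T) l d′)) ⟩
     u (ξ ℤ.- base y ℤ.+ T) * u (ξ ℤ.+ at (x ℤ.+ T) l)
      ≈⟨ *-cong (u-≡ (lem₃ ξ H TL y)) (u-≡ (≡.trans (cong (ℤ._+_ ξ) end) (lem₄ ξ H TL y))) ⟩
     num ξ y ∎
     where
     l : ℕ
     l = L ℕ.+ L ∸ suc p
     lem₃ : ∀ ξ H TL b → ξ ℤ.- (b ℤ.- TL ℤ.+ H) ℤ.+ (H ℤ.+ H) ≡ ξ ℤ.+ H ℤ.+ TL ℤ.- b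
     lem₃ = ℤ-ring
     lem₄ : ∀ ξ H TL b → ξ ℤ.+ (b ℤ.- TL ℤ.+ H ℤ.+ (TL ℤ.+ TL)) ≡ ξ ℤ.+ H ℤ.+ TL ℤ.+ b
     lem₄ = ℤ-ring
     lem₅ : ∀ b p t l → b ℤ.+ p ℤ.+ t ℤ.+ l ≡ b ℤ.+ (t ℤ.+ p ℤ.+ l)
     lem₅ = ℤ-ring
     end : at (x ℤ.+ T) l ≡ y ℤ.- TL ℤ.+ H ℤ.+ (TL ℤ.+ TL)
     end = ≡.trans (at≡ (x ℤ.+ T) l) (≡.trans (cong (λ z → z ℤ.+ T ℤ.+ times l T) (at≡ (base y) p))
      (≡.trans (lem₅ (base y) (times p T) T (times l T)) (cong (ℤ._+_ (base y)) (rem≡ p<))))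

   N⁺ N⁻ : ℤ → List ℤ → Carrier
   N⁺ y = prodOver (num (y ℤ.+ H))
   N⁻ y = prodOver (num (ℤ.- (y ℤ.+ H)))

   Xs-++ : ∀ pre post → Xs (pre ++ post) ≡ Xs pre ++ Xs post
   Xs-++ [] post = ≡.refl
   Xs-++ ((y , p) ∷ pre) post = ≡.trans (cong (cutOf y p ++_) (Xs-++ pre post)) (≡.sym (Listₚ.++-assoc (cutOf y p) (Xs pre) (Xs post)))

   private
    c-shift : ∀ l x l′ → c (l ++ x ∷ l′) ≈ one x * W x (l ++ l′) * c (l ++ l′)
    c-shift l x l′ = c-↭ (shift x l l′)

   -- Advancing one cut inverts the single element Z = Y + H. The two densities share all factors
   -- without Z; the remaining ones are telescoped products at Z and -Z, and their quotient is one
   -- of Weyl denominators up to `num` and a monomial.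
   move : ∀ pre y p post → Compatible (length (pre ++ (y , p) ∷ post)) → Valid pre → suc p ≤ L ℕ.+ L → Valid post →
    Good (chains (ys-of (pre ++ (y , p) ∷ post))) →
    c (Xs (pre ++ (y , suc p) ∷ post)) * N⁺ (Y y p) (ys-of (pre ++ (y , p) ∷ post)) * Δ (Ys (pre ++ (y , p) ∷ post))
    ≈ c (Xs (pre ++ (y , p) ∷ post)) * N⁻ (Y y p) (ys-of (pre ++ (y , p) ∷ post)) * Δ (Ys (pre ++ (y , suc p) ∷ post))
     * E (times ν (4× (Y y p ℤ.+ H)))
   move pre y p post comp vpre p< vpost good = begin
    c (Xs (pre ++ (y , suc p) ∷ post)) * N⁺ Yp ys * Δ (Ys (pre ++ (y , p) ∷ post))
     -- The closed form N⁺ is traded back for W Z over all other elements, so that both W Z and W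
     -- (-Z) occur; at the end W (-Z) is absorbed into N⁻ in the same way.
     ≈⟨ *-cong (*-cong (trans (reflexive (cong c Xs-new)) (c-shift A (ℤ.- x) B)) (trans (N-split Z) (sym (W-all Z (nz⁺)))))
       (trans (reflexive (cong Δ (Listₚ.map-++ _ pre _))) (Δ-shift (Ys pre) Yp (Ys post))) ⟩
    (one (ℤ.- x) * W (ℤ.- x) (A ++ B) * c₀) * (W Z (A ++ B) * (u (Z ℤ.- Z ℤ.+ T) * u (Z ℤ.+ Z ℤ.+ T) * prodOver (den Z) O)) * (signs (Ys pre) * (f₁ Yp * V Yp O) * Δ O)
     ≈⟨ *-congʳ (*-cong (*-congʳ (*-cong (trans (*-congˡ (trans (reflexive (cong j (lem-x x))) (j-neg 2x≢0))) (reflexive (cong (λ x → g (ℤ.- x) * - (E (x ℤ.+ x ℤ.+ (x ℤ.+ x)) * j (x ℤ.+ x))) x≡))) (reflexive (cong (λ z → W (ℤ.- z) (A ++ B)) x≡)))) refl) ⟩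
    (g (ℤ.- Z) * - (E (4× Z) * j (Z ℤ.+ Z)) * W (ℤ.- Z) (A ++ B) * c₀) * (W Z (A ++ B) * (u (Z ℤ.- Z ℤ.+ T) * u (Z ℤ.+ Z ℤ.+ T) * prodOver (den Z) O)) * (signs (Ys pre) * (f₁ Yp * V Yp O) * Δ O)
     ≈⟨ solve Λ 10 2 (λ g j w c₀ w′ d σ f v δ y H →
       (g :* :- (:E (y ⊞ H ⊞ (y ⊞ H) ⊞ (y ⊞ H ⊞ (y ⊞ H))) :* j) :* w :* c₀) :* (w′ :* (:u (y ⊞ H ⊟ (y ⊞ H) ⊞ (H ⊞ H)) :* :u (y ⊞ H ⊞ (y ⊞ H) ⊞ (H ⊞ H)) :* d)) :* (σ :* (f :* v) :* δ)
       := (:- :E (y ⊞ H ⊞ (y ⊞ H) ⊞ (y ⊞ H ⊞ (y ⊞ H))) :* :u (y ⊞ (H ⊞ H) ⊞ (y ⊞ (H ⊞ H)))) :* :u (H ⊞ H) :* (g :* f :* (j :* w :* c₀ :* w′ :* σ :* δ)) :* (d :* v))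
       (g (ℤ.- Z)) (j (Z ℤ.+ Z)) (W (ℤ.- Z) (A ++ B)) c₀ (W Z (A ++ B)) (prodOver (den Z) O) (signs (Ys pre)) (f₁ Yp) (V Yp O) (Δ O) Yp H ⟩
    (- E (4× Z) * u (Yp ℤ.+ T ℤ.+ (Yp ℤ.+ T))) * u T * (g (ℤ.- Z) * f₁ Yp * K) * (prodOver (den Z) O * V Yp O)
     ≈⟨ *-congˡ (den-V Yp O) ⟩
    (- E (4× Z) * u (Yp ℤ.+ T ℤ.+ (Yp ℤ.+ T))) * u T * (g (ℤ.- Z) * f₁ Yp * K) * (prodOver (den (ℤ.- Z)) O * V (Yp ℤ.+ T) O * E (times (length O) (4× Z)))
     ≈⟨ solve Λ 6 3 (λ g f k d v m y H e →
       (:- :E (y ⊞ H ⊞ (y ⊞ H) ⊞ (y ⊞ H ⊞ (y ⊞ H))) :* :u (y ⊞ (H ⊞ H) ⊞ (y ⊞ (H ⊞ H)))) :* :u (H ⊞ H) :* (g :* f :* k) :* (d :* v :* :E e)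
       := (:- :E (⊟ (y ⊞ y)) :* :u (H ⊞ H) :* (d :* v :* k)) :* (g :* f :* :s (y ⊞ (H ⊞ H) ⊞ (y ⊞ (H ⊞ H))) :* :E (y ⊞ H ⊞ (y ⊞ H) ⊞ (y ⊞ H ⊞ (y ⊞ H)) ⊞ (y ⊞ H ⊞ (y ⊞ H) ⊞ (y ⊞ H ⊞ (y ⊞ H)) ⊞ e))))
       (g (ℤ.- Z)) (f₁ Yp) K (prodOver (den (ℤ.- Z)) O) (V (Yp ℤ.+ T) O) 1# Yp H (times (length O) (4× Z)) ⟩
    (- E (ℤ.- (Yp ℤ.+ Yp)) * u T * (prodOver (den (ℤ.- Z)) O * V (Yp ℤ.+ T) O * K)) * (g (ℤ.- Z) * f₁ Yp * s (Yp ℤ.+ T ℤ.+ (Yp ℤ.+ T)) * E (times (suc (suc (length O))) (4× Z)))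
     ≈⟨ *-congˡ (trans (*-congˡ (reflexive (cong (λ k → E (times (suc k) (4× Z))) (≡.sym length≡)))) (comp Yp)) ⟩
    (- E (ℤ.- (Yp ℤ.+ Yp)) * u T * (prodOver (den (ℤ.- Z)) O * V (Yp ℤ.+ T) O * K)) * (g Z * f₁ (Yp ℤ.+ T) * s (Yp ℤ.+ Yp) * E (times ν (4× Z)))
     ≈⟨ solve Λ 10 3 (λ j w c₀ w′ σ δ d v g f y H e →
       (:- :E (⊟ (y ⊞ y)) :* :u (H ⊞ H) :* (d :* v :* (j :* w :* c₀ :* w′ :* σ :* δ))) :* (g :* f :* :s (y ⊞ y) :* :E e)
       := (g :* j :* w′ :* c₀) :* (w :* (:u (⊟ (y ⊞ H) ⊟ (y ⊞ H) ⊞ (H ⊞ H)) :* :u (⊟ (y ⊞ H) ⊞ (y ⊞ H) ⊞ (H ⊞ H)) :* d)) :* (σ :* (f :* v) :* δ) :* :E e)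
       (j (Z ℤ.+ Z)) (W (ℤ.- Z) (A ++ B)) c₀ (W Z (A ++ B)) (signs (Ys pre)) (Δ O) (prodOver (den (ℤ.- Z)) O) (V (Yp ℤ.+ T) O) (g Z) (f₁ (Yp ℤ.+ T)) Yp H (times ν (4× Z)) ⟩
    (g Z * j (Z ℤ.+ Z) * W Z (A ++ B) * c₀) * (W (ℤ.- Z) (A ++ B) * (u (ℤ.- Z ℤ.- Z ℤ.+ T) * u (ℤ.- Z ℤ.+ Z ℤ.+ T) * prodOver (den (ℤ.- Z)) O)) * (signs (Ys pre) * (f₁ (Yp ℤ.+ T) * V (Yp ℤ.+ T) O) * Δ O) * E (times ν (4× Z))
     ≈⟨ *-congʳ (*-cong (*-cong (sym (trans (reflexive (cong c Xs-old)) (trans (c-shift A x B) (reflexive (cong (λ z → one z * W z (A ++ B) * c₀) x≡)))))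
       (trans (W-all (ℤ.- Z) nz⁻) (sym (N-split (ℤ.- Z)))))
       (trans (sym (Δ-shift (Ys pre) (Yp ℤ.+ T) (Ys post))) (trans (reflexive (cong (λ z → Δ (Ys pre ++ z ∷ Ys post)) Y-suc)) (reflexive (cong Δ (≡.sym (Listₚ.map-++ _ pre ((y , suc p) ∷ post)))))))) ⟩
    c (Xs (pre ++ (y , p) ∷ post)) * N⁻ Yp ys * Δ (Ys (pre ++ (y , suc p) ∷ post)) * E (times ν (4× Z)) ∎
    where
    Yp Z : ℤ
    Yp = Y y p
    Z = Yp ℤ.+ H
    ys : List ℤ
    ys = ys-of (pre ++ (y , p) ∷ post)
    l : ℕ
    l = L ℕ.+ L ∸ suc p
    x : ℤ
    x = at (base y) p
    x≡ : x ≡ Z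
    x≡ = at-base y p
    A B O : List ℤ
    A = Xs pre ++ descend (base y) p
    B = ascend (x ℤ.+ T) l ++ Xs post
    O = Ys pre ++ Ys post
    c₀ K : Carrier
    c₀ = c (A ++ B)
    K = j (Z ℤ.+ Z) * W (ℤ.- Z) (A ++ B) * c₀ * W Z (A ++ B) * signs (Ys pre) * Δ O

    rem-suc : L ℕ.+ L ∸ p ≡ suc l
    rem-suc = ≡.trans (cong (_∸ p) (≡.sym (m+[n∸m]≡n p<))) (≡.trans (cong (_∸ p) (≡.sym (+-suc p l))) (m+n∸m≡n p (suc l)))

    lists : ∀ (a b d e : List ℤ) z → (a ++ ((b ++ z ∷ d) ++ e)) ≡ (a ++ b) ++ z ∷ (d ++ e)
    lists a b d e z = ≡.trans (cong (a ++_) (Listₚ.++-assoc b (z ∷ d) e)) (≡.sym (Listₚ.++-assoc a b _))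

    Xs-old : Xs (pre ++ (y , p) ∷ post) ≡ A ++ x ∷ B
    Xs-old = ≡.trans (Xs-++ pre _) (≡.trans (cong (λ k → Xs pre ++ (k ++ Xs post))
     (≡.trans (cong (cut (base y) p) rem-suc) (cut≡ (base y) p (suc l)))) (lists (Xs pre) (descend (base y) p) _ (Xs post) x))

    Xs-new : Xs (pre ++ (y , suc p) ∷ post) ≡ A ++ ℤ.- x ∷ B
    Xs-new = ≡.trans (Xs-++ pre _) (≡.trans (cong (λ k → Xs pre ++ (k ++ Xs post)) (cut-suc≡ (base y) p l)) (lists (Xs pre) (descend (base y) p) _ (Xs post) (ℤ.- x)))

    good′ : Good (x ∷ A ++ B)
    good′ = Good-↭ (shift x A B) (subst Good Xs-old (Signed-Good (Signed-Xs (pre ++ (y , p) ∷ post) (Allₚ.++⁺ vpre (<⇒≤ p< ∷ vpost))) good))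

    2x≢0 : x ℤ.+ x ≢ 0ℤ
    2x≢0 with good′
    ... | d ∷ _ , _ = d

    apart-x : All (Apart x) (A ++ B)
    apart-x with good′
    ... | _ , a ∷ _ = a

    nz⁺ : NonZeroSums Z (A ++ B)
    nz⁺ = subst (λ z → NonZeroSums z (A ++ B)) x≡ (All.map Apart.sum≢0 apart-x)

    nz⁻ : NonZeroSums (ℤ.- Z) (A ++ B)
    nz⁻ = subst (λ z → NonZeroSums (ℤ.- z) (A ++ B)) x≡ (All.map Apart.diff≢0 apart-x)

    lem-x : ∀ x → ℤ.- x ℤ.+ ℤ.- x ≡ ℤ.- (x ℤ.+ x)
    lem-x = ℤ-ring

    Y-suc : Yp ℤ.+ T ≡ Y y (suc p)
    Y-suc = lem y TL (times p T) T
     where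
     lem : ∀ y a p t → y ℤ.- a ℤ.+ p ℤ.+ t ≡ y ℤ.- a ℤ.+ (t ℤ.+ p)
     lem = ℤ-ring

    length≡ : length (pre ++ (y , p) ∷ post) ≡ suc (length O)
    length≡ = ≡.trans (Listₚ.length-++ pre) (≡.trans (+-suc _ _) (cong suc (≡.sym (≡.trans (Listₚ.length-++ (Ys pre))
     (cong₂ ℕ._+_ (Listₚ.length-map _ pre) (Listₚ.length-map _ post))))))

    N-split : ∀ ξ → prodOver (num ξ) ys ≈ num ξ y * (prodOver (num ξ) (ys-of pre) * prodOver (num ξ) (ys-of post))
    N-split ξ = trans (reflexive (cong (prodOver (num ξ)) (Listₚ.map-++ proj₁ pre _)))
     (trans (prodOver-++ (num ξ) (ys-of pre) _) (x*yz≈y*xz _ _ _))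

    W-all : ∀ ξ → NonZeroSums ξ (A ++ B) →
     W ξ (A ++ B) * (u (ξ ℤ.- Z ℤ.+ T) * u (ξ ℤ.+ Z ℤ.+ T) * prodOver (den ξ) O) ≈ num ξ y * (prodOver (num ξ) (ys-of pre) * prodOver (num ξ) (ys-of post))
    W-all ξ nz = let nA , nB = Allₚ.++⁻ A nz ; n₁ , n₂ = Allₚ.++⁻ (Xs pre) nA ; n₃ , n₄ = Allₚ.++⁻ (ascend (x ℤ.+ T) l) nB in begin
     W ξ (A ++ B) * (u (ξ ℤ.- Z ℤ.+ T) * u (ξ ℤ.+ Z ℤ.+ T) * prodOver (den ξ) O)
      ≈⟨ *-cong (trans (prodOver-++ (w ξ) A B) (*-cong (prodOver-++ (w ξ) (Xs pre) _) (prodOver-++ (w ξ) (ascend (x ℤ.+ T) l) _)))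
        (*-cong (reflexive (cong (λ z → u (ξ ℤ.- z ℤ.+ T) * u (ξ ℤ.+ z ℤ.+ T)) (≡.sym x≡))) (prodOver-++ (den ξ) (Ys pre) (Ys post))) ⟩
     (W ξ (Xs pre) * W ξ (descend (base y) p)) * (W ξ (ascend (x ℤ.+ T) l) * W ξ (Xs post)) * (u (ξ ℤ.- x ℤ.+ T) * u (ξ ℤ.+ x ℤ.+ T) * (prodOver (den ξ) (Ys pre) * prodOver (den ξ) (Ys post)))
      ≈⟨ solve Λ 7 0 (λ a b c d e f g → (a :* b) :* (c :* d) :* (e :* (f :* g)) := (b :* c :* e) :* ((a :* f) :* (d :* g))) _ _ _ _ _ _ _ ⟩
     (W ξ (descend (base y) p) * W ξ (ascend (x ℤ.+ T) l) * (u (ξ ℤ.- x ℤ.+ T) * u (ξ ℤ.+ x ℤ.+ T))) * ((W ξ (Xs pre) * prodOver (den ξ) (Ys pre)) * (W ξ (Xs post) * prodOver (den ξ) (Ys post)))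
      ≈⟨ *-cong (self ξ y p p< ≡.refl n₂ n₃) (*-cong (W-Xs ξ pre vpre n₁) (W-Xs ξ post vpost n₄)) ⟩
     num ξ y * (prodOver (num ξ) (ys-of pre) * prodOver (num ξ) (ys-of post)) ∎

-- Reduction of the sign sum to a weighted sum over cuts

module Collapse where

 open Base
 open Solver
 open Signs
 open Littlewood using (times)
 open Chains using (times-+; 4×; module SumN; Config; module Move; Xs; Ys; ys-of; chains; Valid; Y; num; cutSum; cutSum-*; cutSum-cong; signSum-chains)

 times≡* : ∀ n x → times n x ≡ + n ℤ.* x
 times≡* zero x = ≡.sym (ℤₚ.*-zeroˡ x)
 times≡* (suc n) x = ≡.trans (cong (ℤ._+_ x) (times≡* n x)) (lem (+ n) x)
  where
  lem : ∀ n x → x ℤ.+ n ℤ.* x ≡ (+ 1 ℤ.+ n) ℤ.* x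
  lem = ℤ-ring

 -- ν (2 T r² + 4 y r) with r = p - L
 exponent : ℤ → ℕ → ℕ → ℤ → ℕ → ℤ
 exponent H L ν y p = + ν ℤ.* (+ 2 ℤ.* ((H ℤ.+ H) ℤ.* (r ℤ.* r) ℤ.+ + 2 ℤ.* (y ℤ.* r)))
  where r = + p ℤ.- + L

 module _ (Q : QRing) (H : ℤ) (L : ℕ) (g f₁ : ℤ → QRing.Carrier Q) (ν : ℕ) (ys : List ℤ) where
  open QRing Q
  open SignSum Λ
  open SumN Λ
  open Weights Q (H ℤ.+ H)
  open Density g
  open ≈-Reasoning

  private
   T TL : ℤ
   T = H ℤ.+ H
   TL = times L T

  Config′ : Set
  Config′ = Config Q H L

  open Move Q H L g f₁ ν

  Xs′ Ys′ : Config′ → List ℤ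
  Xs′ = Xs Q H L
  Ys′ = Ys Q H L

  -- The shifted factorial (t X_d; t)_k and its inverse.
  P P⁻¹ : ℤ → ℕ → Carrier
  P d zero      = 1#
  P d (suc k)   = u (d ℤ.+ times (suc k) T) * P d k
  P⁻¹ d zero    = 1#
  P⁻¹ d (suc k) = j (d ℤ.+ times (suc k) T) * P⁻¹ d k

  NonZeroShifts : ℤ → Set
  NonZeroShifts d = ∀ e → d ℤ.+ times (suc e) T ≢ 0ℤ

  P-inverse : ∀ {d} k → NonZeroShifts d → P d k * P⁻¹ d k ≈ 1#
  P-inverse zero nz = *-identityˡ _
  P-inverse (suc k) nz = trans (*-interchange _ _ _ _)
   (trans (*-cong (u*j (nz k)) (P-inverse k nz)) (*-identityˡ _))

  four : (ℤ → ℕ → Carrier) → ℤ → ℕ → ℕ → ℤ → Carrier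
  four P y p l b = (P (b ℤ.- y) l * P (ℤ.- b ℤ.- y) l) * (P (b ℤ.+ y) p * P (ℤ.- b ℤ.+ y) p)

  -- Solves the recursion set by the moves: `Qw y p` times N⁺ equals `Qw y (suc p)` times N⁻.
  Qw Qw⁻¹ : ℤ → ℕ → Carrier
  Qw   y p = prodOver (four P y p (L ℕ.+ L ∸ p)) ys
  Qw⁻¹ y p = prodOver (four P⁻¹ y p (L ℕ.+ L ∸ p)) ys

  ex : ℤ → ℕ → ℤ
  ex = exponent H L ν

  -- The weight of the cut p, normalised to 1 at the middle cut p = L.
  ρ : ℤ → ℕ → Carrier
  ρ y p = E (ex y p) * (Qw y L * Qw⁻¹ y p)

  ρs : Config′ → Carrier
  ρs []              = 1#
  ρs ((y , p) ∷ cfg) = ρ y p * ρs cfg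

  mid : List ℤ → Config′
  mid = map (_, L)

  record Admissible : Set where
   field
    compatible : Compatible (length ys)
    good       : Good (chains Q H L ys)
    shifts     : ∀ {y b} → y ∈ ys → b ∈ ys →
          (NonZeroShifts (b ℤ.- y) × NonZeroShifts (ℤ.- b ℤ.- y)) × (NonZeroShifts (b ℤ.+ y) × NonZeroShifts (ℤ.- b ℤ.+ y))
    Δ⁻¹        : List ℤ → Carrier
    Δ-inverse  : ∀ cfg → ys-of Q H L cfg ≡ ys → Δ (Ys′ cfg) * Δ⁻¹ (Ys′ cfg) ≈ 1#

  module _ (adm : Admissible) where
   open Admissible adm

   private
    prod-inverse : ∀ (f f′ : ℤ → Carrier) l → (∀ {b} → b ∈ l → f b * f′ b ≈ 1#) → prodOver f l * prodOver f′ l ≈ 1#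
    prod-inverse f f′ [] h = *-identityˡ _
    prod-inverse f f′ (b ∷ l) h = trans (*-interchange _ _ _ _)
     (trans (*-cong (h (here ≡.refl)) (prod-inverse f f′ l λ m → h (there m))) (*-identityˡ _))

   Qw-inverse : ∀ {y} p → y ∈ ys → Qw y p * Qw⁻¹ y p ≈ 1#
   Qw-inverse p y∈ = prod-inverse _ _ ys λ b∈ → let (s₁ , s₂) , (s₃ , s₄) = shifts y∈ b∈ ; l = L ℕ.+ L ∸ p in
    trans (solve Λ 8 0 (λ a b c d e f g h → ((a :* b) :* (c :* d)) :* ((e :* f) :* (g :* h)) := ((a :* e) :* (b :* f)) :* ((c :* g) :* (d :* h))) _ _ _ _ _ _ _ _)
     (trans (*-cong (*-cong (P-inverse l s₁) (P-inverse l s₂)) (*-cong (P-inverse p s₃) (P-inverse p s₄))) (solve Λ 0 0 ((:1 :* :1) :* (:1 :* :1) := :1)))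

   private
    u-≡ : ∀ {a b} → a ≡ b → u a ≈ u b
    u-≡ ≡.refl = refl

    Yp : ℤ → ℕ → ℤ
    Yp = Y Q H L

    rem-suc : ∀ {p} → suc p ≤ L ℕ.+ L → L ℕ.+ L ∸ p ≡ suc (L ℕ.+ L ∸ suc p)
    rem-suc {p} p< = ≡.trans (cong (_∸ p) (≡.sym (m+[n∸m]≡n p<))) (≡.trans (cong (_∸ p) (≡.sym (+-suc p _))) (m+n∸m≡n p _))

    2TL : ∀ {p} → suc p ≤ L ℕ.+ L → TL ℤ.+ TL ≡ times p T ℤ.+ times (suc (L ℕ.+ L ∸ suc p)) T
    2TL {p} p< = ≡.trans (≡.sym (times-+ L L T)) (≡.trans (cong (λ k → times k T) (≡.trans (≡.sym (m+[n∸m]≡n p<)) (≡.sym (+-suc p _)))) (times-+ p _ T))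

    num⁻ : ∀ y {p} → suc p ≤ L ℕ.+ L → ∀ b → let l = L ℕ.+ L ∸ suc p in
     num Q H L (ℤ.- (Yp y p ℤ.+ H)) b ≈ u (b ℤ.- y ℤ.+ times (suc l) T) * u (ℤ.- b ℤ.- y ℤ.+ times (suc l) T)
    num⁻ y {p} p< b = trans (*-comm _ _) (*-cong
     (u-≡ (≡.trans (lem₁ y TL H (times p T) b) (≡.trans (cong (λ z → b ℤ.- y ℤ.+ (z ℤ.- times p T)) (2TL p<)) (lem₂ (b ℤ.- y) (times p T) _))))
     (u-≡ (≡.trans (lem₃ y TL H (times p T) b) (≡.trans (cong (λ z → ℤ.- b ℤ.- y ℤ.+ (z ℤ.- times p T)) (2TL p<)) (lem₂ (ℤ.- b ℤ.- y) (times p T) _)))))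
     where
     lem₁ : ∀ y a H p b → ℤ.- (y ℤ.- a ℤ.+ p ℤ.+ H) ℤ.+ H ℤ.+ a ℤ.+ b ≡ b ℤ.- y ℤ.+ (a ℤ.+ a ℤ.- p)
     lem₁ = ℤ-ring
     lem₃ : ∀ y a H p b → ℤ.- (y ℤ.- a ℤ.+ p ℤ.+ H) ℤ.+ H ℤ.+ a ℤ.- b ≡ ℤ.- b ℤ.- y ℤ.+ (a ℤ.+ a ℤ.- p)
     lem₃ = ℤ-ring
     lem₂ : ∀ d p q → d ℤ.+ (p ℤ.+ q ℤ.- p) ≡ d ℤ.+ q
     lem₂ = ℤ-ring

    num⁺ : ∀ y p b → num Q H L (Yp y p ℤ.+ H) b ≈ u (b ℤ.+ y ℤ.+ times (suc p) T) * u (ℤ.- b ℤ.+ y ℤ.+ times (suc p) T)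
    num⁺ y p b = trans (*-comm _ _) (*-cong (u-≡ (lem₁ y TL H (times p T) b)) (u-≡ (lem₂ y TL H (times p T) b)))
     where
     lem₁ : ∀ y a H p b → y ℤ.- a ℤ.+ p ℤ.+ H ℤ.+ H ℤ.+ a ℤ.+ b ≡ b ℤ.+ y ℤ.+ (H ℤ.+ H ℤ.+ p)
     lem₁ = ℤ-ring
     lem₂ : ∀ y a H p b → y ℤ.- a ℤ.+ p ℤ.+ H ℤ.+ H ℤ.+ a ℤ.- b ≡ ℤ.- b ℤ.+ y ℤ.+ (H ℤ.+ H ℤ.+ p)
     lem₂ = ℤ-ring

    Qw-suc : ∀ y p → suc p ≤ L ℕ.+ L → Qw y p * N⁺ (Yp y p) ys ≈ Qw y (suc p) * N⁻ (Yp y p) ys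
    Qw-suc y p p< = trans (sym (prodOver-* _ _ ys)) (trans (prodOver-cong ys λ b → begin
      four P y p (L ℕ.+ L ∸ p) b * num Q H L (Yp y p ℤ.+ H) b
       ≈⟨ *-cong (reflexive (cong (λ l → four P y p l b) (rem-suc p<))) (num⁺ y p b) ⟩
      (u (b ℤ.- y ℤ.+ times (suc l) T) * P (b ℤ.- y) l) * (u (ℤ.- b ℤ.- y ℤ.+ times (suc l) T) * P (ℤ.- b ℤ.- y) l) * (P (b ℤ.+ y) p * P (ℤ.- b ℤ.+ y) p) * (u (b ℤ.+ y ℤ.+ times (suc p) T) * u (ℤ.- b ℤ.+ y ℤ.+ times (suc p) T))
       ≈⟨ solve Λ 8 0 (λ a b c d e f g h → (a :* b) :* (c :* d) :* (e :* f) :* (g :* h) := (b :* d) :* ((g :* e) :* (h :* f)) :* (a :* c)) _ _ _ _ _ _ _ _ ⟩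
      four P y (suc p) l b * (u (b ℤ.- y ℤ.+ times (suc l) T) * u (ℤ.- b ℤ.- y ℤ.+ times (suc l) T))
       ≈⟨ *-congˡ (sym (num⁻ y p< b)) ⟩
      four P y (suc p) l b * num Q H L (ℤ.- (Yp y p ℤ.+ H)) b ∎)
     (prodOver-* _ _ ys))
     where l = L ℕ.+ L ∸ suc p

    N⁻-invertible : ∀ {y p} → y ∈ ys → suc p ≤ L ℕ.+ L → ∃ λ k → N⁻ (Yp y p) ys * k ≈ 1#
    N⁻-invertible {y} {p} y∈ p< = _ , trans (*-congʳ (prodOver-cong ys (num⁻ y p<)))
     (prod-inverse _ (λ b → j (b ℤ.- y ℤ.+ times (suc l) T) * j (ℤ.- b ℤ.- y ℤ.+ times (suc l) T)) ys λ b∈ → let (s₁ , s₂) , _ = shifts y∈ b∈ in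
      trans (*-interchange _ _ _ _) (trans (*-cong (u*j (s₁ l)) (u*j (s₂ l))) (*-identityˡ _)))
     where l = L ℕ.+ L ∸ suc p

    ex-suc : ∀ y p → ex y (suc p) ≡ ex y p ℤ.+ times ν (4× (Yp y p ℤ.+ H))
    ex-suc y p = ≡.sym (≡.trans (cong (ℤ._+_ (ex y p)) (≡.trans (times≡* ν _) (cong (λ z → + ν ℤ.* 4× (z ℤ.+ H)) (cong₂ (λ a b → y ℤ.- a ℤ.+ b) (times≡* L T) (times≡* p T)))))
     (lem (+ ν) H y (+ p) (+ L)))
     where
     lem : ∀ ν H y p L → ν ℤ.* (+ 2 ℤ.* ((H ℤ.+ H) ℤ.* ((p ℤ.- L) ℤ.* (p ℤ.- L)) ℤ.+ + 2 ℤ.* (y ℤ.* (p ℤ.- L)))) ℤ.+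
       ν ℤ.* ((y ℤ.- L ℤ.* (H ℤ.+ H) ℤ.+ p ℤ.* (H ℤ.+ H) ℤ.+ H) ℤ.+ (y ℤ.- L ℤ.* (H ℤ.+ H) ℤ.+ p ℤ.* (H ℤ.+ H) ℤ.+ H) ℤ.+ ((y ℤ.- L ℤ.* (H ℤ.+ H) ℤ.+ p ℤ.* (H ℤ.+ H) ℤ.+ H) ℤ.+ (y ℤ.- L ℤ.* (H ℤ.+ H) ℤ.+ p ℤ.* (H ℤ.+ H) ℤ.+ H)))
       ≡ ν ℤ.* (+ 2 ℤ.* ((H ℤ.+ H) ℤ.* ((+ 1 ℤ.+ p ℤ.- L) ℤ.* (+ 1 ℤ.+ p ℤ.- L)) ℤ.+ + 2 ℤ.* (y ℤ.* (+ 1 ℤ.+ p ℤ.- L))))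
     lem = ℤ-ring

    ex-L : ∀ y → ex y L ≡ 0ℤ
    ex-L y = ≡.trans (cong (λ r → + ν ℤ.* (+ 2 ℤ.* (T ℤ.* (r ℤ.* r) ℤ.+ + 2 ℤ.* (y ℤ.* r)))) (ℤₚ.+-inverseʳ (+ L))) (lem (+ ν) T y)
     where
     lem : ∀ ν T y → ν ℤ.* (+ 2 ℤ.* (T ℤ.* (0ℤ ℤ.* 0ℤ) ℤ.+ + 2 ℤ.* (y ℤ.* 0ℤ))) ≡ 0ℤ
     lem = ℤ-ring

    weight : ℤ → ℕ → Carrier
    weight y p = Qw y p * E (ℤ.- ex y p)

    weights : Config′ → Carrier
    weights []              = 1#
    weights ((y , p) ∷ cfg) = weight y p * weights cfg

    weights-shift : ∀ pre y p post → weights (pre ++ (y , p) ∷ post) ≈ weight y p * weights (pre ++ post)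
    weights-shift [] y p post = refl
    weights-shift (_ ∷ pre) y p post = trans (*-congˡ (weights-shift pre y p post)) (x*yz≈y*xz _ _ _)

    -- invariant under moving cuts
    K : Config′ → Carrier
    K cfg = c (Xs′ cfg) * Δ⁻¹ (Ys′ cfg) * weights cfg

    K-suc : ∀ pre y p post → ys-of Q H L (pre ++ (y , p) ∷ post) ≡ ys → Valid Q H L pre → suc p ≤ L ℕ.+ L → Valid Q H L post →
     K (pre ++ (y , suc p) ∷ post) ≈ K (pre ++ (y , p) ∷ post)
    K-suc pre y p post e vpre p< vpost = trans (sym (cancel _)) (trans (*-congʳ NK) (cancel _))
     where
     y∈ : y ∈ ys
     y∈ = subst (y ∈_) (≡.trans (≡.sym (Listₚ.map-++ proj₁ pre ((y , p) ∷ post))) e) (∈-++⁺ʳ (map proj₁ pre) (here ≡.refl))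
     Ni = proj₁ (N⁻-invertible {y} {p} y∈ p<)
     τ : ℤ
     τ = times ν (4× (Yp y p ℤ.+ H))
     n⁺ n⁻ : Carrier
     n⁺ = N⁺ (Yp y p) ys
     n⁻ = N⁻ (Yp y p) ys
     cancel : ∀ x → n⁻ * x * Ni ≈ x
     cancel x = trans (xy*z≈xz*y _ _ _) (trans (*-congʳ (proj₂ (N⁻-invertible {y} {p} y∈ p<))) (*-identityˡ x))
     cfg cfg′ : Config′
     cfg = pre ++ (y , p) ∷ post
     cfg′ = pre ++ (y , suc p) ∷ post
     e′ : ys-of Q H L cfg′ ≡ ys
     e′ = ≡.trans (Listₚ.map-++ proj₁ pre _) (≡.trans (≡.sym (Listₚ.map-++ proj₁ pre ((y , p) ∷ post))) e)
     len : length cfg ≡ length ys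
     len = ≡.trans (≡.sym (Listₚ.length-map proj₁ cfg)) (cong length e)
     moved : c (Xs′ cfg′) * n⁺ * Δ (Ys′ cfg) ≈ c (Xs′ cfg) * n⁻ * Δ (Ys′ cfg′) * E τ
     moved = subst (λ l → c (Xs′ cfg′) * N⁺ (Yp y p) l * Δ (Ys′ cfg) ≈ c (Xs′ cfg) * N⁻ (Yp y p) l * Δ (Ys′ cfg′) * E τ) e
      (move pre y p post (subst Compatible (≡.sym len) compatible) vpre p< vpost (subst (λ l → Good (chains Q H L l)) (≡.sym e) good))
     ratio : c (Xs′ cfg′) * n⁺ * Δ⁻¹ (Ys′ cfg′) ≈ c (Xs′ cfg) * n⁻ * Δ⁻¹ (Ys′ cfg) * E τ
     ratio = begin
      c (Xs′ cfg′) * n⁺ * Δ⁻¹ (Ys′ cfg′)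
       ≈⟨ sym (*-identityʳ _) ⟩
      c (Xs′ cfg′) * n⁺ * Δ⁻¹ (Ys′ cfg′) * 1#
       ≈⟨ *-congˡ (sym (Δ-inverse cfg e)) ⟩
      c (Xs′ cfg′) * n⁺ * Δ⁻¹ (Ys′ cfg′) * (Δ (Ys′ cfg) * Δ⁻¹ (Ys′ cfg))
       ≈⟨ solve Λ 5 0 (λ a b c d e → a :* b :* c :* (d :* e) := (a :* b :* d) :* (c :* e)) _ _ _ _ _ ⟩
      c (Xs′ cfg′) * n⁺ * Δ (Ys′ cfg) * (Δ⁻¹ (Ys′ cfg′) * Δ⁻¹ (Ys′ cfg))
       ≈⟨ *-congʳ moved ⟩
      c (Xs′ cfg) * n⁻ * Δ (Ys′ cfg′) * E τ * (Δ⁻¹ (Ys′ cfg′) * Δ⁻¹ (Ys′ cfg))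
       ≈⟨ solve Λ 6 0 (λ a b c d e f → a :* b :* c :* d :* (e :* f) := a :* b :* f :* d :* (c :* e)) _ _ _ _ _ _ ⟩
      c (Xs′ cfg) * n⁻ * Δ⁻¹ (Ys′ cfg) * E τ * (Δ (Ys′ cfg′) * Δ⁻¹ (Ys′ cfg′))
       ≈⟨ trans (*-congˡ (Δ-inverse cfg′ e′)) (*-identityʳ _) ⟩
      c (Xs′ cfg) * n⁻ * Δ⁻¹ (Ys′ cfg) * E τ ∎
     NK : n⁻ * K cfg′ ≈ n⁻ * K cfg
     NK = begin
      n⁻ * (c (Xs′ cfg′) * Δ⁻¹ (Ys′ cfg′) * weights cfg′)
       ≈⟨ *-congˡ (*-congˡ (trans (weights-shift pre y (suc p) post) (*-congʳ (*-congˡ (reflexive (cong (λ z → E (ℤ.- z)) (ex-suc y p))))))) ⟩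
      n⁻ * (c (Xs′ cfg′) * Δ⁻¹ (Ys′ cfg′) * (Qw y (suc p) * E (ℤ.- (ex y p ℤ.+ τ)) * weights (pre ++ post)))
       ≈⟨ solve Λ 5 2 (λ n c d q w a b → n :* (c :* d :* (q :* :E (⊟ (a ⊞ b)) :* w)) := (q :* n) :* (c :* d :* (:E (⊟ (a ⊞ b)) :* w))) _ _ _ _ _ (ex y p) τ ⟩
      (Qw y (suc p) * n⁻) * (c (Xs′ cfg′) * Δ⁻¹ (Ys′ cfg′) * (E (ℤ.- (ex y p ℤ.+ τ)) * weights (pre ++ post)))
       ≈⟨ *-congʳ (sym (Qw-suc y p p<)) ⟩
      (Qw y p * n⁺) * (c (Xs′ cfg′) * Δ⁻¹ (Ys′ cfg′) * (E (ℤ.- (ex y p ℤ.+ τ)) * weights (pre ++ post)))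
       ≈⟨ solve Λ 5 2 (λ n c d q w a b → (q :* n) :* (c :* d :* (:E (⊟ (a ⊞ b)) :* w)) := (c :* n :* d) :* (q :* (:E (⊟ (a ⊞ b)) :* w))) _ _ _ _ _ (ex y p) τ ⟩
      (c (Xs′ cfg′) * n⁺ * Δ⁻¹ (Ys′ cfg′)) * (Qw y p * (E (ℤ.- (ex y p ℤ.+ τ)) * weights (pre ++ post)))
       ≈⟨ *-congʳ ratio ⟩
      (c (Xs′ cfg) * n⁻ * Δ⁻¹ (Ys′ cfg) * E τ) * (Qw y p * (E (ℤ.- (ex y p ℤ.+ τ)) * weights (pre ++ post)))
       ≈⟨ solve Λ 5 2 (λ n c d q w a b → (c :* n :* d :* :E b) :* (q :* (:E (⊟ (a ⊞ b)) :* w)) := n :* (c :* d :* (q :* :E (⊟ a) :* w))) _ _ _ _ _ (ex y p) τ ⟩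
      n⁻ * (c (Xs′ cfg) * Δ⁻¹ (Ys′ cfg) * (Qw y p * E (ℤ.- ex y p) * weights (pre ++ post)))
       ≈⟨ *-congˡ (*-congˡ (sym (weights-shift pre y p post))) ⟩
      n⁻ * (c (Xs′ cfg) * Δ⁻¹ (Ys′ cfg) * weights cfg) ∎

    relabel : ∀ {pre y p post} q → ys-of Q H L (pre ++ (y , p) ∷ post) ≡ ys → ys-of Q H L (pre ++ (y , q) ∷ post) ≡ ys
    relabel {pre} {y} {p} {post} q e = ≡.trans (Listₚ.map-++ proj₁ pre _) (≡.trans (≡.sym (Listₚ.map-++ proj₁ pre ((y , p) ∷ post))) e)

    K-zero : ∀ pre y p post → ys-of Q H L (pre ++ (y , p) ∷ post) ≡ ys → Valid Q H L pre → p ≤ L ℕ.+ L → Valid Q H L post →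
     K (pre ++ (y , p) ∷ post) ≈ K (pre ++ (y , 0) ∷ post)
    K-zero pre y zero post e vpre p≤ vpost = refl
    K-zero pre y (suc p) post e vpre p≤ vpost = trans (K-suc pre y p post (relabel {pre} p e) vpre p≤ vpost) (K-zero pre y p post (relabel {pre} p e) vpre (<⇒≤ p≤) vpost)

    -- Chain after chain, the cut is lowered to 0 and raised again to L; no step changes `K`.
    K-mid : ∀ pre cfg → ys-of Q H L (pre ++ cfg) ≡ ys → Valid Q H L pre → Valid Q H L cfg → K (pre ++ cfg) ≈ K (pre ++ mid (ys-of Q H L cfg))
    K-mid pre [] e vpre v = refl
    K-mid pre ((y , p) ∷ cfg) e vpre (p≤ ∷ v) = begin
     K (pre ++ (y , p) ∷ cfg) ≈⟨ K-zero pre y p cfg e vpre p≤ v ⟩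
     K (pre ++ (y , 0) ∷ cfg) ≈⟨ sym (K-zero pre y L cfg (relabel {pre} L e) vpre (m≤m+n L L) v) ⟩
     K (pre ++ (y , L) ∷ cfg) ≈⟨ reflexive (cong K (≡.sym (Listₚ.++-assoc pre ((y , L) ∷ []) cfg))) ⟩
     K ((pre ++ (y , L) ∷ []) ++ cfg)
      ≈⟨ K-mid (pre ++ (y , L) ∷ []) cfg (≡.trans (cong (map proj₁) (Listₚ.++-assoc pre ((y , L) ∷ []) cfg)) (relabel {pre} L e)) (Allₚ.++⁺ vpre (m≤m+n L L ∷ [])) v ⟩
     K ((pre ++ (y , L) ∷ []) ++ mid (ys-of Q H L cfg)) ≈⟨ reflexive (cong K (Listₚ.++-assoc pre ((y , L) ∷ []) _)) ⟩
     K (pre ++ (y , L) ∷ mid (ys-of Q H L cfg)) ∎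

    Ys-mid : ∀ l → Ys′ (mid l) ≡ l
    Ys-mid [] = ≡.refl
    Ys-mid (y ∷ l) = cong₂ _∷_ (lem y TL) (Ys-mid l)
     where
     lem : ∀ y a → y ℤ.- a ℤ.+ a ≡ y
     lem = ℤ-ring

    ys-mid : ∀ l → ys-of Q H L (mid l) ≡ l
    ys-mid [] = ≡.refl
    ys-mid (y ∷ l) = cong (y ∷_) (ys-mid l)

    weights-ρ : ∀ cfg → All (λ yp → proj₁ yp ∈ ys) cfg → weights cfg * ρs cfg ≈ weights (mid (ys-of Q H L cfg))
    weights-ρ [] [] = *-identityˡ _
    weights-ρ ((y , p) ∷ cfg) (y∈ ∷ all) = begin
     (Qw y p * E (ℤ.- ex y p) * weights cfg) * (E (ex y p) * (Qw y L * Qw⁻¹ y p) * ρs cfg)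
      ≈⟨ solve Λ 5 1 (λ a b c d e x → (a :* :E (⊟ x) :* b) :* (:E x :* (c :* d) :* e) := (a :* d) :* c :* (b :* e)) _ _ _ _ _ (ex y p) ⟩
     (Qw y p * Qw⁻¹ y p) * Qw y L * (weights cfg * ρs cfg)
      ≈⟨ *-cong (trans (*-congʳ (Qw-inverse p y∈)) (*-identityˡ _)) (weights-ρ cfg all) ⟩
     Qw y L * weights (mid (ys-of Q H L cfg))
      ≈⟨ *-congʳ (sym (trans (*-congˡ (trans (reflexive (cong (λ z → E (ℤ.- z)) (ex-L y))) E-0)) (*-identityʳ _))) ⟩
     (Qw y L * E (ℤ.- ex y L)) * weights (mid (ys-of Q H L cfg)) ∎

    weights-invertible : ∀ cfg → All (λ yp → proj₁ yp ∈ ys) cfg → ∃ λ k → weights cfg * k ≈ 1#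
    weights-invertible [] [] = 1# , *-identityˡ _
    weights-invertible ((y , p) ∷ cfg) (y∈ ∷ all) = let k , h = weights-invertible cfg all in
     E (ex y p) * Qw⁻¹ y p * k , trans (solve Λ 4 1 (λ a b c d x → (a :* :E (⊟ x) :* b) :* (:E x :* c :* d) := (a :* c) :* (b :* d)) _ _ _ _ (ex y p))
      (trans (*-cong (Qw-inverse p y∈) h) (*-identityˡ _))

    all∈ : ∀ cfg {l} → ys-of Q H L cfg ≡ l → All (λ yp → proj₁ yp ∈ l) cfg
    all∈ [] e = []
    all∈ ((y , p) ∷ cfg) ≡.refl = here ≡.refl ∷ All.map there (all∈ cfg ≡.refl)

    c-Xs : ∀ cfg → ys-of Q H L cfg ≡ ys → Valid Q H L cfg → c (Xs′ cfg) * Δ ys ≈ c (Xs′ (mid ys)) * (ρs cfg * Δ (Ys′ cfg))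
    c-Xs cfg e v = begin
     c (Xs′ cfg) * Δ ys
      ≈⟨ sym (*-identityʳ _) ⟩
     c (Xs′ cfg) * Δ ys * 1#
      ≈⟨ *-congˡ (sym (trans (*-cong (Δ-inverse cfg e) (proj₂ winv)) (*-identityˡ _))) ⟩
     c (Xs′ cfg) * Δ ys * ((Δ (Ys′ cfg) * Δ⁻¹ (Ys′ cfg)) * (weights cfg * wi))
      ≈⟨ solve Λ 6 0 (λ a b c d e f → a :* b :* ((c :* d) :* (e :* f)) := (a :* d :* e) :* (b :* c :* f)) _ _ _ _ _ _ ⟩
     K cfg * (Δ ys * Δ (Ys′ cfg) * wi)
      ≈⟨ *-congʳ (trans (K-mid [] cfg e [] v) (reflexive (cong (λ l → K (mid l)) e))) ⟩
     c (Xs′ (mid ys)) * Δ⁻¹ (Ys′ (mid ys)) * weights (mid ys) * (Δ ys * Δ (Ys′ cfg) * wi)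
      ≈⟨ *-cong (*-congˡ (sym (trans (weights-ρ cfg (all∈ cfg e)) (reflexive (cong (λ l → weights (mid l)) e))))) (*-congʳ (*-congʳ (reflexive (cong Δ (≡.sym (Ys-mid ys)))))) ⟩
     c (Xs′ (mid ys)) * Δ⁻¹ (Ys′ (mid ys)) * (weights cfg * ρs cfg) * (Δ (Ys′ (mid ys)) * Δ (Ys′ cfg) * wi)
      ≈⟨ solve Λ 7 0 (λ a b c d e f g → a :* b :* (c :* d) :* (e :* f :* g) := (e :* b) :* (c :* g) :* (a :* (d :* f))) _ _ _ _ _ _ _ ⟩
     (Δ (Ys′ (mid ys)) * Δ⁻¹ (Ys′ (mid ys))) * (weights cfg * wi) * (c (Xs′ (mid ys)) * (ρs cfg * Δ (Ys′ cfg)))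
      ≈⟨ trans (*-congʳ (trans (*-cong (Δ-inverse (mid ys) (ys-mid ys)) (proj₂ winv)) (*-identityˡ _))) (*-identityˡ _) ⟩
     c (Xs′ (mid ys)) * (ρs cfg * Δ (Ys′ cfg)) ∎
     where
     winv = weights-invertible cfg (all∈ cfg e)
     wi = proj₁ winv

   -- By the invariance of `K`, the density of a configuration is proportional to ρs times the Weyl
   -- denominator of its midpoints. The constant is read off at the middle configuration, whose
   -- midpoints are `ys`.
   signSum-collapse : signSum c (chains Q H L ys) * Δ ys ≈ c (Xs′ (mid ys)) * cutSum Q H L (λ cfg → ρs cfg * Δ (Ys′ cfg)) ys
   signSum-collapse = begin
    signSum c (chains Q H L ys) * Δ ys
     ≈⟨ *-congʳ (signSum-chains Q H L c-Vanishing ys) ⟩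
    cutSum Q H L (λ cfg → c (Xs′ cfg)) ys * Δ ys
     ≈⟨ trans (*-comm _ _) (sym (cutSum-* Q H L _ _ ys)) ⟩
    cutSum Q H L (λ cfg → Δ ys * c (Xs′ cfg)) ys
     ≈⟨ cutSum-cong Q H L ys (λ cfg v e → trans (*-comm _ _) (c-Xs cfg e v)) ⟩
    cutSum Q H L (λ cfg → c (Xs′ (mid ys)) * (ρs cfg * Δ (Ys′ cfg))) ys
     ≈⟨ cutSum-* Q H L _ _ ys ⟩
    c (Xs′ (mid ys)) * cutSum Q H L (λ cfg → ρs cfg * Δ (Ys′ cfg)) ys ∎

-- Determinants as iterated alternating sums

module Det where

 open Base
 open Solver
 open Chains using (module SumN)

 module _ (Q : QRing) where
  open QRing Q
  open SumN Λ
  open ≈-Reasoning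

  module _ {A : Set} where
   -- The sum in a Laplace expansion: one element is chosen with alternating sign, and the others
   -- are handed on in their order.
   altSum : (A → List A → Carrier) → List A → Carrier
   altSum G []       = 0#
   altSum G (a ∷ as) = G a as - altSum (λ b bs → G b (a ∷ bs)) as

   altSum-cong′ : ∀ {G H} as → (∀ {a} l → a ∈ as → suc (length l) ≡ length as → G a l ≈ H a l) → altSum G as ≈ altSum H as
   altSum-cong′ []       h = refl
   altSum-cong′ (a ∷ as) h = +-cong (h as (here ≡.refl) ≡.refl) (-‿cong (altSum-cong′ as λ l m e → h (a ∷ l) (there m) (cong suc e)))

   altSum-cong : ∀ {G H} as → (∀ a l → G a l ≈ H a l) → altSum G as ≈ altSum H as
   altSum-cong as h = altSum-cong′ as λ {a} l _ _ → h a l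

   altSum-+ : ∀ G H as → altSum (λ a l → G a l + H a l) as ≈ altSum G as + altSum H as
   altSum-+ G H [] = sym (+-identityˡ _)
   altSum-+ G H (a ∷ as) = trans (+-congˡ (-‿cong (altSum-+ _ _ as)))
    (solve Λ 4 0 (λ a b c d → (a :+ b) :- (c :+ d) := (a :- c) :+ (b :- d)) _ _ _ _)

   altSum-* : ∀ k G as → altSum (λ a l → k * G a l) as ≈ k * altSum G as
   altSum-* k G [] = sym (zeroʳ k)
   altSum-* k G (a ∷ as) = trans (+-congˡ (-‿cong (altSum-* k _ as)))
    (solve Λ 3 0 (λ k a b → k :* a :- k :* b := k :* (a :- b)) _ _ _)

   altSum-neg : ∀ G as → altSum (λ a l → - G a l) as ≈ - altSum G as
   altSum-neg G as = trans (altSum-cong as λ a l → solve Λ 1 0 (λ a → :- a := :- :1 :* a) _)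
    (trans (altSum-* (- 1#) G as) (solve Λ 1 0 (λ a → :- :1 :* a := :- a) _))

   altSum-0 : ∀ {G} as → (∀ {a} l → a ∈ as → G a l ≈ 0#) → altSum G as ≈ 0#
   altSum-0 []       h = refl
   altSum-0 (a ∷ as) h = trans (+-cong (h as (here ≡.refl)) (-‿cong (altSum-0 as λ l m → h (a ∷ l) (there m))))
    (solve Λ 0 0 (:0 :- :0 := :0))

   altSum-sumN : ∀ n (G : ℕ → A → List A → Carrier) as → altSum (λ a l → sumN n (λ k → G k a l)) as ≈ sumN n (λ k → altSum (G k) as)
   altSum-sumN zero G as = refl
   altSum-sumN (suc n) G as = trans (altSum-+ _ _ as) (+-congˡ (altSum-sumN n (λ k → G (suc k)) as))

   -- Choosing two elements in the opposite order reverses the sign.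
   altSum-antisym : ∀ (H : A → A → List A → Carrier) as →
    altSum (λ a → altSum (H a)) as + altSum (λ a → altSum (λ b → H b a)) as ≈ 0#
   altSum-antisym H [] = +-identityˡ _
   altSum-antisym H (r ∷ rs) = begin
    (altSum (H r) rs - altSum (λ a l → altSum (H a) (r ∷ l)) rs) + (altSum (λ b → H b r) rs - altSum (λ a l → altSum (λ b → H b a) (r ∷ l)) rs)
     ≈⟨ +-cong (+-congˡ (-‿cong (expand H))) (+-congˡ (-‿cong (expand (λ a b → H b a)))) ⟩
    (altSum (H r) rs - (altSum (λ a l → H a r l) rs - altSum (λ a → altSum (λ b bs → H a b (r ∷ bs))) rs)) +
    (altSum (λ b → H b r) rs - (altSum (λ a l → H r a l) rs - altSum (λ a → altSum (λ b bs → H b a (r ∷ bs))) rs))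
     ≈⟨ solve Λ 4 0 (λ a b c d → (a :- (b :- c)) :+ (b :- (a :- d)) := c :+ d) _ _ _ _ ⟩
    altSum (λ a → altSum (λ b bs → H a b (r ∷ bs))) rs + altSum (λ a → altSum (λ b bs → H b a (r ∷ bs))) rs
     ≈⟨ altSum-antisym (λ a b bs → H a b (r ∷ bs)) rs ⟩
    0# ∎
    where
    expand : ∀ H → altSum (λ a l → altSum (H a) (r ∷ l)) rs ≈ altSum (λ a l → H a r l) rs - altSum (λ a → altSum (λ b bs → H a b (r ∷ bs))) rs
    expand H = trans (altSum-+ _ _ rs) (+-congˡ (altSum-neg _ rs))

   det : List (A → Carrier) → List A → Carrier
   det []       []      = 1#
   det []       (_ ∷ _) = 0#
   det (f ∷ fs) as      = altSum (λ a l → f a * det fs l) as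

   det-cong : ∀ {f g} fs as → (∀ a → f a ≈ g a) → det (f ∷ fs) as ≈ det (g ∷ fs) as
   det-cong fs as h = altSum-cong as λ a l → *-congʳ (h a)

   det-+ : ∀ f g fs as → det ((λ a → f a + g a) ∷ fs) as ≈ det (f ∷ fs) as + det (g ∷ fs) as
   det-+ f g fs as = trans (altSum-cong as λ a l → distribʳ _ _ _) (altSum-+ _ _ as)

   det-* : ∀ k f fs as → det ((λ a → k * f a) ∷ fs) as ≈ k * det (f ∷ fs) as
   det-* k f fs as = trans (altSum-cong as λ a l → *-assoc _ _ _) (altSum-* k _ as)

   det-swap : ∀ f g fs as → det (f ∷ g ∷ fs) as + det (g ∷ f ∷ fs) as ≈ 0#
   det-swap f g fs as = trans (+-cong
    (altSum-cong as λ a l → sym (altSum-* (f a) _ l))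
    (altSum-cong as λ a l → trans (sym (altSum-* (g a) _ l)) (altSum-cong l λ b l′ → x*yz≈y*xz _ _ _)))
    (altSum-antisym (λ a b l → f a * (g b * det fs l)) as)

   -- For equal neighbours, exchanging them shows only that twice the determinant is 0, so
   -- injectivity of doubling is used. A duplicate further away is brought next to the first column
   -- by an exchange.
   det-duplicate : ∀ {f} fs as → f ∈ fs → det (f ∷ fs) as ≈ 0#
   det-duplicate {f} (.f ∷ fs) as (here ≡.refl) = 2-cancel (det-swap f f fs as)
   det-duplicate {f} (g ∷ fs) as (there m) = trans (solve Λ 2 0 (λ a b → a := (a :+ b) :- b) _ _)
    (trans (+-cong (det-swap f g fs as) (-‿cong (altSum-0 as λ l _ → trans (*-congˡ (det-duplicate fs l m)) (zeroʳ _))))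
     (solve Λ 0 0 (:0 :- :0 := :0)))

   -- Vandermonde determinants for columns φ n obeying z φ (n + 1) = φ (n + 2) + φ n.
   module Vandermonde (φ : ℕ → A → Carrier) (z : A → Carrier) (β : Carrier)
    (rec₀ : ∀ a → z a * φ 0 a ≈ φ 1 a + β * φ 0 a) (rec : ∀ n a → z a * φ (suc n) a ≈ φ (suc (suc n)) a + φ n a) where

    cols : ℕ → List (A → Carrier)
    cols zero    = []
    cols (suc n) = φ n ∷ cols n

    private
     -- Combinations of the first n columns, generated inductively so that multiplication by z
     -- visibly raises n by one and the determinant with such a first column visibly vanishes.
     data Span (n : ℕ) : (A → Carrier) → Set where
      gen : ∀ {i} → i < n → Span n (φ i)
      nil : Span n (λ _ → 0#)
      add : ∀ {f g} → Span n f → Span n g → Span n (λ a → f a + g a)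
      scl : ∀ {f} k → Span n f → Span n (λ a → k * f a)
      ext : ∀ {f g} → (∀ a → f a ≈ g a) → Span n f → Span n g

     mono : ∀ {n f} → Span n f → Span (suc n) f
     mono (gen l) = gen (m<n⇒m<1+n l)
     mono nil = nil
     mono (add p q) = add (mono p) (mono q)
     mono (scl k p) = scl k (mono p)
     mono (ext h p) = ext h (mono p)

     mul-z : ∀ {n f} → Span n f → Span (suc n) (λ a → z a * f a)
     mul-z (gen {zero} l) = ext (λ a → sym (rec₀ a)) (add (gen (s≤s l)) (scl β (gen (s≤s z≤n))))
     mul-z (gen {suc i} l) = ext (λ a → sym (rec i a)) (add (gen (s≤s l)) (gen (m<n⇒m<1+n (<⇒≤ l))))
     mul-z nil = ext (λ a → sym (zeroʳ _)) nil
     mul-z (add p q) = ext (λ a → sym (distribˡ _ _ _)) (add (mul-z p) (mul-z q))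
     mul-z (scl k p) = ext (λ a → x*yz≈y*xz _ _ _) (scl k (mul-z p))
     mul-z (ext h p) = ext (λ a → *-congˡ (h a)) (mul-z p)

     ∈-cols : ∀ {i n} → i < n → φ i ∈ cols n
     ∈-cols {i} {suc n} (s≤s l) with ℕₚ.m≤n⇒m<n∨m≡n l
     ... | inj₁ l′ = there (∈-cols l′)
     ... | inj₂ ≡.refl = here ≡.refl

     det-Span : ∀ {n f} → Span n f → ∀ as → det (f ∷ cols n) as ≈ 0#
     det-Span {n} (gen l) as = det-duplicate (cols n) as (∈-cols l)
     det-Span nil as = altSum-0 as λ l _ → zeroˡ _
     det-Span {n} (add p q) as = trans (det-+ _ _ (cols n) as) (trans (+-cong (det-Span p as) (det-Span q as)) (+-identityˡ _))
     det-Span {n} (scl k p) as = trans (det-* k _ (cols n) as) (trans (*-congˡ (det-Span p as)) (zeroʳ k))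
     det-Span {n} (ext h p) as = trans (det-cong (cols n) as (λ a → sym (h a))) (det-Span p as)

    prod : List A → A → Carrier
    prod []       a = 1#
    prod (r ∷ rs) a = (z a - z r) * prod rs a

    private
     step : ∀ n → Span (suc n) (λ a → z a * φ n a - φ (suc n) a)
     step zero = ext (λ a → trans (solve Λ 2 0 (λ b f → b := (f :+ b) :- f) _ _) (+-congʳ (sym (rec₀ a)))) (scl β (gen (s≤s z≤n)))
     step (suc n) = ext (λ a → trans (solve Λ 2 0 (λ b f → b := (f :+ b) :- f) _ _) (+-congʳ (sym (rec n a)))) (gen (m<n⇒m<1+n ≤-refl))

     -- φ 0 ∏ (z - z r) is φ n plus lower columns
     leading : ∀ rs → Span (length rs) (λ a → φ 0 a * prod rs a - φ (length rs) a)
     leading [] = ext (λ a → solve Λ 1 0 (λ f → :0 := f :* :1 :- f) _) nil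
     leading (r ∷ rs) = ext (λ a → solve Λ 6 0 (λ z zr f p n n₁ → z :* (f :* p :- n) :+ (:- zr) :* (f :* p :- n) :+ (:- zr) :* n :+ (z :* n :- n₁) := f :* ((z :- zr) :* p) :- n₁)
       (z a) (z r) (φ 0 a) (prod rs a) (φ (length rs) a) (φ (suc (length rs)) a)) main
      where
      n = length rs
      main : Span (suc n) (λ a → z a * (φ 0 a * prod rs a - φ n a) + (- z r) * (φ 0 a * prod rs a - φ n a) + (- z r) * φ n a + (z a * φ n a - φ (suc n) a))
      main = add (add (add (mul-z (leading rs)) (scl (- z r) (mono (leading rs)))) (scl (- z r) (gen ≤-refl))) (step n)

    -- Modulo lower columns the first one may be replaced by φ 0 times the product of all z - z r′
    -- with r′ in `rs`. It vanishes at every point but r, so a single term of the expansion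
    -- survives.
    vandermonde-step : ∀ r rs → det (cols (suc (length rs))) (r ∷ rs) ≈ (φ 0 r * prod rs r) * det (cols (length rs)) rs
    vandermonde-step r rs = begin
     det (φ n ∷ cols n) (r ∷ rs)
      ≈⟨ trans (sym (+-identityʳ _)) (+-congˡ (sym (det-Span (leading rs) (r ∷ rs)))) ⟩
     det (φ n ∷ cols n) (r ∷ rs) + det ((λ a → φ 0 a * prod rs a - φ n a) ∷ cols n) (r ∷ rs)
      ≈⟨ sym (det-+ _ _ (cols n) (r ∷ rs)) ⟩
     det ((λ a → φ n a + (φ 0 a * prod rs a - φ n a)) ∷ cols n) (r ∷ rs)
      ≈⟨ det-cong (cols n) (r ∷ rs) (λ a → solve Λ 2 0 (λ n f → n :+ (f :- n) := f) _ _) ⟩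
     (φ 0 r * prod rs r) * det (cols n) rs - altSum (λ a l → (φ 0 a * prod rs a) * det (cols n) (r ∷ l)) rs
      ≈⟨ +-congˡ (-‿cong (altSum-0 rs λ l m → trans (*-congʳ (trans (*-congˡ (root rs m)) (zeroʳ _))) (zeroˡ _))) ⟩
     (φ 0 r * prod rs r) * det (cols n) rs - 0#
      ≈⟨ solve Λ 1 0 (λ a → a :- :0 := a) _ ⟩
     (φ 0 r * prod rs r) * det (cols n) rs ∎
     where
     n = length rs
     root : ∀ rs {a} → a ∈ rs → prod rs a ≈ 0#
     root (r ∷ rs) (here ≡.refl) = trans (*-congʳ (-‿inverseʳ _)) (zeroˡ _)
     root (r ∷ rs) (there m) = trans (*-congˡ (root rs m)) (zeroʳ _)

  altSum-Fubini : ∀ {A B : Set} (G : A → List A → B → List B → Carrier) as bs →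
   altSum (λ a l → altSum (λ b k → G a l b k) bs) as ≈ altSum (λ b k → altSum (λ a l → G a l b k) as) bs
  altSum-Fubini G [] bs = sym (altSum-0 bs λ _ _ → refl)
  altSum-Fubini G (a ∷ as) bs = trans (+-congˡ (-‿cong (altSum-Fubini (λ b l → G b (a ∷ l)) as bs)))
   (trans (+-congˡ (sym (altSum-neg _ bs))) (sym (altSum-+ _ _ bs)))

  -- Expansion along the first column and then the first row, with the two sums exchanged. Induction
  -- runs on a length bound, since the minors keep the first row and are not sublists of the tail.
  det-transpose : ∀ {A B : Set} (M : A → B → Carrier) as bs → det (map (λ b a → M a b) bs) as ≈ det (map M as) bs
  det-transpose {A} {B} M as bs = go (length as) as bs ≤-refl
   where
   col : B → A → Carrier
   col b a = M a b
   go : ∀ n as bs → length as ≤ n → det (map col bs) as ≈ det (map M as) bs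
   go n [] [] e = refl
   go n [] (b ∷ bs) e = refl
   go n (a ∷ as) [] e = refl
   go (suc n) (a ∷ as) (b ∷ bs) (s≤s e) = +-cong (*-congˡ (go n as bs e)) (-‿cong (begin
    altSum (λ a′ l → M a′ b * det (map col bs) (a ∷ l)) as
     ≈⟨ altSum-cong′ as (λ {a′} l _ e″ → trans (*-congˡ (go n (a ∷ l) bs (subst (_≤ n) (≡.sym e″) e))) (sym (altSum-* _ _ bs))) ⟩
    altSum (λ a′ l → altSum (λ b′ k → M a′ b * (M a b′ * det (map M l) k)) bs) as
     ≈⟨ altSum-Fubini _ as bs ⟩
    altSum (λ b′ k → altSum (λ a′ l → M a′ b * (M a b′ * det (map M l) k)) as) bs
     ≈⟨ altSum-cong bs (λ b′ k → trans (altSum-cong′ as λ {a′} l _ e″ → trans (x*yz≈y*xz _ _ _)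
       (*-congˡ (*-congˡ (sym (go n l k (≤-trans (n≤1+n _) (subst (_≤ n) (≡.sym e″) e))))))) (altSum-* _ _ as)) ⟩
    altSum (λ b′ k → M a b′ * det (map col (b ∷ k)) as) bs
     ≈⟨ altSum-cong bs (λ b′ k → *-congˡ (go n as (b ∷ k) e)) ⟩
    altSum (λ b′ k → M a b′ * det (map M as) (b ∷ k)) bs ∎))

-- The sum over cuts as a single determinant

module Columns where

 open Base
 open Solver
 open Chains using (module SumN; Config; module Move; Ys; ys-of; Y; cutSum; cutSum-*; cutSum-cong)
 open Det

 down : ℕ → List ℕ
 down zero    = []
 down (suc n) = n ∷ down n

 module _ (Q : QRing) (H : ℤ) (L : ℕ) where
  open QRing Q
  open SumN Λ
  open ≈-Reasoning

  private
   C = Config Q H L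
   N = L ℕ.+ L

  weightProd : (ℤ → ℕ → Carrier) → C → Carrier
  weightProd ρ []              = 1#
  weightProd ρ ((y , p) ∷ cfg) = ρ y p * weightProd ρ cfg

  private
   cutSum-sumN-swap : ∀ n (h : ℕ → C → Carrier) ys → cutSum Q H L (λ cfg → sumN n (λ k → h k cfg)) ys ≈ sumN n (λ k → cutSum Q H L (h k) ys)
   cutSum-+ : ∀ (h h′ : C → Carrier) ys → cutSum Q H L (λ cfg → h cfg + h′ cfg) ys ≈ cutSum Q H L h ys + cutSum Q H L h′ ys
   cutSum-+ h h′ [] = refl
   cutSum-+ h h′ (y ∷ ys) = trans (sumN-cong N λ p _ → cutSum-+ _ _ ys) (sumN-+ N _ _)
   cutSum-sumN-swap zero h ys = refl
   cutSum-sumN-swap (suc n) h ys = trans (cutSum-+ _ _ ys) (+-congˡ (cutSum-sumN-swap n (λ k → h (suc k)) ys))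

   sumN-neg : ∀ n h → sumN n (λ k → - h k) ≈ - sumN n h
   sumN-neg zero h = refl
   sumN-neg (suc n) h = trans (+-congˡ (sumN-neg n _)) (solve Λ 2 0 (λ a b → :- a :+ :- b := :- (a :+ b)) _ _)

   sumN-swap : ∀ n m (h : ℕ → ℕ → Carrier) → sumN n (λ k → sumN m (h k)) ≈ sumN m (λ i → sumN n (λ k → h k i))
   sumN-swap zero m h = refl
   sumN-swap (suc n) m h = trans (+-congˡ (sumN-swap n m _)) (sym (sumN-+ m _ _))

  cutSum-altSum : ∀ (ρ : ℤ → ℕ → Carrier) (G : ℤ × ℕ → C → Carrier) ys →
   cutSum Q H L (λ cfg → weightProd ρ cfg * altSum Q G cfg) ys ≈
   altSum Q (λ y l → sumN N (λ p → ρ y p * cutSum Q H L (λ cfg → weightProd ρ cfg * G (y , p) cfg) l)) ys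
  cutSum-altSum ρ G [] = zeroʳ _
  cutSum-altSum ρ G (y ∷ ys) = begin
   sumN N (λ p → cutSum Q H L (λ cfg → ρ y p * weightProd ρ cfg * (G (y , p) cfg - altSum Q (λ b bs → G b ((y , p) ∷ bs)) cfg)) ys)
    ≈⟨ (sumN-cong N λ p _ → trans
      (cutSum-cong Q H L ys (λ cfg _ _ → trans
       (solve Λ 4 0 (λ r w g a → r :* w :* (g :- a) := r :* (w :* g) :+ (:- r) :* (w :* a)) _ _ _ _) refl))
      (trans (cutSum-+ _ _ ys) (+-cong (cutSum-* Q H L _ _ ys) (trans (cutSum-* Q H L _ _ ys) (*-congˡ (cutSum-altSum ρ (λ b bs → G b ((y , p) ∷ bs)) ys)))))) ⟩
   sumN N (λ p → ρ y p * cutSum Q H L (λ cfg → weightProd ρ cfg * G (y , p) cfg) ys +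
    (- ρ y p) * altSum Q (λ y′ l → sumN N (λ q → ρ y′ q * cutSum Q H L (λ cfg → weightProd ρ cfg * G (y′ , q) ((y , p) ∷ cfg)) l)) ys)
    ≈⟨ trans (sumN-+ N _ _) (+-congˡ (trans (sumN-cong N λ p _ → solve Λ 2 0 (λ r a → (:- r) :* a := :- (r :* a)) _ _) (sumN-neg N _))) ⟩
   _ - sumN N (λ p → ρ y p * altSum Q (λ y′ l → sumN N (λ q → ρ y′ q * cutSum Q H L (λ cfg → weightProd ρ cfg * G (y′ , q) ((y , p) ∷ cfg)) l)) ys)
    ≈⟨ +-congˡ (-‿cong (trans (sumN-cong N λ p _ → sym (altSum-* Q _ _ ys)) (sym (altSum-sumN Q N _ ys)))) ⟩
   _ - altSum Q (λ y′ l → sumN N (λ p → ρ y p * sumN N (λ q → ρ y′ q * cutSum Q H L (λ cfg → weightProd ρ cfg * G (y′ , q) ((y , p) ∷ cfg)) l))) ys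
    ≈⟨ +-congˡ (-‿cong (altSum-cong Q ys λ y′ l → trans (sumN-cong N λ p _ → sym (sumN-* N _ _)) (trans (sumN-swap N N _)
      (sumN-cong N λ q _ → trans (sumN-cong N λ p _ → trans (x*yz≈y*xz _ _ _)
       (*-congˡ (trans (sym (cutSum-* Q H L _ _ l)) (cutSum-cong Q H L l (λ cfg _ _ → sym (*-assoc _ _ _)))))) (sumN-* N _ _))))) ⟩
   altSum Q (λ y l → sumN N (λ p → ρ y p * cutSum Q H L (λ cfg → weightProd ρ cfg * G (y , p) cfg) l)) (y ∷ ys) ∎

  -- Multilinearity in the rows: the cut of a chain and its weight occur only in the row of that
  -- chain.
  cutSum-det : ∀ ρ (fs : List (ℤ × ℕ → Carrier)) ys →
   cutSum Q H L (λ cfg → weightProd ρ cfg * det Q fs cfg) ys ≈ det Q (map (λ f y → sumN N (λ p → ρ y p * f (y , p))) fs) ys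
  cutSum-det ρ [] [] = *-identityˡ _
  cutSum-det ρ [] (y ∷ ys) = trans (sumN-cong N λ p _ → trans (cutSum-cong Q H L ys λ cfg _ _ → trans (zeroʳ _) (sym (zeroʳ 0#))) (trans (cutSum-* Q H L 0# _ ys) (zeroˡ _))) (zeros N)
   where
   zeros : ∀ n → sumN n (λ _ → 0#) ≈ 0#
   zeros zero = refl
   zeros (suc n) = trans (+-identityˡ _) (zeros n)
  cutSum-det ρ (f ∷ fs) ys = trans (cutSum-altSum ρ (λ r cfg → f r * det Q fs cfg) ys) (altSum-cong Q ys λ y l → trans
   (sumN-cong N λ p _ → trans (*-congˡ (trans (cutSum-cong Q H L l λ cfg _ _ → x*yz≈y*xz _ _ _)
    (trans (cutSum-* Q H L (f (y , p)) _ l) (*-congˡ (cutSum-det ρ fs l))))) (solve Λ 3 0 (λ a b c → a :* (b :* c) := c :* (a :* b)) _ _ _))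
   (trans (sumN-* N _ _) (*-comm _ _)))

  module _ (ψ : ℕ → ℤ → Carrier) (β : Carrier)
   (rec₀ : ∀ a → (E (a ℤ.+ a) + E (ℤ.- (a ℤ.+ a))) * ψ 0 a ≈ ψ 1 a + β * ψ 0 a)
   (rec : ∀ n a → (E (a ℤ.+ a) + E (ℤ.- (a ℤ.+ a))) * ψ (suc n) a ≈ ψ (suc (suc n)) a + ψ n a) where

   at-row : (ℤ → Carrier) → ℤ × ℕ → Carrier
   at-row f (y , p) = f (Y Q H L y p)

   open Vandermonde Q {ℤ × ℕ} (λ n → at-row (ψ n)) (at-row λ a → E (a ℤ.+ a) + E (ℤ.- (a ℤ.+ a))) β (λ _ → rec₀ _) (λ n _ → rec n _)

   module _ (g : ℤ → Carrier) (ν : ℕ) where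
    open Move Q H L g (ψ 0) ν using (Δ; V)

    -- The Weyl denominator formula: with z a = E (a + a) + E (-(a + a)) the difference z a - z b is
    -- s (a + b) s (a - b).
    det-Δ : ∀ cfg → det Q (cols (length cfg)) cfg ≈ Δ (Ys Q H L cfg)
    det-Δ [] = refl
    det-Δ (r ∷ cfg) = trans (vandermonde-step r cfg) (*-cong (*-congˡ (prod-V r cfg)) (det-Δ cfg))
     where
     prod-V : ∀ r cfg → prod cfg r ≈ V (Y Q H L (proj₁ r) (proj₂ r)) (Ys Q H L cfg)
     prod-V r [] = refl
     prod-V r (r′ ∷ cfg) = *-cong (solve Λ 0 2 (λ a b → (:E (a ⊞ a) :+ :E (⊟ (a ⊞ a))) :- (:E (b ⊞ b) :+ :E (⊟ (b ⊞ b))) := :s (a ⊞ b) :* :s (a ⊟ b))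
      (Y Q H L (proj₁ r) (proj₂ r)) (Y Q H L (proj₁ r′) (proj₂ r′))) (prod-V r cfg)

    cutSum-Δ : ∀ ρ ys → cutSum Q H L (λ cfg → weightProd ρ cfg * Δ (Ys Q H L cfg)) ys ≈
     det Q (map (λ k y → sumN N (λ p → ρ y p * ψ k (Y Q H L y p))) (down (length ys))) ys
    cutSum-Δ ρ ys = begin
     cutSum Q H L (λ cfg → weightProd ρ cfg * Δ (Ys Q H L cfg)) ys
      ≈⟨ (cutSum-cong Q H L ys λ cfg _ e → *-congˡ (trans (sym (det-Δ cfg)) (reflexive (cong (λ k → det Q (cols k) cfg)
        (≡.trans (≡.sym (Listₚ.length-map proj₁ cfg)) (cong length e)))))) ⟩
     cutSum Q H L (λ cfg → weightProd ρ cfg * det Q (cols (length ys)) cfg) ys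
      ≈⟨ cutSum-det ρ (cols (length ys)) ys ⟩
     det Q (map (λ f y → sumN N (λ p → ρ y p * f (y , p))) (cols (length ys))) ys
      ≈⟨ reflexive (cong (λ fs → det Q fs ys) (cols-map (length ys))) ⟩
     det Q (map (λ k y → sumN N (λ p → ρ y p * ψ k (Y Q H L y p))) (down (length ys))) ys ∎
     where
     cols-map : ∀ n → map (λ f y → sumN N (λ p → ρ y p * f (y , p))) (cols n) ≡ map (λ k y → sumN N (λ p → ρ y p * ψ k (Y Q H L y p))) (down n)
     cols-map zero = ≡.refl
     cols-map (suc n) = cong ((λ y → sumN N (λ p → ρ y p * ψ n (Y Q H L y p))) ∷_) (cols-map n)

-- Convergence with respect to the valuation

module Limit where

 open Base
 open Solver
 open Littlewood using (times)
 open Chains using (module SumN; Y)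
 open Collapse
 open Det

 module Seq (R : LRing) where
  open LRing R

  Val-1 : Val 0ℤ 1#
  Val-1 = Val-≈ E-0 (Val-E 0ℤ)

  Val-scale : ∀ {k l m x y} → k ℤ.+ l ≡ m → Val k x → Val l y → Val m (x * y)
  Val-scale ≡.refl p q = Val-* p q

  Sequence : Set
  Sequence = ℕ → Carrier

  infix 4 _~_

  -- Sequences are compared with one another, which replaces the construction of limits in a ring
  -- that is not assumed complete.
  _~_ : Sequence → Sequence → Set
  a ~ b = ∀ (k : ℕ) → ∃ λ L₀ → ∀ L → L₀ ≤ L → Val (+ k) (a L - b L)

  Bounded : Sequence → Set
  Bounded a = ∃ λ (k : ℕ) → ∀ L → Val (ℤ.- + k) (a L)

  ≈⇒~ : ∀ {a b} → (∀ L → a L ≈ b L) → a ~ b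
  ≈⇒~ h k = 0 , λ L _ → Val-≈ (trans (sym (-‿inverseʳ _)) (+-congˡ (-‿cong (h L)))) (Val-0 (+ k))

  ~-refl : ∀ {a} → a ~ a
  ~-refl = ≈⇒~ λ _ → refl

  ~-sym : ∀ {a b} → a ~ b → b ~ a
  ~-sym h k = let L₀ , p = h k in L₀ , λ L l → Val-≈ (solve Λ 2 0 (λ a b → :- (a :- b) := b :- a) _ _) (Val-neg (p L l))

  ~-trans : ∀ {a b c} → a ~ b → b ~ c → a ~ c
  ~-trans h h′ k = let L₀ , p = h k ; L₁ , q = h′ k in L₀ ⊔ L₁ , λ L l →
   Val-≈ (solve Λ 3 0 (λ a b c → (a :- b) :+ (b :- c) := a :- c) _ _ _)
    (Val-+ (p L (m⊔n≤o⇒m≤o L₀ L₁ l)) (q L (m⊔n≤o⇒n≤o L₀ L₁ l)))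

  ~-+ : ∀ {a a′ b b′} → a ~ a′ → b ~ b′ → (λ L → a L + b L) ~ (λ L → a′ L + b′ L)
  ~-+ h h′ k = let L₀ , p = h k ; L₁ , q = h′ k in L₀ ⊔ L₁ , λ L l →
   Val-≈ (solve Λ 4 0 (λ a b c d → (a :- b) :+ (c :- d) := (a :+ c) :- (b :+ d)) _ _ _ _)
    (Val-+ (p L (m⊔n≤o⇒m≤o L₀ L₁ l)) (q L (m⊔n≤o⇒n≤o L₀ L₁ l)))

  ~-neg : ∀ {a a′} → a ~ a′ → (λ L → - a L) ~ (λ L → - a′ L)
  ~-neg h k = let L₀ , p = h k in L₀ , λ L l → Val-≈ (solve Λ 2 0 (λ a b → :- (a :- b) := (:- a) :- (:- b)) _ _) (Val-neg (p L l))

  ~-*ˡ : ∀ {a b b′} → Bounded a → b ~ b′ → (λ L → a L * b L) ~ (λ L → a L * b′ L)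
  ~-*ˡ (c , B) h k = let L₀ , p = h (c ℕ.+ k) in L₀ , λ L l →
   Val-≈ (solve Λ 3 0 (λ a b c → a :* (b :- c) := a :* b :- a :* c) _ _ _)
    (Val-scale (lem (+ c) (+ k)) (B L) (p L l))
   where
   lem : ∀ c k → ℤ.- c ℤ.+ (c ℤ.+ k) ≡ k
   lem = ℤ-ring

  ~-* : ∀ {a a′ b b′} → Bounded a → Bounded b′ → a ~ a′ → b ~ b′ → (λ L → a L * b L) ~ (λ L → a′ L * b′ L)
  ~-* Ba Bb h h′ = ~-trans (~-*ˡ Ba h′) (~-trans (≈⇒~ λ L → *-comm _ _) (~-trans (~-*ˡ Bb h) (≈⇒~ λ L → *-comm _ _)))

  Bounded-+ : ∀ {a b} → Bounded a → Bounded b → Bounded (λ L → a L + b L)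
  Bounded-+ (k , B) (l , C) = k ⊔ l , λ L → Val-+ (Val-≤ (ℤₚ.neg-mono-≤ (ℤ.+≤+ (m≤m⊔n k l))) (B L)) (Val-≤ (ℤₚ.neg-mono-≤ (ℤ.+≤+ (m≤n⊔m k l))) (C L))

  Bounded-neg : ∀ {a} → Bounded a → Bounded (λ L → - a L)
  Bounded-neg (k , B) = k , λ L → Val-neg (B L)

  Bounded-* : ∀ {a b} → Bounded a → Bounded b → Bounded (λ L → a L * b L)
  Bounded-* (k , B) (l , C) = k ℕ.+ l , λ L → Val-scale (≡.sym (ℤₚ.neg-distrib-+ (+ k) (+ l))) (B L) (C L)

  Bounded-O : ∀ {a} → (∀ L → Val 0ℤ (a L)) → Bounded a
  Bounded-O h = 0 , h

  -‿≤ : ∀ i → ℤ.- + ∣ i ∣ ℤ.≤ i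
  -‿≤ (+ zero)  = ℤ.+≤+ z≤n
  -‿≤ (+ suc n) = ℤ.-≤+
  -‿≤ ℤ.-[1+ n ] = ℤₚ.≤-refl

  Bounded-E : ∀ a → Bounded (λ _ → E a)
  Bounded-E a = ∣ a ∣ , λ L → Val-≤ (-‿≤ a) (Val-E a)

  ~-constant : ∀ {x y} → (λ _ → x) ~ (λ _ → y) → x ≈ y
  ~-constant {x} {y} h = trans (solve Λ 2 0 (λ x y → x := (x :- y) :+ y) x y)
   (trans (+-congʳ (separated λ k → let L₀ , p = h k in p L₀ ≤-refl)) (+-identityˡ _))

  module _ {A : Set} (P : A → Set) where
   altSum-~ : ∀ (G G′ : ℕ → A → List A → Carrier) as → All P as → (∀ a l → P a → All P l → (λ L → G L a l) ~ (λ L → G′ L a l)) →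
    (λ L → altSum qRing (G L) as) ~ (λ L → altSum qRing (G′ L) as)
   altSum-~ G G′ [] [] h = ~-refl
   altSum-~ G G′ (a ∷ as) (p ∷ ps) h = ~-+ (h a as p ps) (~-neg (altSum-~ (λ L b l → G L b (a ∷ l)) (λ L b l → G′ L b (a ∷ l)) as ps λ b l q qs → h b (a ∷ l) q (p ∷ qs)))

   altSum-Bounded : ∀ (G : ℕ → A → List A → Carrier) as → All P as → (∀ a l → P a → All P l → Bounded (λ L → G L a l)) → Bounded (λ L → altSum qRing (G L) as)
   altSum-Bounded G [] [] h = Bounded-O λ _ → Val-0 0ℤ
   altSum-Bounded G (a ∷ as) (p ∷ ps) h = Bounded-+ (h a as p ps) (Bounded-neg (altSum-Bounded (λ L b l → G L b (a ∷ l)) as ps λ b l q qs → h b (a ∷ l) q (p ∷ qs)))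

   module _ {K : Set} (M M′ : ℕ → K → A → Carrier) (M~M′ : ∀ k a → P a → (λ L → M L k a) ~ (λ L → M′ L k a))
    (BM : ∀ k a → P a → Bounded (λ L → M L k a)) (BM′ : ∀ k a → P a → Bounded (λ L → M′ L k a)) where

    det-Bounded : ∀ ks as → All P as → Bounded (λ L → det qRing (map (M′ L) ks) as)
    det-Bounded [] [] ps = Bounded-O λ _ → Val-1
    det-Bounded [] (_ ∷ _) ps = Bounded-O λ _ → Val-0 0ℤ
    det-Bounded (k ∷ ks) as ps = altSum-Bounded _ as ps λ a l p qs → Bounded-* (BM′ k a p) (det-Bounded ks l qs)

    det-~ : ∀ ks as → All P as → (λ L → det qRing (map (M L) ks) as) ~ (λ L → det qRing (map (M′ L) ks) as)
    det-~ [] [] ps = ~-refl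
    det-~ [] (_ ∷ _) ps = ~-refl
    det-~ (k ∷ ks) as ps = altSum-~ _ _ as ps λ a l p qs → ~-* (BM k a p) (det-Bounded ks l qs) (M~M′ k a p) (det-~ ks l qs)

  One : ℕ → Carrier → Set
  One k x = Val (+ k) (x - 1#)

  One⇒Val : ∀ {k x} → One k x → Val 0ℤ x
  One⇒Val h = Val-≈ (solve Λ 1 0 (λ x → (x :- :1) :+ :1 := x) _) (Val-+ (Val-≤ (ℤ.+≤+ z≤n) h) Val-1)

  One-≈ : ∀ {k x y} → x ≈ y → One k x → One k y
  One-≈ e = Val-≈ (+-congʳ e)

  One-1 : ∀ k → One k 1#
  One-1 k = Val-≈ (sym (-‿inverseʳ 1#)) (Val-0 (+ k))

  One-≤ : ∀ {k l x} → k ≤ l → One l x → One k x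
  One-≤ l = Val-≤ (ℤ.+≤+ l)

  One-* : ∀ {k x y} → One k x → One k y → One k (x * y)
  One-* {k} p q = Val-≈ (solve Λ 2 0 (λ x y → (x :- :1) :* y :+ (y :- :1) := x :* y :- :1) _ _)
   (Val-+ (Val-scale (ℤₚ.+-identityʳ (+ k)) p (One⇒Val q)) q)

  One-u : ∀ {k a} → + k ℤ.≤ a → One k (u a)
  One-u {k} {a} l = Val-≤ (ℤₚ.≤-trans l (ℤₚ.≤-trans (ℤₚ.≤-reflexive (≡.sym (ℤₚ.+-identityʳ a))) (ℤₚ.+-monoʳ-≤ a (ℤₚ.≤-trans (ℤ.+≤+ z≤n) l))))
   (Val-≈ (solve Λ 0 1 (λ a → :- :X a := :u a :- :1) a) (Val-neg (Val-E (a ℤ.+ a))))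

  ≢0-pos : ∀ {a} → + 1 ℤ.≤ a → a ≡ 0ℤ → ⊥
  ≢0-pos (ℤ.+≤+ ()) ≡.refl

  One-j : ∀ {k a} → + 1 ℤ.≤ a → + k ℤ.≤ a → One k (j a)
  One-j {k} {a} l₁ l = Val-≤ (ℤₚ.≤-trans l (ℤₚ.≤-trans (ℤₚ.≤-reflexive (≡.sym (ℤₚ.+-identityʳ a))) (ℤₚ.+-monoʳ-≤ a (ℤₚ.≤-trans (ℤ.+≤+ z≤n) l))))
   (Val-≈ (trans (solve Λ 1 1 (λ j a → :X a :* j := j :- :u a :* j) (j a) a) (+-congˡ (-‿cong (u*j (≢0-pos l₁)))))
    (Val-scale (ℤₚ.+-identityʳ _) (Val-E (a ℤ.+ a)) (Val-j l₁)))

  One⇒~ : ∀ {a} (f : ℕ → ℕ) → (∀ k → ∃ λ L₀ → ∀ L → L₀ ≤ L → k ≤ f L) → (∀ L → One (f L) (a L)) → a ~ (λ _ → 1#)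
  One⇒~ f lim h k = let L₀ , p = lim k in L₀ , λ L l → Val-≤ (ℤ.+≤+ (p L l)) (h L)

 -- Bounds the exponents of a theta series. With B = |b| + 1, B|r| is at most A r² when |r| ≥ B and
 -- at most B² otherwise; the linear term uses up |b||r| and one |r| is left over.
 quadratic-bound : ∀ (A : ℕ) (b c : ℤ) → 1 ≤ A → ∃ λ C → ∀ r → + ∣ r ∣ ℤ.- + C ℤ.≤ + A ℤ.* (r ℤ.* r) ℤ.+ b ℤ.* r ℤ.+ c
 quadratic-bound A b c A≥1 = B ℕ.* B ℕ.+ ∣ c ∣ , λ r → begin
  + ∣ r ∣ ℤ.- + (B ℕ.* B ℕ.+ ∣ c ∣)
   ≡⟨ cong (λ z → + ∣ r ∣ ℤ.- z) (cong (ℤ._+ + ∣ c ∣) (ℤₚ.pos-* B B)) ⟩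
  + ∣ r ∣ ℤ.- (+ B ℤ.* + B ℤ.+ + ∣ c ∣)
   ≡⟨ lem₁ (+ ∣ r ∣) (+ ∣ b ∣) (+ B ℤ.* + B) (+ ∣ c ∣) ⟩
  ((+ 1 ℤ.+ + ∣ b ∣) ℤ.* + ∣ r ∣ ℤ.- + B ℤ.* + B) ℤ.+ ℤ.- (+ ∣ b ∣ ℤ.* + ∣ r ∣) ℤ.+ ℤ.- + ∣ c ∣
   ≤⟨ ℤₚ.+-mono-≤ (ℤₚ.+-mono-≤ (sq r) (lin r)) (neg-abs c) ⟩
  + A ℤ.* (r ℤ.* r) ℤ.+ b ℤ.* r ℤ.+ c ∎
  where
  open ℤₚ.≤-Reasoning
  B = suc ∣ b ∣
  lem₁ : ∀ r b s c → r ℤ.- (s ℤ.+ c) ≡ ((+ 1 ℤ.+ b) ℤ.* r ℤ.- s) ℤ.+ ℤ.- (b ℤ.* r) ℤ.+ ℤ.- c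
  lem₁ = ℤ-ring
  neg-abs : ∀ i → ℤ.- + ∣ i ∣ ℤ.≤ i
  neg-abs (+ zero)  = ℤ.+≤+ z≤n
  neg-abs (+ suc n) = ℤ.-≤+
  neg-abs ℤ.-[1+ n ] = ℤₚ.≤-refl
  lin : ∀ r → ℤ.- (+ ∣ b ∣ ℤ.* + ∣ r ∣) ℤ.≤ b ℤ.* r
  lin r = subst (λ z → ℤ.- z ℤ.≤ b ℤ.* r) (≡.trans (cong +_ (ℤₚ.∣i*j∣≡∣i∣*∣j∣ b r)) (ℤₚ.pos-* ∣ b ∣ ∣ r ∣)) (neg-abs (b ℤ.* r))
  square : ∀ r → r ℤ.* r ≡ + (∣ r ∣ ℕ.* ∣ r ∣)
  square (+ n) = ≡.sym (ℤₚ.pos-* n n)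
  square ℤ.-[1+ n ] = ≡.refl
  natural : ∀ k → B ℕ.* k ≤ A ℕ.* (k ℕ.* k) ℕ.+ B ℕ.* B
  natural k with ≤-total B k
  ... | inj₁ l = ≤-trans (*-monoˡ-≤ k l) (≤-trans (≤-trans (≤-reflexive (≡.sym (ℕₚ.*-identityˡ (k ℕ.* k)))) (*-monoˡ-≤ (k ℕ.* k) A≥1)) (m≤m+n _ _))
  ... | inj₂ l = ≤-trans (*-monoʳ-≤ B l) (m≤n+m _ _)
  sq : ∀ r → (+ 1 ℤ.+ + ∣ b ∣) ℤ.* + ∣ r ∣ ℤ.- + B ℤ.* + B ℤ.≤ + A ℤ.* (r ℤ.* r)
  sq r = begin
   + B ℤ.* + ∣ r ∣ ℤ.- + B ℤ.* + B ≡⟨ cong₂ ℤ._-_ (≡.sym (ℤₚ.pos-* B ∣ r ∣)) (≡.sym (ℤₚ.pos-* B B)) ⟩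
   + (B ℕ.* ∣ r ∣) ℤ.- + (B ℕ.* B) ≤⟨ ℤₚ.+-monoˡ-≤ (ℤ.- + (B ℕ.* B)) (ℤ.+≤+ (natural ∣ r ∣)) ⟩
   + (A ℕ.* (∣ r ∣ ℕ.* ∣ r ∣)) ℤ.+ + (B ℕ.* B) ℤ.- + (B ℕ.* B) ≡⟨ lem₂ (+ (A ℕ.* (∣ r ∣ ℕ.* ∣ r ∣))) (+ (B ℕ.* B)) ⟩
   + (A ℕ.* (∣ r ∣ ℕ.* ∣ r ∣)) ≡⟨ ≡.trans (ℤₚ.pos-* A _) (cong (+ A ℤ.*_) (≡.sym (square r))) ⟩
   + A ℤ.* (r ℤ.* r) ∎
   where
   lem₂ : ∀ a b → a ℤ.+ b ℤ.- b ≡ a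
   lem₂ = ℤ-ring

-- The matrix entries and their theta series

module Entries where

 open Base
 open Solver
 open Littlewood using (times)
 open Chains using (module SumN; Y)
 open Collapse
 open Signs using (module Weights)

 open Limit

 ≤∣∣ : ∀ i → i ℤ.≤ + ∣ i ∣
 ≤∣∣ (+ n) = ℤₚ.≤-refl
 ≤∣∣ ℤ.-[1+ n ] = ℤ.-≤+

 module _ (R : LRing) where
  open LRing R
  open Seq R
  open SumN Λ

  sumN-Val : ∀ {k} n h → (∀ i → i ≤ n → Val k (h i)) → Val k (sumN n h)
  sumN-Val zero h v = v 0 z≤n
  sumN-Val (suc n) h v = Val-+ (v 0 z≤n) (sumN-Val n (λ i → h (suc i)) λ i l → v (suc i) (s≤s l))

  sumN-reverse : ∀ n h → sumN n h ≈ sumN n (λ i → h (n ∸ i))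
  sumN-reverse zero h = refl
  sumN-reverse (suc n) h = trans (trans (snoc n h) (+-comm _ _)) (+-congˡ (sumN-reverse n h))
   where
   snoc : ∀ n h → sumN (suc n) h ≈ sumN n h + h (suc n)
   snoc zero h = refl
   snoc (suc n) h = trans (+-congˡ (snoc n (λ i → h (suc i)))) (sym (+-assoc _ _ _))

  ψ : ℕ → ℤ → Carrier
  ψ c a = E (ℤ.- times c a) - E (times c a)

  module _ (η ν : ℕ) (η≥1 : 1 ≤ η) (ν≥1 : 1 ≤ ν) where
   private
    H T : ℤ
    H = + η
    T = H ℤ.+ H

   -- The truncated theta series obtained from a matrix entry when the quotient of the two `Qw` is
   -- replaced by 1.
   ideal : ℕ → ℤ → ℕ → Carrier
   ideal c y L = sumN (L ℕ.+ L) (λ p → E (exponent H L ν y p) * ψ c (Y qRing H L y p))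

   private
    r : ℕ → ℕ → ℤ
    r L p = + p ℤ.- + L

    Y≡ : ∀ L y p → Y qRing H L y p ≡ y ℤ.+ T ℤ.* r L p
    Y≡ L y p = ≡.trans (cong₂ (λ a b → y ℤ.- a ℤ.+ b) (times≡* L T) (times≡* p T)) (lem y (+ L) (+ p) T)
     where
     lem : ∀ y L p T → y ℤ.- L ℤ.* T ℤ.+ p ℤ.* T ≡ y ℤ.+ T ℤ.* (p ℤ.- L)
     lem = ℤ-ring

    A : ℕ
    A = ν ℕ.* (4 ℕ.* η)

    A≥1 : 1 ≤ A
    A≥1 = *-mono-≤ ν≥1 (*-mono-≤ {1} {4} (s≤s z≤n) η≥1)

    A≡ : + A ≡ + ν ℤ.* (+ 4 ℤ.* H)
    A≡ = ≡.trans (ℤₚ.pos-* ν _) (cong (+ ν ℤ.*_) (ℤₚ.pos-* 4 η))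

    e⁻ e⁺ : ℕ → ℤ → ℕ → ℕ → ℤ
    e⁻ c y L p = exponent H L ν y p ℤ.+ ℤ.- times c (Y qRing H L y p)
    e⁺ c y L p = exponent H L ν y p ℤ.+ times c (Y qRing H L y p)

    e⁻≡ : ∀ c y L p → e⁻ c y L p ≡ + A ℤ.* (r L p ℤ.* r L p) ℤ.+ (+ ν ℤ.* (+ 4 ℤ.* y) ℤ.- + c ℤ.* T) ℤ.* r L p ℤ.+ ℤ.- (+ c ℤ.* y)
    e⁻≡ c y L p = ≡.trans (cong (λ z → exponent H L ν y p ℤ.+ ℤ.- z) (≡.trans (times≡* c _) (cong (+ c ℤ.*_) (Y≡ L y p))))
     (≡.trans (lem (+ ν) H y (+ c) (r L p)) (cong (λ z → z ℤ.* (r L p ℤ.* r L p) ℤ.+ (+ ν ℤ.* (+ 4 ℤ.* y) ℤ.- + c ℤ.* T) ℤ.* r L p ℤ.+ ℤ.- (+ c ℤ.* y)) (≡.sym A≡)))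
     where
     lem : ∀ ν H y c r → ν ℤ.* (+ 2 ℤ.* ((H ℤ.+ H) ℤ.* (r ℤ.* r) ℤ.+ + 2 ℤ.* (y ℤ.* r))) ℤ.+ ℤ.- (c ℤ.* (y ℤ.+ (H ℤ.+ H) ℤ.* r))
      ≡ (ν ℤ.* (+ 4 ℤ.* H)) ℤ.* (r ℤ.* r) ℤ.+ (ν ℤ.* (+ 4 ℤ.* y) ℤ.- c ℤ.* (H ℤ.+ H)) ℤ.* r ℤ.+ ℤ.- (c ℤ.* y)
     lem = ℤ-ring

    e⁺≡ : ∀ c y L p → e⁺ c y L p ≡ + A ℤ.* (r L p ℤ.* r L p) ℤ.+ (+ ν ℤ.* (+ 4 ℤ.* y) ℤ.+ + c ℤ.* T) ℤ.* r L p ℤ.+ + c ℤ.* y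
    e⁺≡ c y L p = ≡.trans (cong (λ z → exponent H L ν y p ℤ.+ z) (≡.trans (times≡* c _) (cong (+ c ℤ.*_) (Y≡ L y p))))
     (≡.trans (lem (+ ν) H y (+ c) (r L p)) (cong (λ z → z ℤ.* (r L p ℤ.* r L p) ℤ.+ (+ ν ℤ.* (+ 4 ℤ.* y) ℤ.+ + c ℤ.* T) ℤ.* r L p ℤ.+ + c ℤ.* y) (≡.sym A≡)))
     where
     lem : ∀ ν H y c r → ν ℤ.* (+ 2 ℤ.* ((H ℤ.+ H) ℤ.* (r ℤ.* r) ℤ.+ + 2 ℤ.* (y ℤ.* r))) ℤ.+ c ℤ.* (y ℤ.+ (H ℤ.+ H) ℤ.* r)
      ≡ (ν ℤ.* (+ 4 ℤ.* H)) ℤ.* (r ℤ.* r) ℤ.+ (ν ℤ.* (+ 4 ℤ.* y) ℤ.+ c ℤ.* (H ℤ.+ H)) ℤ.* r ℤ.+ c ℤ.* y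
     lem = ℤ-ring

    exponent-bound : ∀ c y → ∃ λ C → ∀ L p → (+ ∣ r L p ∣ ℤ.- + C ℤ.≤ e⁻ c y L p) × (+ ∣ r L p ∣ ℤ.- + C ℤ.≤ e⁺ c y L p)
    exponent-bound c y =
     let C₁ , b₁ = quadratic-bound A (+ ν ℤ.* (+ 4 ℤ.* y) ℤ.- + c ℤ.* T) (ℤ.- (+ c ℤ.* y)) A≥1 ; C₂ , b₂ = quadratic-bound A (+ ν ℤ.* (+ 4 ℤ.* y) ℤ.+ + c ℤ.* T) (+ c ℤ.* y) A≥1 in
     C₁ ⊔ C₂ , λ L p →
      ℤₚ.≤-trans (ℤₚ.+-monoʳ-≤ (+ ∣ r L p ∣) (ℤₚ.neg-mono-≤ (ℤ.+≤+ (m≤m⊔n C₁ C₂)))) (ℤₚ.≤-trans (b₁ (r L p)) (ℤₚ.≤-reflexive (≡.sym (e⁻≡ c y L p)))) ,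
      ℤₚ.≤-trans (ℤₚ.+-monoʳ-≤ (+ ∣ r L p ∣) (ℤₚ.neg-mono-≤ (ℤ.+≤+ (m≤n⊔m C₁ C₂)))) (ℤₚ.≤-trans (b₂ (r L p)) (ℤₚ.≤-reflexive (≡.sym (e⁺≡ c y L p))))

    Val-term : ∀ {k l x} c y L p → k ℤ.≤ e⁻ c y L p → k ℤ.≤ e⁺ c y L p → Val l x → Val (k ℤ.+ l) (E (exponent H L ν y p) * ψ c (Y qRing H L y p) * x)
    Val-term c y L p b₁ b₂ v = Val-* (Val-≈ (solve Λ 0 2 (λ e a → :E (e ⊞ ⊟ a) :- :E (e ⊞ a) := :E e :* (:E (⊟ a) :- :E a))
      (exponent H L ν y p) (times c (Y qRing H L y p)))
     (Val-+ (Val-≤ b₁ (Val-E _)) (Val-neg (Val-≤ b₂ (Val-E _))))) v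

   ideal-Bounded : ∀ c y → Bounded (ideal c y)
   ideal-Bounded c y = let C , b = exponent-bound c y in C , λ L → sumN-Val (L ℕ.+ L) _ λ p _ →
    Val-≈ (*-identityʳ _) (Val-≤ (ℤₚ.≤-trans (≤r C L p) (ℤₚ.≤-reflexive (≡.sym (ℤₚ.+-identityʳ _)))) (Val-term c y L p (proj₁ (b L p)) (proj₂ (b L p)) Val-1))
    where
    ≤r : ∀ C L p → ℤ.- + C ℤ.≤ + ∣ r L p ∣ ℤ.- + C
    ≤r C L p = ℤₚ.≤-trans (ℤₚ.≤-reflexive (≡.sym (ℤₚ.+-identityˡ _))) (ℤₚ.+-monoˡ-≤ (ℤ.- + C) (ℤ.+≤+ {0} {∣ r L p ∣} z≤n))

   module _ (ys : List ℤ) (g f₁ : ℤ → Carrier) where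
    PositiveShifts : ℤ → Set
    PositiveShifts d = ∀ e → + suc e ℤ.≤ d ℤ.+ times (suc e) T

    entry : ℕ → ℤ → ℕ → Carrier
    entry c y L = sumN (L ℕ.+ L) (λ p → ρ qRing H L g f₁ ν ys y p * ψ c (Y qRing H L y p))

    module _ (shifts : ∀ {y b} → y ∈ ys → b ∈ ys → (PositiveShifts (b ℤ.- y) × PositiveShifts (ℤ.- b ℤ.- y)) × (PositiveShifts (b ℤ.+ y) × PositiveShifts (ℤ.- b ℤ.+ y))) where

     private
      open Weights qRing T using (prodOver)
      CP CP⁻¹ : ℕ → ℤ → ℕ → Carrier
      CP   L = P qRing H L g f₁ ν ys
      CP⁻¹ L = P⁻¹ qRing H L g f₁ ν ys
      CQw CQw⁻¹ : ℕ → ℤ → ℕ → Carrier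
      CQw   L = Qw qRing H L g f₁ ν ys
      CQw⁻¹ L = Qw⁻¹ qRing H L g f₁ ν ys
      CP-inverse : ∀ L {d} k → NonZeroShifts qRing H L g f₁ ν ys d → CP L d k * CP⁻¹ L d k ≈ 1#
      CP-inverse L = P-inverse qRing H L g f₁ ν ys

      positive⇒nonzero : ∀ {d} → PositiveShifts d → ∀ e → d ℤ.+ times (suc e) T ≡ 0ℤ → ⊥
      positive⇒nonzero h e = ≢0-pos (ℤₚ.≤-trans (ℤ.+≤+ (s≤s z≤n)) (h e))

      P-above : ∀ L {d} → PositiveShifts d → ∀ i p → One p (CP L d (i ℕ.+ p) * CP⁻¹ L d p)
      P-above L {d} h zero p = One-≈ (sym (CP-inverse L p (positive⇒nonzero {d} h))) (One-1 p)
      P-above L {d} h (suc i) p = One-≈ (sym (*-assoc _ _ _)) (One-* (One-u (ℤₚ.≤-trans (ℤ.+≤+ (≤-trans (m≤n+m p i) (n≤1+n _))) (h (i ℕ.+ p)))) (P-above L h i p))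

      P-below : ∀ L {d} → PositiveShifts d → ∀ i p → One p (CP L d p * CP⁻¹ L d (i ℕ.+ p))
      P-below L {d} h zero p = One-≈ (sym (CP-inverse L p (positive⇒nonzero {d} h))) (One-1 p)
      P-below L {d} h (suc i) p = One-≈ (x*yz≈y*xz _ _ _)
       (One-* (One-j (ℤₚ.≤-trans (ℤ.+≤+ (s≤s z≤n)) (h (i ℕ.+ p))) (ℤₚ.≤-trans (ℤ.+≤+ (≤-trans (m≤n+m p i) (n≤1+n _))) (h (i ℕ.+ p)))) (P-below L h i p))

      -- The first min(k, p) factors cancel, and each later one is 1 up to an order that grows with
      -- its index.
      P-ratio : ∀ L {d} → PositiveShifts d → ∀ k p → One (k ⊓ p) (CP L d k * CP⁻¹ L d p)
      P-ratio L {d} h k p with ≤-total k p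
      ... | inj₁ k≤p = One-≤ (m⊓n≤m k p) (subst (λ z → One k (CP L d k * CP⁻¹ L d z)) (m∸n+n≡m k≤p) (P-below L h (p ∸ k) k))
      ... | inj₂ p≤k = One-≤ (m⊓n≤n k p) (subst (λ z → One p (CP L d z * CP⁻¹ L d p)) (m∸n+n≡m p≤k) (P-above L h (k ∸ p) p))

      depth : ℕ → ℕ → ℕ
      depth L p = (L ⊓ (L ℕ.+ L ∸ p)) ⊓ (L ⊓ p)

      one-prod : ∀ k (f f′ : ℤ → Carrier) l → (∀ {b} → b ∈ l → One k (f b * f′ b)) → One k (prodOver f l * prodOver f′ l)
      one-prod k f f′ [] h = One-≈ (sym (*-identityˡ _)) (One-1 k)
      one-prod k f f′ (b ∷ l) h = One-≈ (solve Λ 4 0 (λ a b c d → (a :* c) :* (b :* d) := (a :* b) :* (c :* d)) _ _ _ _)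
       (One-* (h (here ≡.refl)) (one-prod k f f′ l λ m → h (there m)))

      Q-ratio : ∀ L {y} p → y ∈ ys → One (depth L p) (CQw L y L * CQw⁻¹ L y p)
      Q-ratio L {y} p y∈ = one-prod (depth L p) _ _ ys λ {b} b∈ → let (s₁ , s₂) , (s₃ , s₄) = shifts y∈ b∈ in
       One-≈ (solve Λ 8 0 (λ a b c d e f g h → ((a :* e) :* (b :* f)) :* ((c :* g) :* (d :* h)) := ((a :* b) :* (c :* d)) :* ((e :* f) :* (g :* h))) _ _ _ _ _ _ _ _)
        (One-* (One-* (near s₁) (near s₂)) (One-* (One-≤ (m⊓n≤n _ _) (P-ratio L s₃ L p)) (One-≤ (m⊓n≤n _ _) (P-ratio L s₄ L p))))
       where
       near : ∀ {d} → PositiveShifts d → One (depth L p) (CP L d (L ℕ.+ L ∸ L) * CP⁻¹ L d (L ℕ.+ L ∸ p))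
       near {d} h = One-≤ (m⊓n≤m _ _) (subst (λ z → One (L ⊓ (L ℕ.+ L ∸ p)) (CP L d z * CP⁻¹ L d (L ℕ.+ L ∸ p))) (≡.sym (m+n∸n≡m L L)) (P-ratio L h L (L ℕ.+ L ∸ p)))

      depth-bound : ∀ L p → p ≤ L ℕ.+ L → L ≤ depth L p ℕ.+ ∣ r L p ∣
      depth-bound L p p≤ = min (L ⊓ (L ℕ.+ L ∸ p)) (L ⊓ p) (min L (L ℕ.+ L ∸ p) (m≤m+n L _) up) (min L p (m≤m+n L _) lo)
       where
       min : ∀ a b → L ≤ a ℕ.+ ∣ r L p ∣ → L ≤ b ℕ.+ ∣ r L p ∣ → L ≤ a ⊓ b ℕ.+ ∣ r L p ∣
       min a b la lb with ℕₚ.⊓-sel a b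
       ... | inj₁ e = subst (λ z → L ≤ z ℕ.+ ∣ r L p ∣) (≡.sym e) la
       ... | inj₂ e = subst (λ z → L ≤ z ℕ.+ ∣ r L p ∣) (≡.sym e) lb
       lo : L ≤ p ℕ.+ ∣ r L p ∣
       lo = ℤₚ.drop‿+≤+ (ℤₚ.≤-trans (ℤₚ.≤-reflexive (lem (+ p) (+ L))) (ℤₚ.+-monoʳ-≤ (+ p) (ℤₚ.≤-trans (≤∣∣ (ℤ.- r L p)) (ℤₚ.≤-reflexive (cong +_ (ℤₚ.∣-i∣≡∣i∣ (r L p)))))))
        where
        lem : ∀ p L → L ≡ p ℤ.+ ℤ.- (p ℤ.- L)
        lem = ℤ-ring
       up : L ≤ L ℕ.+ L ∸ p ℕ.+ ∣ r L p ∣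
       up = ℤₚ.drop‿+≤+ (ℤₚ.≤-trans (ℤₚ.≤-reflexive (≡.trans (lem (+ p) (+ L)) (cong (ℤ._+ (r L p)) (≡.trans (ℤₚ.[+m]-[+n]≡m⊖n (L ℕ.+ L) p) (ℤₚ.⊖-≥ p≤))))) (ℤₚ.+-monoʳ-≤ (+ (L ℕ.+ L ∸ p)) (≤∣∣ (r L p))))
        where
        lem : ∀ p L → L ≡ L ℤ.+ L ℤ.- p ℤ.+ (p ℤ.- L)
        lem = ℤ-ring

     entry-Bounded : ∀ c y → y ∈ ys → Bounded (entry c y)
     entry-Bounded c y y∈ = let C , b = exponent-bound c y in C , λ L → sumN-Val (L ℕ.+ L) _ λ p _ →
      Val-≈ (xy*z≈xz*y _ _ _)
       (Val-≤ (ℤₚ.≤-trans (≤r C L p) (ℤₚ.≤-reflexive (≡.sym (ℤₚ.+-identityʳ _)))) (Val-term c y L p (proj₁ (b L p)) (proj₂ (b L p)) (One⇒Val (Q-ratio L p y∈))))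
      where
      ≤r : ∀ C L p → ℤ.- + C ℤ.≤ + ∣ r L p ∣ ℤ.- + C
      ≤r C L p = ℤₚ.≤-trans (ℤₚ.≤-reflexive (≡.sym (ℤₚ.+-identityˡ _))) (ℤₚ.+-monoˡ-≤ (ℤ.- + C) (ℤ.+≤+ {0} {∣ r L p ∣} z≤n))

     -- A cut at distance |r| from the middle has a weight quotient that is 1 only up to order
     -- `depth`, at least L - |r|. The quadratic exponent contributes at least |r| - C with C
     -- independent of L, so every term of the difference has order at least L - C.
     entry-~ : ∀ c y → y ∈ ys → entry c y ~ ideal c y
     entry-~ c y y∈ k = let C , b = exponent-bound c y in C ℕ.+ k , λ L L≥ → Val-≈
      (trans (sumN-+ (L ℕ.+ L) _ _) (+-congˡ (trans (sumN-cong (L ℕ.+ L) λ p _ → solve Λ 1 0 (λ a → :- a := :- :1 :* a) _)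
       (trans (sumN-* (L ℕ.+ L) _ _) (solve Λ 1 0 (λ a → :- :1 :* a := :- a) _)))))
      (sumN-Val (L ℕ.+ L) _ λ p p≤ → Val-≈
       (solve Λ 3 0 (λ e s q → (e :* s) :* (q :- :1) := (e :* q) :* s :+ :- (e :* s)) (E (exponent H L ν y p)) (ψ c (Y qRing H L y p)) (CQw L y L * CQw⁻¹ L y p))
       (Val-≤ (total C L p L≥ p≤) (Val-term c y L p (proj₁ (b L p)) (proj₂ (b L p)) (Q-ratio L p y∈))))
      where
      total : ∀ C L p → C ℕ.+ k ≤ L → p ≤ L ℕ.+ L → + k ℤ.≤ (+ ∣ r L p ∣ ℤ.- + C) ℤ.+ + depth L p
      total C L p L≥ p≤ = ℤₚ.≤-trans (ℤₚ.≤-reflexive (lem (+ C) (+ k))) (ℤₚ.≤-trans (ℤₚ.+-monoˡ-≤ (ℤ.- + C) (ℤ.+≤+ (≤-trans L≥ (depth-bound L p p≤))))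
       (ℤₚ.≤-reflexive (lem′ (+ depth L p) (+ ∣ r L p ∣) (+ C))))
       where
       lem : ∀ C k → k ≡ C ℤ.+ k ℤ.+ ℤ.- C
       lem = ℤ-ring
       lem′ : ∀ d r C → d ℤ.+ r ℤ.+ ℤ.- C ≡ (r ℤ.- C) ℤ.+ d
       lem′ = ℤ-ring

  -- Exchanging (ν, c) with (ν′, y) reverses the summation in half of the terms.
  ideal-transpose : ∀ ν ν′ (ν≥1 : 1 ≤ ν) (ν′≥1 : 1 ≤ ν′) (h : 1 ≤ 2 ℕ.* ν′) (h′ : 1 ≤ 2 ℕ.* ν) c y L →
   ideal (2 ℕ.* ν′) ν h ν≥1 c (+ y) L ≈ ideal (2 ℕ.* ν) ν′ h′ ν′≥1 y (+ c) L
  ideal-transpose ν ν′ ν≥1 ν′≥1 h h′ c y L = trans (expand (2 ℕ.* ν′) ν c (+ y)) (trans (+-cong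
    (trans (sumN-reverse (L ℕ.+ L) _) (sumN-cong (L ℕ.+ L) λ p p≤ → reflexive (cong E (eq⁻ p p≤))))
    (-‿cong (sumN-cong (L ℕ.+ L) λ p _ → reflexive (cong E (eq⁺ p))))) (sym (expand (2 ℕ.* ν) ν′ y (+ c))))
   where
   ex⁻ ex⁺ : ℕ → ℕ → ℕ → ℤ → ℕ → ℤ
   ex⁻ η ν c y p = exponent (+ η) L ν y p ℤ.+ ℤ.- times c (Y qRing (+ η) L y p)
   ex⁺ η ν c y p = exponent (+ η) L ν y p ℤ.+ times c (Y qRing (+ η) L y p)

   expand : ∀ η ν c y → sumN (L ℕ.+ L) (λ p → E (exponent (+ η) L ν y p) * ψ c (Y qRing (+ η) L y p)) ≈ sumN (L ℕ.+ L) (λ p → E (ex⁻ η ν c y p)) - sumN (L ℕ.+ L) (λ p → E (ex⁺ η ν c y p))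
   expand η ν c y = trans (sumN-cong (L ℕ.+ L) λ p _ → solve Λ 0 2 (λ e a → :E e :* (:E (⊟ a) :- :E a) := :E (e ⊞ ⊟ a) :+ :- :1 :* :E (e ⊞ a)) _ _)
    (trans (sumN-+ (L ℕ.+ L) _ _) (+-congˡ (trans (sumN-* (L ℕ.+ L) _ _) (solve Λ 1 0 (λ a → :- :1 :* a := :- a) _))))

   Y≡ : ∀ η y p → Y qRing (+ η) L y p ≡ y ℤ.- + L ℤ.* (+ η ℤ.+ + η) ℤ.+ + p ℤ.* (+ η ℤ.+ + η)
   Y≡ η y p = cong₂ (λ a b → y ℤ.- a ℤ.+ b) (times≡* L _) (times≡* p _)

   2*≡ : ∀ n → + (2 ℕ.* n) ≡ + 2 ℤ.* + n
   2*≡ n = ℤₚ.pos-* 2 n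

   normal : ∀ (σ : ℤ) η ν c y p → ℤ
   normal σ η ν c y p = + ν ℤ.* (+ 2 ℤ.* ((+ 2 ℤ.* + η ℤ.+ + 2 ℤ.* + η) ℤ.* ((p ℤ.- + L) ℤ.* (p ℤ.- + L)) ℤ.+ + 2 ℤ.* (y ℤ.* (p ℤ.- + L))))
    ℤ.+ σ ℤ.* (+ c ℤ.* (y ℤ.- + L ℤ.* (+ 2 ℤ.* + η ℤ.+ + 2 ℤ.* + η) ℤ.+ p ℤ.* (+ 2 ℤ.* + η ℤ.+ + 2 ℤ.* + η)))

   norm⁻ : ∀ η ν c y p → ex⁻ (2 ℕ.* η) ν c y p ≡ normal (ℤ.- + 1) η ν c y (+ p)
   norm⁻ η ν c y p = ≡.trans (cong (λ z → exponent (+ (2 ℕ.* η)) L ν y p ℤ.+ ℤ.- z) (≡.trans (times≡* c _) (cong (+ c ℤ.*_) (Y≡ (2 ℕ.* η) y p))))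
    (≡.trans (cong (λ z → + ν ℤ.* (+ 2 ℤ.* ((z ℤ.+ z) ℤ.* ((+ p ℤ.- + L) ℤ.* (+ p ℤ.- + L)) ℤ.+ + 2 ℤ.* (y ℤ.* (+ p ℤ.- + L)))) ℤ.+ ℤ.- (+ c ℤ.* (y ℤ.- + L ℤ.* (z ℤ.+ z) ℤ.+ + p ℤ.* (z ℤ.+ z)))) (2*≡ η))
     (cong (ℤ._+_ (+ ν ℤ.* _)) (lem _)))
    where
    lem : ∀ z → ℤ.- z ≡ (ℤ.- + 1) ℤ.* z
    lem = ℤ-ring

   norm⁺ : ∀ η ν c y p → ex⁺ (2 ℕ.* η) ν c y p ≡ normal (+ 1) η ν c y (+ p)
   norm⁺ η ν c y p = ≡.trans (cong (λ z → exponent (+ (2 ℕ.* η)) L ν y p ℤ.+ z) (≡.trans (times≡* c _) (cong (+ c ℤ.*_) (Y≡ (2 ℕ.* η) y p))))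
    (≡.trans (cong (λ z → + ν ℤ.* (+ 2 ℤ.* ((z ℤ.+ z) ℤ.* ((+ p ℤ.- + L) ℤ.* (+ p ℤ.- + L)) ℤ.+ + 2 ℤ.* (y ℤ.* (+ p ℤ.- + L)))) ℤ.+ + c ℤ.* (y ℤ.- + L ℤ.* (z ℤ.+ z) ℤ.+ + p ℤ.* (z ℤ.+ z))) (2*≡ η))
     (cong (ℤ._+_ (+ ν ℤ.* _)) (≡.sym (ℤₚ.*-identityˡ _))))

   -- Both sides are 8νν′r² + 4(νy + ν′c)r + cy with r = p - L.
   eq⁺ : ∀ p → ex⁺ (2 ℕ.* ν′) ν c (+ y) p ≡ ex⁺ (2 ℕ.* ν) ν′ y (+ c) p
   eq⁺ p = ≡.trans (norm⁺ ν′ ν c (+ y) p) (≡.trans (lem (+ ν) (+ ν′) (+ c) (+ y) (+ p) (+ L)) (≡.sym (norm⁺ ν ν′ y (+ c) p)))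
    where
    lem : ∀ ν η c y p L →
     ν ℤ.* (+ 2 ℤ.* ((+ 2 ℤ.* η ℤ.+ + 2 ℤ.* η) ℤ.* ((p ℤ.- L) ℤ.* (p ℤ.- L)) ℤ.+ + 2 ℤ.* (y ℤ.* (p ℤ.- L)))) ℤ.+ + 1 ℤ.* (c ℤ.* (y ℤ.- L ℤ.* (+ 2 ℤ.* η ℤ.+ + 2 ℤ.* η) ℤ.+ p ℤ.* (+ 2 ℤ.* η ℤ.+ + 2 ℤ.* η)))
     ≡ η ℤ.* (+ 2 ℤ.* ((+ 2 ℤ.* ν ℤ.+ + 2 ℤ.* ν) ℤ.* ((p ℤ.- L) ℤ.* (p ℤ.- L)) ℤ.+ + 2 ℤ.* (c ℤ.* (p ℤ.- L)))) ℤ.+ + 1 ℤ.* (y ℤ.* (c ℤ.- L ℤ.* (+ 2 ℤ.* ν ℤ.+ + 2 ℤ.* ν) ℤ.+ p ℤ.* (+ 2 ℤ.* ν ℤ.+ + 2 ℤ.* ν)))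
    lem = ℤ-ring

   eq⁻ : ∀ p → p ≤ L ℕ.+ L → ex⁻ (2 ℕ.* ν′) ν c (+ y) (L ℕ.+ L ∸ p) ≡ ex⁻ (2 ℕ.* ν) ν′ y (+ c) p
   eq⁻ p p≤ = ≡.trans (norm⁻ ν′ ν c (+ y) (L ℕ.+ L ∸ p)) (≡.trans (cong (normal (ℤ.- + 1) ν′ ν c (+ y)) (≡.sym (≡.trans (ℤₚ.[+m]-[+n]≡m⊖n (L ℕ.+ L) p) (ℤₚ.⊖-≥ p≤))))
    (≡.trans (lem (+ ν) (+ ν′) (+ c) (+ y) (+ p) (+ L)) (≡.sym (norm⁻ ν ν′ y (+ c) p))))
    where
    lem : ∀ ν η c y p L →
     ν ℤ.* (+ 2 ℤ.* ((+ 2 ℤ.* η ℤ.+ + 2 ℤ.* η) ℤ.* ((L ℤ.+ L ℤ.- p ℤ.- L) ℤ.* (L ℤ.+ L ℤ.- p ℤ.- L)) ℤ.+ + 2 ℤ.* (y ℤ.* (L ℤ.+ L ℤ.- p ℤ.- L)))) ℤ.+ (ℤ.- + 1) ℤ.* (c ℤ.* (y ℤ.- L ℤ.* (+ 2 ℤ.* η ℤ.+ + 2 ℤ.* η) ℤ.+ (L ℤ.+ L ℤ.- p) ℤ.* (+ 2 ℤ.* η ℤ.+ + 2 ℤ.* η)))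
     ≡ η ℤ.* (+ 2 ℤ.* ((+ 2 ℤ.* ν ℤ.+ + 2 ℤ.* ν) ℤ.* ((p ℤ.- L) ℤ.* (p ℤ.- L)) ℤ.+ + 2 ℤ.* (c ℤ.* (p ℤ.- L)))) ℤ.+ (ℤ.- + 1) ℤ.* (y ℤ.* (c ℤ.- L ℤ.* (+ 2 ℤ.* ν ℤ.+ + 2 ℤ.* ν) ℤ.+ p ℤ.* (+ 2 ℤ.* ν ℤ.+ + 2 ℤ.* ν)))
    lem = ℤ-ring

-- Residue classes of the chain elements

module Residues where

 open Base
 open Solver
 open Signs
 open Littlewood using (times)
 open Chains using (times-+; module Move; Ys; ys-of; Y; chains; ascend; base; Config)
 open Collapse

 module _ {t : ℕ} where
  residue : ∀ {d} k → 0 < d → d < t → + d ℤ.+ k ℤ.* + t ≢ 0ℤ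
  residue {d} k 0<d d<t e with ∣ k ∣ | ≡.trans (cong ∣_∣ (≡.trans (lem (+ d) (k ℤ.* + t)) (≡.trans (cong (ℤ._- (k ℤ.* + t)) e) (ℤₚ.+-identityˡ (ℤ.- (k ℤ.* + t))))))
     (≡.trans (ℤₚ.∣-i∣≡∣i∣ (k ℤ.* + t)) (ℤₚ.∣i*j∣≡∣i∣*∣j∣ k (+ t)))
   where
   lem : ∀ d x → d ≡ d ℤ.+ x ℤ.- x
   lem = ℤ-ring
  ... | zero  | ≡.refl = n≮0 0<d
  ... | suc i | ≡.refl = ℕₚ.m+n≮m t _ d<t

  residue⁻ : ∀ {d} k → 0 < d → d < t → ℤ.- + d ℤ.+ k ℤ.* + t ≢ 0ℤ
  residue⁻ {d} k 0<d d<t e = residue (ℤ.- k) 0<d d<t (≡.trans (lem (+ d) k (+ t)) (cong (λ z → ℤ.- z) e))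
   where
   lem : ∀ d k t → d ℤ.+ (ℤ.- k) ℤ.* t ≡ ℤ.- (ℤ.- d ℤ.+ k ℤ.* t)
   lem = ℤ-ring

  residue-diff : ∀ {a b} k → a ≢ b → a < t → b < t → + a ℤ.- + b ℤ.+ k ℤ.* + t ≢ 0ℤ
  residue-diff {a} {b} k a≢b a<t b<t e with ≤-total a b
  ... | inj₁ a≤b = residue⁻ {b ℕ.∸ a} k (m<n⇒0<n∸m (≤∧≢⇒< a≤b a≢b)) (≤-<-trans (m∸n≤m b a) b<t)
     (≡.trans (cong (ℤ._+ k ℤ.* + t) (≡.trans (cong (λ z → ℤ.- z) (≡.sym (≡.trans (ℤₚ.[+m]-[+n]≡m⊖n b a) (ℤₚ.⊖-≥ a≤b)))) (lem (+ a) (+ b)))) e)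
   where
   lem : ∀ a b → ℤ.- (b ℤ.- a) ≡ a ℤ.- b
   lem = ℤ-ring
  ... | inj₂ b≤a = residue {a ℕ.∸ b} k (m<n⇒0<n∸m (≤∧≢⇒< b≤a (λ e → a≢b (≡.sym e)))) (≤-<-trans (m∸n≤m a b) a<t)
     (≡.trans (cong (ℤ._+ k ℤ.* + t) (≡.sym (≡.trans (ℤₚ.[+m]-[+n]≡m⊖n a b) (ℤₚ.⊖-≥ b≤a)))) e)

 -- starting points of chains with steps 2η, lying in pairwise distinct classes modulo sign and 2η
 record Spread (η : ℕ) (as : List ℕ) : Set where
  field
   positive : ∀ {a} → a ∈ as → 0 < a
   small    : ∀ {a b} → a ∈ as → b ∈ as → a ℕ.+ b < η ℕ.+ η
   distinct : AllPairs _≢_ as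

 module _ (Q : QRing) (η : ℕ) (L : ℕ) {as : List ℕ} (sp : Spread η as) where
  open QRing Q
  open Spread sp

  private
   H T : ℤ
   H = + η
   T = H ℤ.+ H
   t = η ℕ.+ η

   ys : List ℤ
   ys = map +_ as

   below : ∀ {a} → a ∈ as → a < t
   below {a} a∈ = ≤-<-trans (m≤m+n a a) (small a∈ a∈)

   0<t : ∀ {a} → a ∈ as → 0 < t
   0<t a∈ = ≤-<-trans z≤n (below a∈)

   Element : ℕ → ℤ → Set
   Element a z = ∃ λ k → z ≡ + a ℤ.+ H ℤ.+ k ℤ.* T

   ascend-Element : ∀ {a} x l → Element a x → All (Element a) (ascend Q H L x l)
   ascend-Element x zero e = []
   ascend-Element {a} x (suc l) (k , e) = (k , e) ∷ ascend-Element (x ℤ.+ T) l (k ℤ.+ + 1 , ≡.trans (cong (ℤ._+ T) e) (lem (+ a) H k T))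
    where
    lem : ∀ a H k T → a ℤ.+ H ℤ.+ k ℤ.* T ℤ.+ T ≡ a ℤ.+ H ℤ.+ (k ℤ.+ + 1) ℤ.* T
    lem = ℤ-ring

   base-Element : ∀ a → Element a (base Q H L (+ a))
   base-Element a = ℤ.- + L , ≡.trans (cong (λ z → + a ℤ.- z ℤ.+ H) (times≡* L T)) (lem (+ a) H (+ L) T)
    where
    lem : ∀ a H L T → a ℤ.- L ℤ.* T ℤ.+ H ≡ a ℤ.+ H ℤ.+ (ℤ.- L) ℤ.* T
    lem = ℤ-ring

   -- The two shifts by H add up to T, so only a + b remains modulo T.
   sum-form : ∀ {a b x z} → Element a x → Element b z → ∃ λ k → x ℤ.+ z ≡ + (a ℕ.+ b) ℤ.+ k ℤ.* T
   sum-form {a} {b} (k , ≡.refl) (l , ≡.refl) = k ℤ.+ l ℤ.+ + 1 , lem (+ a) (+ b) H k l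
    where
    lem : ∀ a b H k l → a ℤ.+ H ℤ.+ k ℤ.* (H ℤ.+ H) ℤ.+ (b ℤ.+ H ℤ.+ l ℤ.* (H ℤ.+ H)) ≡ a ℤ.+ b ℤ.+ (k ℤ.+ l ℤ.+ + 1) ℤ.* (H ℤ.+ H)
    lem = ℤ-ring

   sum≢0 : ∀ {a b x z} → a ∈ as → b ∈ as → Element a x → Element b z → x ℤ.+ z ≢ 0ℤ
   sum≢0 {a} {b} a∈ b∈ ex ez e = let k , f = sum-form ex ez in
    residue k (≤-trans (positive a∈) (m≤m+n a b)) (small a∈ b∈) (≡.trans (≡.sym f) e)

   diff≢0 : ∀ {a b x z} → a ∈ as → b ∈ as → a ≢ b → Element a x → Element b z → ℤ.- x ℤ.+ z ≢ 0ℤ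
   diff≢0 {a} {b} a∈ b∈ a≢b (k , ≡.refl) (l , ≡.refl) e =
    residue-diff (l ℤ.- k) (λ e → a≢b (≡.sym e)) (below b∈) (below a∈) (≡.trans (lem (+ a) (+ b) H k l T) e)
    where
    lem : ∀ a b H k l T → b ℤ.- a ℤ.+ (l ℤ.- k) ℤ.* T ≡ ℤ.- (a ℤ.+ H ℤ.+ k ℤ.* T) ℤ.+ (b ℤ.+ H ℤ.+ l ℤ.* T)
    lem = ℤ-ring

   Later : ℤ → ℤ → Set
   Later x z = ∃ λ i → z ≡ x ℤ.+ times (suc i) T

   ascend-Later : ∀ x z l → Later x z → All (Later x) (ascend Q H L z l)
   ascend-Later x z zero h = []
   ascend-Later x z (suc l) (i , e) = (i , e) ∷ ascend-Later x (z ℤ.+ T) l (suc i , ≡.trans (cong (ℤ._+ T) e) (lem x T (times (suc i) T)))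
    where
    lem : ∀ x T z → x ℤ.+ z ℤ.+ T ≡ x ℤ.+ (T ℤ.+ z)
    lem = ℤ-ring

   Later≢0 : ∀ {x z} → 0 < t → Later x z → ℤ.- x ℤ.+ z ≢ 0ℤ
   Later≢0 {x} 0<t (i , ≡.refl) e with ℤₚ.+-injective (≡.trans (≡.trans (ℤₚ.pos-* (suc i) t) (≡.sym (times≡* (suc i) T))) (≡.trans (lem x (times (suc i) T)) e))
    where
    lem : ∀ x z → z ≡ ℤ.- x ℤ.+ (x ℤ.+ z)
    lem = ℤ-ring
   ... | e′ = n≮0 (subst (0 <_) e′ (≤-trans 0<t (m≤m+n t _)))

   good-ascend : ∀ {a} → a ∈ as → ∀ x l → Element a x → Good (ascend Q H L x l)
   good-ascend a∈ x zero e = [] , []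
   good-ascend {a} a∈ x (suc l) e@(k , e₀) =
    let e′ : Element a (x ℤ.+ T) ; e′ = k ℤ.+ + 1 , ≡.trans (cong (ℤ._+ T) e₀) (lem (+ a) H k T) ; ds , aps = good-ascend a∈ (x ℤ.+ T) l e′ in
    sum≢0 a∈ a∈ e e ∷ ds ,
    All.map (λ { (ez , lt) → apart (sum≢0 a∈ a∈ e ez) (Later≢0 {x} (0<t a∈) lt) })
     (All.zip (ascend-Element (x ℤ.+ T) l e′ , ascend-Later x (x ℤ.+ T) l (0 , cong (ℤ._+_ x) (≡.sym (ℤₚ.+-identityʳ T))))) ∷ aps
    where
    lem : ∀ a H k T → a ℤ.+ H ℤ.+ k ℤ.* T ℤ.+ T ≡ a ℤ.+ H ℤ.+ (k ℤ.+ + 1) ℤ.* T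
    lem = ℤ-ring

   chains-Elements : ∀ bs → (∀ {b} → b ∈ bs → b ∈ as) → All (λ z → ∃ λ b → b ∈ bs × Element b z) (chains Q H L (map +_ bs))
   chains-Elements [] h = []
   chains-Elements (b ∷ bs) h = Allₚ.++⁺ (All.map (λ e → b , here ≡.refl , e) (ascend-Element (base Q H L (+ b)) (L ℕ.+ L) (base-Element b)))
    (All.map (λ { (b , m , e) → b , there m , e }) (chains-Elements bs λ m → h (there m)))

   good-chains : ∀ bs → (∀ {b} → b ∈ bs → b ∈ as) → AllPairs _≢_ bs → Good (chains Q H L (map +_ bs))
   good-chains [] h d = [] , []
   good-chains (b ∷ bs) h (b≢ ∷ d) =
    let b∈ = h (here ≡.refl) ; ds₁ , as₁ = good-ascend b∈ (base Q H L (+ b)) (L ℕ.+ L) (base-Element b) ; ds₂ , as₂ = good-chains bs (λ m → h (there m)) d in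
    Allₚ.++⁺ ds₁ ds₂ , AllPairsₚ.++⁺ as₁ as₂ (All.map (λ ex → All.map (λ { (b′ , m , ez) →
     apart (sum≢0 b∈ (h (there m)) ex ez) (diff≢0 b∈ (h (there m)) (All.lookup b≢ m) ex ez) }) (chains-Elements bs λ m → h (there m)))
     (ascend-Element (base Q H L (+ b)) (L ℕ.+ L) (base-Element b)))

  chains-good : Good (chains Q H L ys)
  chains-good = good-chains as (λ m → m) distinct

  Shifted : ℤ → Set
  Shifted d = ∀ e → + suc e ℤ.≤ d ℤ.+ times (suc e) T

  private
   shifted : ∀ {d s} → + d ≡ s ℤ.+ T → 0 < d → 0 < t → Shifted s
   shifted {d} {s} e 0<d 0<t k = ℤₚ.≤-trans (ℤ.+≤+ (+-mono-≤ 0<d (≤-trans (≤-reflexive (≡.sym (ℕₚ.*-identityʳ k))) (*-monoʳ-≤ k 0<t))))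
    (ℤₚ.≤-reflexive (≡.trans (cong₂ ℤ._+_ e (≡.trans (ℤₚ.pos-* k t) (≡.sym (times≡* k T)))) (ℤₚ.+-assoc s T _)))

   minus : ∀ {k l} → k ≤ l → + (l ℕ.∸ k) ≡ + l ℤ.- + k
   minus {k} {l} h = ≡.sym (≡.trans (ℤₚ.[+m]-[+n]≡m⊖n l k) (ℤₚ.⊖-≥ h))

   shift-b-a : ∀ {a b} → a ∈ as → Shifted (+ b ℤ.- + a)
   shift-b-a {a} {b} a∈ = shifted {b ℕ.+ t ℕ.∸ a} {+ b ℤ.- + a} (≡.trans (minus (≤-trans (<⇒≤ (below a∈)) (m≤n+m t b))) (lem (+ b) (+ a) T))
     (m<n⇒0<n∸m (<-≤-trans (below a∈) (m≤n+m t b))) (0<t a∈)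
    where
    lem : ∀ b a T → b ℤ.+ T ℤ.- a ≡ b ℤ.- a ℤ.+ T
    lem = ℤ-ring

  shifts : ∀ {y b} → y ∈ ys → b ∈ ys → (Shifted (b ℤ.- y) × Shifted (ℤ.- b ℤ.- y)) × (Shifted (b ℤ.+ y) × Shifted (ℤ.- b ℤ.+ y))
  shifts {y} {b} y∈ b∈ with ∈-map⁻ +_ y∈ | ∈-map⁻ +_ b∈
  ... | a , a∈ , ≡.refl | b , b∈ , ≡.refl =
   (shift-b-a {a} {b} a∈ , shifted {t ℕ.∸ (b ℕ.+ a)} {ℤ.- + b ℤ.- + a} (≡.trans (minus (<⇒≤ (small b∈ a∈))) (lem₁ (+ b) (+ a) T)) (m<n⇒0<n∸m (small b∈ a∈)) (0<t a∈)) ,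
   (shifted {b ℕ.+ a ℕ.+ t} {+ b ℤ.+ + a} ≡.refl (≤-trans (0<t a∈) (m≤n+m t (b ℕ.+ a))) (0<t a∈) , subst Shifted (lem₂ (+ b) (+ a)) (shift-b-a {b} {a} b∈))
   where
   lem₁ : ∀ b a T → T ℤ.- (b ℤ.+ a) ≡ ℤ.- b ℤ.- a ℤ.+ T
   lem₁ = ℤ-ring
   lem₂ : ∀ b a → a ℤ.- b ≡ ℤ.- b ℤ.+ a
   lem₂ = ℤ-ring

  ψ₀ : ℕ → ℤ → Carrier
  ψ₀ c a = E (ℤ.- times c a) - E (times c a)

  module _ (g : ℤ → Carrier) (c ν : ℕ) where
   open Move Q H L g (ψ₀ c) ν using (Δ; V; Compatible)

   private
    s⁻¹ : ℤ → Carrier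
    s⁻¹ a = E a * j a

    s-inverse : ∀ {a} → a ≢ 0ℤ → (E (ℤ.- a) - E a) * s⁻¹ a ≈ 1#
    s-inverse {a} d = trans (solve Λ 1 1 (λ j a → (:E (⊟ a) :- :E a) :* (:E a :* j) := :u a :* j) (j a) a) (u*j d)

    V⁻¹ : ℤ → List ℤ → Carrier
    V⁻¹ a = Weights.prodOver Q T (λ b → s⁻¹ (a ℤ.+ b) * s⁻¹ (a ℤ.- b))

   Δ⁻¹ : List ℤ → Carrier
   Δ⁻¹ []      = 1#
   Δ⁻¹ (a ∷ l) = s⁻¹ (times c a) * V⁻¹ a l * Δ⁻¹ l

   private
    V-inverse : ∀ a l → All (λ b → a ℤ.+ b ≢ 0ℤ × a ℤ.- b ≢ 0ℤ) l → V a l * V⁻¹ a l ≈ 1#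
    V-inverse a [] [] = *-identityˡ _
    V-inverse a (b ∷ l) ((p , q) ∷ h) = trans (*-interchange _ _ _ _) (trans (*-cong (trans (*-interchange _ _ _ _) (trans (*-cong (s-inverse p) (s-inverse q)) (*-identityˡ _))) (V-inverse a l h)) (*-identityˡ _))

    Residue : ℕ → ℤ → Set
    Residue a z = ∃ λ k → z ≡ + a ℤ.+ k ℤ.* T

    Y-Residue : ∀ a p → Residue a (Y Q H L (+ a) p)
    Y-Residue a p = + p ℤ.- + L , ≡.trans (cong₂ (λ x y → + a ℤ.- x ℤ.+ y) (times≡* L T) (times≡* p T)) (lem (+ a) (+ L) (+ p) T)
     where
     lem : ∀ a L p T → a ℤ.- L ℤ.* T ℤ.+ p ℤ.* T ≡ a ℤ.+ (p ℤ.- L) ℤ.* T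
     lem = ℤ-ring

    apart-residues : ∀ {a b x z} → a ∈ as → b ∈ as → a ≢ b → Residue a x → Residue b z → x ℤ.+ z ≢ 0ℤ × x ℤ.- z ≢ 0ℤ
    apart-residues {a} {b} a∈ b∈ a≢b (k , ≡.refl) (l , ≡.refl) =
     (λ e → residue (k ℤ.+ l) (≤-trans (positive a∈) (m≤m+n a b)) (small a∈ b∈) (≡.trans (lem₁ (+ a) (+ b) k l T) e)) ,
     (λ e → residue-diff (k ℤ.- l) a≢b (below a∈) (below b∈) (≡.trans (lem₂ (+ a) (+ b) k l T) e))
     where
     lem₁ : ∀ a b k l T → a ℤ.+ b ℤ.+ (k ℤ.+ l) ℤ.* T ≡ a ℤ.+ k ℤ.* T ℤ.+ (b ℤ.+ l ℤ.* T)
     lem₁ = ℤ-ring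
     lem₂ : ∀ a b k l T → a ℤ.- b ℤ.+ (k ℤ.- l) ℤ.* T ≡ a ℤ.+ k ℤ.* T ℤ.- (b ℤ.+ l ℤ.* T)
     lem₂ = ℤ-ring

    times≢0 : ∀ {a z} → 1 ≤ c → a ∈ as → Residue a z → times c z ≢ 0ℤ
    times≢0 {a} {z} c≥1 a∈ (k , r) e with ℤₚ.i*j≡0⇒i≡0∨j≡0 (+ c) (≡.trans (≡.sym (times≡* c z)) e)
    ... | inj₁ c≡0 = n≮0 (subst (1 ≤_) (ℤₚ.+-injective c≡0) c≥1)
    ... | inj₂ z≡0 = residue k (positive a∈) (below a∈) (≡.trans (≡.sym r) z≡0)

    Δ-inv : 1 ≤ c → ∀ bs cfg → (∀ {b} → b ∈ bs → b ∈ as) → AllPairs _≢_ bs → ys-of Q H L cfg ≡ map +_ bs → Δ (Ys Q H L cfg) * Δ⁻¹ (Ys Q H L cfg) ≈ 1#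
    Δ-inv c≥1 [] [] h d e = *-identityˡ _
    Δ-inv c≥1 (b ∷ bs) ((_ , p) ∷ cfg) h (b≢ ∷ d) e with Listₚ.∷-injective e
    ... | ≡.refl , e′ = trans (solve Λ 6 0 (λ a b c d e f → (a :* b :* c) :* (d :* e :* f) := (a :* d) :* (b :* e) :* (c :* f)) _ _ _ _ _ _)
     (trans (*-cong (*-cong (s-inverse (times≢0 c≥1 (h (here ≡.refl)) (Y-Residue b p)))
       (V-inverse (Y Q H L (+ b) p) _ (later bs cfg e′ (λ m → h (there m)) b≢)))
      (Δ-inv c≥1 bs cfg (λ m → h (there m)) d e′)) (solve Λ 0 0 (:1 :* :1 :* :1 := :1)))
     where
     later : ∀ bs cfg → ys-of Q H L cfg ≡ map +_ bs → (∀ {b} → b ∈ bs → b ∈ as) → All (b ≢_) bs →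
      All (λ z → Y Q H L (+ b) p ℤ.+ z ≢ 0ℤ × Y Q H L (+ b) p ℤ.- z ≢ 0ℤ) (Ys Q H L cfg)
     later [] [] e h [] = []
     later (b′ ∷ bs) ((_ , q) ∷ cfg) e h′ (b≢ ∷ bs≢) with Listₚ.∷-injective e
     ... | ≡.refl , e′ = apart-residues (h (here ≡.refl)) (h′ (here ≡.refl)) b≢ (Y-Residue b p) (Y-Residue b′ q) ∷ later bs cfg e′ (λ m → h′ (there m)) bs≢

   admissible : 1 ≤ c → Compatible (length ys) → Admissible Q H L g (ψ₀ c) ν ys
   admissible c≥1 comp = record
    { compatible = comp
    ; good = chains-good
    ; shifts = λ {y} {b} y∈ b∈ → let (s₁ , s₂) , (s₃ , s₄) = shifts y∈ b∈ in
      (nz {b ℤ.- y} s₁ , nz {ℤ.- b ℤ.- y} s₂) , (nz {b ℤ.+ y} s₃ , nz {ℤ.- b ℤ.+ y} s₄)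
    ; Δ⁻¹ = Δ⁻¹
    ; Δ-inverse = λ cfg e → Δ-inv c≥1 as cfg (λ m → m) distinct e
    }
    where
    nz : ∀ {d} → Shifted d → ∀ e → d ℤ.+ times (suc e) T ≢ 0ℤ
    nz s e eq with subst (+ suc e ℤ.≤_) eq (s e)
    ... | ℤ.+≤+ ()

-- The two systems of chains and their common determinant

module Systems where

 open Base
 open Solver
 open Signs
 open JSum using (γ; J; signSum-c)
 open Littlewood using (times)
 open Chains using (times-+; 4×; module Move; module SumN; Ys; Xs; ys-of; Y; chains; Config; cutSum-cong)
 open Collapse
 open Det
 open Columns
 open Limit
 open Entries
 open Residues

 dbl : ℕ → ℕ
 dbl zero    = 0
 dbl (suc k) = suc (suc (dbl k))

 odd even : ℕ → ℕ
 odd  k = suc (dbl k)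
 even k = dbl (suc k)

 dbl≡ : ∀ k → dbl k ≡ k ℕ.+ k
 dbl≡ zero = ≡.refl
 dbl≡ (suc k) = cong suc (≡.trans (cong suc (dbl≡ k)) (≡.sym (+-suc k k)))

 2*≡ : ∀ k → 2 ℕ.* k ≡ dbl k
 2*≡ k = ≡.trans (cong (k ℕ.+_) (ℕₚ.+-identityʳ k)) (≡.sym (dbl≡ k))

 dbl-mono : ∀ {k l} → k ≤ l → dbl k ≤ dbl l
 dbl-mono z≤n = z≤n
 dbl-mono (s≤s h) = s≤s (s≤s (dbl-mono h))

 dbl-inj : ∀ {k l} → dbl k ≡ dbl l → k ≡ l
 dbl-inj {zero} {zero} e = ≡.refl
 dbl-inj {suc k} {suc l} e = cong suc (dbl-inj (suc-injective (suc-injective e)))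

 down-< : ∀ n {k} → k ∈ down n → k < n
 down-< (suc n) (here ≡.refl) = ≤-refl
 down-< (suc n) (there m) = m<n⇒m<1+n (down-< n m)

 down-distinct : ∀ n (f : ℕ → ℕ) → (∀ {k l} → f k ≡ f l → k ≡ l) → AllPairs _≢_ (map f (down n))
 down-distinct zero f inj = []
 down-distinct (suc n) f inj = Allₚ.map⁺ (All.tabulate λ m e → <-irrefl (≡.sym (inj e)) (down-< n m)) ∷ down-distinct n f inj

 length-down : ∀ n → length (down n) ≡ n
 length-down zero = ≡.refl
 length-down (suc n) = cong suc (length-down n)

 odds evens : ℕ → List ℕ
 odds  n = map odd (down n)
 evens n = map even (down n)

 odds-spread : ∀ n → Spread (2 ℕ.* n) (odds n)
 odds-spread n = record
  { positive = λ m → let k , _ , e = ∈-map⁻ odd m in subst (0 <_) (≡.sym e) (s≤s z≤n)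
  ; small = λ m m′ → +-mono-< (bound m) (bound m′)
  ; distinct = down-distinct n odd (λ e → dbl-inj (suc-injective e))
  }
  where
  bound : ∀ {a} → a ∈ odds n → a < 2 ℕ.* n
  bound m with ∈-map⁻ odd m
  ... | k , k∈ , ≡.refl = subst (odd k <_) (≡.sym (2*≡ n)) (dbl-mono (down-< n k∈))

 evens-spread : ∀ n h → n < h → Spread (2 ℕ.* h) (evens n)
 evens-spread n h n<h = record
  { positive = λ m → let k , _ , e = ∈-map⁻ even m in subst (0 <_) (≡.sym e) (s≤s z≤n)
  ; small = λ m m′ → +-mono-< (bound m) (bound m′)
  ; distinct = down-distinct n even (λ e → suc-injective (dbl-inj e))
  }
  where
  bound : ∀ {a} → a ∈ evens n → a < 2 ℕ.* h
  bound m with ∈-map⁻ even m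
  ... | k , k∈ , ≡.refl = subst (even k <_) (≡.sym (2*≡ h)) (≤-trans (s≤s (dbl-mono (down-< n k∈))) (≤-trans (n≤1+n _) (dbl-mono n<h)))

 module _ (R : LRing) where
  open LRing R
  open Seq R
  open SignSum Λ
  open SumN Λ

  det-map : ∀ {A B : Set} (o : A → B) fs as → det qRing fs (map o as) ≈ det qRing (map (_∘ o) fs) as
  det-map o [] [] = refl
  det-map o [] (_ ∷ _) = refl
  det-map {A} {B} o (f ∷ fs) as = trans (altSum-map (λ b l → f b * det qRing fs l) as) (altSum-cong qRing as λ a l → *-congˡ (det-map o fs l))
   where
   altSum-map : ∀ (G : B → List B → Carrier) as → altSum qRing G (map o as) ≈ altSum qRing (λ a l → G (o a) (map o l)) as
   altSum-map G [] = refl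
   altSum-map G (a ∷ as) = +-congˡ (-‿cong (altSum-map (λ b l → G b (o a ∷ l)) as))

  det-ext : ∀ {K A : Set} {M M′ : K → A → Carrier} → (∀ k a → M k a ≈ M′ k a) → ∀ ks as → det qRing (map M ks) as ≈ det qRing (map M′ ks) as
  det-ext h [] [] = refl
  det-ext h [] (_ ∷ _) = refl
  det-ext h (k ∷ ks) as = altSum-cong qRing as λ a l → *-cong (h k a) (det-ext h ks l)

  module System (η ν : ℕ) (η≥1 : 1 ≤ η) (ν≥1 : 1 ≤ ν) (n : ℕ) (as : List ℕ) (len : length as ≡ n) (sp : Spread η as)
   (g : ℤ → Carrier) (c : ℕ) (c≥1 : 1 ≤ c) (β : Carrier)
   (rec₀ : ∀ a → (E (a ℤ.+ a) + E (ℤ.- (a ℤ.+ a))) * ψ R c a ≈ ψ R (2 ℕ.+ c) a + β * ψ R c a) where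

   ys : List ℤ
   ys = map +_ as

   col : ℕ → ℕ
   col k = dbl k ℕ.+ c

   private
    rec : ∀ k a → (E (a ℤ.+ a) + E (ℤ.- (a ℤ.+ a))) * ψ R (col (suc k)) a ≈ ψ R (col (suc (suc k))) a + ψ R (col k) a
    rec k a = solve Λ 0 2 (λ a t → (:E (a ⊞ a) :+ :E (⊟ (a ⊞ a))) :* :s (a ⊞ (a ⊞ t)) := :s (a ⊞ (a ⊞ (a ⊞ (a ⊞ t)))) :+ :s t) a (times (col k) a)

    length-ys : length ys ≡ n
    length-ys = ≡.trans (Listₚ.length-map +_ as) len

   D : ℕ → Carrier
   D L = det qRing (map (λ k y → entry R η ν η≥1 ν≥1 ys g (ψ R c) (col k) y L) (down n)) ys

   D₀ : ℕ → Carrier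
   D₀ L = det qRing (map (λ k y → ideal R η ν η≥1 ν≥1 (col k) y L) (down n)) ys

   private
    shifts′ : ∀ {y b} → y ∈ ys → b ∈ ys → _
    shifts′ = shifts qRing η 0 sp
    all∈ : All (_∈ ys) ys
    all∈ = All.tabulate λ m → m

   D~D₀ : D ~ D₀
   D~D₀ = det-~ (_∈ ys) (λ L k y → entry R η ν η≥1 ν≥1 ys g (ψ R c) (col k) y L) (λ L k y → ideal R η ν η≥1 ν≥1 (col k) y L)
    (λ k y y∈ → entry-~ R η ν η≥1 ν≥1 ys g (ψ R c) shifts′ (col k) y y∈)
    (λ k y y∈ → entry-Bounded R η ν η≥1 ν≥1 ys g (ψ R c) shifts′ (col k) y y∈)
    (λ k y _ → ideal-Bounded R η ν η≥1 ν≥1 (col k) y) (down n) ys all∈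

   D-Bounded : Bounded D
   D-Bounded = det-Bounded (_∈ ys) (λ L k y → ideal R η ν η≥1 ν≥1 (col k) y L) (λ L k y → entry R η ν η≥1 ν≥1 ys g (ψ R c) (col k) y L)
    (λ k y y∈ → ~-sym (entry-~ R η ν η≥1 ν≥1 ys g (ψ R c) shifts′ (col k) y y∈))
    (λ k y _ → ideal-Bounded R η ν η≥1 ν≥1 (col k) y)
    (λ k y y∈ → entry-Bounded R η ν η≥1 ν≥1 ys g (ψ R c) shifts′ (col k) y y∈) (down n) ys all∈

   module _ (comp : ∀ L → Move.Compatible qRing (+ η) L g (ψ R c) ν n) where
    open Weights qRing (+ η ℤ.+ + η)
    open Density g using () renaming (c to density)

    X₀ : ℕ → List ℤ
    X₀ L = Xs qRing (+ η) L (map (_, L) ys)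

    Δ₀ : ℕ → Carrier
    Δ₀ L = Move.Δ qRing (+ η) L g (ψ R c) ν ys

    collapse : ∀ L → signSum density (chains qRing (+ η) L ys) * Δ₀ L ≈ density (X₀ L) * D L
    collapse L = trans (signSum-collapse qRing (+ η) L g (ψ R c) ν ys adm) (*-congˡ (trans
      (cutSum-cong qRing (+ η) L ys λ cfg _ _ → *-congʳ (ρs≈ cfg))
      (trans (cutSum-Δ qRing (+ η) L (λ k → ψ R (col k)) β rec₀ rec g ν (ρ qRing (+ η) L g (ψ R c) ν ys) ys)
       (reflexive (cong (λ k → det qRing (map (λ k y → entry R η ν η≥1 ν≥1 ys g (ψ R c) (col k) y L) (down k)) ys) length-ys)))))
     where
     adm : Admissible qRing (+ η) L g (ψ R c) ν ys
     adm = admissible qRing η L sp g c ν c≥1 (subst (Move.Compatible qRing (+ η) L g (ψ R c) ν) (≡.sym length-ys) (comp L))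
     ρs≈ : ∀ cfg → ρs qRing (+ η) L g (ψ R c) ν ys cfg ≈ weightProd qRing (+ η) L (ρ qRing (+ η) L g (ψ R c) ν ys) cfg
     ρs≈ [] = refl
     ρs≈ (_ ∷ cfg) = *-congˡ (ρs≈ cfg)

  module Pair (m n : ℕ) (n≥1 : 1 ≤ n) where
   h : ℕ
   h = m ℕ.+ suc n

   private
    h≥1 : 1 ≤ h
    h≥1 = ≤-trans (s≤s z≤n) (m≤n+m (suc n) m)
    2n≥1 : 1 ≤ 2 ℕ.* n
    2n≥1 = ≤-trans n≥1 (m≤m+n n _)
    2h≥1 : 1 ≤ 2 ℕ.* h
    2h≥1 = ≤-trans h≥1 (m≤m+n h _)

    length-map-down : ∀ (f : ℕ → ℕ) → length (map f (down n)) ≡ n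
    length-map-down f = ≡.trans (Listₚ.length-map f (down n)) (length-down n)

   g₁ : ℤ → Carrier
   g₁ z = E (ℤ.- times m (z ℤ.+ z))

   qʰ : Carrier
   qʰ = E (+ (2 ℕ.* h) ℤ.+ + (2 ℕ.* h))

   -- This is (1 + X)(1 + q^h X). As g₀ = 1 and g₂ = q^h, the sign summation gives a product of
   -- factors 1 - q^(h + kκ).
   g₂ : ℤ → Carrier
   g₂ = γ qRing (+ (2 ℕ.* h) ℤ.+ + (2 ℕ.* h)) 1# (1# + qʰ) qʰ

   private
    rec₁ : ∀ a → (E (a ℤ.+ a) + E (ℤ.- (a ℤ.+ a))) * ψ R 2 a ≈ ψ R 4 a + 0# * ψ R 2 a
    rec₁ = solve Λ 0 1 (λ a → (:E (a ⊞ a) :+ :E (⊟ (a ⊞ a))) :* :s (a ⊞ (a ⊞ icon 0ℤ)) := :s (a ⊞ (a ⊞ (a ⊞ (a ⊞ icon 0ℤ)))) :+ :0 :* :s (a ⊞ (a ⊞ icon 0ℤ)))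
    rec₂ : ∀ a → (E (a ℤ.+ a) + E (ℤ.- (a ℤ.+ a))) * ψ R 1 a ≈ ψ R 3 a + - 1# * ψ R 1 a
    rec₂ = solve Λ 0 1 (λ a → (:E (a ⊞ a) :+ :E (⊟ (a ⊞ a))) :* :s (a ⊞ icon 0ℤ) := :s (a ⊞ (a ⊞ (a ⊞ icon 0ℤ))) :+ :- :1 :* :s (a ⊞ icon 0ℤ))

   -- `S₁` has ratio E (8n) = q^(2n) and type C, `S₂` ratio E (8h) = q^κ and type B. The numbers β =
   -- 0 and β = -1 come from ψ 0 = 0 and ψ (-1) = -ψ 1 in the three-term recurrence. The columns of
   -- each system are the starting points of the other.
   module S₁ = System (2 ℕ.* n) h 2n≥1 h≥1 n (odds n) (length-map-down odd) (odds-spread n) g₁ 2 (s≤s z≤n) 0# rec₁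
   module S₂ = System (2 ℕ.* h) n 2h≥1 n≥1 n (evens n) (length-map-down even) (evens-spread n h (m≤n+m (suc n) m)) g₂ 1 (s≤s z≤n) (- 1#) rec₂

   -- Fixes ν = h = m + n + 1: the numerator X^(-m) contributes m and the move n + 1.
   compatible₁ : ∀ L → Move.Compatible qRing (+ (2 ℕ.* n)) L g₁ (ψ R 2) h n
   compatible₁ L Y = trans (*-congʳ (*-congʳ (*-congʳ (reflexive (cong (λ z → E (ℤ.- z)) neg-times)))))
    (trans (solve Λ 0 4 (λ Y H M S → :E (⊟ ⊟ M) :* :s (Y ⊞ (Y ⊞ icon 0ℤ)) :* :s (Y ⊞ (H ⊞ H) ⊞ (Y ⊞ (H ⊞ H))) :* :E S
      := :E (⊟ M) :* :s (Y ⊞ (H ⊞ H) ⊞ (Y ⊞ (H ⊞ H) ⊞ icon 0ℤ)) :* :s (Y ⊞ Y) :* :E (M ⊞ M ⊞ S)) Y H M (times (suc n) (4× x)))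
     (*-congˡ (reflexive (cong E (≡.sym (≡.trans (times-+ m (suc n) (4× x)) (cong (ℤ._+ times (suc n) (4× x)) double)))))))
    where
    H x M : ℤ
    H = + (2 ℕ.* n)
    x = Y ℤ.+ H
    M = times m (x ℤ.+ x)
    neg-times : times m (ℤ.- x ℤ.+ ℤ.- x) ≡ ℤ.- M
    neg-times = ≡.trans (times≡* m _) (≡.trans (lem (+ m) x) (cong (λ z → ℤ.- z) (≡.sym (times≡* m _))))
     where
     lem : ∀ m x → m ℤ.* (ℤ.- x ℤ.+ ℤ.- x) ≡ ℤ.- (m ℤ.* (x ℤ.+ x))
     lem = ℤ-ring
    double : times m (4× x) ≡ M ℤ.+ M
    double = ≡.trans (times≡* m _) (≡.trans (ℤₚ.*-distribˡ-+ (+ m) _ _) (≡.sym (cong₂ ℤ._+_ (times≡* m _) (times≡* m _))))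

   -- Since s (a + a) = s a (E a + E (-a)), the factor 1 + q^h X supplies the binomials at Y and Y +
   -- T. Together with the effect of 1 + X a monomial E (-4 (Y + H)) is left, which lowers n + 1 to
   -- ν = n.
   compatible₂ : ∀ L → Move.Compatible qRing (+ (2 ℕ.* h)) L g₂ (ψ R 1) n n
   compatible₂ L Y = solve Λ 0 3 (λ Y H S →
     (:1 :+ (:1 :+ :E (H ⊞ H)) :* :X (⊟ (Y ⊞ H)) :+ :E (H ⊞ H) :* (:X (⊟ (Y ⊞ H)) :* :X (⊟ (Y ⊞ H)))) :* :s (Y ⊞ icon 0ℤ) :* :s (Y ⊞ (H ⊞ H) ⊞ (Y ⊞ (H ⊞ H))) :* :E (Y ⊞ H ⊞ (Y ⊞ H) ⊞ (Y ⊞ H ⊞ (Y ⊞ H)) ⊞ S)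
     := (:1 :+ (:1 :+ :E (H ⊞ H)) :* :X (Y ⊞ H) :+ :E (H ⊞ H) :* (:X (Y ⊞ H) :* :X (Y ⊞ H))) :* :s (Y ⊞ (H ⊞ H) ⊞ icon 0ℤ) :* :s (Y ⊞ Y) :* :E S)
    Y (+ (2 ℕ.* h)) (times n (4× (Y ℤ.+ + (2 ℕ.* h))))

   -- Both determinants are asymptotic to those of their theta series, and these matrices are
   -- transposes: the entry in row 2l + 1, column 2k + 2 of the first is the one in row 2k + 2,
   -- column 2l + 1 of the second.
   D₁~D₂ : S₁.D ~ S₂.D
   D₁~D₂ = ~-trans S₁.D~D₀ (~-trans (≈⇒~ same) (~-sym S₂.D~D₀))
    where
    I₁ I₂ : ℕ → ℕ → ℤ → Carrier
    I₁ L c y = ideal R (2 ℕ.* n) h 2n≥1 h≥1 c y L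
    I₂ L c y = ideal R (2 ℕ.* h) n 2h≥1 n≥1 c y L
    col₁ : ∀ k → dbl k ℕ.+ 2 ≡ even k
    col₁ k = ℕₚ.+-comm (dbl k) 2
    col₂ : ∀ k → dbl k ℕ.+ 1 ≡ odd k
    col₂ k = ℕₚ.+-comm (dbl k) 1
    same : ∀ L → S₁.D₀ L ≈ S₂.D₀ L
    same L = begin
     det qRing (map (λ k y → I₁ L (S₁.col k) y) (down n)) (map +_ (map odd (down n)))
      ≈⟨ trans (det-map +_ (map (λ k y → I₁ L (S₁.col k) y) (down n)) (odds n)) (det-map odd (map (_∘ +_) (map (λ k y → I₁ L (S₁.col k) y) (down n))) (down n)) ⟩
     det qRing (map (_∘ odd) (map (_∘ +_) (map (λ k y → I₁ L (S₁.col k) y) (down n)))) (down n)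
      ≈⟨ reflexive (cong (λ fs → det qRing fs (down n)) (≡.trans (≡.sym (Listₚ.map-∘ (map (λ k y → I₁ L (S₁.col k) y) (down n)))) (≡.sym (Listₚ.map-∘ (down n))))) ⟩
     det qRing (map (λ k l → I₁ L (S₁.col k) (+ odd l)) (down n)) (down n)
      ≈⟨ det-transpose qRing (λ l k → I₁ L (S₁.col k) (+ odd l)) (down n) (down n) ⟩
     det qRing (map (λ l k → I₁ L (S₁.col k) (+ odd l)) (down n)) (down n)
      ≈⟨ det-ext (λ l k → trans (reflexive (cong (λ c → I₁ L c (+ odd l)) (col₁ k))) (trans (ideal-transpose R h n h≥1 n≥1 2n≥1 2h≥1 (even k) (odd l) L)
        (reflexive (cong (λ c → I₂ L c (+ even k)) (≡.sym (col₂ l)))))) (down n) (down n) ⟩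
     det qRing (map (λ l k → I₂ L (S₂.col l) (+ even k)) (down n)) (down n)
      ≈⟨ reflexive (cong (λ fs → det qRing fs (down n)) (≡.sym (≡.trans (≡.sym (Listₚ.map-∘ (map (λ k y → I₂ L (S₂.col k) y) (down n)))) (≡.sym (Listₚ.map-∘ (down n)))))) ⟩
     det qRing (map (_∘ even) (map (_∘ +_) (map (λ k y → I₂ L (S₂.col k) y) (down n)))) (down n)
      ≈⟨ sym (trans (det-map +_ (map (λ k y → I₂ L (S₂.col k) y) (down n)) (evens n)) (det-map even (map (_∘ +_) (map (λ k y → I₂ L (S₂.col k) y) (down n))) (down n))) ⟩
     det qRing (map (λ k y → I₂ L (S₂.col k) y) (down n)) (map +_ (map even (down n))) ∎
     where open ≈-Reasoning

-- The density at the middle configuration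

module Midpoint where

 open Base
 open Solver
 open Signs
 open Littlewood using (times)
 open Chains using (Xs; ascend; descend; at; at≡; cut≡; base; W-ascend; NonZeroSums)
 open Collapse using (P; times≡*)
 open Limit
 open Residues

 module _ (R : LRing) (η L : ℕ) where
  open LRing R
  open Seq R

  private
   H T : ℤ
   H = + η
   T = H ℤ.+ H

   asc : ℤ → ℕ → List ℤ
   asc = ascend qRing H L

   u-≡ : ∀ {a b} → a ≡ b → u a ≈ u b
   u-≡ ≡.refl = refl

  -- The chain of a with its first half inverted, reordered as two ascending runs. For a < η all
  -- elements are positive, so the factors at the far ends tend to 1.
  zs : ℕ → List ℤ
  zs a = asc (H ℤ.- + a) L ++ asc (H ℤ.+ + a) L

  Zs : List ℕ → List ℤ
  Zs []       = []
  Zs (a ∷ as) = zs a ++ Zs as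

  private
   descend↭ : ∀ x z p → ℤ.- x ℤ.+ T ≡ z ℤ.+ times p T → descend qRing H L x p ↭ asc z p
   descend↭ x z zero e = Perm.refl
   descend↭ x z (suc p) e = ↭-trans (prep (ℤ.- x) (descend↭ (x ℤ.+ T) z p (≡.trans (lem₁ x T) (≡.trans (cong (ℤ._- T) e) (lem₂ z T (times p T))))))
    (↭-trans (Permₚ.∷↭∷ʳ (ℤ.- x) (asc z p)) (↭-reflexive (≡.sym (≡.trans (snoc z p) (cong (λ y → asc z p ++ y ∷ []) (≡.trans (at≡ qRing H L z p) (≡.sym (≡.trans (lem₃ x T) (≡.trans (cong (ℤ._- T) e) (lem₂ z T (times p T)))))))))))
    where
    lem₁ : ∀ x T → ℤ.- (x ℤ.+ T) ℤ.+ T ≡ ℤ.- x ℤ.+ T ℤ.- T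
    lem₁ = ℤ-ring
    lem₂ : ∀ z T p → z ℤ.+ (T ℤ.+ p) ℤ.- T ≡ z ℤ.+ p
    lem₂ = ℤ-ring
    lem₃ : ∀ x T → ℤ.- x ≡ ℤ.- x ℤ.+ T ℤ.- T
    lem₃ = ℤ-ring
    snoc : ∀ z p → asc z (suc p) ≡ asc z p ++ at qRing H L z p ∷ []
    snoc z zero = ≡.refl
    snoc z (suc p) = cong (z ∷_) (snoc (z ℤ.+ T) p)

  mid↭ : ∀ as → Xs qRing H L (map (_, L) (map +_ as)) ↭ Zs as
  mid↭ [] = Perm.refl
  mid↭ (a ∷ as) = Permₚ.++⁺ (↭-trans (↭-reflexive (≡.trans (cong (λ l → Chains.cut qRing H L (base qRing H L (+ a)) L l) (m+n∸n≡m L L)) (cut≡ qRing H L (base qRing H L (+ a)) L L)))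
    (Permₚ.++⁺ (descend↭ (base qRing H L (+ a)) (H ℤ.- + a) L (lem₁ (+ a) H (times L T))) (↭-reflexive (cong (λ x → asc x L) (≡.trans (at≡ qRing H L _ L) (lem₂ (+ a) H (times L T)))))))
   (mid↭ as)
   where
   lem₁ : ∀ a H L → ℤ.- (a ℤ.- L ℤ.+ H) ℤ.+ (H ℤ.+ H) ≡ H ℤ.- a ℤ.+ L
   lem₁ = ℤ-ring
   lem₂ : ∀ a H L → a ℤ.- L ℤ.+ H ℤ.+ L ≡ H ℤ.+ a
   lem₂ = ℤ-ring

  Positive : ℤ → Set
  Positive z = + 1 ℤ.≤ z

  private
   T≥0 : 0ℤ ℤ.≤ T
   T≥0 = ℤ.+≤+ z≤n

   asc-positive : ∀ x l → Positive x → All Positive (asc x l)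
   asc-positive x zero h = []
   asc-positive x (suc l) h = h ∷ asc-positive (x ℤ.+ T) l (ℤₚ.≤-trans h (ℤₚ.≤-trans (ℤₚ.≤-reflexive (≡.sym (ℤₚ.+-identityʳ x))) (ℤₚ.+-monoʳ-≤ x T≥0)))

   start⁻ : ∀ {a} → a < η → Positive (H ℤ.- + a)
   start⁻ {a} a<η = subst Positive (≡.sym (≡.trans (ℤₚ.[+m]-[+n]≡m⊖n η a) (ℤₚ.⊖-≥ (<⇒≤ a<η)))) (ℤ.+≤+ (m<n⇒0<n∸m a<η))

   start⁺ : ∀ {a} → a < η → Positive (H ℤ.+ + a)
   start⁺ {a} a<η = ℤ.+≤+ (≤-trans (≤-<-trans z≤n a<η) (m≤m+n η a))

  zs-positive : ∀ {a} → a < η → All Positive (zs a)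
  zs-positive {a} h = Allₚ.++⁺ (asc-positive _ L (start⁻ h)) (asc-positive _ L (start⁺ h))

  private
   sums≢0 : ∀ {ξ l} → Positive ξ → All Positive l → NonZeroSums qRing H L ξ l
   sums≢0 p = All.map λ q e → ≢0-pos (ℤₚ.≤-trans (ℤ.+≤+ (s≤s z≤n)) (ℤₚ.+-mono-≤ p q)) e

   One-far : ∀ {x} → 0ℤ ℤ.≤ x → 1 ≤ η → One L (u (x ℤ.+ times L T))
   One-far {x} h η≥1 = One-u (ℤₚ.≤-trans (ℤₚ.≤-trans (ℤ.+≤+ (≤-trans (≤-reflexive (≡.sym (ℕₚ.*-identityʳ L))) (*-monoʳ-≤ L (≤-trans η≥1 (m≤m+n η η)))))
    (ℤₚ.≤-reflexive (≡.trans (≡.sym (ℤₚ.+-identityˡ _)) (cong (ℤ._+_ 0ℤ) (≡.trans (ℤₚ.pos-* L (η ℕ.+ η)) (≡.sym (times≡* L T))))))) (ℤₚ.+-monoˡ-≤ (times L T) h))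

  module _ (g : ℤ → Carrier) (f₁ : ℤ → Carrier) where
   open Weights qRing T
   open Density g

   P′ : ℤ → ℕ → Carrier
   P′ = P qRing H L g f₁ 0 []

   private
    prod-snoc : ∀ (f : ℤ → Carrier) x l → prodOver f (asc x (suc l)) ≈ f (at qRing H L x l) * prodOver f (asc x l)
    prod-snoc f x zero = refl
    prod-snoc f x (suc l) = trans (*-congˡ (prod-snoc f (x ℤ.+ T) l)) (x*yz≈y*xz _ _ _)

    prod-P : ∀ x e d l → x ℤ.+ e ≡ d ℤ.+ T → prodOver (λ ξ → u (ξ ℤ.+ e)) (asc x l) ≈ P′ d l
    prod-P x e d zero h = refl
    prod-P x e d (suc l) h = trans (prod-snoc (λ ξ → u (ξ ℤ.+ e)) x l) (*-cong (u-≡ (≡.trans (cong (ℤ._+ e) (at≡ qRing H L x l)) (≡.trans (lem x e (times l T)) (≡.trans (cong (ℤ._+ times l T) h) (ℤₚ.+-assoc d T _))))) (prod-P x e d l h))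
     where
     lem : ∀ x e k → x ℤ.+ k ℤ.+ e ≡ x ℤ.+ e ℤ.+ k
     lem = ℤ-ring

    prod-P² : ∀ x d l → x ℤ.+ x ≡ d ℤ.+ T → prodOver (λ ξ → u (ξ ℤ.+ ξ) * u (ξ ℤ.+ ξ ℤ.+ T)) (asc x l) ≈ P′ d (l ℕ.+ l)
    prod-P² x d zero h = refl
    prod-P² x d (suc l) h = trans (prod-snoc _ x l) (trans (*-cong (*-cong (u-≡ (≡.trans (cong (λ z → z ℤ.+ z) (at≡ qRing H L x l)) (≡.trans (lem₁ x (times l T)) (≡.trans (cong₂ ℤ._+_ h (≡.sym (Chains.times-+ l l T))) (ℤₚ.+-assoc d T _)))))
      (u-≡ (≡.trans (cong (λ z → z ℤ.+ z ℤ.+ T) (at≡ qRing H L x l)) (≡.trans (lem₂ x (times l T) T) (≡.trans (cong₂ (λ a b → a ℤ.+ (T ℤ.+ b)) h (≡.sym (Chains.times-+ l l T))) (lem₃ d T (times (l ℕ.+ l) T)))))))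
     (prod-P² x d l h)) (trans (solve Λ 3 0 (λ a b c → (a :* b) :* c := b :* (a :* c)) _ _ _) (reflexive (cong (P′ d) (cong suc (≡.sym (+-suc l l)))))))
     where
     lem₁ : ∀ x k → x ℤ.+ k ℤ.+ (x ℤ.+ k) ≡ x ℤ.+ x ℤ.+ (k ℤ.+ k)
     lem₁ = ℤ-ring
     lem₂ : ∀ x k T → x ℤ.+ k ℤ.+ (x ℤ.+ k) ℤ.+ T ≡ x ℤ.+ x ℤ.+ (T ℤ.+ (k ℤ.+ k))
     lem₂ = ℤ-ring
     lem₃ : ∀ d T k → d ℤ.+ T ℤ.+ (T ℤ.+ k) ≡ d ℤ.+ (T ℤ.+ (T ℤ.+ k))
     lem₃ = ℤ-ring

    -- Each ξ has its own denominator u (ξ + ξ), and its weights with the later elements telescope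
    -- to the near end u (ξ + ξ + T) and a far end.
    c-asc : ∀ x l → Positive x → c (asc x l) * prodOver (λ ξ → u (ξ ℤ.+ ξ) * u (ξ ℤ.+ ξ ℤ.+ T)) (asc x l) ≈ prodOver g (asc x l) * prodOver (λ ξ → u (ξ ℤ.+ at qRing H L x l)) (asc x l)
    c-asc x zero h = refl
    c-asc x (suc l) h = begin
     (g x * j (x ℤ.+ x) * W x rest * c rest) * (u (x ℤ.+ x) * u (x ℤ.+ x ℤ.+ T) * prodOver _ rest)
      ≈⟨ solve Λ 7 0 (λ g j w c u v p → (g :* j :* w :* c) :* (u :* v :* p) := g :* (u :* j) :* (w :* v) :* (c :* p)) _ _ _ _ _ _ _ ⟩
     g x * (u (x ℤ.+ x) * j (x ℤ.+ x)) * (W x rest * u (x ℤ.+ x ℤ.+ T)) * (c rest * prodOver _ rest)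
      ≈⟨ *-cong (*-cong (trans (*-congˡ (u*j λ e → ≢0-pos (ℤₚ.≤-trans (ℤ.+≤+ (s≤s z≤n)) (ℤₚ.+-mono-≤ h h)) e)) (*-identityʳ _))
        (trans (*-congˡ (u-≡ (ℤₚ.+-assoc x x T))) (W-ascend qRing H L x (x ℤ.+ T) l (sums≢0 h pos₂)))) (c-asc (x ℤ.+ T) l pos₁) ⟩
     g x * u (x ℤ.+ at qRing H L (x ℤ.+ T) l) * (prodOver g rest * prodOver (λ ξ → u (ξ ℤ.+ at qRing H L (x ℤ.+ T) l)) rest)
      ≈⟨ *-interchange _ _ _ _ ⟩
     _ ∎
     where
     open ≈-Reasoning
     rest : List ℤ
     rest = asc (x ℤ.+ T) l
     pos₁ : Positive (x ℤ.+ T)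
     pos₁ = ℤₚ.≤-trans h (ℤₚ.≤-trans (ℤₚ.≤-reflexive (≡.sym (ℤₚ.+-identityʳ x))) (ℤₚ.+-monoʳ-≤ x T≥0))
     pos₂ : All Positive rest
     pos₂ = asc-positive (x ℤ.+ T) l pos₁

    One-prod : ∀ (f : ℤ → Carrier) l → All (λ z → One L (f z)) l → One L (prodOver f l)
    One-prod f [] [] = One-1 L
    One-prod f (z ∷ l) (h ∷ hs) = One-* h (One-prod f l hs)

   -- The near ends left within one chain: two products for the runs by themselves, one for the runs
   -- against each other. The numerators `g` are kept apart.
   selfDen : ℕ → Carrier
   selfDen a = P′ (ℤ.- (+ a ℤ.+ + a)) (L ℕ.+ L) * P′ (+ a ℤ.+ + a) (L ℕ.+ L) * P′ 0ℤ L

   pairDen : ℕ → ℕ → Carrier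
   pairDen a b = (P′ (ℤ.- + a ℤ.- + b) L * P′ (ℤ.- + a ℤ.+ + b) L) * (P′ (+ a ℤ.- + b) L * P′ (+ a ℤ.+ + b) L)

   pairDens : ℕ → List ℕ → Carrier
   pairDens a []       = 1#
   pairDens a (b ∷ bs) = pairDen a b * pairDens a bs

   Den : List ℕ → Carrier
   Den []       = 1#
   Den (a ∷ as) = selfDen a * pairDens a as * Den as

   module _ (η≥1 : 1 ≤ η) where
    open ≈-Reasoning

    private
     -- x ≈ y up to a factor that is 1 modulo E L
     infix 4 _≐_
     _≐_ : Carrier → Carrier → Set
     x ≐ y = ∃ λ k → x ≈ y * k × One L k

     ≐-* : ∀ {x x′ y y′} → x ≐ x′ → y ≐ y′ → x * y ≐ x′ * y′
     ≐-* (k , e , o) (k′ , e′ , o′) = k * k′ , trans (*-cong e e′) (*-interchange _ _ _ _) , One-* o o′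

     ≐-≈ : ∀ {x x′ y y′} → x ≈ x′ → y ≈ y′ → x ≐ y → x′ ≐ y′
     ≐-≈ e e′ (k , h , o) = k , trans (sym e) (trans h (*-congʳ e′)) , o

     sum≥0 : ∀ {x y} → Positive x → 0ℤ ℤ.≤ y → 0ℤ ℤ.≤ x ℤ.+ y
     sum≥0 p q = ℤₚ.+-mono-≤ (ℤₚ.≤-trans (ℤ.+≤+ z≤n) p) q

     positive⇒≥0 : ∀ {x} → Positive x → 0ℤ ℤ.≤ x
     positive⇒≥0 p = ℤₚ.≤-trans (ℤ.+≤+ z≤n) p

     W-asc : ∀ {ξ x} → Positive ξ → Positive x → W ξ (asc x L) * u (ξ ℤ.+ x) ≐ 1#
     W-asc {ξ} {x} p q = u (ξ ℤ.+ x ℤ.+ times L T) , trans (W-ascend qRing H L ξ x L (sums≢0 p (asc-positive x L q)))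
       (trans (u-≡ (≡.trans (cong (ℤ._+_ ξ) (at≡ qRing H L x L)) (≡.sym (ℤₚ.+-assoc ξ x _)))) (sym (*-identityˡ _))) ,
      One-far (sum≥0 p (positive⇒≥0 q)) η≥1

     c-asc≐ : ∀ x d → Positive x → x ℤ.+ x ≡ d ℤ.+ T → c (asc x L) * P′ d (L ℕ.+ L) ≐ prodOver g (asc x L)
     c-asc≐ x d p e = _ , trans (*-congˡ (sym (prod-P² x d L e))) (c-asc x L p) ,
      One-prod _ (asc x L) (All.map (λ {ξ} q → One-≈ (u-≡ (≡.trans (ℤₚ.+-assoc ξ x _) (cong (ℤ._+_ ξ) (≡.sym (at≡ qRing H L x L))))) (One-far (sum≥0 q (positive⇒≥0 p)) η≥1)) (asc-positive x L p))

     cross : ∀ l x → All Positive l → Positive x → prodOver (λ ξ → W ξ (asc x L)) l * prodOver (λ ξ → u (ξ ℤ.+ x)) l ≐ 1#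
     cross [] x [] q = 1# , refl , One-1 L
     cross (ξ ∷ l) x (p ∷ ps) q = ≐-≈ (*-interchange _ _ _ _) (*-identityˡ _) (≐-* (W-asc p q) (cross l x ps q))

     c-zs : ∀ a → a < η → c (zs a) * selfDen a ≐ prodOver g (zs a)
     c-zs a h = ≐-≈
      (trans (solve Λ 6 0 (λ c p c′ p′ w q → ((c :* p) :* (c′ :* p′)) :* (w :* q) := (c :* w :* c′) :* (p :* p′ :* q)) _ _ _ _ _ _) (*-congʳ (sym (c-++ (asc (H ℤ.- + a) L) _))))
      (trans (*-identityʳ _) (sym (prodOver-++ g (asc (H ℤ.- + a) L) _)))
      (≐-* (≐-* (c-asc≐ (H ℤ.- + a) (ℤ.- (+ a ℤ.+ + a)) (start⁻ h) (lem₁ H (+ a))) (c-asc≐ (H ℤ.+ + a) (+ a ℤ.+ + a) (start⁺ h) (lem₂ H (+ a))))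
       (≐-≈ (*-congˡ (prod-P (H ℤ.- + a) (H ℤ.+ + a) 0ℤ L (lem₃ H (+ a)))) refl (cross (asc (H ℤ.- + a) L) (H ℤ.+ + a) (asc-positive _ L (start⁻ h)) (start⁺ h))))
      where
      lem₁ : ∀ H a → H ℤ.- a ℤ.+ (H ℤ.- a) ≡ ℤ.- (a ℤ.+ a) ℤ.+ (H ℤ.+ H)
      lem₁ = ℤ-ring
      lem₂ : ∀ H a → H ℤ.+ a ℤ.+ (H ℤ.+ a) ≡ a ℤ.+ a ℤ.+ (H ℤ.+ H)
      lem₂ = ℤ-ring
      lem₃ : ∀ H a → H ℤ.- a ℤ.+ (H ℤ.+ a) ≡ 0ℤ ℤ.+ (H ℤ.+ H)
      lem₃ = ℤ-ring

     cross-zs : ∀ a bs → a < η → All (_< η) bs → prodOver (λ ξ → W ξ (Zs bs)) (zs a) * pairDens a bs ≐ 1#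
     cross-zs a [] h [] = 1# , trans (*-identityʳ _) (trans (ones (zs a)) (sym (*-identityˡ _))) , One-1 L
      where
      ones : ∀ l → prodOver (λ ξ → 1#) l ≈ 1#
      ones [] = refl
      ones (_ ∷ l) = trans (*-identityˡ _) (ones l)
     cross-zs a (b ∷ bs) h (h′ ∷ hs) = ≐-≈
      (trans (solve Λ 8 0 (λ v p w q r x y z → ((v :* (x :* p)) :* (w :* (q :* r))) :* (y :* z) := ((v :* w) :* y) :* (((x :* q) :* (p :* r)) :* z)) _ _ _ _ _ _ _ _)
       (*-cong (sym (trans (prodOver-cong (zs a) λ ξ → trans (prodOver-++ (w ξ) (zs b) (Zs bs)) (*-congʳ (prodOver-++ (w ξ) (asc (H ℤ.- + b) L) _)))
        (trans (prodOver-* _ _ (zs a)) (*-congʳ (prodOver-* _ _ (zs a)))))) refl))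
      (solve Λ 0 0 ((:1 :* :1) :* :1 := :1))
      (≐-* (≐-* (≐-≈ (*-congˡ (trans (prodOver-++ _ (asc (H ℤ.- + a) L) _) (*-cong (prod-P (H ℤ.- + a) (H ℤ.- + b) (ℤ.- + a ℤ.- + b) L (lem₁ H (+ a) (+ b))) (prod-P (H ℤ.+ + a) (H ℤ.- + b) (+ a ℤ.- + b) L (lem₂ H (+ a) (+ b)))))) refl
         (cross (zs a) (H ℤ.- + b) (zs-positive h) (start⁻ h′)))
        (≐-≈ (*-congˡ (trans (prodOver-++ _ (asc (H ℤ.- + a) L) _) (*-cong (prod-P (H ℤ.- + a) (H ℤ.+ + b) (ℤ.- + a ℤ.+ + b) L (lem₃ H (+ a) (+ b))) (prod-P (H ℤ.+ + a) (H ℤ.+ + b) (+ a ℤ.+ + b) L (lem₄ H (+ a) (+ b)))))) refl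
         (cross (zs a) (H ℤ.+ + b) (zs-positive h) (start⁺ h′))))
       (cross-zs a bs h hs))
      where
      lem₁ : ∀ H a b → H ℤ.- a ℤ.+ (H ℤ.- b) ≡ ℤ.- a ℤ.- b ℤ.+ (H ℤ.+ H)
      lem₁ = ℤ-ring
      lem₂ : ∀ H a b → H ℤ.+ a ℤ.+ (H ℤ.- b) ≡ a ℤ.- b ℤ.+ (H ℤ.+ H)
      lem₂ = ℤ-ring
      lem₃ : ∀ H a b → H ℤ.- a ℤ.+ (H ℤ.+ b) ≡ ℤ.- a ℤ.+ b ℤ.+ (H ℤ.+ H)
      lem₃ = ℤ-ring
      lem₄ : ∀ H a b → H ℤ.+ a ℤ.+ (H ℤ.+ b) ≡ a ℤ.+ b ℤ.+ (H ℤ.+ H)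
      lem₄ = ℤ-ring

    c-Zs : ∀ as → All (_< η) as → ∃ λ k → c (Zs as) * Den as ≈ prodOver g (Zs as) * k × One L k
    c-Zs [] [] = 1# , refl , One-1 L
    c-Zs (a ∷ as) (h ∷ hs) = ≐-≈
     (trans (solve Λ 6 0 (λ c s w p z d → ((c :* s) :* (w :* p)) :* (z :* d) := (c :* w :* z) :* (s :* p :* d)) _ _ _ _ _ _) (*-congʳ (sym (c-++ (zs a) (Zs as)))))
     (trans (*-congʳ (*-identityʳ _)) (sym (prodOver-++ g (zs a) (Zs as))))
     (≐-* (≐-* (c-zs a h) (cross-zs a as h hs)) (c-Zs as hs))

    c-mid : ∀ as → All (_< η) as → ∃ λ k → c (Xs qRing H L (map (_, L) (map +_ as))) * Den as ≈ prodOver g (Zs as) * k × One L k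
    c-mid as hs = let k , e , o = c-Zs as hs in k , trans (*-congʳ (c-↭ (mid↭ as))) e , o

-- The first system and the odd exponents

module Odds where

 open Base
 open Solver
 open Signs
 open Littlewood using (times; F; F≈signSum; c-scale)
 open Chains using (Xs; ascend; Valid; Signed-Xs; ys-of; chains)
 open Columns using (down)
 open Collapse using (times≡*)
 open Limit
 open Residues
 open Systems
 open Midpoint

 pigeonhole : ∀ {A : Set} (xs ys : List A) → AllPairs _≢_ xs → All (_∈ ys) xs → length ys ≤ length xs → xs ↭ ys
 pigeonhole [] [] d s l = Perm.refl
 pigeonhole (x ∷ xs) ys (x≢ ∷ d) (x∈ ∷ s) l with ∈-∃++ x∈
 ... | as , bs , ≡.refl = ↭-trans (prep x (pigeonhole xs (as ++ bs) d
     (All.zipWith (λ { (x≢z , z∈) → avoid x≢z (Permₚ.∈-resp-↭ (Permₚ.shift x as bs) z∈) }) (x≢ , s))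
     (≤-pred (≤-trans (≤-reflexive (≡.sym (Permₚ.↭-length (Permₚ.shift x as bs)))) l)))) (↭-sym (Permₚ.shift x as bs))
  where
  avoid : ∀ {z} → x ≢ z → z ∈ x ∷ as ++ bs → z ∈ as ++ bs
  avoid x≢z (here e) = ⊥-elim (x≢z (≡.sym e))
  avoid x≢z (there m) = m

 oddℤ : ℕ → ℤ
 oddℤ a = + odd a

 module _ (R : LRing) (n L : ℕ) (n≥1 : 1 ≤ n) where
  open LRing R
  open SignSum Λ

  private
   η N : ℕ
   η = 2 ℕ.* n
   N = η ℕ.* L
   H T : ℤ
   H = + η
   T = H ℤ.+ H
   ys : List ℤ
   ys = map +_ (odds n)

  OddBelow : ℤ → Set
  OddBelow z = ∃ λ b → z ≡ oddℤ b × b < N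

  private
   odd-shift : ∀ s → oddℤ s ℤ.+ T ≡ oddℤ (s ℕ.+ η)
   odd-shift s = cong +_ (≡.trans (cong suc (cong (ℕ._+ (η ℕ.+ η)) (dbl≡ s))) (cong suc (≡.trans (lem s η) (≡.sym (dbl≡ (s ℕ.+ η))))))
    where
    lem : ∀ s e → s ℕ.+ s ℕ.+ (e ℕ.+ e) ≡ s ℕ.+ e ℕ.+ (s ℕ.+ e)
    lem = ℕ-ring

   asc-odd : ∀ s l → s ℕ.+ η ℕ.* l < η ℕ.+ N → All OddBelow (ascend qRing H L (oddℤ s) l)
   asc-odd s zero h = []
   asc-odd s (suc l) h = (s , ≡.refl , ℕₚ.+-cancelˡ-< η s N (≤-<-trans (≤-trans (≤-reflexive (ℕₚ.+-comm η s)) (+-monoʳ-≤ s (≤-trans (≤-reflexive (≡.sym (ℕₚ.*-identityʳ η))) (*-monoʳ-≤ η (s≤s z≤n))))) h))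
    ∷ subst (λ z → All OddBelow (ascend qRing H L z l)) (≡.sym (odd-shift s))
      (asc-odd (s ℕ.+ η) l (subst (_< η ℕ.+ N) (≡.trans (cong (s ℕ.+_) (*-suc η l)) (≡.sym (ℕₚ.+-assoc s η _))) h))

   length-asc : ∀ x l → length (ascend qRing H L x l) ≡ l
   length-asc x zero = ≡.refl
   length-asc x (suc l) = cong suc (length-asc (x ℤ.+ T) l)

   length-Zs : ∀ as → length (Zs R η L as) ≡ length as ℕ.* (L ℕ.+ L)
   length-Zs [] = ≡.refl
   length-Zs (a ∷ as) = ≡.trans (Listₚ.length-++ (zs R η L a)) (cong₂ ℕ._+_ (≡.trans (Listₚ.length-++ (ascend qRing H L (H ℤ.- + a) L)) (cong₂ ℕ._+_ (length-asc _ L) (length-asc _ L))) (length-Zs as))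

   start⁻ : ∀ {k} → k < n → H ℤ.- oddℤ k ≡ oddℤ (n ℕ.∸ suc k)
   start⁻ {k} k<n = ≡.trans (cong (λ z → + z ℤ.- oddℤ k) e) (lem (oddℤ (n ℕ.∸ suc k)) (oddℤ k))
    where
    lem : ∀ a b → a ℤ.+ b ℤ.- b ≡ a
    lem = ℤ-ring
    lem₁ : ∀ a k → (a ℕ.+ (1 ℕ.+ k)) ℕ.+ (a ℕ.+ (1 ℕ.+ k)) ≡ 1 ℕ.+ (a ℕ.+ a) ℕ.+ (1 ℕ.+ (k ℕ.+ k))
    lem₁ = ℕ-ring
    e : η ≡ odd (n ℕ.∸ suc k) ℕ.+ odd k
    e = ≡.trans (2*≡ n) (≡.trans (dbl≡ n) (≡.trans (cong (λ z → z ℕ.+ z) (≡.sym (m∸n+n≡m k<n))) (≡.trans (lem₁ (n ℕ.∸ suc k) k) (cong₂ (λ a b → suc a ℕ.+ suc b) (≡.sym (dbl≡ _)) (≡.sym (dbl≡ k))))))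

   start⁺ : ∀ k → H ℤ.+ oddℤ k ≡ oddℤ (n ℕ.+ k)
   start⁺ k = cong +_ (≡.trans (cong₂ (λ a b → a ℕ.+ suc b) (≡.trans (2*≡ n) (dbl≡ n)) (dbl≡ k)) (≡.trans (lem n k) (cong suc (≡.sym (dbl≡ (n ℕ.+ k))))))
    where
    lem : ∀ n k → n ℕ.+ n ℕ.+ (1 ℕ.+ (k ℕ.+ k)) ≡ 1 ℕ.+ (n ℕ.+ k ℕ.+ (n ℕ.+ k))
    lem = ℕ-ring

   zs-odd : ∀ {k} → k < n → All OddBelow (zs R η L (odd k))
   zs-odd {k} k<n = Allₚ.++⁺
    (subst (λ z → All OddBelow (ascend qRing H L z L)) (≡.sym (start⁻ k<n)) (asc-odd _ L (+-monoˡ-< N (<-≤-trans (≤-<-trans (m∸n≤m n (suc k)) (n<2n)) ≤-refl))))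
    (subst (λ z → All OddBelow (ascend qRing H L z L)) (≡.sym (start⁺ k)) (asc-odd _ L (+-monoˡ-< N (<-≤-trans (ℕₚ.+-monoʳ-< n k<n) (≤-reflexive (cong (n ℕ.+_) (≡.sym (ℕₚ.+-identityʳ n))))))))
    where
    n<2n : n < η
    n<2n = ≤-trans (≤-reflexive (ℕₚ.+-comm 1 n)) (+-monoʳ-≤ n (≤-trans n≥1 (≤-reflexive (≡.sym (ℕₚ.+-identityʳ n)))))

   Zs-odd : ∀ ks → (∀ {k} → k ∈ ks → k < n) → All OddBelow (Zs R η L (map odd ks))
   Zs-odd [] h = []
   Zs-odd (k ∷ ks) h = Allₚ.++⁺ (zs-odd (h (here ≡.refl))) (Zs-odd ks λ m → h (there m))

   indices : ∀ zs → All OddBelow zs → ∃ λ bs → zs ≡ map oddℤ bs × All (_< N) bs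
   indices [] [] = [] , ≡.refl , []
   indices (z ∷ zs) ((b , e , b<) ∷ h) = let bs , es , bs< = indices zs h in b ∷ bs , cong₂ _∷_ e es , b< ∷ bs<

   apart⇒distinct : ∀ bs → AllPairs Apart (map oddℤ bs) → AllPairs _≢_ bs
   apart⇒distinct [] [] = []
   apart⇒distinct (b ∷ bs) (a ∷ as) = All.map (λ { {b′} ap ≡.refl → Apart.diff≢0 ap (ℤₚ.+-inverseˡ (oddℤ b)) }) (Allₚ.map⁻ a) ∷ apart⇒distinct bs as

  X₀′ : List ℤ
  X₀′ = Xs qRing H L (map (_, L) ys)

  private
   ys-mid : ∀ l → ys-of qRing H L (map (_, L) l) ≡ l
   ys-mid [] = ≡.refl
   ys-mid (y ∷ l) = cong (y ∷_) (ys-mid l)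

   valid-mid : ∀ l → Valid qRing H L (map (_, L) l)
   valid-mid [] = []
   valid-mid (y ∷ l) = m≤m+n L L ∷ valid-mid l

  X₀-signed : Signed X₀′ (chains qRing H L ys)
  X₀-signed = subst (λ l → Signed X₀′ (chains qRing H L l)) (ys-mid ys) (Signed-Xs qRing H L (map (_, L) ys) (valid-mid ys))

  X₀-good : Good X₀′
  X₀-good = Signed-Good X₀-signed (chains-good qRing η L (odds-spread n))

  V : List ℤ
  V = map oddℤ (upTo N)

  -- After inversion of the first halves, the n chains of length 2L consist of 2nL distinct numbers
  -- 2b + 1 with b < N. As N = 2nL, every such number occurs.
  X₀↭V : X₀′ ↭ V
  X₀↭V with indices (Zs R η L (odds n)) (Zs-odd (down n) (down-< n))
  ... | bs , e , bs< = ↭-trans (mid↭ R η L (odds n)) (↭-trans (↭-reflexive e) (Permₚ.map⁺ oddℤ (pigeonhole bs (upTo N)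
    (apart⇒distinct bs (subst (AllPairs Apart) e (proj₂ (Good-↭ (mid↭ R η L (odds n)) X₀-good)))) (All.map ∈-upTo⁺ bs<)
    (≤-reflexive (≡.trans (Listₚ.length-upTo N) (≡.trans (lem n L) (≡.trans (cong (ℕ._* (L ℕ.+ L)) (≡.sym (≡.trans (Listₚ.length-map odd (down n)) (length-down n))))
     (≡.trans (≡.sym (length-Zs (odds n))) (≡.trans (cong length e) (Listₚ.length-map oddℤ bs))))))))))
   where
   lem : ∀ n L → (n ℕ.+ (n ℕ.+ 0)) ℕ.* L ≡ n ℕ.* (L ℕ.+ L)
   lem = ℕ-ring

  signSum-signed : ∀ {l xs} → Signed l xs → ∀ G → signSum G l ≈ signSum G xs
  signSum-signed [] G = refl
  signSum-signed (pos s) G = +-cong (signSum-signed s _) (signSum-signed s _)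
  signSum-signed (neg {x} {l} s) G = trans (signSum-neg G x l) (+-cong (signSum-signed s _) (signSum-signed s _))

  module _ (m : ℕ) where
   open Weights qRing T
   open Pair R m n n≥1

   private
    up : ℤ → Carrier
    up x = E (times m (x ℤ.+ x))

    V-good : Good V
    V-good = Good-↭ X₀↭V X₀-good

   -- the multisum in terms of a determinant; the factor g₁ of the density cancels at the middle configuration
   F-det : F qRing T m V * S₁.Δ₀ compatible₁ L ≈ Density.c (λ _ → 1#) V * S₁.D L
   F-det = begin
    F qRing T m V * S₁.Δ₀ compatible₁ L
     ≈⟨ *-congʳ (F≈signSum qRing T m V V-good) ⟩
    prodOver up V * signSum (Density.c g₁) V * S₁.Δ₀ compatible₁ L
     ≈⟨ trans (*-assoc _ _ _) (*-congˡ (*-congʳ (trans (sym (signSum-↭ (Density.c-↭ g₁) X₀↭V)) (signSum-signed X₀-signed (Density.c g₁))))) ⟩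
    prodOver up V * (signSum (Density.c g₁) (chains qRing H L ys) * S₁.Δ₀ compatible₁ L)
     ≈⟨ *-congˡ (S₁.collapse compatible₁ L) ⟩
    prodOver up V * (Density.c g₁ X₀′ * S₁.D L)
     ≈⟨ *-congˡ (*-congʳ (trans (Density.c-↭ g₁ X₀↭V) (trans (c-ext V) (c-scale qRing T g₁ (λ _ → 1#) V)))) ⟩
    prodOver up V * (prodOver g₁ V * Density.c (λ _ → 1#) V * S₁.D L)
     ≈⟨ solve Λ 4 0 (λ a b c d → a :* (b :* c :* d) := (a :* b) :* (c :* d)) _ _ _ _ ⟩
    (prodOver up V * prodOver g₁ V) * (Density.c (λ _ → 1#) V * S₁.D L)
     ≈⟨ trans (*-congʳ (trans (sym (prodOver-* up g₁ V)) (ones V))) (*-identityˡ _) ⟩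
    Density.c (λ _ → 1#) V * S₁.D L ∎
    where
    open ≈-Reasoning
    ones : ∀ l → prodOver (λ x → up x * g₁ x) l ≈ 1#
    ones [] = refl
    ones (x ∷ l) = trans (*-cong (solve Λ 0 1 (λ a → :E a :* :E (⊟ a) := :1) (times m (x ℤ.+ x))) (ones l)) (*-identityˡ _)
    c-ext : ∀ l → Density.c g₁ l ≈ Density.c (λ z → g₁ z * 1#) l
    c-ext [] = refl
    c-ext (z ∷ l) = *-cong (*-congʳ (*-congʳ (sym (*-identityʳ _)))) (c-ext l)

-- Finite products as shifted factorials

module Pochhammer where

 open Base
 open Solver
 open Signs
 open Littlewood using (times)
 open Chains using (module Move; ascend)
 open Columns using (down)
 open Collapse using (times≡*)
 open Entries using (ψ)
 open Limit
 open Systems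
 open Odds using (oddℤ)

 module _ (R : LRing) where
  open LRing R
  open Seq R
  open ≈-Reasoning

  -- This is 1 - q^c, because q = E 4; hence `pk c d k` is (q^c; q^d)_k.
  U : ℕ → Carrier
  U c = u (+ (c ℕ.+ c))

  Π< : ℕ → (ℕ → Carrier) → Carrier
  Π< zero    f = 1#
  Π< (suc n) f = f n * Π< n f

  pk : ℕ → ℕ → ℕ → Carrier
  pk c d k = Π< k (λ i → U (c ℕ.+ i ℕ.* d))

  prodFrom : (ℕ → Carrier) → ℕ → ℕ → Carrier
  prodFrom f a zero    = 1#
  prodFrom f a (suc l) = f a * prodFrom f (suc a) l

  U-≡ : ∀ {a b} → a ≡ b → U a ≈ U b
  U-≡ ≡.refl = refl

  Π<-cong : ∀ {f g} n → (∀ k → k < n → f k ≈ g k) → Π< n f ≈ Π< n g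
  Π<-cong zero h = refl
  Π<-cong (suc n) h = *-cong (h n ≤-refl) (Π<-cong n λ k l → h k (m<n⇒m<1+n l))

  Π<-* : ∀ n f g → Π< n (λ k → f k * g k) ≈ Π< n f * Π< n g
  Π<-* zero f g = sym (*-identityˡ _)
  Π<-* (suc n) f g = trans (*-congˡ (Π<-* n f g)) (*-interchange _ _ _ _)

  Π<-cons : ∀ n f → Π< (suc n) f ≈ f 0 * Π< n (λ k → f (suc k))
  Π<-cons zero f = refl
  Π<-cons (suc n) f = trans (*-congˡ (Π<-cons n f)) (x*yz≈y*xz _ _ _)

  prodFrom-snoc : ∀ f a l → prodFrom f a (suc l) ≈ f (a ℕ.+ l) * prodFrom f a l
  prodFrom-snoc f a zero = *-congʳ (reflexive (cong f (≡.sym (ℕₚ.+-identityʳ a))))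
  prodFrom-snoc f a (suc l) = trans (*-congˡ (prodFrom-snoc f (suc a) l)) (trans (x*yz≈y*xz _ _ _)
   (*-congʳ (reflexive (cong f (≡.sym (+-suc a l))))))

  prodFrom-++ : ∀ f a k l → prodFrom f a (k ℕ.+ l) ≈ prodFrom f a k * prodFrom f (a ℕ.+ k) l
  prodFrom-++ f a zero l = trans (reflexive (cong (λ b → prodFrom f b l) (≡.sym (ℕₚ.+-identityʳ a)))) (sym (*-identityˡ _))
  prodFrom-++ f a (suc k) l = trans (*-congˡ (trans (prodFrom-++ f (suc a) k l) (*-congˡ (reflexive (cong (λ b → prodFrom f b l) (≡.sym (+-suc a k))))))) (sym (*-assoc _ _ _))

  prodFrom≈Π< : ∀ f a l → prodFrom f a l ≈ Π< l (λ i → f (a ℕ.+ i))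
  prodFrom≈Π< f a zero = refl
  prodFrom≈Π< f a (suc l) = trans (prodFrom-snoc f a l) (*-congˡ (prodFrom≈Π< f a l))

  prodFrom≈pk : ∀ a l → prodFrom U a l ≈ pk a 1 l
  prodFrom≈pk a l = trans (prodFrom≈Π< U a l) (Π<-cong l λ i _ → U-≡ (cong (a ℕ.+_) (≡.sym (ℕₚ.*-identityʳ i))))

  Π<-reverse : ∀ k f → Π< k (λ i → f (k ∸ i)) ≈ prodFrom f 1 k
  Π<-reverse zero f = refl
  Π<-reverse (suc k) f = *-cong (reflexive (cong f (≡.trans (+-∸-assoc 1 {k} ≤-refl) (cong suc (n∸n≡0 k)))))
   (trans (Π<-cong k λ i i<k → reflexive (cong f (+-∸-assoc 1 (<⇒≤ i<k)))) (trans (Π<-reverse k (λ i → f (suc i))) (shifted f 1 k)))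
   where
   shifted : ∀ f a k → prodFrom (λ i → f (suc i)) a k ≈ prodFrom f (suc a) k
   shifted f a zero = refl
   shifted f a (suc k) = *-congˡ (shifted f (suc a) k)

  pk-cons : ∀ c d k → pk c d (suc k) ≈ U c * pk (c ℕ.+ d) d k
  pk-cons c d k = trans (Π<-cons k _) (*-cong (U-≡ (ℕₚ.+-identityʳ c)) (Π<-cong k λ i _ → U-≡ (≡.sym (ℕₚ.+-assoc c d (i ℕ.* d)))))

  private
   doubled : ∀ a b → odd a ℕ.+ odd b ≡ suc (a ℕ.+ b) ℕ.+ suc (a ℕ.+ b)
   doubled a b = ≡.trans (cong₂ (λ x y → suc x ℕ.+ suc y) (dbl≡ a) (dbl≡ b)) (lem a b)
    where
    lem : ∀ a b → suc (a ℕ.+ a) ℕ.+ suc (b ℕ.+ b) ≡ suc (a ℕ.+ b) ℕ.+ suc (a ℕ.+ b)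
    lem = ℕ-ring

   dbl-diff : ∀ {i k} → i ≤ k → + dbl k ℤ.- + dbl i ≡ + ((k ∸ i) ℕ.+ (k ∸ i))
   dbl-diff {i} {k} l = ≡.trans (cong (λ z → + z ℤ.- + dbl i) (≡.trans (dbl≡ k) (≡.trans (cong (λ z → z ℕ.+ z) (≡.sym (m∸n+n≡m l))) (≡.trans (lem₁ (k ∸ i) i) (cong (((k ∸ i) ℕ.+ (k ∸ i)) ℕ.+_) (≡.sym (dbl≡ i)))))))
    (lem₂ (+ ((k ∸ i) ℕ.+ (k ∸ i))) (+ dbl i))
    where
    lem₁ : ∀ a b → a ℕ.+ b ℕ.+ (a ℕ.+ b) ≡ a ℕ.+ a ℕ.+ (b ℕ.+ b)
    lem₁ = ℕ-ring
    lem₂ : ∀ a b → a ℤ.+ b ℤ.- b ≡ a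
    lem₂ = ℤ-ring

   s s-u : ℤ → Carrier
   s a = E (ℤ.- a) - E a
   s-u a = E (ℤ.- a) * u a

   u-≡ : ∀ {a b} → a ≡ b → u a ≈ u b
   u-≡ ≡.refl = refl

   ss : ∀ a b {c d} → a ℤ.+ b ≡ + (c ℕ.+ c) → a ℤ.- b ≡ + (d ℕ.+ d) → s (a ℤ.+ b) * s (a ℤ.- b) ≈ E (ℤ.- (a ℤ.+ a)) * (U c * U d)
   ss a b e e′ = trans (solve Λ 0 2 (λ a b → :s (a ⊞ b) :* :s (a ⊟ b) := :E (⊟ (a ⊞ a)) :* (:u (a ⊞ b) :* :u (a ⊟ b))) a b)
    (*-congˡ (*-cong (u-≡ e) (u-≡ e′)))

  module _ (H : ℤ) (L : ℕ) (g : ℤ → Carrier) (ν : ℕ) where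
   private
    module M₁ = Move qRing H L g (ψ R 2) ν
    module M₂ = Move qRing H L g (ψ R 1) ν

    V-product : ∀ a k (o : ℕ → ℕ) (f f′ : ℕ → ℕ) → (∀ {i} → i < k → a ℤ.+ + o i ≡ + (f i ℕ.+ f i)) → (∀ {i} → i < k → a ℤ.- + o i ≡ + (f′ i ℕ.+ f′ i)) →
     M₁.V a (map +_ (map o (down k))) ≈ E (times k (ℤ.- (a ℤ.+ a))) * Π< k (λ i → U (f i) * U (f′ i))
    V-product a zero o f f′ h h′ = sym (trans (*-identityʳ _) E-0)
    V-product a (suc k) o f f′ h h′ = trans (*-cong (ss a (+ o k) {f k} {f′ k} (h ≤-refl) (h′ ≤-refl)) (V-product a k o f f′ (λ l → h (m<n⇒m<1+n l)) (λ l → h′ (m<n⇒m<1+n l))))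
     (trans (*-interchange _ _ _ _) (*-congʳ (sym (E-+ _ _))))

    even-doubled : ∀ k i → + even k ℤ.+ + even i ≡ + ((k ℕ.+ i ℕ.+ 2) ℕ.+ (k ℕ.+ i ℕ.+ 2))
    even-doubled k i = cong +_ (≡.trans (cong₂ (λ x y → suc (suc x) ℕ.+ suc (suc y)) (dbl≡ k) (dbl≡ i)) (lem k i))
     where
     lem : ∀ k i → suc (suc (k ℕ.+ k)) ℕ.+ suc (suc (i ℕ.+ i)) ≡ (k ℕ.+ i ℕ.+ 2) ℕ.+ (k ℕ.+ i ℕ.+ 2)
     lem = ℕ-ring

    shifted-diff : ∀ a b c → c ℤ.+ a ℤ.- (c ℤ.+ b) ≡ a ℤ.- b
    shifted-diff = ℤ-ring

   -- The same for both systems, so that the monomials cancel when the two evaluations are compared.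
   exponent-Δ : ℕ → ℤ
   exponent-Δ k = times (suc k) (ℤ.- (oddℤ k ℤ.+ oddℤ k))

   -- In row k the differences give 1 - q^i for 1 ≤ i ≤ k, the sums those for k < i ≤ 2k, and ψ 2
   -- the last one, i = 2k + 1: together (q; q)_(2k+1).
   Δ-odds : ∀ n → M₁.Δ (map +_ (odds n)) ≈ Π< n (λ k → E (exponent-Δ k)) * Π< n (λ k → prodFrom U 1 (suc (k ℕ.+ k)))
   Δ-odds zero = sym (*-identityˡ _)
   Δ-odds (suc k) = trans (*-cong row (Δ-odds k)) (*-interchange _ _ _ _)
    where
    a : ℤ
    a = oddℤ k
    a≡ : a ℤ.+ a ≡ + (suc (k ℕ.+ k) ℕ.+ suc (k ℕ.+ k))
    a≡ = cong +_ (doubled k k)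
    row : ψ R 2 a * M₁.V a (map +_ (odds k)) ≈ E (exponent-Δ k) * prodFrom U 1 (suc (k ℕ.+ k))
    row = begin
     ψ R 2 a * M₁.V a (map +_ (odds k))
      ≈⟨ *-cong (trans (solve Λ 0 1 (λ a → :s (a ⊞ (a ⊞ icon 0ℤ)) := :E (⊟ (a ⊞ a)) :* :u (a ⊞ a)) a) (*-congˡ (u-≡ a≡)))
        (V-product a k odd (λ i → suc (k ℕ.+ i)) (λ i → k ∸ i) (λ {i} _ → cong +_ (doubled k i)) (λ {i} l → ≡.trans (shifted-diff (+ dbl k) (+ dbl i) (+ 1)) (dbl-diff (<⇒≤ l)))) ⟩
     (E (ℤ.- (a ℤ.+ a)) * U (suc (k ℕ.+ k))) * (E (times k (ℤ.- (a ℤ.+ a))) * Π< k (λ i → U (suc (k ℕ.+ i)) * U (k ∸ i)))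
      ≈⟨ trans (*-interchange _ _ _ _) (*-cong (sym (E-+ _ _)) (*-congˡ (trans (Π<-* k _ _) (*-cong (sym (prodFrom≈Π< U (suc k) k)) (Π<-reverse k U))))) ⟩
     E (exponent-Δ k) * (U (suc (k ℕ.+ k)) * (prodFrom U (suc k) k * prodFrom U 1 k))
      ≈⟨ *-congˡ (trans (*-congˡ (trans (*-comm _ _) (sym (prodFrom-++ U 1 k k)))) (sym (prodFrom-snoc U 1 (k ℕ.+ k)))) ⟩
     E (exponent-Δ k) * prodFrom U 1 (suc (k ℕ.+ k)) ∎

   Δ-evens : ∀ n → M₂.Δ (map +_ (evens n)) ≈ Π< n (λ k → E (exponent-Δ k)) * Π< n (λ k → U (suc k) * Π< k (λ i → U (k ℕ.+ i ℕ.+ 2) * U (k ∸ i)))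
   Δ-evens zero = sym (*-identityˡ _)
   Δ-evens (suc k) = trans (*-cong row (Δ-evens k)) (*-interchange _ _ _ _)
    where
    a : ℤ
    a = + even k
    expo : ℤ.- a ℤ.+ times k (ℤ.- (a ℤ.+ a)) ≡ exponent-Δ k
    expo = ≡.trans (cong (ℤ._+_ (ℤ.- a)) (times≡* k _)) (≡.trans (cong (λ z → ℤ.- (+ 2 ℤ.+ + z) ℤ.+ + k ℤ.* ℤ.- ((+ 2 ℤ.+ + z) ℤ.+ (+ 2 ℤ.+ + z))) (dbl≡ k))
     (≡.trans (lem (+ k)) (≡.sym (≡.trans (times≡* (suc k) _) (cong (λ z → (+ 1 ℤ.+ + k) ℤ.* ℤ.- ((+ 1 ℤ.+ + z) ℤ.+ (+ 1 ℤ.+ + z))) (dbl≡ k))))))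
     where
     lem : ∀ k → ℤ.- (+ 2 ℤ.+ (k ℤ.+ k)) ℤ.+ k ℤ.* ℤ.- ((+ 2 ℤ.+ (k ℤ.+ k)) ℤ.+ (+ 2 ℤ.+ (k ℤ.+ k))) ≡ (+ 1 ℤ.+ k) ℤ.* ℤ.- ((+ 1 ℤ.+ (k ℤ.+ k)) ℤ.+ (+ 1 ℤ.+ (k ℤ.+ k)))
     lem = ℤ-ring
    row : ψ R 1 a * M₂.V a (map +_ (evens k)) ≈ E (exponent-Δ k) * (U (suc k) * Π< k (λ i → U (k ℕ.+ i ℕ.+ 2) * U (k ∸ i)))
    row = begin
     ψ R 1 a * M₂.V a (map +_ (evens k))
      ≈⟨ *-cong (trans (solve Λ 0 1 (λ a → :s (a ⊞ icon 0ℤ) := :E (⊟ a) :* :u a) a) (*-congˡ (u-≡ (cong +_ (≡.trans (dbl≡ (suc k)) ≡.refl)))))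
        (V-product a k even (λ i → k ℕ.+ i ℕ.+ 2) (λ i → k ∸ i) (λ {i} _ → even-doubled k i) (λ {i} l → ≡.trans (shifted-diff (+ dbl k) (+ dbl i) (+ 2)) (dbl-diff (<⇒≤ l)))) ⟩
     (E (ℤ.- a) * U (suc k)) * (E (times k (ℤ.- (a ℤ.+ a))) * Π< k (λ i → U (k ℕ.+ i ℕ.+ 2) * U (k ∸ i)))
      ≈⟨ trans (*-interchange _ _ _ _) (*-congʳ (trans (sym (E-+ _ _)) (reflexive (cong E expo)))) ⟩
     E (exponent-Δ k) * (U (suc k) * Π< k (λ i → U (k ℕ.+ i ℕ.+ 2) * U (k ∸ i))) ∎

  module _ (n : ℕ) where
   private
    H T : ℤ
    H = + (2 ℕ.* n)
    T = H ℤ.+ H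
   open Weights qRing T
   open Density (λ _ → 1#)

   private
    jU : ℕ → Carrier
    jU c = j (+ (c ℕ.+ c))

    U*jU : ∀ {c} → 1 ≤ c → U c * jU c ≈ 1#
    U*jU {suc c} _ = u*j λ ()

    w-odd : ∀ a b → w (oddℤ a) (oddℤ b) ≈ U (suc (a ℕ.+ b) ℕ.+ 2 ℕ.* n) * jU (suc (a ℕ.+ b))
    w-odd a b = *-cong (u-≡ (cong +_ (≡.trans (cong (ℕ._+ (2 ℕ.* n ℕ.+ 2 ℕ.* n)) (doubled a b)) (lem (suc (a ℕ.+ b)) (2 ℕ.* n)))))
     (reflexive (cong (λ z → j (+ z)) (doubled a b)))
     where
     lem : ∀ s t → s ℕ.+ s ℕ.+ (t ℕ.+ t) ≡ s ℕ.+ t ℕ.+ (s ℕ.+ t)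
     lem = ℕ-ring

    from : ℕ → ℕ → List ℤ
    from a zero    = []
    from a (suc l) = oddℤ a ∷ from (suc a) l

    W-from : ∀ a b l → W (oddℤ a) (from b l) * prodFrom U (suc (a ℕ.+ b)) l ≈ prodFrom U (suc (a ℕ.+ b) ℕ.+ 2 ℕ.* n) l
    W-from a b zero = *-identityˡ _
    W-from a b (suc l) = begin
     w (oddℤ a) (oddℤ b) * W (oddℤ a) (from (suc b) l) * (U (suc (a ℕ.+ b)) * prodFrom U (suc (suc (a ℕ.+ b))) l)
      ≈⟨ trans (*-congʳ (*-congʳ (w-odd a b))) (solve Λ 5 0 (λ u j w v p → (u :* j) :* w :* (v :* p) := u :* (v :* j) :* (w :* p)) _ _ _ _ _) ⟩
     U (suc (a ℕ.+ b) ℕ.+ 2 ℕ.* n) * (U (suc (a ℕ.+ b)) * jU (suc (a ℕ.+ b))) * (W (oddℤ a) (from (suc b) l) * prodFrom U (suc (suc (a ℕ.+ b))) l)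
      ≈⟨ *-cong (trans (*-congˡ (U*jU {suc (a ℕ.+ b)} (s≤s z≤n))) (*-identityʳ _)) (trans (*-congˡ (reflexive (cong (λ z → prodFrom U (suc z) l) (≡.sym (+-suc a b)))))
        (trans (W-from a (suc b) l) (reflexive (cong (λ z → prodFrom U (suc z ℕ.+ 2 ℕ.* n) l) (+-suc a b))))) ⟩
     prodFrom U (suc (a ℕ.+ b) ℕ.+ 2 ℕ.* n) (suc l) ∎

    invertible : ∀ a l → 1 ≤ a → ∃ λ k → prodFrom U a l * k ≈ 1#
    invertible a zero h = 1# , *-identityˡ _
    invertible a (suc l) h = let k , e = invertible (suc a) l (s≤s z≤n) in jU a * k , trans (*-interchange _ _ _ _) (trans (*-cong (U*jU h) e) (*-identityˡ _))

    -- A run of 2n + 1 + l consecutive factors is cut once after 2n + 1 and once after l + 1 of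
    -- them; the common piece of l + 1 factors is invertible and drops out.
    row : ∀ a l → (one (oddℤ a) * W (oddℤ a) (from (suc a) l)) * prodFrom U (suc (a ℕ.+ a)) (suc (2 ℕ.* n)) ≈ prodFrom U (suc (a ℕ.+ a) ℕ.+ suc l) (2 ℕ.* n)
    row a l = begin
     X * Y
      ≈⟨ trans (sym (*-identityʳ _)) (*-congˡ (sym e)) ⟩
     (X * Y) * (Z * k)
      ≈⟨ solve Λ 4 0 (λ x y z k → (x :* y) :* (z :* k) := ((x :* z) :* y) :* k) X Y Z k ⟩
     ((X * Z) * Y) * k
      ≈⟨ *-congʳ (trans (*-congʳ XZ) (trans (*-comm _ _) (trans (sym (prodFrom-++ U r (suc (2 ℕ.* n)) l)) (trans (reflexive (cong (prodFrom U r) (lem (2 ℕ.* n) l))) (prodFrom-++ U r (suc l) (2 ℕ.* n)))))) ⟩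
     (Z * prodFrom U (r ℕ.+ suc l) (2 ℕ.* n)) * k
      ≈⟨ trans (xy*z≈xz*y _ _ _) (trans (*-congʳ e) (*-identityˡ _)) ⟩
     prodFrom U (r ℕ.+ suc l) (2 ℕ.* n) ∎
     where
     r : ℕ
     r = suc (a ℕ.+ a)
     X Y Z k : Carrier
     X = one (oddℤ a) * W (oddℤ a) (from (suc a) l)
     Y = prodFrom U r (suc (2 ℕ.* n))
     Z = prodFrom U r (suc l)
     k = proj₁ (invertible r (suc l) (s≤s z≤n))
     e = proj₂ (invertible r (suc l) (s≤s z≤n))
     lem : ∀ t l → suc t ℕ.+ l ≡ suc l ℕ.+ t
     lem = ℕ-ring
     XZ : X * Z ≈ prodFrom U (r ℕ.+ suc (2 ℕ.* n)) l
     XZ = begin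
      (1# * j (oddℤ a ℤ.+ oddℤ a) * W (oddℤ a) (from (suc a) l)) * (U r * prodFrom U (suc r) l)
       ≈⟨ trans (*-congʳ (*-congʳ (*-congˡ (reflexive (cong (λ z → j (+ z)) (doubled a a)))))) (solve Λ 4 0 (λ j w u p → (:1 :* j :* w) :* (u :* p) := (u :* j) :* (w :* p)) _ _ _ _) ⟩
      (U r * jU r) * (W (oddℤ a) (from (suc a) l) * prodFrom U (suc r) l)
       ≈⟨ trans (*-cong (U*jU {r} (s≤s z≤n)) (trans (*-congˡ (reflexive (cong (λ z → prodFrom U (suc z) l) (≡.sym (+-suc a a))))) (W-from a (suc a) l))) (*-identityˡ _) ⟩
      prodFrom U (suc (a ℕ.+ suc a) ℕ.+ 2 ℕ.* n) l
       ≈⟨ reflexive (cong (λ z → prodFrom U z l) (lem′ a (2 ℕ.* n))) ⟩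
      prodFrom U (r ℕ.+ suc (2 ℕ.* n)) l ∎
      where
      lem′ : ∀ a t → suc (a ℕ.+ suc a) ℕ.+ t ≡ suc (a ℕ.+ a) ℕ.+ suc t
      lem′ = ℕ-ring

    One-prodFrom : ∀ {N} a l → N ≤ a → One N (prodFrom U a l)
    One-prodFrom {N} a zero h = One-1 N
    One-prodFrom a (suc l) h = One-* (One-u (ℤ.+≤+ (≤-trans h (m≤m+n a a)))) (One-prodFrom (suc a) l (m≤n⇒m≤1+n h))

    c-from : ∀ N a l → a ℕ.+ l ≡ N → ∃ λ k → c (from a l) * prodFrom (λ a → prodFrom U (suc (a ℕ.+ a)) (suc (2 ℕ.* n))) a l ≈ k × One N k
    c-from N a zero h = 1# , *-identityˡ _ , One-1 N
    c-from N a (suc l) h = let k , e , o = c-from N (suc a) l (≡.trans (≡.sym (+-suc a l)) h) in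
     prodFrom U (suc (a ℕ.+ a) ℕ.+ suc l) (2 ℕ.* n) * k , trans (*-interchange _ _ _ _) (*-cong (row a l) e) ,
     One-* (One-prodFrom (suc (a ℕ.+ a) ℕ.+ suc l) (2 ℕ.* n) (≤-trans (≤-reflexive (≡.sym h)) (+-monoˡ-≤ (suc l) (≤-trans (m≤m+n a a) (n≤1+n _))))) o

    from≡ : ∀ f a l → (∀ i → f i ≡ a ℕ.+ i) → map oddℤ (applyUpTo f l) ≡ from a l
    from≡ f a zero h = ≡.refl
    from≡ f a (suc l) h = cong₂ _∷_ (cong oddℤ (≡.trans (h 0) (ℕₚ.+-identityʳ a))) (from≡ (λ i → f (suc i)) (suc a) l λ i → ≡.trans (h (suc i)) (+-suc a i))

   -- Asymptotically the inverse of the density at the odd exponents. Its factor with index k starts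
   -- at 1 - q^(2k+2), right after row k of `Δ-odds`; in the limit the two make up (q; q)_∞.
   B₁ : ℕ → Carrier
   B₁ N = pk 1 2 N * Π< n (λ k → prodFrom U (suc (suc (k ℕ.+ k))) (N ℕ.+ N))

   private
    two-step : ∀ c n → prodFrom U c (2 ℕ.* n) ≈ Π< n (λ k → U (c ℕ.+ (k ℕ.+ k)) * U (suc (c ℕ.+ (k ℕ.+ k))))
    two-step c zero = refl
    two-step c (suc n) = trans (reflexive (cong (prodFrom U c) (lem n))) (trans (prodFrom-snoc U c _) (trans (*-congˡ (prodFrom-snoc U c _))
     (trans (solve Λ 3 0 (λ a b c → a :* (b :* c) := b :* a :* c) _ _ _) (*-cong (*-cong (U-≡ (cong (c ℕ.+_) (lem₂ n))) (U-≡ (≡.trans (+-suc c _) (cong (λ z → suc (c ℕ.+ z)) (lem₂ n))))) (two-step c n)))))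
     where
     lem : ∀ n → 2 ℕ.* suc n ≡ suc (suc (2 ℕ.* n))
     lem = ℕ-ring
     lem₂ : ∀ n → 2 ℕ.* n ≡ n ℕ.+ n
     lem₂ = ℕ-ring

    -- Each row has 2n + 1 consecutive factors, beginning with an odd exponent. The first factor
    -- goes to (q; q²)_N; the other 2n form n pairs, which lengthen the n runs by two.
    rows≈B₁ : ∀ N → prodFrom (λ a → prodFrom U (suc (a ℕ.+ a)) (suc (2 ℕ.* n))) 0 N ≈ B₁ N
    rows≈B₁ zero = sym (trans (*-identityˡ _) (ones n))
     where
     ones : ∀ n → Π< n (λ _ → 1#) ≈ 1#
     ones zero = refl
     ones (suc n) = trans (*-identityˡ _) (ones n)
    rows≈B₁ (suc N) = begin
     prodFrom (λ a → prodFrom U (suc (a ℕ.+ a)) (suc (2 ℕ.* n))) 0 (suc N)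
      ≈⟨ trans (prodFrom-snoc _ 0 N) (*-congˡ (rows≈B₁ N)) ⟩
     (U (suc (N ℕ.+ N)) * prodFrom U (suc (suc (N ℕ.+ N))) (2 ℕ.* n)) * B₁ N
      ≈⟨ *-congʳ (*-cong (U-≡ (lem N)) (two-step (suc (suc (N ℕ.+ N))) n)) ⟩
     (U (1 ℕ.+ N ℕ.* 2) * Π< n (λ k → U (suc (suc (N ℕ.+ N)) ℕ.+ (k ℕ.+ k)) * U (suc (suc (suc (N ℕ.+ N)) ℕ.+ (k ℕ.+ k))))) * B₁ N
      ≈⟨ trans (*-interchange _ _ _ _) (*-congˡ (trans (sym (Π<-* n _ _)) (Π<-cong n λ k _ → sym (begin
        prodFrom U (suc (suc (k ℕ.+ k))) (suc N ℕ.+ suc N)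
         ≈⟨ reflexive (cong (prodFrom U (suc (suc (k ℕ.+ k)))) (cong suc (+-suc N N))) ⟩
        prodFrom U (suc (suc (k ℕ.+ k))) (suc (suc (N ℕ.+ N)))
         ≈⟨ trans (prodFrom-snoc U (suc (suc (k ℕ.+ k))) (suc (N ℕ.+ N))) (*-congˡ (prodFrom-snoc U (suc (suc (k ℕ.+ k))) (N ℕ.+ N))) ⟩
        U (suc (suc (k ℕ.+ k)) ℕ.+ suc (N ℕ.+ N)) * (U (suc (suc (k ℕ.+ k)) ℕ.+ (N ℕ.+ N)) * prodFrom U (suc (suc (k ℕ.+ k))) (N ℕ.+ N))
         ≈⟨ trans (solve Λ 3 0 (λ a b c → a :* (b :* c) := b :* a :* c) _ _ _) (*-congʳ (*-cong (U-≡ (lem₁ k N)) (U-≡ (lem₂ k N)))) ⟩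
        (U (suc (suc (N ℕ.+ N)) ℕ.+ (k ℕ.+ k)) * U (suc (suc (suc (N ℕ.+ N)) ℕ.+ (k ℕ.+ k)))) * prodFrom U (suc (suc (k ℕ.+ k))) (N ℕ.+ N) ∎)))) ⟩
     B₁ (suc N) ∎
     where
     lem : ∀ N → suc (N ℕ.+ N) ≡ 1 ℕ.+ N ℕ.* 2
     lem = ℕ-ring
     lem₁ : ∀ k N → suc (suc (k ℕ.+ k)) ℕ.+ (N ℕ.+ N) ≡ suc (suc (N ℕ.+ N)) ℕ.+ (k ℕ.+ k)
     lem₁ = ℕ-ring
     lem₂ : ∀ k N → suc (suc (k ℕ.+ k)) ℕ.+ suc (N ℕ.+ N) ≡ suc (suc (suc (N ℕ.+ N)) ℕ.+ (k ℕ.+ k))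
     lem₂ = ℕ-ring

   c-odds : ∀ N → ∃ λ k → c (map oddℤ (upTo N)) * B₁ N ≈ k × One N k
   c-odds N = let k , e , o = c-from N 0 N ≡.refl in
    k , trans (*-cong (reflexive (cong c (from≡ (λ i → i) 0 N λ _ → ≡.refl))) (sym (rows≈B₁ N))) e , o

-- Both systems evaluated in the limit

module Evaluate where

 open Base
 open Solver
 open Signs
 open JSum using (J; tpow; γ; signSum-c)
 open Littlewood using (times; F)
 open Chains using (Xs; ascend; chains; module Move)
 open Columns using (down)
 open Collapse using (times≡*; P)
 open Entries using (ψ)
 open Limit
 open Residues
 open Systems
 open Midpoint
 open Odds
 open Pochhammer

 module _ (R : LRing) where
  open LRing R
  open Seq R

  private
   U′ = U R
   pk′ = pk R
   Π = Π< R
   u-≡ : ∀ {a b} → a ≡ b → u a ≈ u b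
   u-≡ ≡.refl = refl

  infix 4 _≋_
  -- Integrality is carried along because convergence alone is not preserved by products.
  record _≋_ (a b : Sequence) : Set where
   constructor conv
   field
    close     : a ~ b
    integralˡ : ∀ L → Val 0ℤ (a L)
    integralʳ : ∀ L → Val 0ℤ (b L)

  ≋-* : ∀ {a a′ b b′} → a ≋ a′ → b ≋ b′ → (λ L → a L * b L) ≋ (λ L → a′ L * b′ L)
  ≋-* (conv p i i′) (conv q j j′) = conv (~-* (Bounded-O i) (Bounded-O j′) p q) (λ L → Val-* (i L) (j L)) (λ L → Val-* (i′ L) (j′ L))

  ≋-≈ : ∀ {a a′ b} → (∀ L → a L ≈ a′ L) → a ≋ b → a′ ≋ b
  ≋-≈ e (conv p i i′) = conv (~-trans (≈⇒~ λ L → sym (e L)) p) (λ L → Val-≈ (e L) (i L)) i′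

  Π-Val : ∀ n f → (∀ k → Val 0ℤ (f k)) → Val 0ℤ (Π n f)
  Π-Val zero f h = Val-1
  Π-Val (suc n) f h = Val-* (h n) (Π-Val n f h)

  U-Val : ∀ c → Val 0ℤ (U′ c)
  U-Val c = One⇒Val {0} (One-u {0} {+ (c ℕ.+ c)} (ℤ.+≤+ z≤n))

  Π-≋ : ∀ n (f : ℕ → ℕ → Carrier) f′ → (∀ k → k < n → (λ L → f L k) ≋ (λ _ → f′ k)) → (λ L → Π n (f L)) ≋ (λ _ → Π n f′)
  Π-≋ zero f f′ h = conv ~-refl (λ _ → Val-1) (λ _ → Val-1)
  Π-≋ (suc n) f f′ h = ≋-* (h n ≤-refl) (Π-≋ n f f′ λ k l → h k (m<n⇒m<1+n l))

  module _ (inf : ℕ → ℕ → Carrier) (inf-Val : ∀ c d → Val 0ℤ (inf c d))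
   (inf-lim : ∀ c d → 1 ≤ c → 1 ≤ d → ∀ L → Val (+ L) (pk′ c d L - inf c d)) where

   lim : ∀ {c d} → 1 ≤ c → 1 ≤ d → (f : ℕ → ℕ) → (∀ L → L ≤ f L) → (λ L → pk′ c d (f L)) ≋ (λ _ → inf c d)
   lim {c} {d} c≥1 d≥1 f h = conv (λ k → k , λ L l → Val-≤ (ℤ.+≤+ (≤-trans l (h L))) (inf-lim c d c≥1 d≥1 (f L))) (λ L → Π-Val (f L) _ λ i → U-Val (c ℕ.+ i ℕ.* d)) (λ _ → inf-Val c d)

   module _ (m n : ℕ) (n≥1 : 1 ≤ n) where
    open Pair R m n n≥1

    private
     κ : ℕ
     κ = 2 ℕ.* h
     T₂ : ℤ
     T₂ = + κ ℤ.+ + κ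

     n<h : n < h
     n<h = m≤n+m (suc n) m
     h≥1 : 1 ≤ h
     h≥1 = ≤-trans (s≤s z≤n) n<h
     κ≡ : κ ≡ h ℕ.+ h
     κ≡ = cong (h ℕ.+_) (ℕₚ.+-identityʳ h)
     κ≥1 : 1 ≤ κ
     κ≥1 = ≤-trans h≥1 (m≤m+n h _)

     N : ℕ → ℕ
     N L = 2 ℕ.* n ℕ.* L

     N≥ : ∀ L → L ≤ N L
     N≥ L = ≤-trans (≤-reflexive (≡.sym (ℕₚ.*-identityˡ L))) (*-monoˡ-≤ L (≤-trans n≥1 (m≤m+n n _)))

    A : ℕ → Carrier
    A L = Π n (λ k → prodFrom R U′ 1 (suc (k ℕ.+ k))) * B₁ R n (N L)

    A∞ : Carrier
    A∞ = inf 1 2 * Π n (λ _ → inf 1 1)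

    A≋ : A ≋ (λ _ → A∞)
    A≋ = ≋-≈ (λ L → trans (*-congˡ (trans (Π<-cong R n λ k _ → trans (sym (prodFrom≈pk R 1 (suc (k ℕ.+ k) ℕ.+ (N L ℕ.+ N L))))
        ((prodFrom-++ R U′ 1 (suc (k ℕ.+ k)) (N L ℕ.+ N L)))) (Π<-* R n _ _)))
       (x*yz≈y*xz _ _ _))
     (≋-* (lim (s≤s z≤n) (s≤s z≤n) N N≥) (Π-≋ n _ _ λ k _ → lim (s≤s z≤n) (s≤s z≤n) (λ L → suc (k ℕ.+ k) ℕ.+ (N L ℕ.+ N L))
      λ L → ≤-trans (N≥ L) (≤-trans (m≤m+n (N L) (N L)) (m≤n+m _ (suc (k ℕ.+ k))))))

    private
     J≈ : ∀ xs → J qRing T₂ 1# (1# + qʰ) qʰ xs ≈ pk′ h κ (length xs)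
     J≈ [] = refl
     J≈ (x ∷ xs) = *-cong (trans (+-congˡ (-‿cong (trans (*-congˡ (tpow≈ xs)) (trans (sym (E-+ _ _)) (reflexive (cong E (expo (length xs)))))))) refl) (J≈ xs)
      where
      tpow≈ : ∀ l → tpow qRing T₂ l ≈ E (times (length l) (T₂ ℤ.+ T₂))
      tpow≈ [] = sym E-0
      tpow≈ (_ ∷ l) = trans (*-congˡ (tpow≈ l)) (sym (E-+ _ _))
      expo : ∀ k → + κ ℤ.+ + κ ℤ.+ times k (T₂ ℤ.+ T₂) ≡ + ((h ℕ.+ k ℕ.* κ) ℕ.+ (h ℕ.+ k ℕ.* κ)) ℤ.+ + ((h ℕ.+ k ℕ.* κ) ℕ.+ (h ℕ.+ k ℕ.* κ))
      expo k = ≡.trans (cong (ℤ._+_ (+ κ ℤ.+ + κ)) (≡.trans (times≡* k _) (≡.sym (ℤₚ.pos-* k (κ ℕ.+ κ ℕ.+ (κ ℕ.+ κ)))))) (cong +_ (lem h k))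
       where
       lem : ∀ h k → 2 ℕ.* h ℕ.+ 2 ℕ.* h ℕ.+ k ℕ.* (2 ℕ.* h ℕ.+ 2 ℕ.* h ℕ.+ (2 ℕ.* h ℕ.+ 2 ℕ.* h)) ≡ (h ℕ.+ k ℕ.* (2 ℕ.* h)) ℕ.+ (h ℕ.+ k ℕ.* (2 ℕ.* h)) ℕ.+ ((h ℕ.+ k ℕ.* (2 ℕ.* h)) ℕ.+ (h ℕ.+ k ℕ.* (2 ℕ.* h)))
       lem = ℕ-ring

     length-chains : ∀ L as → length (chains qRing (+ κ) L (map +_ as)) ≡ length as ℕ.* (L ℕ.+ L)
     length-chains L [] = ≡.refl
     length-chains L (a ∷ as) = ≡.trans (Listₚ.length-++ (ascend qRing (+ κ) L (Chains.base qRing (+ κ) L (+ a)) (L ℕ.+ L))) (cong₂ ℕ._+_ (len _ (L ℕ.+ L)) (length-chains L as))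
      where
      len : ∀ x l → length (ascend qRing (+ κ) L x l) ≡ l
      len x zero = ≡.refl
      len x (suc l) = cong suc (len (x ℤ.+ T₂) l)

    Jₗ : ℕ → Carrier
    Jₗ L = pk′ h κ (n ℕ.* (L ℕ.+ L))

    B₂ : ℕ → Carrier
    B₂ L = Π n λ k → pk′ (h ∸ suc k) h (L ℕ.+ L) * pk′ (h ℕ.+ suc k) h (L ℕ.+ L) * pk′ κ κ L *
     Π k (λ i → (pk′ (κ ∸ (k ℕ.+ i ℕ.+ 2)) κ L * pk′ (κ ∸ (k ∸ i)) κ L) * (pk′ (κ ℕ.+ (k ∸ i)) κ L * pk′ (κ ℕ.+ (k ℕ.+ i ℕ.+ 2)) κ L))

    private
     Vp : ℕ → Carrier
     Vp c = 1# + E (+ (c ℕ.+ c) ℤ.+ + (c ℕ.+ c))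

     VV : ℕ → ℕ → Carrier
     VV c l = Π l (λ i → Vp (c ℕ.+ i ℕ.* h))

     Vp-inverse : ∀ {c} → 1 ≤ c → ∃ λ k → Vp c * k ≈ 1#
     Vp-inverse {suc c} _ = U′ (suc c) * j (+ (suc c ℕ.+ suc c) ℤ.+ + (suc c ℕ.+ suc c)) ,
      trans (solve Λ 1 1 (λ j x → (:1 :+ :E (x ⊞ x)) :* (:u x :* j) := :u (x ⊞ x) :* j) _ (+ (suc c ℕ.+ suc c))) (u*j λ ())

     VV-inverse : ∀ {c} l → 1 ≤ c → ∃ λ k → VV c l * k ≈ 1#
     VV-inverse zero c≥1 = 1# , *-identityˡ _
     VV-inverse {c} (suc l) c≥1 = let k , e = Vp-inverse {c ℕ.+ l ℕ.* h} (≤-trans c≥1 (m≤m+n c _)) ; k′ , e′ = VV-inverse l c≥1 in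
      k * k′ , trans (*-interchange _ _ _ _) (trans (*-cong e e′) (*-identityˡ _))

     -- From 1 - q^(2c) = (1 - q^c)(1 + q^c), as κ = 2h. This is where the base q^h of the first
     -- product comes from; the factors 1 + q^c cancel against the values of `g₂`.
     pk-double : ∀ c l → pk′ (c ℕ.+ c) κ l ≈ pk′ c h l * VV c l
     pk-double c zero = sym (*-identityˡ _)
     pk-double c (suc l) = trans (*-cong (trans (U-≡ R (lem c h l)) (solve Λ 0 1 (λ x → :u (x ⊞ x) := :u x :* (:1 :+ :E (x ⊞ x))) (+ ((c ℕ.+ l ℕ.* h) ℕ.+ (c ℕ.+ l ℕ.* h))))) (pk-double c l)) (*-interchange _ _ _ _)
      where
      lem : ∀ c h l → (c ℕ.+ c) ℕ.+ l ℕ.* (2 ℕ.* h) ≡ (c ℕ.+ l ℕ.* h) ℕ.+ (c ℕ.+ l ℕ.* h)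
      lem = ℕ-ring

     open Weights qRing T₂ using (prodOver; prodOver-++)

     -- At X = q^c the numerator is (1 + q^c)(1 + q^(c+h)), and the next element is q^(c+2h); the
     -- binomials interleave to one progression of step h.
     g₂-asc : ∀ L x c l → x ≡ + (c ℕ.+ c) → prodOver g₂ (ascend qRing (+ κ) L x l) ≈ VV c (l ℕ.+ l)
     g₂-asc L x c zero e = refl
     g₂-asc L x c (suc l) ≡.refl = begin
      g₂ x * prodOver g₂ (ascend qRing (+ κ) L (x ℤ.+ T₂) l)
       ≈⟨ *-cong factor (g₂-asc L (x ℤ.+ T₂) (c ℕ.+ h ℕ.+ h) l (cong +_ (lem c h))) ⟩
      Vp c * Vp (c ℕ.+ h) * VV (c ℕ.+ h ℕ.+ h) (l ℕ.+ l)
       ≈⟨ *-assoc _ _ _ ⟩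
      Vp c * (Vp (c ℕ.+ h) * VV (c ℕ.+ h ℕ.+ h) (l ℕ.+ l))
       ≈⟨ *-congˡ (sym (cons (c ℕ.+ h) (l ℕ.+ l))) ⟩
      Vp c * VV (c ℕ.+ h) (suc (l ℕ.+ l))
       ≈⟨ sym (cons c (suc (l ℕ.+ l))) ⟩
      VV c (suc (suc (l ℕ.+ l)))
       ≈⟨ reflexive (cong (VV c) (cong suc (≡.sym (+-suc l l)))) ⟩
      VV c (suc l ℕ.+ suc l) ∎
      where
      open ≈-Reasoning
      lem : ∀ c h → c ℕ.+ c ℕ.+ (2 ℕ.* h ℕ.+ 2 ℕ.* h) ≡ (c ℕ.+ h ℕ.+ h) ℕ.+ (c ℕ.+ h ℕ.+ h)
      lem = ℕ-ring
      cons : ∀ c k → VV c (suc k) ≈ Vp c * VV (c ℕ.+ h) k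
      cons c k = trans (Π<-cons R k _) (*-cong (reflexive (cong Vp (ℕₚ.+-identityʳ c))) (Π<-cong R k λ i _ → reflexive (cong Vp (≡.sym (ℕₚ.+-assoc c h (i ℕ.* h))))))
      factor : g₂ x ≈ Vp c * Vp (c ℕ.+ h)
      factor = trans (solve Λ 0 2 (λ x H → :1 :+ (:1 :+ :E (H ⊞ H)) :* :X x :+ :E (H ⊞ H) :* (:X x :* :X x) := (:1 :+ :E (x ⊞ x)) :* (:1 :+ :E ((x ⊞ H) ⊞ (x ⊞ H)))) x (+ κ))
       (*-congˡ (reflexive (cong (λ z → 1# + E (+ z ℤ.+ + z)) (lem₁ c h))))
       where
       lem₁ : ∀ c h → c ℕ.+ c ℕ.+ 2 ℕ.* h ≡ (c ℕ.+ h) ℕ.+ (c ℕ.+ h)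
       lem₁ = ℕ-ring

     module _ (L : ℕ) where
      Pm : ℤ → ℕ → Carrier
      Pm = P′ R κ L g₂ (ψ R 1)

      P≈pk : ∀ d c k → d ℤ.+ T₂ ≡ + (c ℕ.+ c) → Pm d k ≈ pk′ c κ k
      P≈pk d c zero e = refl
      P≈pk d c (suc k) e = *-cong (u-≡ (≡.trans (≡.sym (ℤₚ.+-assoc d T₂ _)) (≡.trans (cong₂ ℤ._+_ e (≡.trans (times≡* k T₂) (≡.sym (ℤₚ.pos-* k (κ ℕ.+ κ))))) (cong +_ (lem c k κ))))) (P≈pk d c k e)
       where
       lem : ∀ c k κ → c ℕ.+ c ℕ.+ k ℕ.* (κ ℕ.+ κ) ≡ (c ℕ.+ k ℕ.* κ) ℕ.+ (c ℕ.+ k ℕ.* κ)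
       lem = ℕ-ring

      plus : ∀ {d} x → d ≡ + (x ℕ.+ x) → d ℤ.+ T₂ ≡ + ((κ ℕ.+ x) ℕ.+ (κ ℕ.+ x))
      plus x ≡.refl = cong +_ (lem x κ)
       where
       lem : ∀ x κ → x ℕ.+ x ℕ.+ (κ ℕ.+ κ) ≡ (κ ℕ.+ x) ℕ.+ (κ ℕ.+ x)
       lem = ℕ-ring

      minus : ∀ {d} x → x ≤ κ → d ≡ ℤ.- + (x ℕ.+ x) → d ℤ.+ T₂ ≡ + ((κ ∸ x) ℕ.+ (κ ∸ x))
      minus x x≤ ≡.refl = ≡.trans (cong (λ z → ℤ.- + (x ℕ.+ x) ℤ.+ + (z ℕ.+ z)) (≡.sym (m∸n+n≡m x≤))) (lem (+ (κ ∸ x)) (+ x))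
       where
       lem : ∀ y x → ℤ.- (x ℤ.+ x) ℤ.+ (y ℤ.+ x ℤ.+ (y ℤ.+ x)) ≡ y ℤ.+ y
       lem = ℤ-ring

      even≡ : ∀ k → even k ≡ suc k ℕ.+ suc k
      even≡ k = dbl≡ (suc k)

      even-sum : ∀ k i → + even k ℤ.+ + even i ≡ + ((k ℕ.+ i ℕ.+ 2) ℕ.+ (k ℕ.+ i ℕ.+ 2))
      even-sum k i = cong +_ (≡.trans (cong₂ ℕ._+_ (even≡ k) (even≡ i)) (lem k i))
       where
       lem : ∀ k i → suc k ℕ.+ suc k ℕ.+ (suc i ℕ.+ suc i) ≡ (k ℕ.+ i ℕ.+ 2) ℕ.+ (k ℕ.+ i ℕ.+ 2)
       lem = ℕ-ring

      even-diff : ∀ {k i} → i ≤ k → + even k ℤ.- + even i ≡ + ((k ∸ i) ℕ.+ (k ∸ i))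
      even-diff {k} {i} l = ≡.trans (cong₂ (λ a b → + a ℤ.- + b) (≡.trans (even≡ k) (≡.trans (cong (λ z → suc z ℕ.+ suc z) (≡.sym (m∸n+n≡m l))) (lem₁ (k ∸ i) i))) (even≡ i))
       (lem₂ (+ ((k ∸ i) ℕ.+ (k ∸ i))) (+ (suc i ℕ.+ suc i)))
       where
       lem₁ : ∀ a i → suc (a ℕ.+ i) ℕ.+ suc (a ℕ.+ i) ≡ a ℕ.+ a ℕ.+ (suc i ℕ.+ suc i)
       lem₁ = ℕ-ring
       lem₂ : ∀ a b → a ℤ.+ b ℤ.- b ≡ a
       lem₂ = ℤ-ring

      k+i+2≤κ : ∀ {k i} → k < n → i < k → k ℕ.+ i ℕ.+ 2 ≤ κ
      k+i+2≤κ {k} {i} k<n i<k = ≤-trans (≤-reflexive (lem k i)) (≤-trans (+-mono-≤ (≤-trans k<n (<⇒≤ n<h)) (≤-trans i<k (≤-trans (<⇒≤ k<n) (<⇒≤ n<h)))) (≤-reflexive (≡.sym κ≡)))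
       where
       lem : ∀ k i → k ℕ.+ i ℕ.+ 2 ≡ suc k ℕ.+ suc i
       lem = ℕ-ring

      pairs≈ : ∀ k j → k < n → j ≤ k → pairDens R κ L g₂ (ψ R 1) (even k) (evens j) ≈
       Π j (λ i → (pk′ (κ ∸ (k ℕ.+ i ℕ.+ 2)) κ L * pk′ (κ ∸ (k ∸ i)) κ L) * (pk′ (κ ℕ.+ (k ∸ i)) κ L * pk′ (κ ℕ.+ (k ℕ.+ i ℕ.+ 2)) κ L))
      pairs≈ k zero k<n l = refl
      pairs≈ k (suc i) k<n l = *-cong (*-cong
        (*-cong (P≈pk _ (κ ∸ (k ℕ.+ i ℕ.+ 2)) L (minus (k ℕ.+ i ℕ.+ 2) (k+i+2≤κ k<n l) (≡.trans (lem₁ (+ even k) (+ even i)) (cong (λ z → ℤ.- z) (even-sum k i)))))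
         (P≈pk _ (κ ∸ (k ∸ i)) L (minus (k ∸ i) (≤-trans (m∸n≤m k i) (≤-trans (≤-trans (m≤m+n k i) (m≤m+n _ 2)) (k+i+2≤κ k<n l))) (≡.trans (lem₂ (+ even k) (+ even i)) (cong (λ z → ℤ.- z) (even-diff (<⇒≤ l)))))))
        (*-cong (P≈pk _ (κ ℕ.+ (k ∸ i)) L (plus (k ∸ i) (even-diff (<⇒≤ l)))) (P≈pk _ (κ ℕ.+ (k ℕ.+ i ℕ.+ 2)) L (plus (k ℕ.+ i ℕ.+ 2) (even-sum k i)))))
       (pairs≈ k i k<n (<⇒≤ l))
       where
       lem₁ : ∀ a b → ℤ.- a ℤ.- b ≡ ℤ.- (a ℤ.+ b)
       lem₁ = ℤ-ring
       lem₂ : ∀ a b → ℤ.- a ℤ.+ b ≡ ℤ.- (a ℤ.- b)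
       lem₂ = ℤ-ring

      j<h : ∀ {k} → k < n → suc k < h
      j<h k<n = ≤-<-trans k<n n<h

      double-minus : ∀ {x} → x ≤ h → κ ∸ (x ℕ.+ x) ≡ (h ∸ x) ℕ.+ (h ∸ x)
      double-minus {x} l = ≡.trans (cong (_∸ (x ℕ.+ x)) (≡.trans κ≡ (≡.trans (cong (λ z → z ℕ.+ z) (≡.sym (m∸n+n≡m l))) (lem (h ∸ x) x)))) (m+n∸n≡m _ (x ℕ.+ x))
       where
       lem : ∀ y x → y ℕ.+ x ℕ.+ (y ℕ.+ x) ≡ y ℕ.+ y ℕ.+ (x ℕ.+ x)
       lem = ℕ-ring

      double-plus : ∀ x → κ ℕ.+ (x ℕ.+ x) ≡ (h ℕ.+ x) ℕ.+ (h ℕ.+ x)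
      double-plus x = lem h x
       where
       lem : ∀ h x → 2 ℕ.* h ℕ.+ (x ℕ.+ x) ≡ (h ℕ.+ x) ℕ.+ (h ℕ.+ x)
       lem = ℕ-ring

      2j≤κ : ∀ {k} → k < n → even k ≤ κ
      2j≤κ {k} k<n = ≤-trans (≤-reflexive (even≡ k)) (≤-trans (+-mono-≤ (<⇒≤ (j<h k<n)) (<⇒≤ (j<h k<n))) (≤-reflexive (≡.sym κ≡)))

      self≈ : ∀ k → k < n → selfDen R κ L g₂ (ψ R 1) (even k) ≈ (pk′ (h ∸ suc k) h (L ℕ.+ L) * pk′ (h ℕ.+ suc k) h (L ℕ.+ L) * pk′ κ κ L) * (VV (h ∸ suc k) (L ℕ.+ L) * VV (h ℕ.+ suc k) (L ℕ.+ L))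
      self≈ k k<n = trans (*-cong (*-cong
        (trans (P≈pk _ (κ ∸ even k) (L ℕ.+ L) (minus (even k) (2j≤κ k<n) ≡.refl)) (trans (reflexive (cong (λ z → pk′ z κ (L ℕ.+ L)) (≡.trans (cong (κ ∸_) (even≡ k)) (double-minus (<⇒≤ (j<h k<n)))))) (pk-double (h ∸ suc k) (L ℕ.+ L))))
        (trans (P≈pk _ (κ ℕ.+ even k) (L ℕ.+ L) (plus (even k) ≡.refl)) (trans (reflexive (cong (λ z → pk′ z κ (L ℕ.+ L)) (≡.trans (cong (κ ℕ.+_) (even≡ k)) (double-plus (suc k))))) (pk-double (h ℕ.+ suc k) (L ℕ.+ L)))))
        (P≈pk 0ℤ κ L (ℤₚ.+-identityˡ _)))
       (solve Λ 5 0 (λ a b c d e → (a :* b) :* (c :* d) :* e := (a :* c :* e) :* (b :* d)) _ _ _ _ _)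

      VVs : ℕ → Carrier
      VVs j = Π j (λ k → VV (h ∸ suc k) (L ℕ.+ L) * VV (h ℕ.+ suc k) (L ℕ.+ L))

      B₂′ : ℕ → Carrier
      B₂′ j = Π j λ k → pk′ (h ∸ suc k) h (L ℕ.+ L) * pk′ (h ℕ.+ suc k) h (L ℕ.+ L) * pk′ κ κ L *
       Π k (λ i → (pk′ (κ ∸ (k ℕ.+ i ℕ.+ 2)) κ L * pk′ (κ ∸ (k ∸ i)) κ L) * (pk′ (κ ℕ.+ (k ∸ i)) κ L * pk′ (κ ℕ.+ (k ℕ.+ i ℕ.+ 2)) κ L))

      Den≈ : ∀ j → j ≤ n → Den R κ L g₂ (ψ R 1) (evens j) ≈ B₂′ j * VVs j
      Den≈ zero l = sym (*-identityˡ _)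
      Den≈ (suc k) l = trans (*-cong (*-cong (self≈ k l) (pairs≈ k k l ≤-refl)) (Den≈ k (<⇒≤ l)))
       (solve Λ 5 0 (λ s v p b w → (s :* v) :* p :* (b :* w) := (s :* p :* b) :* (v :* w)) _ _ _ _ _)

      g₂-Zs : ∀ j → j ≤ n → prodOver g₂ (Zs R κ L (evens j)) ≈ VVs j
      g₂-Zs zero l = refl
      g₂-Zs (suc k) l = trans (prodOver-++ g₂ (zs R κ L (even k)) _) (*-cong (trans (prodOver-++ g₂ (ascend qRing (+ κ) L (+ κ ℤ.- + even k) L) _)
       (*-cong (g₂-asc L _ (h ∸ suc k) L start⁻) (g₂-asc L _ (h ℕ.+ suc k) L (cong +_ (≡.trans (cong (κ ℕ.+_) (even≡ k)) (double-plus (suc k))))))) (g₂-Zs k (<⇒≤ l)))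
       where
       start⁻ : + κ ℤ.- + even k ≡ + ((h ∸ suc k) ℕ.+ (h ∸ suc k))
       start⁻ = ≡.trans (≡.trans (ℤₚ.[+m]-[+n]≡m⊖n κ (even k)) (ℤₚ.⊖-≥ (2j≤κ l))) (cong +_ (≡.trans (cong (κ ∸_) (even≡ k)) (double-minus (<⇒≤ (j<h l)))))

      VVs-inverse : ∀ j → j ≤ n → ∃ λ k → VVs j * k ≈ 1#
      VVs-inverse zero l = 1# , *-identityˡ _
      VVs-inverse (suc k) l = let a , e = VV-inverse {h ∸ suc k} (L ℕ.+ L) (m<n⇒0<n∸m (j<h l)) ; b , e′ = VV-inverse {h ℕ.+ suc k} (L ℕ.+ L) (≤-trans h≥1 (m≤m+n h _)) ; d , e″ = VVs-inverse k (<⇒≤ l) in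
       (a * b) * d , trans (*-interchange _ _ _ _) (trans (*-cong (trans (*-interchange _ _ _ _) (trans (*-cong e e′) (*-identityˡ _))) e″) (*-identityˡ _))

     c-B₂ : ∀ L → ∃ λ k → Weights.Density.c qRing T₂ g₂ (S₂.X₀ compatible₂ L) * B₂ L ≈ k × One L k
     c-B₂ L = k , (begin
      cₘ * B₂ L
       ≈⟨ trans (sym (*-identityʳ _)) (*-congˡ (sym (proj₂ inv))) ⟩
      cₘ * B₂ L * (VVs L n * proj₁ inv)
       ≈⟨ solve Λ 4 0 (λ c b v i → c :* b :* (v :* i) := (c :* (b :* v)) :* i) _ _ _ _ ⟩
      cₘ * (B₂ L * VVs L n) * proj₁ inv
       ≈⟨ *-congʳ (trans (*-congˡ (sym (Den≈ L n ≤-refl))) (trans e (*-congʳ (g₂-Zs L n ≤-refl)))) ⟩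
      VVs L n * k * proj₁ inv
       ≈⟨ trans (xy*z≈xz*y _ _ _) (trans (*-congʳ (proj₂ inv)) (*-identityˡ _)) ⟩
      k ∎) , o
      where
      open ≈-Reasoning
      cₘ = Weights.Density.c qRing T₂ g₂ (S₂.X₀ compatible₂ L)
      inv = VVs-inverse L n ≤-refl
      below : All (_< κ) (evens n)
      below = All.tabulate λ m → ≤-<-trans (m≤m+n _ _) (bound m)
       where
       bound : ∀ {a} → a ∈ evens n → a ℕ.+ 0 < κ
       bound {a} m = subst (_< κ) (≡.sym (ℕₚ.+-identityʳ a)) (half (Spread.small (evens-spread n h n<h) m m))
        where
        half : ∀ {a} → a ℕ.+ a < κ ℕ.+ κ → a < κ
        half {a} l with a ℕ.<? κ
        ... | yes p = p
        ... | no ¬p = ⊥-elim (ℕₚ.<⇒≱ l (+-mono-≤ (≮⇒≥ ¬p) (≮⇒≥ ¬p)))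
      mid = c-mid R κ L g₂ (ψ R 1) κ≥1 (evens n) below
      k = proj₁ mid
      e = proj₁ (proj₂ mid)
      o = proj₂ (proj₂ mid)

    Rhs : ℕ → Carrier
    Rhs L = Jₗ L * (Π n (λ k → U′ (suc k) * Π k (λ i → U′ (k ℕ.+ i ℕ.+ 2) * U′ (k ∸ i))) * B₂ L)

    Rhs∞ : Carrier
    Rhs∞ = inf h κ * Π n (λ k → inf (h ∸ suc k) h * inf (suc k) h * inf κ κ *
     Π k (λ i → (inf (κ ∸ (k ℕ.+ i ℕ.+ 2)) κ * inf (κ ∸ (k ∸ i)) κ) * (inf (k ∸ i) κ * inf (k ℕ.+ i ℕ.+ 2) κ)))

    -- The factors from the Weyl denominator are the missing first ones: 1 - q^c times (q^(κ+c);
    -- q^κ)_L is (q^c; q^κ)_(L+1), and likewise for the base q^h.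
    Rhs≋ : Rhs ≋ (λ _ → Rhs∞)
    Rhs≋ = ≋-* (lim h≥1 κ≥1 (λ L → n ℕ.* (L ℕ.+ L)) λ L → ≤-trans (m≤m+n L L) (≤-trans (≤-reflexive (≡.sym (ℕₚ.*-identityˡ _))) (*-monoˡ-≤ (L ℕ.+ L) n≥1)))
     (≋-≈ (λ L → Π<-* R n _ _) (Π-≋ n _ _ λ k k<n → ≋-≈
       (λ L → trans (*-congˡ (Π<-* R k _ _)) (solve Λ 6 0 (λ u a b c p q → (a :* (u :* b) :* c) :* (p :* q) := (u :* p) :* (a :* b :* c :* q)) _ _ _ _ _ _))
       (≋-* (≋-* (≋-* (lim (m<n⇒0<n∸m (≤-<-trans k<n n<h)) h≥1 (λ L → L ℕ.+ L) L≤)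
         (≋-≈ (λ L → trans (pk-cons R (suc k) h (L ℕ.+ L)) (*-congˡ (reflexive (cong (λ c → pk′ c h (L ℕ.+ L)) (ℕₚ.+-comm (suc k) h))))) (lim (s≤s z≤n) h≥1 (λ L → suc (L ℕ.+ L)) λ L → m≤n⇒m≤1+n (L≤ L))))
         (lim κ≥1 κ≥1 (λ L → L) λ _ → ≤-refl))
        (Π-≋ k _ _ λ i i<k → ≋-≈
         (λ L → solve Λ 6 0 (λ u v a b c d → (a :* b) :* ((v :* c) :* (u :* d)) := (u :* v) :* ((a :* b) :* (c :* d))) _ _ _ _ _ _)
         (≋-* (≋-* (lim (m<n⇒0<n∸m (<-≤-trans (k+i+2< k<n i<k) ≤-refl)) κ≥1 (λ L → L) λ _ → ≤-refl)
            (lim (m<n⇒0<n∸m (≤-<-trans (≤-trans (m∸n≤m k i) (≤-trans (m≤m+n k i) (m≤m+n _ 2))) (k+i+2< k<n i<k))) κ≥1 (λ L → L) λ _ → ≤-refl))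
          (≋-* (step (k ∸ i) (m<n⇒0<n∸m i<k)) (step (k ℕ.+ i ℕ.+ 2) (≤-trans (s≤s z≤n) (m≤n+m 2 (k ℕ.+ i))))))))))
     where
     L≤ : ∀ L → L ≤ L ℕ.+ L
     L≤ L = m≤m+n L L
     k+i+2< : ∀ {k i} → k < n → i < k → k ℕ.+ i ℕ.+ 2 < κ
     k+i+2< {k} {i} k<n i<k = ≤-<-trans (≤-reflexive (lem k i)) (<-≤-trans (ℕₚ.+-mono-≤-< (≤-trans k<n (<⇒≤ n<h)) (≤-<-trans i<k (<-trans k<n n<h))) (≤-reflexive (≡.sym κ≡)))
      where
      lem : ∀ k i → k ℕ.+ i ℕ.+ 2 ≡ suc k ℕ.+ suc i
      lem = ℕ-ring
     step : ∀ c → 1 ≤ c → (λ L → U′ c * pk′ (κ ℕ.+ c) κ L) ≋ (λ _ → inf c κ)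
     step c c≥1 = ≋-≈ (λ L → trans (pk-cons R c κ L) (*-congˡ (reflexive (cong (λ z → pk′ z κ L) (ℕₚ.+-comm c κ))))) (lim c≥1 κ≥1 suc λ L → n≤1+n L)

    private
     δ : ℕ → ℤ
     δ = exponent-Δ R (+ 0) 0 (λ _ → 1#) 0
     Ed Ed⁻¹ : Carrier
     Ed   = Π n (λ k → E (δ k))
     Ed⁻¹ = Π n (λ k → E (ℤ.- δ k))

     Ed-inverse : ∀ n → Π n (λ k → E (δ k)) * Π n (λ k → E (ℤ.- δ k)) ≈ 1#
     Ed-inverse zero = *-identityˡ _
     Ed-inverse (suc n) = trans (*-interchange _ _ _ _) (trans (*-cong (solve Λ 0 1 (λ a → :E a :* :E (⊟ a) := :1) _) (Ed-inverse n)) (*-identityˡ _))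

     Ed⁻¹-Bounded : ∀ n → Bounded (λ _ → Π n (λ k → E (ℤ.- δ k)))
     Ed⁻¹-Bounded zero = Bounded-O λ _ → Val-1
     Ed⁻¹-Bounded (suc n) = Bounded-* (Bounded-E _) (Ed⁻¹-Bounded n)

     One-close : ∀ {D} (k : ℕ → Carrier) → (∀ L → One L (k L)) → Bounded D → (λ L → k L * D L) ~ D
     One-close k o B = ~-trans (~-* (Bounded-O λ L → One⇒Val (o L)) B (One⇒~ (λ L → L) (λ k → k , λ _ l → l) o) ~-refl) (≈⇒~ λ L → *-identityˡ _)

     Fₗ : ℕ → Carrier
     Fₗ L = F qRing (+ (2 ℕ.* n) ℤ.+ + (2 ℕ.* n)) m (V R n L n≥1)

     left : ∀ L → ∃ λ k → Fₗ L * (Ed * A L) ≈ k * S₁.D L × One L k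
     left L = let k , e , o = c-odds R n (N L) in k , (begin
      Fₗ L * (Ed * A L)
       ≈⟨ solve Λ 4 0 (λ f e p b → f :* (e :* (p :* b)) := f :* (e :* p) :* b) _ _ _ _ ⟩
      Fₗ L * (Ed * Π n (λ k → prodFrom R U′ 1 (suc (k ℕ.+ k)))) * B₁ R n (N L)
       ≈⟨ *-congʳ (trans (*-congˡ (sym (Δ-odds R (+ (2 ℕ.* n)) L g₁ h n))) (F-det R n L n≥1 m)) ⟩
      Weights.Density.c qRing (+ (2 ℕ.* n) ℤ.+ + (2 ℕ.* n)) (λ _ → 1#) (V R n L n≥1) * S₁.D L * B₁ R n (N L)
       ≈⟨ xy*z≈xz*y _ _ _ ⟩
      Weights.Density.c qRing (+ (2 ℕ.* n) ℤ.+ + (2 ℕ.* n)) (λ _ → 1#) (V R n L n≥1) * B₁ R n (N L) * S₁.D L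
       ≈⟨ *-congʳ e ⟩
      k * S₁.D L ∎) , One-≤ (N≥ L) o
      where open ≈-Reasoning

     -- The sign sum over the second chains is computed in two ways: in closed form by `signSum-c`,
     -- and as a determinant by the collapse.
     right : ∀ L → ∃ λ k → Ed * Rhs L ≈ k * S₂.D L × One L k
     right L = let k , e , o = c-B₂ L in k , (begin
      Ed * Rhs L
       ≈⟨ solve Λ 4 0 (λ e j p b → e :* (j :* (p :* b)) := j :* (e :* p) :* b) _ _ _ _ ⟩
      Jₗ L * (Ed * Π n (λ k → U′ (suc k) * Π k (λ i → U′ (k ℕ.+ i ℕ.+ 2) * U′ (k ∸ i)))) * B₂ L
       ≈⟨ *-congʳ (*-cong (trans (reflexive (cong (pk′ h κ) (≡.sym (≡.trans (length-chains L (evens n)) (cong (ℕ._* (L ℕ.+ L)) (≡.trans (Listₚ.length-map even (down n)) (length-down n)))))))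
         (sym (trans (signSum-c qRing T₂ 1# (1# + qʰ) qʰ (chains qRing (+ κ) L (map +_ (evens n))) (chains-good qRing κ L (evens-spread n h n<h))) (J≈ (chains qRing (+ κ) L (map +_ (evens n)))))))
         (sym (Δ-evens R (+ κ) L g₂ n n))) ⟩
      SignSum.signSum Λ (Weights.Density.c qRing T₂ g₂) (chains qRing (+ κ) L (map +_ (evens n))) * S₂.Δ₀ compatible₂ L * B₂ L
       ≈⟨ *-congʳ (S₂.collapse compatible₂ L) ⟩
      Weights.Density.c qRing T₂ g₂ (S₂.X₀ compatible₂ L) * S₂.D L * B₂ L
       ≈⟨ xy*z≈xz*y _ _ _ ⟩
      Weights.Density.c qRing T₂ g₂ (S₂.X₀ compatible₂ L) * B₂ L * S₂.D L
       ≈⟨ *-congʳ e ⟩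
      k * S₂.D L ∎) , o
      where open ≈-Reasoning

    -- Multiplied by the monomial `Ed`, both sides are asymptotic to the two determinants, which are
    -- asymptotic to each other. `Ed` does not vary with L and is invertible, so it can be divided
    -- out.
    F-limit : ∀ f → (λ L → F qRing (+ (2 ℕ.* n) ℤ.+ + (2 ℕ.* n)) m (V R n L n≥1)) ≋ (λ _ → f) → f * A∞ ≈ Rhs∞
    F-limit f F≋f = ~-constant (~-trans (~-sym (_≋_.close (≋-* F≋f A≋))) (~-trans (~-trans (unit _)
      (~-*ˡ (Ed⁻¹-Bounded n) (~-trans (≈⇒~ λ L → trans (x*yz≈y*xz _ _ _) (proj₁ (proj₂ (left L))))
       (~-trans (One-close (λ L → proj₁ (left L)) (λ L → proj₂ (proj₂ (left L))) S₁.D-Bounded) (~-trans D₁~D₂ (~-trans (~-sym (One-close (λ L → proj₁ (right L)) (λ L → proj₂ (proj₂ (right L))) S₂.D-Bounded))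
        (≈⇒~ λ L → sym (proj₁ (proj₂ (right L))))))))))
      (~-trans (~-sym (unit _)) (_≋_.close Rhs≋))))
     where
     unit : ∀ a → a ~ (λ L → Ed⁻¹ * (Ed * a L))
     unit a = ≈⇒~ λ L → sym (trans (solve Λ 3 0 (λ i e a → i :* (e :* a) := (e :* i) :* a) _ _ _) (trans (*-congʳ (Ed-inverse n)) (*-identityˡ _)))

-- Laurent series in a fourth root of q

module Laurent where

 open Defs
 open Base
 open Solver

 tail : Series → Series
 tail f k = f (suc k)

 -- The Cauchy product by recursion on the degree; the ring laws are proved in this form by
 -- induction and carried over to `⊗`.
 conv : Series → Series → ℕ → ℤ
 conv f g zero    = f 0 ℤ.* g 0
 conv f g (suc k) = f 0 ℤ.* g (suc k) ℤ.+ conv (tail f) g k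

 ⊗≡conv : ∀ f g k → (f ⊗ g) k ≡ conv f g k
 ⊗≡conv f g k = ≡.trans (cong sumℤ (map-upTo (λ i → f i ℤ.* g (k ∸ i)) (λ i → i) (suc k))) (sum≡ f g k)
  where
  map-upTo : ∀ (F : ℕ → ℤ) (h : ℕ → ℕ) n → map F (applyUpTo h n) ≡ applyUpTo (λ i → F (h i)) n
  map-upTo F h zero = ≡.refl
  map-upTo F h (suc n) = cong (F (h 0) ∷_) (map-upTo F (λ i → h (suc i)) n)
  sum≡ : ∀ f g k → sumℤ (applyUpTo (λ i → f i ℤ.* g (k ∸ i)) (suc k)) ≡ conv f g k
  sum≡ f g zero = ℤₚ.+-identityʳ _
  sum≡ f g (suc k) = cong (ℤ._+_ (f 0 ℤ.* g (suc k))) (sum≡ (tail f) g k)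

 private
  conv-cong : ∀ {f f′ g g′} → f ≈S f′ → g ≈S g′ → ∀ k → conv f g k ≡ conv f′ g′ k
  conv-cong p q zero = cong₂ ℤ._*_ (p 0) (q 0)
  conv-cong p q (suc k) = cong₂ ℤ._+_ (cong₂ ℤ._*_ (p 0) (q (suc k))) (conv-cong (λ i → p (suc i)) q k)

  conv-snoc : ∀ f g k → conv f g (suc k) ≡ conv f (tail g) k ℤ.+ f (suc k) ℤ.* g 0
  conv-snoc f g zero = ≡.refl
  conv-snoc f g (suc k) = ≡.trans (cong (ℤ._+_ (f 0 ℤ.* g (suc (suc k)))) (conv-snoc (tail f) g k)) (≡.sym (ℤₚ.+-assoc (f 0 ℤ.* g (suc (suc k))) _ _))

  conv-comm : ∀ f g k → conv f g k ≡ conv g f k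
  conv-comm f g zero = ℤₚ.*-comm (f 0) (g 0)
  conv-comm f g (suc k) = ≡.trans (conv-snoc f g k) (≡.trans (cong₂ ℤ._+_ (conv-comm f (tail g) k) (ℤₚ.*-comm (f (suc k)) (g 0))) (ℤₚ.+-comm (conv (tail g) f k) _))

  conv-distribʳ : ∀ f g h k → conv (f ⊕ g) h k ≡ conv f h k ℤ.+ conv g h k
  conv-distribʳ f g h zero = ℤₚ.*-distribʳ-+ (h 0) (f 0) (g 0)
  conv-distribʳ f g h (suc k) = ≡.trans (cong (ℤ._+_ ((f 0 ℤ.+ g 0) ℤ.* h (suc k))) (conv-distribʳ (tail f) (tail g) h k))
   (lem (f 0) (g 0) (h (suc k)) (conv (tail f) h k) (conv (tail g) h k))
   where
   lem : ∀ a b c d e → (a ℤ.+ b) ℤ.* c ℤ.+ (d ℤ.+ e) ≡ (a ℤ.* c ℤ.+ d) ℤ.+ (b ℤ.* c ℤ.+ e)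
   lem = ℤ-ring

  conv-scale : ∀ a f g k → conv (λ i → a ℤ.* f i) g k ≡ a ℤ.* conv f g k
  conv-scale a f g zero = ℤₚ.*-assoc a (f 0) (g 0)
  conv-scale a f g (suc k) = ≡.trans (cong (ℤ._+_ (a ℤ.* f 0 ℤ.* g (suc k))) (conv-scale a (tail f) g k)) (lem a (f 0) (g (suc k)) (conv (tail f) g k))
   where
   lem : ∀ a b c d → a ℤ.* b ℤ.* c ℤ.+ a ℤ.* d ≡ a ℤ.* (b ℤ.* c ℤ.+ d)
   lem = ℤ-ring

  conv-assoc : ∀ f g h k → conv (conv f g) h k ≡ conv f (conv g h) k
  conv-assoc f g h zero = ℤₚ.*-assoc (f 0) (g 0) (h 0)
  conv-assoc f g h (suc k) = ≡.trans (cong (ℤ._+_ (f 0 ℤ.* g 0 ℤ.* h (suc k))) (≡.trans (conv-distribʳ (λ i → f 0 ℤ.* tail g i) (conv (tail f) g) h k)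
    (cong₂ ℤ._+_ (conv-scale (f 0) (tail g) h k) (conv-assoc (tail f) g h k))))
   (lem (f 0) (g 0) (h (suc k)) (conv (tail g) h k) (conv (tail f) (conv g h) k))
   where
   lem : ∀ a b c d e → a ℤ.* b ℤ.* c ℤ.+ (a ℤ.* d ℤ.+ e) ≡ a ℤ.* (b ℤ.* c ℤ.+ d) ℤ.+ e
   lem = ℤ-ring

  conv-0 : ∀ g k → conv 0S g k ≡ 0ℤ
  conv-0 g zero = ℤₚ.*-zeroˡ (g 0)
  conv-0 g (suc k) = cong₂ ℤ._+_ (ℤₚ.*-zeroˡ (g (suc k))) (conv-0 g k)

  conv-1 : ∀ g k → conv 1S g k ≡ g k
  conv-1 g zero = ℤₚ.*-identityˡ (g 0)
  conv-1 g (suc k) = ≡.trans (cong₂ ℤ._+_ (ℤₚ.*-identityˡ (g (suc k))) (conv-0 g k)) (ℤₚ.+-identityʳ _)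

 neg : Series → Series
 neg f k = ℤ.- f k

 seriesRing : CommutativeRing 0ℓ 0ℓ
 seriesRing = record
  { Carrier = Series ; _≈_ = _≈S_ ; _+_ = _⊕_ ; _*_ = _⊗_ ; -_ = neg ; 0# = 0S ; 1# = 1S
  ; isCommutativeRing = record
   { isRing = record
    { +-isAbelianGroup = record
     { isGroup = record
      { isMonoid = record
       { isSemigroup = record
        { isMagma = record
         { isEquivalence = record { refl = λ k → ≡.refl ; sym = λ p k → ≡.sym (p k) ; trans = λ p q k → ≡.trans (p k) (q k) }
         ; ∙-cong = λ p q k → cong₂ ℤ._+_ (p k) (q k) }
        ; assoc = λ f g h k → ℤₚ.+-assoc (f k) (g k) (h k) }
       ; identity = (λ f k → ℤₚ.+-identityˡ (f k)) , (λ f k → ℤₚ.+-identityʳ (f k)) }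
      ; inverse = (λ f k → ℤₚ.+-inverseˡ (f k)) , (λ f k → ℤₚ.+-inverseʳ (f k))
      ; ⁻¹-cong = λ p k → cong (λ z → ℤ.- z) (p k) }
     ; comm = λ f g k → ℤₚ.+-comm (f k) (g k) }
    ; *-cong = λ {f} {f′} {g} {g′} p q k → via f g f′ g′ (conv-cong p q k)
    ; *-assoc = λ f g h k → ≡.trans (⊗≡conv (f ⊗ g) h k) (≡.trans (conv-cong (⊗≡conv f g) (λ _ → ≡.refl) k)
      (≡.trans (conv-assoc f g h k) (≡.trans (conv-cong {f} (λ _ → ≡.refl) (λ i → ≡.sym (⊗≡conv g h i)) k) (≡.sym (⊗≡conv f (g ⊗ h) k)))))
    ; *-identity = identityˡ , λ f k → ≡.trans (comm f 1S k) (identityˡ f k)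
    ; distrib = (λ f g h k → ≡.trans (comm f (g ⊕ h) k) (≡.trans (distribʳ f g h k) (cong₂ ℤ._+_ (comm g f k) (comm h f k)))) , distribʳ }
   ; *-comm = comm } }
  where
  via : ∀ f g f′ g′ {k} → conv f g k ≡ conv f′ g′ k → (f ⊗ g) k ≡ (f′ ⊗ g′) k
  via f g f′ g′ {k} e = ≡.trans (⊗≡conv f g k) (≡.trans e (≡.sym (⊗≡conv f′ g′ k)))
  comm : ∀ f g → (f ⊗ g) ≈S (g ⊗ f)
  comm f g k = via f g g f (conv-comm f g k)
  identityˡ : ∀ f → (1S ⊗ f) ≈S f
  identityˡ f k = ≡.trans (⊗≡conv 1S f k) (conv-1 f k)
  distribʳ : ∀ h f g → ((f ⊕ g) ⊗ h) ≈S ((f ⊗ h) ⊕ (g ⊗ h))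
  distribʳ h f g k = ≡.trans (⊗≡conv (f ⊕ g) h k) (≡.trans (conv-distribʳ f g h k) (cong₂ ℤ._+_ (≡.sym (⊗≡conv f h k)) (≡.sym (⊗≡conv g h k))))

 -- The trivial exponential makes the solver and the summation lemmas available for power series.
 seriesExp : ExpRing
 seriesExp = record { commRing = seriesRing ; E = λ _ → 1S ; E-0 = λ _ → ≡.refl ; E-+ = λ _ _ k → ≡.sym (CommutativeRing.*-identityˡ seriesRing 1S k) }

 module S = ExpRing seriesExp

 ⊗-congˡ : ∀ f {g h} → g ≈S h → (f ⊗ g) ≈S (f ⊗ h)
 ⊗-congˡ f = S.*-congˡ {f}

 ⊗-congʳ : ∀ h {f g} → f ≈S g → (f ⊗ h) ≈S (g ⊗ h)
 ⊗-congʳ h = S.*-congʳ {h}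

 -- Inverses.  The helper functions of invS are private; unification recovers
 -- the tail sum Σ_i f (j + 1 + i) (invS f (n - i)) computed by them.

 mutual
  private
   tailSum₀ : Series → ℕ → ℤ
   tailSum₀ = _

   invS-suc : ∀ f n → invS f (suc n) ≡ ℤ.- (f 0 ℤ.* tailSum₀ f n)
   invS-suc f n = ≡.refl

 mutual
  private
   tailSum : Series → ℕ → ℕ → ℤ
   tailSum = _

   tailSum₀≡ : ∀ f n → tailSum₀ f n ≡ tailSum f 0 n
   tailSum₀≡ f n with 0
   ... | _ = ≡.refl

 invS-inverse : ∀ f → f 0 ℤ.* f 0 ≡ + 1 → (f ⊗ invS f) ≈S 1S
 invS-inverse f unit k = ≡.trans (⊗≡conv f (invS f) k) (go k)
  where
  tailSum≡ : ∀ j n → tailSum f j n ≡ conv (λ i → f (suc (j ℕ.+ i))) (invS f) n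
  tailSum≡ j zero = ≡.trans (ℤₚ.+-identityʳ _) (cong (λ z → f (suc z) ℤ.* f 0) (≡.sym (ℕₚ.+-identityʳ j)))
  tailSum≡ j (suc n) = cong₂ ℤ._+_ (cong (λ z → f (suc z) ℤ.* invS f (suc n)) (≡.sym (ℕₚ.+-identityʳ j)))
   (≡.trans (tailSum≡ (suc j) n) (conv-cong {g = invS f} (λ i → cong (λ z → f (suc z)) (≡.sym (+-suc j i))) (λ _ → ≡.refl) n))
  go : ∀ k → conv f (invS f) k ≡ 1S k
  go zero = unit
  go (suc n) = ≡.trans (cong₂ ℤ._+_ (cong (f 0 ℤ.*_) (≡.trans (invS-suc f n) (cong (λ z → ℤ.- (f 0 ℤ.* z)) (≡.trans (tailSum₀≡ f n) (tailSum≡ 0 n))))) ≡.refl)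
   (≡.trans (lem (f 0) (conv (tail f) (invS f) n)) (≡.trans (cong (λ z → ℤ.- (z ℤ.* conv (tail f) (invS f) n) ℤ.+ conv (tail f) (invS f) n) unit) (lem′ (conv (tail f) (invS f) n))))
   where
   lem : ∀ a b → a ℤ.* (ℤ.- (a ℤ.* b)) ℤ.+ b ≡ ℤ.- ((a ℤ.* a) ℤ.* b) ℤ.+ b
   lem = ℤ-ring
   lem′ : ∀ b → ℤ.- (+ 1 ℤ.* b) ℤ.+ b ≡ + 0
   lem′ = ℤ-ring

 -- Laurent series v⁻ⁿ f as pairs (n , f)

 v : Series
 v = mono 1

 vp : ℕ → Series
 vp zero    = 1S
 vp (suc n) = v ⊗ vp n

 vp-+ : ∀ m n → vp (m ℕ.+ n) ≈S (vp m ⊗ vp n)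
 vp-+ zero n = S.sym (S.*-identityˡ (vp n))
 vp-+ (suc m) n = S.trans (⊗-congˡ v (vp-+ m n)) (S.sym (S.*-assoc v (vp m) (vp n)))

 private
  v⊗-suc : ∀ f k → (v ⊗ f) (suc k) ≡ f k
  v⊗-suc f k = ≡.trans (⊗≡conv v f (suc k)) (≡.trans (cong₂ ℤ._+_ (ℤₚ.*-zeroˡ (f (suc k))) (≡.trans (conv-cong {g = f} tail-v (λ _ → ≡.refl) k) (conv-1 f k))) (ℤₚ.+-identityˡ _))
   where
   tail-v : tail v ≈S 1S
   tail-v zero = ≡.refl
   tail-v (suc k) = ≡.refl

  v⊗-zero : ∀ f → (v ⊗ f) 0 ≡ 0ℤ
  v⊗-zero f = ≡.trans (⊗≡conv v f 0) (ℤₚ.*-zeroˡ (f 0))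

  vp-cancel : ∀ n {f g} → (vp n ⊗ f) ≈S (vp n ⊗ g) → f ≈S g
  vp-cancel zero {f} {g} e = S.trans (S.sym (S.*-identityˡ f)) (S.trans e (S.*-identityˡ g))
  vp-cancel (suc n) {f} {g} e = vp-cancel n λ k → ≡.trans (≡.sym (v⊗-suc (vp n ⊗ f) k)) (≡.trans (S.trans (S.sym (S.*-assoc v (vp n) f)) (S.trans e (S.*-assoc v (vp n) g)) (suc k)) (v⊗-suc (vp n ⊗ g) k))

 vp-low : ∀ n f {k} → k < n → (vp n ⊗ f) k ≡ 0ℤ
 vp-low (suc n) f {zero} l = ≡.trans (S.*-assoc v (vp n) f 0) (v⊗-zero (vp n ⊗ f))
 vp-low (suc n) f {suc k} (s≤s l) = ≡.trans (S.*-assoc v (vp n) f (suc k)) (≡.trans (v⊗-suc (vp n ⊗ f) k) (vp-low n f l))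

 low-vp : ∀ n f → (∀ k → k < n → f k ≡ 0ℤ) → ∃ λ g → f ≈S (vp n ⊗ g)
 low-vp zero f h = f , S.sym (S.*-identityˡ f)
 low-vp (suc n) f h = let g , e = low-vp n (tail f) (λ k l → h (suc k) (s≤s l)) in g , λ
  { zero → ≡.trans (h 0 (s≤s z≤n)) (≡.sym (≡.trans (S.*-assoc v (vp n) g 0) (v⊗-zero (vp n ⊗ g))))
  ; (suc k) → ≡.trans (e k) (≡.sym (≡.trans (S.*-assoc v (vp n) g (suc k)) (v⊗-suc (vp n ⊗ g) k))) }

 Laurent : Set
 Laurent = ℕ × Series

 infix 4 _≈L_
 -- Equality of fractions, cross-multiplied by powers of v, since the pairs are not reduced.
 record _≈L_ (x y : Laurent) : Set where
  constructor mk
  field eq : (vp (proj₁ y) ⊗ proj₂ x) ≈S (vp (proj₁ x) ⊗ proj₂ y)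

 private
  open SetoidReasoning S.setoid

  same : ∀ {n m f g} → n ≡ m → f ≈S g → (n , f) ≈L (m , g)
  same {n} ≡.refl e = mk (⊗-congˡ (vp n) e)

  _+L_ _*L_ : Laurent → Laurent → Laurent
  (n , f) +L (m , g) = n ℕ.+ m , ((vp m ⊗ f) ⊕ (vp n ⊗ g))
  (n , f) *L (m , g) = n ℕ.+ m , (f ⊗ g)

  -L_ : Laurent → Laurent
  -L (n , f) = n , neg f

  trans-L : ∀ {x y z} → x ≈L y → y ≈L z → x ≈L z
  trans-L {n , f} {m , g} {k , h} (mk p) (mk q) = mk (vp-cancel m (begin
   vp m ⊗ (vp k ⊗ f) ≈⟨ S.x*yz≈y*xz (vp m) (vp k) f ⟩
   vp k ⊗ (vp m ⊗ f) ≈⟨ ⊗-congˡ (vp k) p ⟩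
   vp k ⊗ (vp n ⊗ g) ≈⟨ S.x*yz≈y*xz (vp k) (vp n) g ⟩
   vp n ⊗ (vp k ⊗ g) ≈⟨ ⊗-congˡ (vp n) q ⟩
   vp n ⊗ (vp m ⊗ h) ≈⟨ S.x*yz≈y*xz (vp n) (vp m) h ⟩
   vp m ⊗ (vp n ⊗ h) ∎))

  +-cong-L : ∀ {x x′ y y′} → x ≈L x′ → y ≈L y′ → (x +L y) ≈L (x′ +L y′)
  +-cong-L {n , f} {n′ , f′} {m , g} {m′ , g′} (mk p) (mk q) = mk (begin
   vp (n′ ℕ.+ m′) ⊗ ((vp m ⊗ f) ⊕ (vp n ⊗ g))
    ≈⟨ S.*-congʳ (vp-+ n′ m′) ⟩
   (vp n′ ⊗ vp m′) ⊗ ((vp m ⊗ f) ⊕ (vp n ⊗ g))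
    ≈⟨ solve seriesExp 6 0 (λ a b c d f g → (a :* b) :* (c :* f :+ d :* g) := b :* c :* (a :* f) :+ a :* d :* (b :* g)) (vp n′) (vp m′) (vp m) (vp n) f g ⟩
   ((vp m′ ⊗ vp m) ⊗ (vp n′ ⊗ f)) ⊕ ((vp n′ ⊗ vp n) ⊗ (vp m′ ⊗ g))
    ≈⟨ S.+-cong (⊗-congˡ (vp m′ ⊗ vp m) p) (⊗-congˡ (vp n′ ⊗ vp n) q) ⟩
   ((vp m′ ⊗ vp m) ⊗ (vp n ⊗ f′)) ⊕ ((vp n′ ⊗ vp n) ⊗ (vp m ⊗ g′))
    ≈⟨ solve seriesExp 6 0 (λ a b c d f g → b :* c :* (d :* f) :+ a :* d :* (c :* g) := (d :* c) :* (b :* f :+ a :* g)) (vp n′) (vp m′) (vp m) (vp n) f′ g′ ⟩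
   (vp n ⊗ vp m) ⊗ ((vp m′ ⊗ f′) ⊕ (vp n′ ⊗ g′))
    ≈⟨ S.*-congʳ (S.sym (vp-+ n m)) ⟩
   vp (n ℕ.+ m) ⊗ ((vp m′ ⊗ f′) ⊕ (vp n′ ⊗ g′)) ∎)

  *-cong-L : ∀ {x x′ y y′} → x ≈L x′ → y ≈L y′ → (x *L y) ≈L (x′ *L y′)
  *-cong-L {n , f} {n′ , f′} {m , g} {m′ , g′} (mk p) (mk q) = mk (begin
   vp (n′ ℕ.+ m′) ⊗ (f ⊗ g) ≈⟨ S.*-congʳ (vp-+ n′ m′) ⟩
   (vp n′ ⊗ vp m′) ⊗ (f ⊗ g) ≈⟨ S.*-interchange (vp n′) (vp m′) f g ⟩
   (vp n′ ⊗ f) ⊗ (vp m′ ⊗ g) ≈⟨ S.*-cong p q ⟩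
   (vp n ⊗ f′) ⊗ (vp m ⊗ g′) ≈⟨ S.sym (S.*-interchange (vp n) (vp m) f′ g′) ⟩
   (vp n ⊗ vp m) ⊗ (f′ ⊗ g′) ≈⟨ S.*-congʳ (S.sym (vp-+ n m)) ⟩
   vp (n ℕ.+ m) ⊗ (f′ ⊗ g′) ∎)

  +-assoc-L : ∀ x y z → ((x +L y) +L z) ≈L (x +L (y +L z))
  +-assoc-L (n , f) (m , g) (k , h) = same (ℕₚ.+-assoc n m k) (S.trans (S.+-congˡ {vp k ⊗ ((vp m ⊗ f) ⊕ (vp n ⊗ g))} (⊗-congʳ h (vp-+ n m)))
   (S.trans (solve seriesExp 6 0 (λ a b c f g h → c :* (b :* f :+ a :* g) :+ (a :* b) :* h := (b :* c) :* f :+ a :* (c :* g :+ b :* h)) (vp n) (vp m) (vp k) f g h)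
    (S.+-congʳ {vp n ⊗ ((vp k ⊗ g) ⊕ (vp m ⊗ h))} (⊗-congʳ f (S.sym (vp-+ m k))))))

  +-comm-L : ∀ x y → (x +L y) ≈L (y +L x)
  +-comm-L (n , f) (m , g) = same (ℕₚ.+-comm n m) (S.+-comm (vp m ⊗ f) (vp n ⊗ g))

  +-identity-L : ∀ x → ((0 , 0S) +L x) ≈L x
  +-identity-L (n , f) = same ≡.refl (solve seriesExp 2 0 (λ a f → a :* :0 :+ :1 :* f := f) (vp n) f)

  +-inverse-L : ∀ x → ((-L x) +L x) ≈L (0 , 0S)
  +-inverse-L (n , f) = mk (solve seriesExp 3 0 (λ a b f → :1 :* (a :* (:- f) :+ a :* f) := b :* :0) (vp n) (vp (n ℕ.+ n)) f)

  neg-cong-L : ∀ {x y} → x ≈L y → (-L x) ≈L (-L y)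
  neg-cong-L {n , f} {m , g} (mk p) = mk (S.trans (solve seriesExp 2 0 (λ a f → a :* (:- f) := :- (a :* f)) (vp m) f)
   (S.trans (S.-‿cong p) (solve seriesExp 2 0 (λ a f → :- (a :* f) := a :* (:- f)) (vp n) g)))

  *-assoc-L : ∀ x y z → ((x *L y) *L z) ≈L (x *L (y *L z))
  *-assoc-L (n , f) (m , g) (k , h) = same (ℕₚ.+-assoc n m k) (S.*-assoc f g h)

  *-comm-L : ∀ x y → (x *L y) ≈L (y *L x)
  *-comm-L (n , f) (m , g) = same (ℕₚ.+-comm n m) (S.*-comm f g)

  *-identity-L : ∀ x → ((0 , 1S) *L x) ≈L x
  *-identity-L (n , f) = same ≡.refl (S.*-identityˡ f)

  distrib-L : ∀ x y z → ((y +L z) *L x) ≈L ((y *L x) +L (z *L x))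
  distrib-L (n , f) (m , g) (k , h) = mk (begin
   vp ((m ℕ.+ n) ℕ.+ (k ℕ.+ n)) ⊗ (((vp k ⊗ g) ⊕ (vp m ⊗ h)) ⊗ f)
    ≈⟨ S.*-congʳ (S.trans (vp-+ (m ℕ.+ n) (k ℕ.+ n)) (S.*-cong (vp-+ m n) (vp-+ k n))) ⟩
   ((vp m ⊗ vp n) ⊗ (vp k ⊗ vp n)) ⊗ (((vp k ⊗ g) ⊕ (vp m ⊗ h)) ⊗ f)
    ≈⟨ solve seriesExp 6 0 (λ a b c f g h → ((b :* a) :* (c :* a)) :* ((c :* g :+ b :* h) :* f) := ((b :* c) :* a) :* ((c :* a) :* (g :* f) :+ (b :* a) :* (h :* f))) (vp n) (vp m) (vp k) f g h ⟩
   ((vp m ⊗ vp k) ⊗ vp n) ⊗ (((vp k ⊗ vp n) ⊗ (g ⊗ f)) ⊕ ((vp m ⊗ vp n) ⊗ (h ⊗ f)))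
    ≈⟨ S.*-cong (S.sym (S.trans (vp-+ (m ℕ.+ k) n) (S.*-congʳ (vp-+ m k)))) (S.+-cong (S.*-congʳ (S.sym (vp-+ k n))) (S.*-congʳ (S.sym (vp-+ m n)))) ⟩
   vp ((m ℕ.+ k) ℕ.+ n) ⊗ ((vp (k ℕ.+ n) ⊗ (g ⊗ f)) ⊕ (vp (m ℕ.+ n) ⊗ (h ⊗ f))) ∎)

 laurentRing : CommutativeRing 0ℓ 0ℓ
 laurentRing = record
  { Carrier = Laurent ; _≈_ = _≈L_ ; _+_ = _+L_ ; _*_ = _*L_ ; -_ = -L_ ; 0# = 0 , 0S ; 1# = 0 , 1S
  ; isCommutativeRing = record
   { isRing = record
    { +-isAbelianGroup = record
     { isGroup = record
      { isMonoid = record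
       { isSemigroup = record
        { isMagma = record
         { isEquivalence = record { refl = mk λ _ → ≡.refl ; sym = λ { (mk p) → mk (S.sym p) } ; trans = trans-L }
         ; ∙-cong = +-cong-L }
        ; assoc = +-assoc-L }
       ; identity = +-identity-L , λ x → trans-L (+-comm-L x (0 , 0S)) (+-identity-L x) }
      ; inverse = +-inverse-L , λ x → trans-L (+-comm-L x (-L x)) (+-inverse-L x)
      ; ⁻¹-cong = neg-cong-L }
     ; comm = +-comm-L }
    ; *-cong = *-cong-L
    ; *-assoc = *-assoc-L
    ; *-identity = *-identity-L , λ x → trans-L (*-comm-L x (0 , 1S)) (*-identity-L x)
    ; distrib = (λ x y z → trans-L (*-comm-L x (y +L z)) (trans-L (distrib-L x y z) (+-cong-L (*-comm-L y x) (*-comm-L z x)))) , distrib-L }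
   ; *-comm = *-comm-L } }

 private
  EL : ℤ → Laurent
  EL (+ a)    = 0 , vp a
  EL -[1+ a ] = suc a , 1S

  EL-⊖ : ∀ a b → EL (a ℤ.⊖ b) ≈L (b , vp a)
  EL-⊖ zero zero = same ≡.refl (λ _ → ≡.refl)
  EL-⊖ zero (suc b) = same ≡.refl (λ _ → ≡.refl)
  EL-⊖ (suc a) zero = same ≡.refl (λ _ → ≡.refl)
  EL-⊖ (suc a) (suc b) = subst (λ z → EL z ≈L (suc b , vp (suc a))) (≡.sym (ℤₚ.[1+m]⊖[1+n]≡m⊖n a b)) (trans-L (EL-⊖ a b)
   (mk (solve seriesExp 3 0 (λ v a b → (v :* b) :* a := b :* (v :* a)) v (vp a) (vp b))))

  EL-+ : ∀ a b → EL (a ℤ.+ b) ≈L (EL a *L EL b)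
  EL-+ (+ a) (+ b) = same ≡.refl (vp-+ a b)
  EL-+ (+ a) -[1+ b ] = trans-L (EL-⊖ a (suc b)) (same ≡.refl (S.sym (S.*-identityʳ (vp a))))
  EL-+ -[1+ a ] (+ b) = trans-L (EL-⊖ b (suc a)) (same (≡.sym (ℕₚ.+-identityʳ (suc a))) (S.sym (S.*-identityˡ (vp b))))
  EL-+ -[1+ a ] -[1+ b ] = same (cong suc (≡.sym (+-suc a b))) (S.sym (S.*-identityˡ 1S))

 laurentExp : ExpRing
 laurentExp = record { commRing = laurentRing ; E = EL ; E-0 = same ≡.refl (λ _ → ≡.refl) ; E-+ = EL-+ }

 module L = ExpRing laurentExp

 ι : Series → Laurent
 ι f = 0 , f

 ι-cong : ∀ {f g} → f ≈S g → ι f ≈L ι g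
 ι-cong = same ≡.refl

 ι-+ : ∀ f g → ι (f ⊕ g) ≈L (ι f L.+ ι g)
 ι-+ f g = same ≡.refl (S.+-cong (S.sym (S.*-identityˡ f)) (S.sym (S.*-identityˡ g)))

 ι-inj : ∀ {f g} → ι f ≈L ι g → f ≈S g
 ι-inj {f} {g} (mk p) = S.trans (S.sym (S.*-identityˡ f)) (S.trans p (S.*-identityˡ g))

 private
  uL : ℤ → Laurent
  uL a = L.1# L.- L.E (a ℤ.+ a)

  geometric : ℕ → Series
  geometric c = invS (1S ⊖ vp (c ℕ.+ c))

  -- For negative index by 1 / (1 - X⁻¹) = -X / (1 - X), so that only series with constant term 1
  -- are inverted. At index 0 the value is arbitrary.
  jL : ℤ → Laurent
  jL (+ a)    = ι (geometric a)
  jL -[1+ a ] = L.- (L.E (+ (suc a ℕ.+ suc a)) L.* ι (geometric (suc a)))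

  u*j⁺ : ∀ a → (uL (+ suc a) L.* jL (+ suc a)) ≈L L.1#
  u*j⁺ a = trans-L (*-cong-L {y = jL (+ suc a)} {jL (+ suc a)} (same ≡.refl (solve seriesExp 1 0 (λ x → :1 :* :1 :+ :1 :* (:- x) := :1 :- x) (vp (suc a ℕ.+ suc a)))) (mk λ _ → ≡.refl))
   (same ≡.refl (invS-inverse (1S ⊖ vp (suc a ℕ.+ suc a)) (cong (λ z → (+ 1 ℤ.- z) ℤ.* (+ 1 ℤ.- z)) (v⊗-zero (vp (a ℕ.+ suc a))))))

  u*jL : ∀ {a} → a ≢ 0ℤ → (uL a L.* jL a) ≈L L.1#
  u*jL {+ zero} d = ⊥-elim (d ≡.refl)
  u*jL {+ suc a} d = u*j⁺ a
  u*jL { -[1+ a ] } d = trans-L (solve laurentExp 1 1 (λ j x → :u (⊟ x) :* (:- (:X x :* j)) := :u x :* j) (ι (geometric (suc a))) (+ suc a)) (u*j⁺ a)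

  double-zero : ∀ z → z ℤ.+ z ≡ 0ℤ → z ≡ 0ℤ
  double-zero (+ zero) e = ≡.refl

  2-cancelL : ∀ {x} → (x L.+ x) ≈L L.0# → x ≈L L.0#
  2-cancelL {n , f} (mk p) = mk (S.trans (S.*-identityˡ f) (S.trans (vp-cancel n (λ k → ≡.trans (double-zero ((vp n ⊗ f) k) (≡.trans (≡.sym (S.*-identityˡ ((vp n ⊗ f) ⊕ (vp n ⊗ f)) k)) (≡.trans (p k) (S.zeroʳ (vp (n ℕ.+ n)) k)))) (≡.sym (S.zeroʳ (vp n) k)))) (S.sym (S.zeroʳ (vp n)))))

 laurentQ : QRing
 laurentQ = record { Λ = laurentExp ; j = jL ; u*j = u*jL ; 2-cancel = 2-cancelL }

 LVal : ℤ → Laurent → Set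
 LVal k x = ∃ λ f → x ≈L (L.E k L.* ι f)

 private
  nonneg : ∀ {i} → 0ℤ ℤ.≤ i → ∃ λ n → i ≡ + n
  nonneg {+ n} _ = n , ≡.refl

  ι-* : ∀ f g → ι (f ⊗ g) ≈L (ι f L.* ι g)
  ι-* f g = same ≡.refl (λ _ → ≡.refl)

 laurent : LRing
 laurent = record
  { qRing = laurentQ
  ; Val = LVal
  ; Val-≈ = λ e (f , p) → f , L.trans (L.sym e) p
  ; Val-0 = λ k → 0S , L.sym (L.zeroʳ (L.E k))
  ; Val-+ = λ {k} (f , p) (g , q) → f ⊕ g , L.trans (L.+-cong p q) (L.trans (L.sym (L.distribˡ (L.E k) (ι f) (ι g))) (L.*-congˡ {L.E k} (L.sym (ι-+ f g))))
  ; Val-neg = λ {k} (f , p) → neg f , L.trans (L.-‿cong p) (solve laurentExp 2 0 (λ e f → :- (e :* f) := e :* (:- f)) (L.E k) (ι f))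
  ; Val-* = λ {k} {l} (f , p) (g , q) → f ⊗ g , L.trans (L.*-cong p q) (solve laurentExp 2 2 (λ f g k l → (:E k :* f) :* (:E l :* g) := :E (k ⊞ l) :* (f :* g)) (ι f) (ι g) k l)
  ; Val-E = λ a → 1S , L.sym (L.*-identityʳ (L.E a))
  ; Val-j = λ { {+ a} _ → geometric a , L.sym (L.*-identityˡ (jL (+ a))) }
  ; Val-≤ = λ {k} {l} h (f , p) → let n , e = nonneg (ℤₚ.i≤j⇒0≤j-i h) in vp n ⊗ f ,
    L.trans p (L.trans (solve laurentExp 1 2 (λ f k l → :E l :* f := :E k :* (:E (l ⊟ k) :* f)) (ι f) k l) (L.*-congˡ {L.E k} (L.*-congʳ {ι f} (L.reflexive (cong L.E e)))))
  ; separated = λ { {n , g} h → mk λ i → ≡.trans (S.*-identityˡ g i) (≡.trans (vanish n g h i) (≡.sym (S.zeroʳ (vp n) i))) }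
  }
  where
  vanish : ∀ n g → (∀ k → LVal (+ k) (n , g)) → ∀ i → g i ≡ 0ℤ
  vanish n g h i with h (suc i)
  ... | f , mk p = ≡.trans (≡.sym (S.*-identityˡ g i)) (≡.trans (p i) (≡.trans (S.sym (S.*-assoc (vp n) (vp (suc i)) f) i)
   (≡.trans (⊗-congʳ f (S.sym (vp-+ n (suc i))) i) (vp-low (n ℕ.+ suc i) f (m≤n+m (suc i) n)))))

 -- The substitution q = v⁴, in accordance with q = E 4.
 φ : Series → Series
 φ f 0 = f 0
 φ f 1 = 0ℤ
 φ f 2 = 0ℤ
 φ f 3 = 0ℤ
 φ f (suc (suc (suc (suc k)))) = φ (tail f) k

 φ-cong : ∀ {f g} → f ≈S g → φ f ≈S φ g
 φ-cong h 0 = h 0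
 φ-cong h 1 = ≡.refl
 φ-cong h 2 = ≡.refl
 φ-cong h 3 = ≡.refl
 φ-cong h (suc (suc (suc (suc k)))) = φ-cong (λ i → h (suc i)) k

 φ-pointwise : (_∙_ : ℤ → ℤ → ℤ) → 0ℤ ∙ 0ℤ ≡ 0ℤ → ∀ f g → φ (λ k → f k ∙ g k) ≈S (λ k → φ f k ∙ φ g k)
 φ-pointwise _∙_ z f g 0 = ≡.refl
 φ-pointwise _∙_ z f g 1 = ≡.sym z
 φ-pointwise _∙_ z f g 2 = ≡.sym z
 φ-pointwise _∙_ z f g 3 = ≡.sym z
 φ-pointwise _∙_ z f g (suc (suc (suc (suc k)))) = φ-pointwise _∙_ z (tail f) (tail g) k

 φ-⊗ : ∀ f g → φ (f ⊗ g) ≈S (φ f ⊗ φ g)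
 φ-⊗ f g k = ≡.trans (φ-cong (⊗≡conv f g) k) (≡.trans (go f g k) (≡.sym (⊗≡conv (φ f) (φ g) k)))
  where
  four : ∀ a b c d x → a ℤ.+ x ≡ a ℤ.+ (0ℤ ℤ.* b ℤ.+ (0ℤ ℤ.* c ℤ.+ (0ℤ ℤ.* d ℤ.+ x)))
  four = ℤ-ring
  go : ∀ f g → φ (conv f g) ≈S conv (φ f) (φ g)
  go f g 0 = ≡.refl
  go f g 1 = e₁ (f 0) (g 0)
   where
   e₁ : ∀ a b → 0ℤ ≡ a ℤ.* 0ℤ ℤ.+ 0ℤ ℤ.* b
   e₁ = ℤ-ring
  go f g 2 = e₂ (f 0) (g 0)
   where
   e₂ : ∀ a b → 0ℤ ≡ a ℤ.* 0ℤ ℤ.+ (0ℤ ℤ.* 0ℤ ℤ.+ 0ℤ ℤ.* b)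
   e₂ = ℤ-ring
  go f g 3 = e₃ (f 0) (g 0)
   where
   e₃ : ∀ a b → 0ℤ ≡ a ℤ.* 0ℤ ℤ.+ (0ℤ ℤ.* 0ℤ ℤ.+ (0ℤ ℤ.* 0ℤ ℤ.+ 0ℤ ℤ.* b))
   e₃ = ℤ-ring
  go f g (suc (suc (suc (suc k)))) = ≡.trans (φ-pointwise ℤ._+_ ≡.refl (λ i → f 0 ℤ.* g (suc i)) (conv (tail f) g) k)
   (≡.trans (cong₂ ℤ._+_ (scale (f 0) (tail g) k) (go (tail f) g k))
    (four (f 0 ℤ.* φ (tail g) k) (φ g (suc (suc (suc k)))) (φ g (suc (suc k))) (φ g (suc k)) (conv (φ (tail f)) (φ g) k)))
   where
   scale : ∀ a h → φ (λ i → a ℤ.* h i) ≈S (λ i → a ℤ.* φ h i)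
   scale a h 0 = ≡.refl
   scale a h 1 = ≡.sym (ℤₚ.*-zeroʳ a)
   scale a h 2 = ≡.sym (ℤₚ.*-zeroʳ a)
   scale a h 3 = ≡.sym (ℤₚ.*-zeroʳ a)
   scale a h (suc (suc (suc (suc k)))) = scale a (tail h) k

 φ-0 : φ 0S ≈S 0S
 φ-0 0 = ≡.refl
 φ-0 1 = ≡.refl
 φ-0 2 = ≡.refl
 φ-0 3 = ≡.refl
 φ-0 (suc (suc (suc (suc k)))) = φ-0 k

 φ-1 : φ 1S ≈S 1S
 φ-1 0 = ≡.refl
 φ-1 1 = ≡.refl
 φ-1 2 = ≡.refl
 φ-1 3 = ≡.refl
 φ-1 (suc (suc (suc (suc k)))) = φ-0 k

 mono-suc : ∀ a → mono (suc a) ≈S (v ⊗ mono a)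
 mono-suc a zero = ≡.sym (v⊗-zero (mono a))
 mono-suc a (suc k) = ≡.sym (v⊗-suc (mono a) k)

 mono-+ : ∀ a b → mono (a ℕ.+ b) ≈S (mono a ⊗ mono b)
 mono-+ zero b = S.sym (S.trans (⊗-congʳ (mono b) one) (S.*-identityˡ (mono b)))
  where
  one : mono 0 ≈S 1S
  one zero = ≡.refl
  one (suc k) = ≡.refl
 mono-+ (suc a) b = S.trans (mono-suc (a ℕ.+ b)) (S.trans (⊗-congˡ v (mono-+ a b)) (S.trans (S.sym (S.*-assoc v (mono a) (mono b))) (⊗-congʳ (mono b) (S.sym (mono-suc a)))))

 Φ : Series → Laurent
 Φ f = ι (φ f)

 Φ-cong : ∀ {f g} → f ≈S g → Φ f ≈L Φ g
 Φ-cong h = ι-cong (φ-cong h)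

 Φ-⊗ : ∀ f g → Φ (f ⊗ g) ≈L (Φ f L.* Φ g)
 Φ-⊗ f g = ι-cong (φ-⊗ f g)

 Φ-⊕ : ∀ f g → Φ (f ⊕ g) ≈L (Φ f L.+ Φ g)
 Φ-⊕ f g = L.trans (ι-cong (φ-pointwise ℤ._+_ ≡.refl f g)) (ι-+ (φ f) (φ g))

 Φ-⊖ : ∀ f g → Φ (f ⊖ g) ≈L (Φ f L.- Φ g)
 Φ-⊖ f g = L.trans (ι-cong (φ-pointwise ℤ._-_ ≡.refl f g)) (ι-+ (φ f) (neg (φ g)))

 Φ-1 : Φ 1S ≈L L.1#
 Φ-1 = ι-cong φ-1

 Φ-0 : Φ 0S ≈L L.0#
 Φ-0 = ι-cong φ-0

 Φ-mono : ∀ a → Φ (mono a) ≈L L.E (+ (a ℕ.+ a ℕ.+ (a ℕ.+ a)))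
 Φ-mono a = ι-cong (S.trans (go a) (λ k → cong (λ n → vp n k) (lem a)))
  where
  lem : ∀ a → a ℕ.* 4 ≡ a ℕ.+ a ℕ.+ (a ℕ.+ a)
  lem = ℕ-ring
  one : mono 0 ≈S 1S
  one zero = ≡.refl
  one (suc k) = ≡.refl
  v⁴ : φ (mono 1) ≈S vp 4
  v⁴ 0 = ≡.refl
  v⁴ 1 = ≡.refl
  v⁴ 2 = ≡.refl
  v⁴ 3 = ≡.refl
  v⁴ 4 = ≡.refl
  v⁴ (suc (suc (suc (suc (suc k))))) = ≡.sym (≡.trans (v⊗-suc (vp 3) (4 ℕ.+ k)) (≡.trans (v⊗-suc (vp 2) (3 ℕ.+ k)) (≡.trans (v⊗-suc (vp 1) (2 ℕ.+ k)) (≡.trans (v⊗-suc 1S (suc k)) (≡.sym (zero-tail (suc k)))))))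
   where
   zero-tail : ∀ k → φ (tail (mono 1)) k ≡ 1S k
   zero-tail k = ≡.trans (φ-cong one′ k) (φ-1 k)
    where
    one′ : tail (mono 1) ≈S 1S
    one′ zero = ≡.refl
    one′ (suc k) = ≡.refl
  go : ∀ a → φ (mono a) ≈S vp (a ℕ.* 4)
  go zero = S.trans (φ-cong one) φ-1
  go (suc a) = S.trans (φ-cong (mono-suc a)) (S.trans (φ-⊗ v (mono a)) (S.trans (S.*-cong v⁴ (go a)) (S.sym (vp-+ 4 (a ℕ.* 4)))))

 φ-4× : ∀ f k → φ f (k ℕ.* 4) ≡ f k
 φ-4× f zero = ≡.refl
 φ-4× f (suc k) = φ-4× (tail f) k

 Φ-inj : ∀ {f g} → Φ f ≈L Φ g → f ≈S g
 Φ-inj {f} {g} e k = ≡.trans (≡.sym (φ-4× f k)) (≡.trans (ι-inj e (k ℕ.* 4)) (φ-4× g k))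

 Φ-inverse : ∀ f → f 0 ℤ.* f 0 ≡ + 1 → (Φ f L.* Φ (invS f)) ≈L L.1#
 Φ-inverse f h = L.trans (L.sym (Φ-⊗ f (invS f))) (L.trans (Φ-cong (invS-inverse f h)) Φ-1)

 Φ-Val : ∀ f → LVal 0ℤ (Φ f)
 Φ-Val f = φ f , L.sym (L.*-identityˡ (Φ f))

 agree⇒Val : ∀ N {f g} → (∀ k → k < N → f k ≡ g k) → LVal (+ N) (Φ f L.- Φ g)
 agree⇒Val N {f} {g} h = let r , e = low-vp N (φ (f ⊖ g)) low in r ,
  L.trans (L.sym (Φ-⊖ f g)) (L.trans (ι-cong e) (ι-* (vp N) r))
  where
  low′ : ∀ N f → (∀ k → k < N → f k ≡ 0ℤ) → ∀ k → k < N → φ f k ≡ 0ℤ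
  low′ N f h 0 l = h 0 l
  low′ N f h 1 l = ≡.refl
  low′ N f h 2 l = ≡.refl
  low′ N f h 3 l = ≡.refl
  low′ (suc N) f h (suc (suc (suc (suc k)))) (s≤s l) = low′ N (tail f) (λ i l → h (suc i) (s≤s l)) k (≤-trans (s≤s (≤-trans (n≤1+n k) (≤-trans (n≤1+n _) (n≤1+n _)))) l)
  low : ∀ k → k < N → φ (f ⊖ g) k ≡ 0ℤ
  low = low′ N (f ⊖ g) λ k l → ≡.trans (cong (ℤ._- g k) (h k l)) (ℤₚ.+-inverseʳ (g k))

 Val⇒agree : ∀ {N f g} → LVal (+ N) (Φ f L.- Φ g) → ∀ k → k ℕ.* 4 < N → f k ≡ g k
 Val⇒agree {N} {f} {g} (r , p) k l = ≡.trans (≡.trans (lem (f k) (g k)) (cong (ℤ._+ g k) zero′)) (ℤₚ.+-identityˡ (g k))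
  where
  lem : ∀ a b → a ≡ a ℤ.- b ℤ.+ b
  lem = ℤ-ring
  zero′ : f k ℤ.- g k ≡ 0ℤ
  zero′ = ≡.trans (≡.sym (φ-4× (f ⊖ g) k)) (≡.trans (ι-inj (L.trans (Φ-⊖ f g) (L.trans p (L.sym (ι-* (vp N) r)))) (k ℕ.* 4)) (vp-low N r l))

-- Hall-Littlewood sums, choosing one variable at a time

module Picks where

 open Base
 open Solver
 open Interp
 open Signs
 open Split
 open Limit
 open Systems using (odd; dbl; dbl≡; dbl-inj)
 open Odds using (oddℤ)

 Distinct : List ℕ → Set
 Distinct = AllPairs _≢_

 data Pick {A : Set} : A → List A → List A → Set where
  here  : ∀ {a V} → Pick a V (a ∷ V)
  there : ∀ {a b r V} → Pick a r V → Pick a (b ∷ r) (b ∷ V)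

 Pick-↭ : ∀ {A : Set} {a : A} {r V} → Pick a r V → a ∷ r ↭ V
 Pick-↭ here = Perm.refl
 Pick-↭ (there {b = b} p) = Perm.trans (swap _ b Perm.refl) (prep b (Pick-↭ p))

 Pick-All : ∀ {A : Set} {P : A → Set} {a r V} → Pick a r V → All P V → P a × All P r
 Pick-All here (p ∷ ps) = p , ps
 Pick-All (there k) (p ∷ ps) = let q , qs = Pick-All k ps in q , p ∷ qs

 Pick-Distinct : ∀ {a r V} → Pick a r V → Distinct V → All (a ≢_) r × Distinct r
 Pick-Distinct here (h ∷ d) = h , d
 Pick-Distinct (there k) (h ∷ d) = let p , q = Pick-Distinct k d ; b≢a , b≢r = Pick-All k h in (λ e → b≢a (≡.sym e)) ∷ p , b≢r ∷ q

 Pick-length : ∀ {A : Set} {a : A} {r V} → Pick a r V → length V ≡ suc (length r)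
 Pick-length here = ≡.refl
 Pick-length (there k) = cong suc (Pick-length k)

 Split-Distinct : ∀ {S W V} → Split S W V → Distinct V → Distinct S × Distinct W
 Split-Distinct [] d = [] , []
 Split-Distinct (left s) (h ∷ d) = let p , q = Split-Distinct s d in Split-Allˡ s h ∷ p , q
 Split-Distinct (right s) (h ∷ d) = let p , q = Split-Distinct s d in p , Split-Allʳ s h ∷ q

 Split-apart : ∀ {S W V} → Split S W V → Distinct V → All (λ a → All (a ≢_) W) S
 Split-apart [] d = []
 Split-apart (left s) (h ∷ d) = Split-Allʳ s h ∷ Split-apart s d
 Split-apart (right s) (h ∷ d) = All.zipWith (λ { (b≢a , ps) → (λ e → b≢a (≡.sym e)) ∷ ps }) (Split-Allˡ s h , Split-apart s d)

 module PickSum (Λ : ExpRing) {A : Set} where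
  open ExpRing Λ
  open SplitSum Λ {A}

  pickSum : (A → List A → Carrier) → List A → Carrier
  pickSum H []       = 0#
  pickSum H (x ∷ xs) = H x xs + pickSum (λ a r → H a (x ∷ r)) xs

  pickSum-cong : ∀ {H G} V → (∀ {a r} → Pick a r V → H a r ≈ G a r) → pickSum H V ≈ pickSum G V
  pickSum-cong []      h = refl
  pickSum-cong (x ∷ V) h = +-cong (h here) (pickSum-cong V λ k → h (there k))

  pickSum-+ : ∀ H G V → pickSum (λ a r → H a r + G a r) V ≈ pickSum H V + pickSum G V
  pickSum-+ H G []      = sym (+-identityˡ _)
  pickSum-+ H G (x ∷ V) = trans (+-congˡ (pickSum-+ _ _ V)) (+-interchange _ _ _ _)

  pickSum-* : ∀ k H V → pickSum (λ a r → k * H a r) V ≈ k * pickSum H V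
  pickSum-* k H []      = sym (zeroʳ k)
  pickSum-* k H (x ∷ V) = trans (+-congˡ (pickSum-* k _ V)) (sym (distribˡ _ _ _))

  pickSum-0 : ∀ {H} V → (∀ {a r} → Pick a r V → H a r ≈ 0#) → pickSum H V ≈ 0#
  pickSum-0 []      h = refl
  pickSum-0 (x ∷ V) h = trans (+-cong (h here) (pickSum-0 V λ k → h (there k))) (+-identityˡ _)

  pickSum-↭ : ∀ {H V V′} → (∀ a {r r′} → r ↭ r′ → H a r ≈ H a r′) → V ↭ V′ → pickSum H V ≈ pickSum H V′
  pickSum-↭ S Perm.refl = refl
  pickSum-↭ S (prep x p) = +-cong (S x p) (pickSum-↭ (λ a q → S a (prep x q)) p)
  pickSum-↭ {H} {x ∷ y ∷ V} {.y ∷ .x ∷ V′} S (swap x y p) = trans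
   (+-cong (S x (prep y p)) (+-cong (S y (prep x p)) (trans (pickSum-cong V λ _ → S _ (swap x y Perm.refl)) (pickSum-↭ (λ a q → S a (prep y (prep x q))) p))))
   (solve Λ 3 0 (λ a b c → a :+ (b :+ c) := b :+ (a :+ c)) _ _ _)
  pickSum-↭ S (Perm.trans p q) = trans (pickSum-↭ S p) (pickSum-↭ S q)

  pickSum-splitSum : ∀ (H : A → List A → List A → Carrier) V →
   pickSum (λ a r → splitSum (λ S W → H a S W) r) V ≈ splitSum (λ Z W → pickSum (λ a S → H a S W) Z) V
  pickSum-splitSum H [] = refl
  pickSum-splitSum H (x ∷ V) = trans
   (+-congˡ (trans (pickSum-+ _ _ V) (+-cong (pickSum-splitSum (λ a S W → H a (x ∷ S) W) V) (pickSum-splitSum (λ a S W → H a S (x ∷ W)) V))))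
   (trans (sym (+-assoc _ _ _)) (+-congʳ (sym (splitSum-+ _ _ V))))

 module _ (R : LRing) (n : ℕ) where
  open LRing R
  open Seq R
  open PickSum Λ {ℕ}
  open SplitSum Λ {ℕ}

  private
   H T : ℤ
   H = + (2 ℕ.* n)
   T = H ℤ.+ H

  open Weights qRing T using (w; j-neg)

  t : Carrier
  t = E (T ℤ.+ T)

  -- (x_a - t x_b) / (x_a - x_b) with x_a = q^(a + 1/2)
  ff : ℕ → ℕ → Carrier
  ff a b = w (ℤ.- oddℤ a) (oddℤ b)

  Π : (ℕ → Carrier) → List ℕ → Carrier
  Π f []       = 1#
  Π f (b ∷ bs) = f b * Π f bs

  Π-↭ : ∀ f {l l′} → l ↭ l′ → Π f l ≈ Π f l′
  Π-↭ f Perm.refl = refl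
  Π-↭ f (prep x r) = *-congˡ (Π-↭ f r)
  Π-↭ f (swap x y r) = trans (*-congˡ (*-congˡ (Π-↭ f r))) (x*yz≈y*xz _ _ _)
  Π-↭ f (Perm.trans r s) = trans (Π-↭ f r) (Π-↭ f s)

  Π-Split : ∀ f {S W V} → Split S W V → Π f V ≈ Π f S * Π f W
  Π-Split f [] = sym (*-identityˡ _)
  Π-Split f (left s) = trans (*-congˡ (Π-Split f s)) (sym (*-assoc _ _ _))
  Π-Split f (right s) = trans (*-congˡ (Π-Split f s)) (x*yz≈y*xz _ _ _)

  Π-Val : ∀ f l → All (λ b → Val 0ℤ (f b)) l → Val 0ℤ (Π f l)
  Π-Val f [] [] = Val-1
  Π-Val f (b ∷ l) (h ∷ hs) = Val-* h (Π-Val f l hs)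

  odd-diff≢0 : ∀ {a b} → a ≢ b → ℤ.- oddℤ a ℤ.+ oddℤ b ≢ 0ℤ
  odd-diff≢0 {a} {b} d e = d (dbl-inj (suc-injective (ℤₚ.+-injective (≡.trans (lem (oddℤ a) (oddℤ b)) (≡.trans (cong (λ z → oddℤ b ℤ.- z) e) (ℤₚ.+-identityʳ _))))))
   where
   lem : ∀ a b → a ≡ b ℤ.- (ℤ.- a ℤ.+ b)
   lem = ℤ-ring

  -- Lagrange interpolation: Σ_a ∏_{b ≠ a} (x_a - t x_b) / (x_a - x_b) = (1 - t^N) / (1 - t)

  bracket : ℕ → Carrier
  bracket zero    = 0#
  bracket (suc k) = 1# + t * bracket k

  X : ℕ → Carrier
  X a = E (oddℤ a ℤ.+ oddℤ a)

  ff-clear : ∀ {a b} → a ≢ b → ff a b * (X a - X b) ≈ X a - t * X b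
  ff-clear {a} {b} d = trans
   (solve Λ 1 3 (λ j a b T → :u (⊟ a ⊞ b ⊞ T) :* j :* (:X a :- :X b) := (:X a :- :X T :* :X b) :* (:u (⊟ a ⊞ b) :* j)) _ (oddℤ a) (oddℤ b) T)
   (trans (*-congˡ (u*j (odd-diff≢0 d))) (*-identityʳ _))

  private
   Y-X tX : Carrier → ℕ → Carrier
   Y-X y b = - X b + 1# * y
   tX  y b = - (t * X b) + 1# * y

   tpw : List ℕ → Carrier
   tpw []      = 1#
   tpw (_ ∷ V) = t * tpw V

   lin-poly : ∀ (k : ℕ → Carrier) V → IsPoly Λ (length V) (λ y → Π (λ b → k b + 1# * y) V) 1#
   lin-poly k []      = λ _ → refl
   lin-poly k (b ∷ V) = poly-ext Λ (suc (length V)) (λ _ → refl) (*-identityˡ _) (poly-lin Λ (length V) (k b) 1# (lin-poly k V))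

   Σ-poly : ∀ N (G : ℕ → List ℕ → Carrier → Carrier) V → (∀ {a r} → Pick a r V → IsPoly Λ N (G a r) 0#) → IsPoly Λ N (λ y → pickSum (λ a r → G a r y) V) 0#
   Σ-poly zero G [] h = λ _ → refl
   Σ-poly (suc N) G [] h = 0# , (λ _ → 0#) , Σ-poly N (λ _ _ _ → 0#) [] (λ ()) , λ y → solve Λ 1 0 (λ y → :0 := :0 :+ y :* :0) y
   Σ-poly N G (x ∷ V) h = poly-ext Λ N (λ _ → refl) (+-identityˡ _) (poly-+ Λ N (h here) (Σ-poly N (λ a r → G a (x ∷ r)) V λ k → h (there k)))

   -- The product of all y - t X_b minus that of all y - X_b, minus its Lagrange interpolation at
   -- the nodes X_a. The top terms cancel, so the degree is below the number of nodes, where the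
   -- difference vanishes.
   f : List ℕ → Carrier → Carrier
   f V y = (Π (tX y) V + - 1# * Π (Y-X y) V) + - (1# - t) * pickSum (λ a r → (X a * Π (ff a) r) * Π (Y-X y) r) V

   f-poly : ∀ V → IsPoly Λ (length V) (f V) 0#
   f-poly V = poly-ext Λ (length V) (λ _ → refl) (solve Λ 1 0 (λ t → (:1 :+ :- :1 :* :1) :+ :- (:1 :- t) :* :0 := :0) t)
    (poly-+ Λ (length V) (poly-+ Λ (length V) (lin-poly _ V) (poly-* Λ (length V) (- 1#) (lin-poly _ V)))
     (poly-* Λ (length V) (- (1# - t)) (Σ-poly (length V) _ V λ {a} {r} k → subst (λ N → IsPoly Λ N (λ y → (X a * Π (ff a) r) * Π (Y-X y) r) 0#) (≡.sym (Pick-length k))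
      (poly-ext Λ (suc (length r)) (λ _ → refl) (refl) (poly-lift Λ (length r) (poly-* Λ (length r) (X a * Π (ff a) r) (lin-poly _ r)))))))

   f-head : ∀ a V → All (a ≢_) V → f (a ∷ V) (X a) ≈ 0#
   f-head a V d = begin
    (tX (X a) a * Π (tX (X a)) V + - 1# * (Y-X (X a) a * Π (Y-X (X a)) V)) + - (1# - t) * ((X a * Π (ff a) V) * Π (Y-X (X a)) V + pickSum _ V)
     ≈⟨ +-congˡ (*-congˡ (trans (+-congˡ (pickSum-0 V λ k → solve Λ 4 0 (λ c x y p → c :* ((:- x :+ :1 :* x) :* p) := :0) _ (X a) 1# _)) (+-identityʳ _))) ⟩
    (tX (X a) a * Π (tX (X a)) V + - 1# * (Y-X (X a) a * Π (Y-X (X a)) V)) + - (1# - t) * ((X a * Π (ff a) V) * Π (Y-X (X a)) V)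
     ≈⟨ solve Λ 5 0 (λ x t p q f → ((:- (t :* x) :+ :1 :* x) :* p :+ :- :1 :* ((:- x :+ :1 :* x) :* q)) :+ :- (:1 :- t) :* ((x :* f) :* q) := (:1 :- t) :* x :* (p :- f :* q)) (X a) t _ _ _ ⟩
    (1# - t) * X a * (Π (tX (X a)) V - Π (ff a) V * Π (Y-X (X a)) V)
     ≈⟨ *-congˡ (trans (+-congˡ (-‿cong (clear V d))) (-‿inverseʳ _)) ⟩
    (1# - t) * X a * 0#
     ≈⟨ zeroʳ _ ⟩
    0# ∎
    where
    open ≈-Reasoning
    clear : ∀ V → All (a ≢_) V → Π (ff a) V * Π (Y-X (X a)) V ≈ Π (tX (X a)) V
    clear [] [] = *-identityˡ _
    clear (b ∷ V) (d ∷ ds) = trans (*-interchange _ _ _ _) (*-cong (trans (*-congˡ (solve Λ 2 0 (λ x y → :- y :+ :1 :* x := x :- y) (X a) (X b)))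
     (trans (ff-clear d) (solve Λ 3 0 (λ x y t → x :- t :* y := :- (t :* y) :+ :1 :* x) (X a) (X b) t))) (clear V ds))

   f-↭ : ∀ {V V′} y → V ↭ V′ → f V y ≈ f V′ y
   f-↭ y p = +-cong (+-cong (Π-↭ _ p) (*-congˡ (Π-↭ _ p))) (*-congˡ (pickSum-↭ (λ a q → *-cong (*-congˡ (Π-↭ (ff a) q)) (Π-↭ _ q)) p))

   f-roots : ∀ pre V → Distinct (pre ++ V) → All (λ r → f (pre ++ V) r ≈ 0#) (map X V)
   f-roots pre [] d = []
   f-roots pre (a ∷ V) d with distinct-↭ (Permₚ.shift a pre V) d
    where
    distinct-↭ : ∀ {V V′} → V ↭ V′ → Distinct V → Distinct V′
    distinct-↭ Perm.refl d = d
    distinct-↭ (prep x p) (h ∷ d) = Permₚ.All-resp-↭ p h ∷ distinct-↭ p d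
    distinct-↭ (swap x y p) ((xy ∷ h) ∷ h′ ∷ d) = ((λ e → xy (≡.sym e)) ∷ Permₚ.All-resp-↭ p h′) ∷ Permₚ.All-resp-↭ p h ∷ distinct-↭ p d
    distinct-↭ (Perm.trans p q) d = distinct-↭ q (distinct-↭ p d)
   ... | h ∷ _ = trans (f-↭ (X a) (Permₚ.shift a pre V)) (f-head a (pre ++ V) h) ∷
    All.map (λ {r} e → trans (reflexive (cong (λ l → f l r) (assoc pre))) e) (f-roots (pre ++ a ∷ []) V (subst Distinct (assoc pre) d))
    where
    assoc : ∀ pre → pre ++ a ∷ V ≡ (pre ++ a ∷ []) ++ V
    assoc [] = ≡.refl
    assoc (b ∷ pre) = cong (b ∷_) (assoc pre)

   X-separated : ∀ V → Distinct V → AllPairs (Separated Λ) (map X V)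
   X-separated [] [] = []
   X-separated (a ∷ V) (h ∷ d) = go h ∷ X-separated V d
    where
    go : ∀ {V} → All (a ≢_) V → All (Separated Λ (X a)) (map X V)
    go [] = []
    go {b ∷ _} (ab ∷ h) = (λ {x} e → trans (sym (trans (solve Λ 2 2 (λ j x a b → :X (⊟ a) :* (:- j) :* ((:X b :- :X a) :* x) := (:u (⊟ a ⊞ b) :* j) :* x) (j (ℤ.- oddℤ a ℤ.+ oddℤ b)) x (oddℤ a) (oddℤ b))
     (trans (*-congʳ (u*j (odd-diff≢0 ab))) (*-identityˡ x)))) (trans (*-congˡ e) (zeroʳ _))) ∷ go h

   map-length : ∀ V → length (map X V) ≡ length V
   map-length [] = ≡.refl
   map-length (_ ∷ V) = cong suc (map-length V)

   f-zero : ∀ V → Distinct V → ∀ y → f V y ≈ 0#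
   f-zero V d = poly-zero Λ (map X V) (subst (λ N → IsPoly Λ N (f V) 0#) (≡.sym (map-length V)) (f-poly V)) refl (X-separated V d) (f-roots [] V d)

   -- the value at y = 0, divided by ∏ (- x_b)
   at-0 : ∀ V → f V 0# ≈ Π (λ b → - X b) V * ((tpw V - 1#) + (1# - t) * pickSum (λ a r → Π (ff a) r) V)
   at-0 V = trans (+-cong (+-cong (t-part V) (*-congˡ (Π-cong V))) (*-congˡ (trans (pickSum-cong V λ {a} {r} k → term k) (pickSum-* _ _ V))))
    (solve Λ 4 0 (λ p q t s → (p :* q :+ :- :1 :* p) :+ :- (:1 :- t) :* (:- p :* s) := p :* ((q :- :1) :+ (:1 :- t) :* s)) (Π (λ b → - X b) V) (tpw V) t _)
    where
    Π-cong : ∀ V → Π (Y-X 0#) V ≈ Π (λ b → - X b) V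
    Π-cong [] = refl
    Π-cong (b ∷ V) = *-cong (solve Λ 1 0 (λ x → :- x :+ :1 :* :0 := :- x) (X b)) (Π-cong V)
    t-part : ∀ V → Π (tX 0#) V ≈ Π (λ b → - X b) V * tpw V
    t-part [] = sym (*-identityˡ _)
    t-part (b ∷ V) = trans (*-cong (solve Λ 2 0 (λ t x → :- (t :* x) :+ :1 :* :0 := (:- x) :* t) t (X b)) (t-part V)) (*-interchange _ _ _ _)
    term : ∀ {a r} → Pick a r V → (X a * Π (ff a) r) * Π (Y-X 0#) r ≈ - Π (λ b → - X b) V * Π (ff a) r
    term {a} {r} k = trans (*-congˡ (Π-cong r)) (trans (solve Λ 3 0 (λ x f p → (x :* f) :* p := :- ((:- x) :* p) :* f) (X a) (Π (ff a) r) (Π (λ b → - X b) r)) (*-congʳ (-‿cong (Π-↭ _ (Pick-↭ k)))))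

  lagrange : ∀ V → Distinct V → (1# - t) * pickSum (λ a r → Π (ff a) r) V ≈ (1# - t) * bracket (length V)
  lagrange V d = begin
   (1# - t) * s
    ≈⟨ solve Λ 2 0 (λ a b → b := (a :+ b) :- a) (tpw V - 1#) _ ⟩
   ((tpw V - 1#) + (1# - t) * s) - (tpw V - 1#)
    ≈⟨ +-congʳ (cancel V (trans (sym (at-0 V)) (f-zero V d 0#))) ⟩
   0# - (tpw V - 1#)
    ≈⟨ bracket≈ V ⟩
   (1# - t) * bracket (length V) ∎
   where
   open ≈-Reasoning
   s : Carrier
   s = pickSum (λ a r → Π (ff a) r) V
   cancel : ∀ V {x} → Π (λ b → - X b) V * x ≈ 0# → x ≈ 0#
   cancel [] e = trans (sym (*-identityˡ _)) e
   cancel (b ∷ V) {x} e = cancel V (trans (solve Λ 2 1 (λ p x b → p :* x := (:- :X (⊟ b)) :* ((:- :X b) :* p :* x)) _ x (oddℤ b)) (trans (*-congˡ e) (zeroʳ _)))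
   bracket≈ : ∀ V → 0# - (tpw V - 1#) ≈ (1# - t) * bracket (length V)
   bracket≈ [] = solve Λ 1 0 (λ t → :0 :- (:1 :- :1) := (:1 :- t) :* :0) t
   bracket≈ (_ ∷ V) = trans (solve Λ 2 0 (λ t p → :0 :- (t :* p :- :1) := (:1 :- t) :+ t :* (:0 :- (p :- :1))) t (tpw V))
    (trans (+-congˡ (*-congˡ (bracket≈ V))) (solve Λ 2 0 (λ t b → (:1 :- t) :+ t :* ((:1 :- t) :* b) := (:1 :- t) :* (:1 :+ t :* b)) t _))

  -- The t-factorial (t; t)_k / (1 - t)^k, one factor of the normalisation v.
  fac : ℕ → Carrier
  fac zero    = 1#
  fac (suc k) = bracket (suc k) * fac k

  qp : ℕ → Carrier
  qp k = E (+ (k ℕ.+ k ℕ.+ (k ℕ.+ k)))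

  qp-+ : ∀ a b → qp (a ℕ.+ b) ≈ qp a * qp b
  qp-+ a b = trans (reflexive (cong (λ z → E (+ z)) (lem a b))) (E-+ _ _)
   where
   lem : ∀ a b → a ℕ.+ b ℕ.+ (a ℕ.+ b) ℕ.+ (a ℕ.+ b ℕ.+ (a ℕ.+ b)) ≡ (a ℕ.+ a ℕ.+ (a ℕ.+ a)) ℕ.+ (b ℕ.+ b ℕ.+ (b ℕ.+ b))
   lem = ℕ-ring

  -- The unnormalised Hall–Littlewood sum, with the factors for zero parts left out.
  Pt : List ℕ → List ℕ → Carrier
  Pt []       V = 1#
  Pt (k ∷ μ) V = pickSum (λ a r → qp (k ℕ.* a) * Π (ff a) r * Pt μ r) V

  module _ (1-t-cancel : ∀ {x y} → (1# - t) * x ≈ (1# - t) * y → x ≈ y) where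
   lagrange′ : ∀ V → Distinct V → pickSum (λ a r → Π (ff a) r) V ≈ bracket (length V)
   lagrange′ V d = 1-t-cancel (lagrange V d)

   -- Once the parts of μ are placed, i variables remain. Choosing them one by one gives, by
   -- Lagrange interpolation, the brackets of i, i - 1, ..., 1.
   Pt-zeros : ∀ μ i V → Distinct V → length V ≡ length μ ℕ.+ i → Pt (μ ++ replicate i 0) V ≈ fac i * Pt μ V
   Pt-zeros [] zero V d e = sym (*-identityˡ _)
   Pt-zeros [] (suc i) V d e = trans (pickSum-cong V λ {a} {r} k → trans (*-cong (trans (*-congʳ E-0) (*-identityˡ _))
     (Pt-zeros [] i r (proj₂ (Pick-Distinct k d)) (suc-injective (≡.trans (≡.sym (Pick-length k)) e)))) (solve Λ 2 0 (λ p f → p :* (f :* :1) := f :* p) _ _))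
    (trans (pickSum-* _ _ V) (trans (*-congˡ (trans (lagrange′ V d) (reflexive (cong bracket e)))) (solve Λ 2 0 (λ f b → f :* b := b :* f :* :1) _ _)))
   Pt-zeros (x ∷ μ) i V d e = trans (pickSum-cong V λ {a} {r} k → trans (*-congˡ (Pt-zeros μ i r (proj₂ (Pick-Distinct k d)) (suc-injective (≡.trans (≡.sym (Pick-length k)) e))))
    (x*yz≈y*xz _ _ _)) (pickSum-* _ _ V)

   δ : ℕ → ℕ → Carrier
   δ zero    zero    = 1#
   δ zero    (suc k) = 0#
   δ (suc j) zero    = 0#
   δ (suc j) (suc k) = δ j k

   A : List ℕ → List ℕ → Carrier
   A S W = Π (λ a → Π (ff a) W) S

   -- Variables chosen one after another for j equal parts form a set S. Summing over the orders in
   -- which S can be chosen gives `fac j`, again by Lagrange interpolation inside S; this is what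
   -- makes the largest parts split off as in the recursion for `F`.
   Pt-equal : ∀ k j μ V → Distinct V → Pt (replicate j k ++ μ) V ≈ fac j * splitSum (λ S W → δ j (length S) * Π (λ a → qp (k ℕ.* a)) S * A S W * Pt μ W) V
   Pt-equal k zero μ V d = sym (trans (*-identityˡ _) (trans (only V) refl))
    where
    only : ∀ V → splitSum (λ S W → δ 0 (length S) * Π (λ a → qp (k ℕ.* a)) S * A S W * Pt μ W) V ≈ Pt μ V
    only V = trans (go (Pt μ) V) refl
     where
     zero-sum : ∀ {G : List ℕ → List ℕ → Carrier} V → (∀ S W → G S W ≈ 0#) → splitSum G V ≈ 0#
     zero-sum [] h = h [] []
     zero-sum (x ∷ V) h = trans (+-cong (zero-sum V λ S W → h (x ∷ S) W) (zero-sum V λ S W → h S (x ∷ W))) (+-identityˡ _)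
     go : ∀ (P : List ℕ → Carrier) V → splitSum (λ S W → δ 0 (length S) * Π (λ a → qp (k ℕ.* a)) S * A S W * P W) V ≈ P V
     go P [] = solve Λ 1 0 (λ p → :1 :* :1 :* :1 :* p := p) _
     go P (x ∷ V) = trans (+-cong (zero-sum V λ S W → solve Λ 3 0 (λ a b c → :0 :* a :* b :* c := :0) _ _ _)
      (trans (splitSum-cong V λ {S} _ → δ-A S) (go (λ W → P (x ∷ W)) V))) (+-identityˡ _)
      where
      δ-A : ∀ S {W} → δ 0 (length S) * Π (λ a → qp (k ℕ.* a)) S * A S (x ∷ W) * P (x ∷ W) ≈ δ 0 (length S) * Π (λ a → qp (k ℕ.* a)) S * A S W * P (x ∷ W)
      δ-A [] = refl
      δ-A (_ ∷ S) = solve Λ 4 0 (λ a b c d → :0 :* a :* b :* d := :0 :* a :* c :* d) _ _ _ _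
   Pt-equal k (suc j) μ V d = begin
    pickSum (λ a r → qp (k ℕ.* a) * Π (ff a) r * Pt (replicate j k ++ μ) r) V
     ≈⟨ (pickSum-cong V λ {a} {r} p → trans (*-congˡ (Pt-equal k j μ r (proj₂ (Pick-Distinct p d))))
       (trans (x*yz≈y*xz _ _ _) (*-congˡ (trans (sym (splitSum-* _ _ r)) (splitSum-cong r λ s →
        trans (*-congʳ (*-congˡ (Π-Split (ff a) s))) (solve Λ 7 0 (λ q x y d e A P → q :* (x :* y) :* (d :* e :* A :* P) := d :* (q :* e) :* (y :* A) :* P :* x) _ _ _ _ _ _ _)))))) ⟩
    pickSum (λ a r → fac j * splitSum (λ S W → G a S W * Π (ff a) S) r) V
     ≈⟨ trans (pickSum-* _ _ V) (*-congˡ (pickSum-splitSum _ V)) ⟩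
    fac j * splitSum (λ Z W → pickSum (λ a S → G a S W * Π (ff a) S) Z) V
     ≈⟨ *-congˡ (splitSum-cong V λ {Z} {W} s → trans (pickSum-cong Z λ {a} {S} p → *-congʳ (*-congʳ (*-cong (*-cong (reflexive (cong (δ (suc j)) (≡.sym (Pick-length p)))) (Π-↭ _ (Pick-↭ p))) (Π-↭ _ (Pick-↭ p)))))
       (trans (pickSum-* _ _ Z) (trans (*-congˡ (lagrange′ Z (proj₁ (Split-Distinct s d)))) (δ-bracket (length Z) _ _ _)))) ⟩
    fac j * splitSum (λ Z W → bracket (suc j) * (δ (suc j) (length Z) * Π (λ a → qp (k ℕ.* a)) Z * A Z W * Pt μ W)) V
     ≈⟨ trans (*-congˡ (splitSum-* _ _ V)) (solve Λ 3 0 (λ a b c → a :* (b :* c) := (b :* a) :* c) _ _ _) ⟩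
    fac (suc j) * splitSum (λ S W → δ (suc j) (length S) * Π (λ a → qp (k ℕ.* a)) S * A S W * Pt μ W) V ∎
    where
    open ≈-Reasoning
    G : ℕ → List ℕ → List ℕ → Carrier
    G a S W = δ (suc j) (suc (length S)) * (qp (k ℕ.* a) * Π (λ a → qp (k ℕ.* a)) S) * (Π (ff a) W * A S W) * Pt μ W
    δ-bracket : ∀ l x y z → δ (suc j) l * x * y * z * bracket l ≈ bracket (suc j) * (δ (suc j) l * x * y * z)
    δ-bracket l x y z = trans (solve Λ 5 0 (λ d x y z b → d :* x :* y :* z :* b := (d :* b) :* (x :* y :* z)) _ _ _ _ _)
     (trans (*-congʳ (swap-δ (suc j) l)) (solve Λ 5 0 (λ d x y z b → (d :* b) :* (x :* y :* z) := b :* (d :* x :* y :* z)) _ _ _ _ _))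
     where
     agree : ∀ j l → (δ j l ≈ 0#) ⊎ (j ≡ l)
     agree zero zero = inj₂ ≡.refl
     agree zero (suc l) = inj₁ refl
     agree (suc j) zero = inj₁ refl
     agree (suc j) (suc l) with agree j l
     ... | inj₁ e = inj₁ e
     ... | inj₂ e = inj₂ (cong suc e)
     swap-δ : ∀ j l → δ j l * bracket l ≈ δ j l * bracket j
     swap-δ j l with agree j l
     ... | inj₁ e = trans (*-congʳ e) (trans (zeroˡ _) (sym (trans (*-congʳ e) (zeroˡ _))))
     ... | inj₂ ≡.refl = refl

  private
   odd-gap : ∀ {a b} → a < b → + 1 ℤ.≤ ℤ.- oddℤ a ℤ.+ oddℤ b × ℤ.- oddℤ a ℤ.+ oddℤ b ≡ + ((b ∸ a) ℕ.+ (b ∸ a))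
   odd-gap {a} {b} l = subst (+ 1 ℤ.≤_) (≡.sym e) (ℤ.+≤+ (≤-trans (m<n⇒0<n∸m l) (m≤m+n _ _))) , e
    where
    lem : ∀ a k → ℤ.- (+ 1 ℤ.+ (a ℤ.+ a)) ℤ.+ (+ 1 ℤ.+ (k ℤ.+ a ℤ.+ (k ℤ.+ a))) ≡ k ℤ.+ k
    lem = ℤ-ring
    e : ℤ.- oddℤ a ℤ.+ oddℤ b ≡ + ((b ∸ a) ℕ.+ (b ∸ a))
    e = ≡.trans (cong₂ (λ x y → ℤ.- (+ 1 ℤ.+ + x) ℤ.+ (+ 1 ℤ.+ + y)) (dbl≡ a) (≡.trans (dbl≡ b) (cong (λ z → z ℕ.+ z) (≡.sym (m∸n+n≡m (<⇒≤ l)))))) (lem (+ a) (+ (b ∸ a)))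

   Val-t : Val 0ℤ t
   Val-t = Val-≤ (ℤ.+≤+ z≤n) (Val-E (T ℤ.+ T))

  -- For a > b numerator and denominator are multiplied by X_a / X_b, up to sign, so that the
  -- denominator is again 1 minus a positive power.
  Val-ff : ∀ {a b} → a ≢ b → Val 0ℤ (ff a b)
  Val-ff {a} {b} d with <-cmp a b
  ... | tri< l _ _ = let g , _ = odd-gap l in Val-* (One⇒Val {0} (One-u {0} (ℤₚ.≤-trans (ℤ.+≤+ z≤n) (ℤₚ.+-mono-≤ (ℤₚ.≤-trans (ℤ.+≤+ z≤n) g) (ℤ.+≤+ z≤n))))) (Val-j g)
  ... | tri≈ _ e _ = ⊥-elim (d e)
  ... | tri> _ _ l = let g , e = odd-gap l ; c = ℤ.- oddℤ b ℤ.+ oddℤ a in Val-≈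
    (trans (solve Λ 1 3 (λ j a b T → (:X T :- :X (⊟ b ⊞ a)) :* j := :u (⊟ a ⊞ b ⊞ T) :* :- (:X (⊟ b ⊞ a) :* j)) (j c) (oddℤ a) (oddℤ b) T)
     (*-congˡ (trans (sym (j-neg (λ z → ≢0-pos g z))) (reflexive (cong j (lem (oddℤ a) (oddℤ b)))))))
    (Val-* (Val-+ Val-t (Val-neg (Val-≤ (ℤₚ.+-mono-≤ (ℤₚ.≤-trans (ℤ.+≤+ z≤n) g) (ℤₚ.≤-trans (ℤ.+≤+ z≤n) g)) (Val-E (c ℤ.+ c))))) (Val-j g))
   where
   lem : ∀ a b → ℤ.- (ℤ.- b ℤ.+ a) ≡ ℤ.- a ℤ.+ b
   lem = ℤ-ring

  Val-qp : ∀ k → Val 0ℤ (qp k)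
  Val-qp k = Val-≤ (ℤ.+≤+ z≤n) (Val-E _)

  Val-Πff : ∀ {a r} → All (a ≢_) r → Val 0ℤ (Π (ff a) r)
  Val-Πff h = Π-Val _ _ (All.map Val-ff h)

  pickSum-Val : ∀ {k H} V → (∀ {a r} → Pick a r V → Val k (H a r)) → Val k (pickSum H V)
  pickSum-Val [] h = Val-0 _
  pickSum-Val (x ∷ V) h = Val-+ (h here) (pickSum-Val V λ p → h (there p))

  Val-Pt : ∀ μ V → Distinct V → Val 0ℤ (Pt μ V)
  Val-Pt [] V d = Val-1
  Val-Pt (k ∷ μ) V d = pickSum-Val V λ {a} {r} p → let h , d′ = Pick-Distinct p d in Val-* (Val-* (Val-qp (k ℕ.* a)) (Val-Πff h)) (Val-Pt μ r d′)

  fourfold : ℕ → ℕ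
  fourfold k = k ℕ.+ k ℕ.+ (k ℕ.+ k)

  private
   ff-far : ∀ {a M} → a < M → Val (+ fourfold (M ∸ a)) (ff a M - 1#)
   ff-far {a} {M} l = let g , e = odd-gap l ; c = ℤ.- oddℤ a ℤ.+ oddℤ M in Val-≈
    (trans (solve Λ 1 2 (λ j c T → :X c :* ((:1 :- :X T) :* j) := :u (c ⊞ T) :* j :- :u c :* j) (j c) c T) (+-congˡ (-‿cong (u*j (λ z → ≢0-pos g z)))))
    (Val-scale (≡.trans (ℤₚ.+-identityʳ _) (cong (λ z → z ℤ.+ z) e)) (Val-E (c ℤ.+ c)) (Val-* (Val-+ Val-1 (Val-neg Val-t)) (Val-j g)))

  -- Giving a part k ≥ 1 to the new variable q^M costs q^(kM). Giving it to an old variable q^a adds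
  -- a factor that differs from 1 by order q^(M-a), and the power q^(ka) makes up for the missing
  -- q^a.
  stable : ∀ μ M V → All (1 ≤_) μ → Distinct V → All (_< M) V → Val (+ fourfold M) (Pt μ (V ++ M ∷ []) - Pt μ V)
  stable [] M V h d b = Val-≈ (sym (-‿inverseʳ 1#)) (Val-0 _)
  stable (k ∷ μ) M V (k≥1 ∷ h) d b = Val-≈ (sym (trans (+-congʳ (trans (pick-snoc V) refl)) refl))
   (Val-≈ (solve Λ 3 0 (λ a b c → (a :- c) :+ b := (a :+ b) :- c) _ _ _) (Val-+
    (Val-≈ (trans (pickSum-+ _ _ V) (+-congˡ (trans (pickSum-cong V λ _ → solve Λ 1 0 (λ a → :- a := :- :1 :* a) _) (trans (pickSum-* _ _ V) (solve Λ 1 0 (λ a → :- :1 :* a := :- a) _)))))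
     (pickSum-Val V λ {a} {r} p → let a≢r , d′ = Pick-Distinct p d ; a<M , r<M = Pick-All p b in
      Val-≈ (trans (solve Λ 6 0 (λ q f g P P′ c → (q :* (f :- :1)) :* (g :* P) :+ q :* g :* (P :- P′) := q :* (f :* g) :* P :- q :* g :* P′) _ _ _ _ _ 1#) (+-congʳ (*-congʳ (*-congˡ (sym (Π-↭ (ff a) (Perm.↭-trans (Permₚ.shift M r []) (prep M (Perm.↭-reflexive (Listₚ.++-identityʳ r)))))))))) (Val-+
       (Val-scale (ℤₚ.+-identityʳ _) (Val-≤ (near k k≥1 a<M) (Val-* (Val-E (+ fourfold (k ℕ.* a))) (ff-far a<M))) (Val-* (Val-Πff a≢r) (Val-Pt μ (r ++ M ∷ []) (distinct-snoc r d′ r<M))))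
       (Val-scale (ℤₚ.+-identityˡ _) (Val-* (Val-qp (k ℕ.* a)) (Val-Πff a≢r)) (stable μ M r h d′ r<M)))))
    (Val-scale {+ fourfold M} {0ℤ} (ℤₚ.+-identityʳ _) (Val-scale {+ fourfold M} {0ℤ} (ℤₚ.+-identityʳ _) (Val-≤ (ℤ.+≤+ (four-mono (≤-trans (≤-reflexive (≡.sym (ℕₚ.*-identityˡ M))) (*-monoˡ-≤ M k≥1)))) (Val-E _)) (Val-Πff (All.map (λ l e → <-irrefl (≡.sym e) l) b))) (Val-Pt μ V d))))
   where
   four-mono : ∀ {a b} → a ≤ b → fourfold a ≤ fourfold b
   four-mono l = +-mono-≤ (+-mono-≤ l l) (+-mono-≤ l l)
   near : ∀ k {a} → 1 ≤ k → a < M → + fourfold M ℤ.≤ + fourfold (k ℕ.* a) ℤ.+ + fourfold (M ∸ a)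
   near k {a} k≥1 l = ℤ.+≤+ (≤-trans (four-mono (≤-trans (≤-reflexive (≡.sym (m+[n∸m]≡n (<⇒≤ l)))) (+-monoˡ-≤ (M ∸ a) (≤-trans (≤-reflexive (≡.sym (ℕₚ.*-identityˡ a))) (*-monoˡ-≤ a k≥1)))))
    (≤-reflexive (lem (k ℕ.* a) (M ∸ a))))
    where
    lem : ∀ a b → a ℕ.+ b ℕ.+ (a ℕ.+ b) ℕ.+ (a ℕ.+ b ℕ.+ (a ℕ.+ b)) ≡ (a ℕ.+ a ℕ.+ (a ℕ.+ a)) ℕ.+ (b ℕ.+ b ℕ.+ (b ℕ.+ b))
    lem = ℕ-ring
   distinct-snoc : ∀ r → Distinct r → All (_< M) r → Distinct (r ++ M ∷ [])
   distinct-snoc [] [] [] = [] ∷ []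
   distinct-snoc (x ∷ r) (h ∷ d) (l ∷ ls) = snoc h ∷ distinct-snoc r d ls
    where
    snoc : ∀ {r} → All (x ≢_) r → All (x ≢_) (r ++ M ∷ [])
    snoc [] = (λ e → <-irrefl e l) ∷ []
    snoc (p ∷ ps) = p ∷ snoc ps
   pick-snoc : ∀ {H} V → pickSum H (V ++ M ∷ []) ≈ pickSum (λ a r → H a (r ++ M ∷ [])) V + H M V
   pick-snoc [] = +-comm _ _
   pick-snoc (x ∷ V) = trans (+-congˡ (pick-snoc V)) (sym (+-assoc _ _ _))

-- The sum over permutations

module Perms where

 open Base
 open Solver
 open Picks
 open Defs using (insertions; perms)

 insertions-↭ : ∀ x {zs V} → zs ↭ V → All (_↭ x ∷ V) (insertions x zs)
 insertions-↭ x {[]} p = prep x p ∷ []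
 insertions-↭ x {y ∷ ys} p = prep x p ∷ Allₚ.map⁺ (All.map (λ q → ↭-trans (prep y q) (↭-trans (swap y x Perm.refl) (prep x p))) (insertions-↭ x Perm.refl))

 perms-↭ : ∀ V → All (_↭ V) (perms V)
 perms-↭ [] = Perm.refl ∷ []
 perms-↭ (x ∷ V) = Allₚ.concat⁺ (Allₚ.map⁺ (All.map (insertions-↭ x) (perms-↭ V)))

 module ListSum (Λ : ExpRing) where
  open ExpRing Λ

  listSum : ∀ {B : Set} → (B → Carrier) → List B → Carrier
  listSum G []       = 0#
  listSum G (b ∷ bs) = G b + listSum G bs

  module _ {B : Set} where
   listSum-cong : ∀ {G H : B → Carrier} {l} → All (λ b → G b ≈ H b) l → listSum G l ≈ listSum H l
   listSum-cong []       = refl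
   listSum-cong (e ∷ es) = +-cong e (listSum-cong es)

   listSum-++ : ∀ (G : B → Carrier) l l′ → listSum G (l ++ l′) ≈ listSum G l + listSum G l′
   listSum-++ G [] l′      = sym (+-identityˡ _)
   listSum-++ G (b ∷ l) l′ = trans (+-congˡ (listSum-++ G l l′)) (sym (+-assoc _ _ _))

   listSum-+ : ∀ (G H : B → Carrier) l → listSum (λ b → G b + H b) l ≈ listSum G l + listSum H l
   listSum-+ G H []      = sym (+-identityˡ _)
   listSum-+ G H (b ∷ l) = trans (+-congˡ (listSum-+ G H l)) (+-interchange _ _ _ _)

   listSum-* : ∀ k (G : B → Carrier) l → listSum (λ b → k * G b) l ≈ k * listSum G l
   listSum-* k G []      = sym (zeroʳ k)
   listSum-* k G (b ∷ l) = trans (+-congˡ (listSum-* k G l)) (sym (distribˡ _ _ _))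

  listSum-map : ∀ {B C : Set} (G : C → Carrier) (f : B → C) l → listSum G (map f l) ≈ listSum (λ b → G (f b)) l
  listSum-map G f []      = refl
  listSum-map G f (b ∷ l) = +-congˡ (listSum-map G f l)

  listSum-concatMap : ∀ {B C : Set} (G : C → Carrier) (f : B → List C) l → listSum G (concatMap f l) ≈ listSum (λ b → listSum G (f b)) l
  listSum-concatMap G f []      = refl
  listSum-concatMap G f (b ∷ l) = trans (listSum-++ G (f b) _) (+-congˡ (listSum-concatMap G f l))

  sum< : ℕ → (ℕ → Carrier) → Carrier
  sum< zero    f = 0#
  sum< (suc k) f = f k + sum< k f

  sum<-cong : ∀ k {f g} → (∀ i → i < k → f i ≈ g i) → sum< k f ≈ sum< k g
  sum<-cong zero    h = refl
  sum<-cong (suc k) h = +-cong (h k ≤-refl) (sum<-cong k λ i l → h i (m<n⇒m<1+n l))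

  listSum-applyUpTo : ∀ {B : Set} (G : B → Carrier) (f : ℕ → B) k → listSum G (applyUpTo f k) ≈ sum< k (λ i → G (f i))
  listSum-applyUpTo G f zero    = refl
  listSum-applyUpTo G f (suc k) = trans (+-congˡ (listSum-applyUpTo G (λ i → f (suc i)) k)) (front k λ i → G (f i))
   where
   front : ∀ k g → g 0 + sum< k (λ i → g (suc i)) ≈ sum< (suc k) g
   front zero g    = refl
   front (suc k) g = trans (solve Λ 3 0 (λ a b c → a :+ (b :+ c) := b :+ (a :+ c)) _ _ _) (+-congˡ (front k g))

  open PickSum Λ {ℕ}

  private
   permSum : (List ℕ → Carrier) → List ℕ → Carrier
   permSum G V = listSum G (perms V)

   insert later : ℕ → (List ℕ → Carrier) → List ℕ → Carrier
   insert x G zs = listSum G (insertions x zs)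
   later x G []       = 0#
   later x G (y ∷ ys) = insert x (λ l → G (y ∷ l)) ys

   insert≈ : ∀ x G zs → insert x G zs ≈ G (x ∷ zs) + later x G zs
   insert≈ x G []       = refl
   insert≈ x G (y ∷ ys) = +-congˡ (listSum-map G (y ∷_) (insertions x ys))

   permSum-∷ : ∀ G x V → permSum G (x ∷ V) ≈ permSum (insert x G) V
   permSum-∷ G x V = listSum-concatMap G (insertions x) (perms V)

  -- `perms` inserts x into the permutations of V, whereas `Pt` is a recursion on the first entry.
  -- Either x is that entry, or it is inserted behind it, and the latter case is the same statement
  -- for V.
  permSum-pickSum : ∀ G x V → listSum G (perms (x ∷ V)) ≈ pickSum (λ a r → listSum (λ w → G (a ∷ w)) (perms r)) (x ∷ V)
  permSum-pickSum G x V = trans (permSum-∷ G x V) (trans (listSum-cong (All.universal (insert≈ x G) (perms V))) (trans (listSum-+ _ _ (perms V)) (+-congˡ (go V))))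
   where
   go : ∀ V → permSum (later x G) V ≈ pickSum (λ a r → permSum (λ w → G (a ∷ w)) (x ∷ r)) V
   go [] = +-identityˡ _
   go (y ∷ V) = trans (permSum-pickSum (later x G) y V) (pickSum-cong (y ∷ V) λ {a} {r} _ → sym (permSum-∷ (λ w → G (a ∷ w)) x r))

 module _ (R : LRing) (n : ℕ) where
  open LRing R
  open ListSum Λ
  open PickSum Λ {ℕ}

  arranged : List ℕ → List ℕ → Carrier
  arranged (k ∷ μ) (a ∷ w) = qp R n (k ℕ.* a) * Π R n (ff R n a) w * arranged μ w
  arranged _       _       = 1#

  permSum≈Pt : ∀ μ V → length μ ≡ length V → listSum (arranged μ) (perms V) ≈ Pt R n μ V
  permSum≈Pt [] [] e = +-identityʳ _
  permSum≈Pt (k ∷ μ) (x ∷ V) e = trans (permSum-pickSum (arranged (k ∷ μ)) x V) (pickSum-cong (x ∷ V) λ {a} {r} p →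
   trans (listSum-cong (All.map (λ q → *-congʳ (*-congˡ (Π-↭ R n (ff R n a) q))) (perms-↭ r)))
    (trans (listSum-* _ _ (perms r)) (*-congˡ (permSum≈Pt μ r (suc-injective (≡.trans e (Pick-length p)))))))

-- Generating functions over partitions with bounded parts

module Partitions where

 open Base
 open Solver
 open Signs
 open Split
 open Littlewood using (times; F)
 open Collapse using (times≡*)
 open Limit
 open Systems using (odd; dbl≡)
 open Odds using (oddℤ)
 open Picks
 open Perms
 open Defs using (partsF; from1; count; double)

 PartsIn : ℕ → List ℕ → Set
 PartsIn m = All (λ p → 1 ≤ p × p ≤ m)

 partsF-bounded : ∀ f m s → All (PartsIn m) (partsF f m s)
 partsF-bounded f m zero = [] ∷ []
 partsF-bounded zero m (suc s) = []
 partsF-bounded (suc f) m (suc s) = Allₚ.concat⁺ (Allₚ.map⁺ (Allₚ.map⁺ (Allₚ.applyUpTo⁺₁ (λ i → i) (m ⊓ suc s) λ {i} i< →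
  let k≤m = ≤-trans i< (m⊓n≤m m (suc s)) in
  Allₚ.map⁺ (All.map (λ h → (s≤s z≤n , k≤m) ∷ All.map (λ (p , q) → p , ≤-trans q k≤m) h) (partsF-bounded f (suc i) (s ∸ i))))))

 count-≡ : ∀ i l → count i (i ∷ l) ≡ suc (count i l)
 count-≡ i l with i ≡ᵇ i | ℕₚ.≡⇒≡ᵇ i i ≡.refl
 ... | true | _ = ≡.refl

 count-≢ : ∀ {i x} l → i ≢ x → count i (x ∷ l) ≡ count i l
 count-≢ {i} {x} l d with i ≡ᵇ x | ℕₚ.≡ᵇ⇒≡ i x
 ... | false | _ = ≡.refl
 ... | true  | h = ⊥-elim (d (h _))

 count-absent : ∀ {i} l → All (i ≢_) l → count i l ≡ 0
 count-absent [] [] = ≡.refl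
 count-absent (x ∷ l) (d ∷ ds) = ≡.trans (count-≢ l d) (count-absent l ds)

 count-replicate : ∀ i j l → count i (replicate j i ++ l) ≡ j ℕ.+ count i l
 count-replicate i zero l = ≡.refl
 count-replicate i (suc j) l = ≡.trans (count-≡ i (replicate j i ++ l)) (cong suc (count-replicate i j l))

 count-other : ∀ {i k} j l → i ≢ k → count i (replicate j k ++ l) ≡ count i l
 count-other zero l d = ≡.refl
 count-other {k = k} (suc j) l d = ≡.trans (count-≢ (replicate j k ++ l) d) (count-other j l d)

 module _ (Λ : ExpRing) where
  open ExpRing Λ
  open ListSum Λ

  partSum : ℕ → ℕ → (List ℕ → Carrier) → Carrier
  partSum m s φ = listSum φ (partsF s m s)

  private
   parts : ℕ → ℕ → ℕ → (List ℕ → Carrier) → Carrier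
   parts f m s φ = listSum φ (partsF f m s)

   parts-suc : ∀ f m s φ → parts (suc f) m (suc s) φ ≈ sum< (m ⊓ suc s) (λ i → parts f (suc i) (s ∸ i) (λ l → φ (suc i ∷ l)))
   parts-suc f m s φ = trans (listSum-concatMap φ _ (from1 (m ⊓ suc s))) (trans (listSum-map _ suc (upTo (m ⊓ suc s)))
    (trans (listSum-applyUpTo _ (λ i → i) (m ⊓ suc s)) (sum<-cong (m ⊓ suc s) λ i _ → listSum-map φ (suc i ∷_) (partsF f (suc i) (s ∸ i)))))

   fuel : ∀ f g m s φ → s ≤ f → s ≤ g → parts f m s φ ≈ parts g m s φ
   fuel f g m zero φ l l′ = refl
   fuel (suc f) (suc g) m (suc s) φ (s≤s l) (s≤s l′) = trans (parts-suc f m s φ) (trans (sum<-cong (m ⊓ suc s) λ i _ →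
    fuel f g (suc i) (s ∸ i) _ (≤-trans (m∸n≤m s i) l) (≤-trans (m∸n≤m s i) l′)) (sym (parts-suc g m s φ)))

   large : ∀ {m s} φ → m ≤ s → partSum (suc m) (suc s) φ ≈ partSum (suc m) (s ∸ m) (λ l → φ (suc m ∷ l)) + partSum m (suc s) φ
   large {m} {s} φ m≤s = trans (parts-suc s (suc m) s φ) (trans (reflexive (cong (λ k → sum< (suc k) g) (m≤n⇒m⊓n≡m m≤s)))
    (+-cong (fuel s (s ∸ m) (suc m) (s ∸ m) _ (m∸n≤m s m) ≤-refl) (trans (reflexive (cong (λ k → sum< k g) (≡.sym (m≤n⇒m⊓n≡m (m≤n⇒m≤1+n m≤s))))) (sym (parts-suc s m s φ)))))
    where
    g : ℕ → Carrier
    g i = parts s (suc i) (s ∸ i) (λ l → φ (suc i ∷ l))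

   small : ∀ {m s} φ → s < m → partSum (suc m) (suc s) φ ≈ partSum m (suc s) φ
   small {m} {s} φ s<m = trans (parts-suc s (suc m) s φ) (trans (reflexive (cong (λ k → sum< k _) (≡.trans (m≥n⇒m⊓n≡n (m≤n⇒m≤1+n s<m)) (≡.sym (m≥n⇒m⊓n≡n s<m)))))
    (sym (parts-suc s m s φ)))

  -- Σ_{|λ| < K, λ₁ ≤ m} z^|λ| φ λ, with z^s given as z s
  module Total (z : ℕ → Carrier) (z-+ : ∀ a b → z (a ℕ.+ b) ≈ z a * z b) where
   Tot : ℕ → ℕ → (List ℕ → Carrier) → Carrier
   Tot m K φ = sum< K (λ s → z s * partSum m s φ)

   Tot-cong : ∀ m K {φ χ} → (∀ {l} → PartsIn m l → φ l ≈ χ l) → Tot m K φ ≈ Tot m K χ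
   Tot-cong m K h = sum<-cong K λ s _ → *-congˡ (listSum-cong (All.map h (partsF-bounded s m s)))

   -- Either no part equals m + 1, or one such part is removed, which lowers the size bound by m +
   -- 1.
   Tot-suc : ∀ m K φ → Tot (suc m) K φ ≈ Tot m K φ + z (suc m) * Tot (suc m) (K ∸ suc m) (λ l → φ (suc m ∷ l))
   Tot-suc m zero φ = sym (trans (+-congˡ (zeroʳ _)) (+-identityˡ _))
   Tot-suc m (suc zero) φ = sym (trans (+-congˡ (trans (*-congˡ (reflexive (cong (λ k → Tot (suc m) k (λ l → φ (suc m ∷ l))) (ℕₚ.0∸n≡0 m)))) (zeroʳ _))) (+-identityʳ _))
   Tot-suc m (suc (suc s)) φ = step (Tot-suc m (suc s) φ) (m ℕ.≤? s)
    where
    open ≈-Reasoning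
    φ′ : List ℕ → Carrier
    φ′ l = φ (suc m ∷ l)
    P : Carrier
    P = partSum (suc m) (s ∸ m) φ′
    step : Tot (suc m) (suc s) φ ≈ Tot m (suc s) φ + z (suc m) * Tot (suc m) (s ∸ m) φ′ → Dec (m ≤ s) →
     Tot (suc m) (suc (suc s)) φ ≈ Tot m (suc (suc s)) φ + z (suc m) * Tot (suc m) (suc s ∸ m) φ′
    step ih (yes m≤s) = begin
     z (suc s) * partSum (suc m) (suc s) φ + Tot (suc m) (suc s) φ
      ≈⟨ +-cong (*-congˡ (large φ m≤s)) ih ⟩
     z (suc s) * (P + partSum m (suc s) φ) + (Tot m (suc s) φ + z (suc m) * Tot (suc m) (s ∸ m) φ′)
      ≈⟨ +-congʳ (trans (distribˡ _ _ _) (+-congʳ (trans (*-congʳ (trans (reflexive (cong (λ k → z (suc k)) (≡.sym (m+[n∸m]≡n m≤s)))) (z-+ (suc m) (s ∸ m)))) (*-assoc _ _ _)))) ⟩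
     (z (suc m) * (z (s ∸ m) * P) + z (suc s) * partSum m (suc s) φ) + (Tot m (suc s) φ + z (suc m) * Tot (suc m) (s ∸ m) φ′)
      ≈⟨ solve Λ 5 0 (λ z a b c d → (z :* a :+ b) :+ (c :+ z :* d) := (b :+ c) :+ z :* (a :+ d)) (z (suc m)) _ _ _ _ ⟩
     Tot m (suc (suc s)) φ + z (suc m) * Tot (suc m) (suc (s ∸ m)) φ′
      ≈⟨ +-congˡ (*-congˡ (reflexive (cong (λ k → Tot (suc m) k φ′) (≡.sym (+-∸-assoc 1 m≤s))))) ⟩
     Tot m (suc (suc s)) φ + z (suc m) * Tot (suc m) (suc s ∸ m) φ′ ∎
    step ih (no m≰s) = let s<m = ℕₚ.≰⇒> m≰s in trans (+-cong (*-congˡ (small φ s<m)) ih) (trans (sym (+-assoc _ _ _))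
     (+-congˡ (*-congˡ (reflexive (cong (λ k → Tot (suc m) k φ′) (≡.trans (m≤n⇒m∸n≡0 (<⇒≤ s<m)) (≡.sym (m≤n⇒m∸n≡0 s<m))))))))

   Tot-+ : ∀ m K φ χ → Tot m K (λ l → φ l + χ l) ≈ Tot m K φ + Tot m K χ
   Tot-+ m zero φ χ = sym (+-identityˡ _)
   Tot-+ m (suc K) φ χ = trans (+-cong (*-congˡ (listSum-+ φ χ (partsF K m K))) (Tot-+ m K φ χ))
    (solve Λ 5 0 (λ z a b c d → z :* (a :+ b) :+ (c :+ d) := (z :* a :+ c) :+ (z :* b :+ d)) _ _ _ _ _)

   Tot-* : ∀ m K k φ → Tot m K (λ l → k * φ l) ≈ k * Tot m K φ
   Tot-* m zero k φ = sym (zeroʳ k)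
   Tot-* m (suc K) k φ = trans (+-cong (*-congˡ (listSum-* k φ (partsF K m K))) (Tot-* m K k φ))
    (solve Λ 4 0 (λ z k a c → z :* (k :* a) :+ k :* c := k :* (z :* a :+ c)) _ k _ _)

   Tot-splitSum : ∀ {A : Set} m K (G : List A → List A → List ℕ → Carrier) V →
    Tot m K (λ l → SplitSum.splitSum Λ (λ S W → G S W l) V) ≈ SplitSum.splitSum Λ (λ S W → Tot m K (G S W)) V
   Tot-splitSum m K G [] = refl
   Tot-splitSum m K G (x ∷ V) = trans (Tot-+ m K _ _) (+-cong (Tot-splitSum m K _ V) (Tot-splitSum m K _ V))

 module _ (R : LRing) (n : ℕ) where
  open LRing R
  open Seq R
  open ListSum Λ
  open SplitSum Λ
  open Total Λ (qp R n) (qp-+ R n)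

  private
   z = qp R n
   Π′ = Π R n

  module Truncation (1-t-cancel : ∀ {x y} → (1# - t R n) * x ≈ (1# - t R n) * y → x ≈ y)
   (facinv : ℕ → Carrier) (facinv-inverse : ∀ k → facinv k * fac R n k ≈ 1#) where
   vinv : ℕ → List ℕ → Carrier
   vinv zero    λs = 1#
   vinv (suc m) λs = facinv (count (suc m) λs) * vinv m λs

   normalised : ℕ → List ℕ → List ℕ → Carrier
   normalised m V λs = vinv m λs * Pt R n (double λs) V

   private
    A′ = A R n 1-t-cancel
    δ′ = δ R n 1-t-cancel

    vinv-other : ∀ m {k} j l → m < k → vinv m (replicate j k ++ l) ≈ vinv m l
    vinv-other zero j l h = refl
    vinv-other (suc m) j l h = *-cong (reflexive (cong facinv (count-other j l (ℕₚ.<⇒≢ h)))) (vinv-other m j l (<-trans ≤-refl h))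

    vinv-replicate : ∀ m j {l} → PartsIn m l → vinv (suc m) (replicate j (suc m) ++ l) ≈ facinv j * vinv m l
    vinv-replicate m j {l} h = *-cong (reflexive (cong facinv (≡.trans (count-replicate (suc m) j l) (≡.trans (cong (j ℕ.+_) (count-absent l (All.map (λ (_ , p) e → <-irrefl (≡.sym e) (s≤s p)) h))) (ℕₚ.+-identityʳ j)))))
     (vinv-other m j l ≤-refl)

    double-replicate : ∀ j k l → double (replicate j k ++ l) ≡ replicate j (2 ℕ.* k) ++ double l
    double-replicate zero k l = ≡.refl
    double-replicate (suc j) k l = cong (2 ℕ.* k ∷_) (double-replicate j k l)

    e : ℕ → List ℕ → Carrier
    e m = Π′ (λ a → z (2 ℕ.* suc m ℕ.* a))

    -- The factorial produced by j equal parts cancels against their factor in the normalisation.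
    normalised-replicate : ∀ m j V → Distinct V → ∀ {l} → PartsIn m l →
     normalised (suc m) V (replicate j (suc m) ++ l) ≈ splitSum (λ S W → (δ′ j (length S) * e m S * A′ S W) * normalised m W l) V
    normalised-replicate m j V d {l} h = begin
     vinv (suc m) (replicate j (suc m) ++ l) * Pt R n (double (replicate j (suc m) ++ l)) V
      ≈⟨ *-cong (vinv-replicate m j h) (trans (reflexive (cong (λ μ → Pt R n μ V) (double-replicate j (suc m) l))) (Pt-equal R n 1-t-cancel (2 ℕ.* suc m) j (double l) V d)) ⟩
     (facinv j * vinv m l) * (fac R n j * s)
      ≈⟨ *-interchange _ _ _ _ ⟩
     (facinv j * fac R n j) * (vinv m l * s)
      ≈⟨ trans (*-congʳ (facinv-inverse j)) (*-identityˡ _) ⟩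
     vinv m l * s
      ≈⟨ trans (sym (splitSum-* _ _ V)) (splitSum-cong V λ _ → solve Λ 5 0 (λ v a b c p → v :* (a :* b :* c :* p) := (a :* b :* c) :* (v :* p)) _ _ _ _ _) ⟩
     splitSum (λ S W → (δ′ j (length S) * e m S * A′ S W) * normalised m W l) V ∎
     where
     open ≈-Reasoning
     s : Carrier
     s = splitSum (λ S W → δ′ j (length S) * e m S * A′ S W * Pt R n (double l) W) V

   -- The recursion for `F` before the weight q^|λ| is absorbed into the variables: an element a
   -- stands for q^a here and corresponds to 2a + 1 there.
   Fℕ : ℕ → List ℕ → Carrier
   Fℕ zero    V = 1#
   Fℕ (suc m) V = splitSum (λ S W → (Π′ (λ _ → z (suc m)) S * e m S * A′ S W) * Fℕ m W) V

   private
    splitSum-Val : ∀ {k} {G : List ℕ → List ℕ → Carrier} V → (∀ {S W} → Split S W V → Val k (G S W)) → Val k (splitSum G V)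
    splitSum-Val [] h = h []
    splitSum-Val (x ∷ V) h = Val-+ (splitSum-Val V λ s → h (left s)) (splitSum-Val V λ s → h (right s))

    Val-coefficient : ∀ m {S W V} → Split S W V → Distinct V → Val 0ℤ (e m S * A′ S W)
    Val-coefficient m {S} s d = Val-* (Π-Val R n _ S (All.universal (λ a → Val-qp R n (2 ℕ.* suc m ℕ.* a)) S)) (Π-Val R n _ S (All.map (Val-Πff R n) (Split-apart s d)))

   Val-Fℕ : ∀ m V → Distinct V → Val 0ℤ (Fℕ m V)
   Val-Fℕ zero V d = Val-1
   Val-Fℕ (suc m) V d = splitSum-Val V λ {S} {W} s → Val-* {0ℤ} {0ℤ} (Val-≈ (sym (*-assoc _ _ _)) (Val-* {0ℤ} {0ℤ} (Π-Val R n _ S (All.universal (λ _ → Val-qp R n (suc m)) S)) (Val-coefficient m s d))) (Val-Fℕ m W (proj₂ (Split-Distinct s d)))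

   private
    -- This is q^((m+1)(k-j)) for k ≥ j and 0 otherwise: the weight of the parts m + 1 beyond the
    -- first j, when there are k of them in all.
    ω : ℕ → ℕ → ℕ → Carrier
    ω m zero    k       = Π′ (λ _ → z (suc m)) (replicate k 0)
    ω m (suc j) zero    = 0#
    ω m (suc j) (suc k) = ω m j k

    ω-Val : ∀ m j k → Val 0ℤ (ω m j k)
    ω-Val m zero k = Π-Val R n _ _ (All.universal (λ _ → Val-qp R n (suc m)) (replicate k 0))
    ω-Val m (suc j) zero = Val-0 _
    ω-Val m (suc j) (suc k) = ω-Val m j k

    ω-step : ∀ m j k → ω m j k ≈ δ′ j k + z (suc m) * ω m (suc j) k
    ω-step m zero zero = solve Λ 1 0 (λ z → :1 := :1 :+ z :* :0) _
    ω-step m zero (suc k) = sym (+-identityˡ _)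
    ω-step m (suc j) zero = solve Λ 1 0 (λ z → :0 := :0 :+ z :* :0) _
    ω-step m (suc j) (suc k) = ω-step m j k

    ω-length : ∀ m (S : List ℕ) → ω m 0 (length S) ≈ Π′ (λ _ → z (suc m)) S
    ω-length m [] = refl
    ω-length m (_ ∷ S) = *-congˡ (ω-length m S)

    ff-cover : ∀ m K → + fourfold R n K ℤ.≤ + fourfold R n (suc m) ℤ.+ + fourfold R n (K ∸ suc m)
    ff-cover m K = ℤ.+≤+ (≤-trans (mono (ℕₚ.m≤n+m∸n K (suc m))) (≤-reflexive (lem (suc m) (K ∸ suc m))))
     where
     mono : ∀ {a b} → a ≤ b → fourfold R n a ≤ fourfold R n b
     mono l = +-mono-≤ (+-mono-≤ l l) (+-mono-≤ l l)
     lem : ∀ a b → a ℕ.+ b ℕ.+ (a ℕ.+ b) ℕ.+ (a ℕ.+ b ℕ.+ (a ℕ.+ b)) ≡ (a ℕ.+ a ℕ.+ (a ℕ.+ a)) ℕ.+ (b ℕ.+ b ℕ.+ (b ℕ.+ b))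
     lem = ℕ-ring

   -- Inside the step from m to m + 1, j counts the parts m + 1 already removed. Source and target
   -- obey the same recursion in j, with one power q^(m+1) per step, and the size bound K falls by m
   -- + 1; once it reaches 0, integrality is enough.
   truncation : ∀ m K V → Distinct V → Val (+ fourfold R n K) (Tot m K (normalised m V) - Fℕ m V)
   truncation zero zero V d = Val-≈ (solve Λ 0 0 (:- :1 := :0 :- :1)) (Val-neg Val-1)
   truncation zero (suc K) V d = Val-≈ (sym (trans (+-congʳ (go K)) (-‿inverseʳ 1#))) (Val-0 _)
    where
    go : ∀ K → Tot zero (suc K) (normalised zero V) ≈ 1#
    go zero = trans (+-congʳ (*-congʳ E-0)) (solve Λ 0 0 (:1 :* (:1 :* :1 :+ :0) :+ :0 := :1))
    go (suc K) = trans (+-congʳ (zeroʳ _)) (trans (+-identityˡ _) (go K))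
   truncation (suc m) K V d = Val-≈ (+-congˡ (-‿cong (splitSum-cong V λ {S} _ → *-congʳ (*-congʳ (*-congʳ (ω-length m S)))))) (go (suc K) K 0 ≤-refl)
    where
    target : ℕ → Carrier
    target j = splitSum (λ S W → (ω m j (length S) * e m S * A′ S W) * Fℕ m W) V
    source : ℕ → ℕ → Carrier
    source j K = Tot (suc m) K (λ l → normalised (suc m) V (replicate j (suc m) ++ l))
    first : ℕ → ℕ → Carrier
    first j K = Tot m K (λ l → normalised (suc m) V (replicate j (suc m) ++ l))
    first′ : ℕ → Carrier
    first′ j = splitSum (λ S W → (δ′ j (length S) * e m S * A′ S W) * Fℕ m W) V
    snoc : ∀ j l → replicate j (suc m) ++ suc m ∷ l ≡ replicate (suc j) (suc m) ++ l
    snoc zero l = ≡.refl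
    snoc (suc j) l = cong (suc m ∷_) (snoc j l)
    δ-Val : ∀ j k → Val 0ℤ (δ′ j k)
    δ-Val zero zero = Val-1
    δ-Val zero (suc k) = Val-0 _
    δ-Val (suc j) zero = Val-0 _
    δ-Val (suc j) (suc k) = δ-Val j k
    first-close : ∀ j K → Val (+ fourfold R n K) (first j K - first′ j)
    first-close j K = Val-≈ (sym (trans (+-congʳ (trans (Tot-cong m K (normalised-replicate m j V d)) (trans (Tot-splitSum m K _ V) (splitSum-cong V λ {S} {W} _ → Tot-* m K _ (normalised m W))))) (difference V)))
     (splitSum-Val V λ {S} {W} s → Val-scale {0ℤ} {+ fourfold R n K} (ℤₚ.+-identityˡ _)
      (Val-≈ (sym (*-assoc _ _ _)) (Val-* {0ℤ} {0ℤ} (δ-Val j (length S)) (Val-coefficient m s d))) (truncation m K W (proj₂ (Split-Distinct s d))))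
     where
     difference : ∀ {G : List ℕ → List ℕ → Carrier} {f g : List ℕ → Carrier} V → splitSum (λ S W → G S W * f W) V - splitSum (λ S W → G S W * g W) V ≈ splitSum (λ S W → G S W * (f W - g W)) V
     difference [] = solve Λ 3 0 (λ a b c → a :* b :- a :* c := a :* (b :- c)) _ _ _
     difference {G} {f} {g} (x ∷ V) = trans (solve Λ 4 0 (λ a b c d → (a :+ b) :- (c :+ d) := (a :- c) :+ (b :- d)) _ _ _ _)
      (+-cong (difference V) (difference {λ S W → G S (x ∷ W)} {λ W → f (x ∷ W)} {λ W → g (x ∷ W)} V))
    target-step : ∀ j → target j ≈ first′ j + z (suc m) * target (suc j)
    target-step j = trans (splitSum-cong V λ {S} {W} _ → trans (*-congʳ (*-congʳ (*-congʳ (ω-step m j (length S)))))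
      (solve Λ 6 0 (λ d z w e a f → ((d :+ z :* w) :* e :* a) :* f := (d :* e :* a) :* f :+ z :* ((w :* e :* a) :* f)) _ _ _ _ _ _))
     (trans (splitSum-+ _ _ V) (+-congˡ (splitSum-* _ _ V)))
    target-Val : ∀ j → Val 0ℤ (target j)
    target-Val j = splitSum-Val V λ {S} {W} s → Val-* {0ℤ} {0ℤ} (Val-≈ (sym (*-assoc _ _ _)) (Val-* {0ℤ} {0ℤ} (ω-Val m j (length S)) (Val-coefficient m s d))) (Val-Fℕ m W (proj₂ (Split-Distinct s d)))
    go : ∀ b K j → K < b → Val (+ fourfold R n K) (source j K - target j)
    go (suc b) zero j _ = Val-≈ (sym (+-identityˡ _)) (Val-neg (target-Val j))
    go (suc b) (suc K) j (s≤s l) = Val-≈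
     (sym (trans (+-cong (trans (Tot-suc m (suc K) _) (+-congˡ (*-congˡ (Tot-cong (suc m) (suc K ∸ suc m) λ {λs} _ → reflexive (cong (normalised (suc m) V) (snoc j λs)))))) (-‿cong (target-step j)))
      (solve Λ 5 0 (λ a z b c d → (a :+ z :* b) :- (c :+ z :* d) := (a :- c) :+ z :* (b :- d)) _ _ _ _ _)))
     (Val-+ (first-close j (suc K)) (Val-≤ (ff-cover m (suc K)) (Val-* (Val-E (+ fourfold R n (suc m))) (go b (K ∸ m) (suc j) (≤-<-trans (m∸n≤m K m) l)))))

   private
    T′ : ℤ
    T′ = + (2 ℕ.* n) ℤ.+ + (2 ℕ.* n)

    Π≈prodOver : ∀ f S → Π′ (λ a → f (oddℤ a)) S ≈ Weights.prodOver qRing T′ f (map oddℤ S)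
    Π≈prodOver f [] = refl
    Π≈prodOver f (a ∷ S) = *-congˡ (Π≈prodOver f S)

    A≈ : ∀ S W → A′ S W ≈ Littlewood.A qRing T′ (map oddℤ S) (map oddℤ W)
    A≈ [] W = refl
    A≈ (a ∷ S) W = *-cong (Π≈prodOver _ W) (A≈ S W)

    splitSum-map : ∀ (G : List ℤ → List ℤ → Carrier) V → splitSum G (map oddℤ V) ≈ splitSum (λ S W → G (map oddℤ S) (map oddℤ W)) V
    splitSum-map G [] = refl
    splitSum-map G (x ∷ V) = +-cong (splitSum-map _ V) (splitSum-map _ V)

    weights : ∀ m S → Π′ (λ _ → z (suc m)) S * e m S ≈ Π′ (λ a → E (times (suc m) (oddℤ a ℤ.+ oddℤ a ℤ.+ (oddℤ a ℤ.+ oddℤ a)))) S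
    weights m [] = *-identityˡ _
    weights m (a ∷ S) = trans (*-interchange _ _ _ _) (*-cong (trans (sym (qp-+ R n (suc m) (2 ℕ.* suc m ℕ.* a)))
      (reflexive (cong E (≡.trans (cong +_ (≡.trans (lem (suc m) a) (cong (λ d → suc m ℕ.* (suc d ℕ.+ suc d ℕ.+ (suc d ℕ.+ suc d))) (≡.sym (dbl≡ a)))))
       (≡.trans (ℤₚ.pos-* (suc m) _) (≡.sym (times≡* (suc m) (oddℤ a ℤ.+ oddℤ a ℤ.+ (oddℤ a ℤ.+ oddℤ a))))))))) (weights m S))
     where
     lem : ∀ m a → (m ℕ.+ 2 ℕ.* m ℕ.* a) ℕ.+ (m ℕ.+ 2 ℕ.* m ℕ.* a) ℕ.+ ((m ℕ.+ 2 ℕ.* m ℕ.* a) ℕ.+ (m ℕ.+ 2 ℕ.* m ℕ.* a))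
      ≡ m ℕ.* ((1 ℕ.+ (a ℕ.+ a)) ℕ.+ (1 ℕ.+ (a ℕ.+ a)) ℕ.+ ((1 ℕ.+ (a ℕ.+ a)) ℕ.+ (1 ℕ.+ (a ℕ.+ a))))
     lem = ℕ-ring

   F≈Fℕ : ∀ m V → F qRing T′ m (map oddℤ V) ≈ Fℕ m V
   F≈Fℕ zero V = refl
   F≈Fℕ (suc m) V = trans (splitSum-map _ V) (splitSum-cong V λ {S} {W} _ → *-cong (*-cong (trans (sym (Π≈prodOver _ S)) (sym (weights m S))) (sym (A≈ S W))) (F≈Fℕ m W))

-- Transfer of power series identities into the valued ring

module Transport where

 open Base
 open Solver
 open Limit
 open Laurent using (conv; ⊗≡conv; ⊗-congˡ; ⊗-congʳ; laurent; module S)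
 open Pochhammer
 open Defs

 -- The Laurent ring is kept abstract from here on: its operations unfold too eagerly.
 record Realisation : Set₁ where
  field
   lring : LRing
  open LRing lring public
  field
   Φ         : Series → Carrier
   Φ-cong    : ∀ {f g} → f ≈S g → Φ f ≈ Φ g
   Φ-⊗       : ∀ f g → Φ (f ⊗ g) ≈ Φ f * Φ g
   Φ-⊕       : ∀ f g → Φ (f ⊕ g) ≈ Φ f + Φ g
   Φ-⊖       : ∀ f g → Φ (f ⊖ g) ≈ Φ f - Φ g
   Φ-1       : Φ 1S ≈ 1#
   Φ-0       : Φ 0S ≈ 0#
   Φ-mono    : ∀ a → Φ (mono a) ≈ E (+ (a ℕ.+ a ℕ.+ (a ℕ.+ a)))
   Φ-inj     : ∀ {f g} → Φ f ≈ Φ g → f ≈S g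
   Φ-inverse : ∀ f → f 0 ℤ.* f 0 ≡ + 1 → Φ f * Φ (invS f) ≈ 1#
   Φ-Val     : ∀ f → Val 0ℤ (Φ f)
   agree⇒Val : ∀ N {f g} → (∀ k → k < N → f k ≡ g k) → Val (+ N) (Φ f - Φ g)
   Val⇒agree : ∀ {N f g} → Val (+ N) (Φ f - Φ g) → ∀ k → k ℕ.* 4 < N → f k ≡ g k

 inLaurent : Realisation
 inLaurent = record
  { lring = laurent ; Φ = Laurent.Φ ; Φ-cong = Laurent.Φ-cong ; Φ-⊗ = Laurent.Φ-⊗ ; Φ-⊕ = Laurent.Φ-⊕ ; Φ-⊖ = Laurent.Φ-⊖ ; Φ-1 = Laurent.Φ-1 ; Φ-0 = Laurent.Φ-0 ; Φ-mono = Laurent.Φ-mono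
  ; Φ-inj = Laurent.Φ-inj ; Φ-inverse = Laurent.Φ-inverse ; Φ-Val = Laurent.Φ-Val ; agree⇒Val = λ N {f} {g} → Laurent.agree⇒Val N {f} {g} ; Val⇒agree = λ {N} {f} {g} → Laurent.Val⇒agree {N} {f} {g} }

 ⊗-local : ∀ k {f f′ g g′} → (∀ i → i ≤ k → f i ≡ f′ i) → (∀ i → i ≤ k → g i ≡ g′ i) → (f ⊗ g) k ≡ (f′ ⊗ g′) k
 ⊗-local k {f} {f′} {g} {g′} p q = ≡.trans (⊗≡conv f g k) (≡.trans (go k p q) (≡.sym (⊗≡conv f′ g′ k)))
  where
  go : ∀ k {f f′ g g′ : Series} → (∀ i → i ≤ k → f i ≡ f′ i) → (∀ i → i ≤ k → g i ≡ g′ i) → conv f g k ≡ conv f′ g′ k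
  go zero p q = cong₂ ℤ._*_ (p 0 z≤n) (q 0 z≤n)
  go (suc k) p q = cong₂ ℤ._+_ (cong₂ ℤ._*_ (p 0 z≤n) (q (suc k) ≤-refl)) (go k (λ i l → p (suc i) (s≤s l)) λ i l → q i (m≤n⇒m≤1+n l))

 mono-low : ∀ {a k} → k < a → mono a k ≡ 0ℤ
 mono-low {suc a} {zero} l = ≡.refl
 mono-low {suc a} {suc k} (s≤s l) = mono-low l

 prodS-snoc : ∀ (g : ℕ → Series) h k → prodS (map g (applyUpTo h (suc k))) ≈S (prodS (map g (applyUpTo h k)) ⊗ g (h k))
 prodS-snoc g h zero = S.*-comm (g (h 0)) 1S
 prodS-snoc g h (suc k) = S.trans (⊗-congˡ (g (h 0)) (prodS-snoc g (λ i → h (suc i)) k)) (S.sym (S.*-assoc (g (h 0)) (prodS (map g (applyUpTo (λ i → h (suc i)) k))) (g (h (suc k)))))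

 -- The additional factors are 1 modulo q^(k+1).
 pochFin-stable : ∀ c d → 1 ≤ d → ∀ l k → pochFin c d (l ℕ.+ suc k) k ≡ pochInf c d k
 pochFin-stable c d d≥1 zero k = ≡.refl
 pochFin-stable c d d≥1 (suc l) k = ≡.trans (prodS-snoc (λ j → 1S ⊖ mono (c ℕ.+ j ℕ.* d)) (λ i → i) (l ℕ.+ suc k) k) (≡.trans
  (⊗-local k {f = f} (λ _ _ → ≡.refl) (λ i i≤k → ≡.trans (cong (λ z → 1S i ℤ.- z) (mono-low (low i≤k))) (ℤₚ.+-identityʳ (1S i))))
  (≡.trans (S.*-identityʳ f k) (pochFin-stable c d d≥1 l k)))
  where
  f : Series
  f = pochFin c d (l ℕ.+ suc k)
  low : ∀ {i} → i ≤ k → i < c ℕ.+ (l ℕ.+ suc k) ℕ.* d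
  low i≤k = ≤-trans (s≤s i≤k) (≤-trans (m≤n+m (suc k) l) (≤-trans (≤-trans (≤-reflexive (≡.sym (ℕₚ.*-identityʳ _))) (*-monoʳ-≤ (l ℕ.+ suc k) d≥1)) (m≤n+m _ c)))

 Monic : Series → Set
 Monic f = f 0 ≡ + 1

 Monic-1-q : ∀ {a} → 1 ≤ a → Monic (1S ⊖ mono a)
 Monic-1-q (s≤s _) = ≡.refl

 Monic-⊗ : ∀ {f g} → Monic f → Monic g → Monic (f ⊗ g)
 Monic-⊗ p q = ≡.trans (ℤₚ.+-identityʳ _) (cong₂ ℤ._*_ p q)

 Monic-prodS : ∀ {B : Set} (g : B → Series) l → (∀ b → Monic (g b)) → Monic (prodS (map g l))
 Monic-prodS g [] h = ≡.refl
 Monic-prodS g (b ∷ l) h = Monic-⊗ {g b} {prodS (map g l)} (h b) (Monic-prodS g l h)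

 Monic-powS : ∀ {f} k → Monic f → Monic (powS f k)
 Monic-powS zero h = ≡.refl
 Monic-powS {f} (suc k) h = Monic-⊗ {f} {powS f k} h (Monic-powS k h)

 Monic-pochFin : ∀ c d k → 1 ≤ c → Monic (pochFin c d k)
 Monic-pochFin c d k h = Monic-prodS _ (upTo k) λ j → Monic-1-q (≤-trans h (m≤m+n c _))

 module Transfer (P : Realisation) where
  open Realisation P

  private
   R = lring

  Φ-⊘ : ∀ f g {y} → Monic g → Φ f ≈ y * Φ g → Φ (f ⊘ g) ≈ y
  Φ-⊘ f g {y} h e = trans (Φ-⊗ f (invS g)) (trans (*-congʳ e) (trans (*-assoc _ _ _) (trans (*-congˡ (Φ-inverse g (cong₂ ℤ._*_ h h))) (*-identityʳ _))))

  Φ-cancel : ∀ g {x y} → Monic g → Φ g * x ≈ Φ g * y → x ≈ y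
  Φ-cancel g {x} {y} h e = trans (go x) (trans (*-congˡ e) (sym (go y)))
   where
   go : ∀ x → x ≈ Φ (invS g) * (Φ g * x)
   go x = sym (trans (solve Λ 3 0 (λ a b c → a :* (b :* c) := (b :* a) :* c) _ _ _) (trans (*-congʳ (Φ-inverse g (cong₂ ℤ._*_ h h))) (*-identityˡ _)))

  Φ-1-q : ∀ a → Φ (1S ⊖ mono a) ≈ U R a
  Φ-1-q a = trans (Φ-⊖ 1S (mono a)) (+-cong Φ-1 (-‿cong (Φ-mono a)))

  Φ-prodS : ∀ (g : ℕ → Series) h k → Φ (prodS (map g (applyUpTo h k))) ≈ Π< R k (λ i → Φ (g (h i)))
  Φ-prodS g h zero    = Φ-1
  Φ-prodS g h (suc k) = trans (Φ-⊗ (g (h 0)) _) (trans (*-congˡ (Φ-prodS g (λ i → h (suc i)) k)) (sym (Π<-cons R k (λ i → Φ (g (h i))))))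

  Φ-powS : ∀ f k → Φ (powS f k) ≈ Π< R k (λ _ → Φ f)
  Φ-powS f zero    = Φ-1
  Φ-powS f (suc k) = trans (Φ-⊗ f (powS f k)) (*-congˡ (Φ-powS f k))

  Φ-pochFin : ∀ c d k → Φ (pochFin c d k) ≈ pk R c d k
  Φ-pochFin c d k = trans (Φ-prodS _ (λ i → i) k) (Π<-cong R k λ i _ → Φ-1-q (c ℕ.+ i ℕ.* d))

  inf : ℕ → ℕ → Carrier
  inf c d = Φ (pochInf c d)

  inf-lim : ∀ c d → 1 ≤ c → 1 ≤ d → ∀ L → Val (+ L) (pk R c d L - inf c d)
  inf-lim c d c≥1 d≥1 L = Val-≈ (+-congʳ (Φ-pochFin c d L)) (agree⇒Val L λ k k<L →
   ≡.trans (cong (λ l → pochFin c d l k) (≡.sym (m∸n+n≡m k<L))) (pochFin-stable c d d≥1 (L ∸ suc k) k))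

-- The Hall-Littlewood polynomials of the statement

module HallLittlewood where

 open Base
 open Solver
 open Signs
 open Limit
 open Laurent using (seriesExp; ⊗-congˡ; ⊗-congʳ; mono-+; module S)
 open Pochhammer
 open Odds using (oddℤ)
 open Systems using (dbl≡)
 open Picks
 open Perms
 open Partitions
 open Transport
 open Defs

 branch : ∀ {A : Set} a b (x y : A) → ((if a ℕ.<ᵇ b then x else y) ≡ x × a < b) ⊎ ((if a ℕ.<ᵇ b then x else y) ≡ y × b ≤ a)
 branch a b x y with a ℕ.<ᵇ b | ℕₚ.<ᵇ⇒< a b | ℕₚ.<⇒<ᵇ {a} {b}
 ... | true  | lt | _  = inj₁ (≡.refl , lt _)
 ... | false | _  | ge = inj₂ (≡.refl , ≮⇒≥ ge)

 distinct-resp-↭ : ∀ {V V′} → V ↭ V′ → Distinct V → Distinct V′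
 distinct-resp-↭ _↭_.refl d = d
 distinct-resp-↭ (_↭_.prep x p) (h ∷ d) = Permₚ.All-resp-↭ p h ∷ distinct-resp-↭ p d
 distinct-resp-↭ (_↭_.swap x y p) ((xy ∷ h) ∷ h′ ∷ d) = ((λ e → xy (≡.sym e)) ∷ Permₚ.All-resp-↭ p h′) ∷ Permₚ.All-resp-↭ p h ∷ distinct-resp-↭ p d
 distinct-resp-↭ (_↭_.trans p q) d = distinct-resp-↭ q (distinct-resp-↭ p d)

 maxL-absent : ∀ {i} l → maxL l < i → count i l ≡ 0
 maxL-absent l h = count-absent l (All.map (λ p e → <-irrefl (≡.sym e) (≤-<-trans p h)) (bounded l))
  where
  bounded : ∀ l → All (_≤ maxL l) l
  bounded [] = []
  bounded (x ∷ l) = m≤m⊔n x (maxL l) ∷ All.map (λ p → ≤-trans p (m≤n⊔m x (maxL l))) (bounded l)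

 maxL-≤ : ∀ {b} l → All (_≤ b) l → maxL l ≤ b
 maxL-≤ [] [] = z≤n
 maxL-≤ (x ∷ l) (p ∷ ps) = ℕₚ.⊔-lub p (maxL-≤ l ps)

 count-++ : ∀ i l l′ → count i (l ++ l′) ≡ count i l ℕ.+ count i l′
 count-++ i [] l′ = ≡.refl
 count-++ i (x ∷ l) l′ = ≡.trans (cong (_ ℕ.+_) (count-++ i l l′)) (≡.sym (ℕₚ.+-assoc (if i ℕ.≡ᵇ x then 1 else 0) (count i l) (count i l′)))

 count-double : ∀ i l → count (2 ℕ.* i) (double l) ≡ count i l
 count-double i [] = ≡.refl
 count-double i (x ∷ l) with i ℕ.≟ x
 ... | yes ≡.refl = ≡.trans (count-≡ (2 ℕ.* i) (double l)) (≡.trans (cong suc (count-double i l)) (≡.sym (count-≡ i l)))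
 ... | no d = ≡.trans (count-≢ (double l) (λ e → d (ℕₚ.*-cancelˡ-≡ i x 2 e))) (≡.trans (count-double i l) (≡.sym (count-≢ l d)))

 count-odd : ∀ i l → count (suc (2 ℕ.* i)) (double l) ≡ 0
 count-odd i l = count-absent (double l) (Allₚ.map⁺ (All.universal (λ x e → ℕₚ.even≢odd x i (≡.sym e)) l))

 module _ (P : Realisation) (n : ℕ) (n≥1 : 1 ≤ n) where
  open Realisation P
  open Transfer P

  private
   R = lring
   e : ℕ
   e = 2 ℕ.* n
   e≥1 : 1 ≤ e
   e≥1 = ≤-trans n≥1 (m≤m+n n _)
   z = qp R n
   t′ = t R n
   ff′ = ff R n
   Π′ = Π R n

  open Seq R
  open ListSum Λ

  1-t-cancel : ∀ {x y} → (1# - t′) * x ≈ (1# - t′) * y → x ≈ y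
  1-t-cancel eq = Φ-cancel (1S ⊖ mono e) (Monic-1-q e≥1) (trans (*-congʳ (Φ-1-q e)) (trans eq (*-congʳ (sym (Φ-1-q e)))))

  facS : ℕ → Series
  facS k = pochFin e e k ⊘ powS (1S ⊖ mono e) k

  Φ-fac : ∀ k → Φ (facS k) ≈ fac R n k
  Φ-fac k = Φ-⊘ (pochFin e e k) _ (Monic-powS k (Monic-1-q e≥1)) (trans (Φ-pochFin e e k) (trans (pk-fac k) (*-congˡ (sym (trans (Φ-powS _ k) (Π<-cong R k λ _ _ → Φ-1-q e))))))
   where
   bracket-U : ∀ k → (1# - t′) * bracket R n k ≈ U R (k ℕ.* e)
   bracket-U zero = trans (zeroʳ _) (sym (trans (+-congˡ (-‿cong E-0)) (-‿inverseʳ 1#)))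
   bracket-U (suc k) = trans (solve Λ 2 0 (λ t b → (:1 :- t) :* (:1 :+ t :* b) := (:1 :- t) :+ t :* ((:1 :- t) :* b)) t′ _)
    (trans (+-congˡ (*-congˡ (bracket-U k))) (trans (solve Λ 2 0 (λ t z → (:1 :- t) :+ t :* (:1 :- z) := :1 :- t :* z) t′ (z (k ℕ.* e))) (+-congˡ (-‿cong (sym (qp-+ R n e (k ℕ.* e)))))))
   pk-fac : ∀ k → pk R e e k ≈ fac R n k * Π< R k (λ _ → U R e)
   pk-fac zero = sym (*-identityˡ _)
   pk-fac (suc k) = trans (*-cong (sym (bracket-U (suc k))) (pk-fac k))
    (solve Λ 4 0 (λ u b f p → (u :* b) :* (f :* p) := (b :* f) :* (u :* p)) (1# - t′) _ _ _)

  Monic-facS : ∀ k → Monic (facS k)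
  Monic-facS k = Monic-⊗ {pochFin e e k} {invS (powS (1S ⊖ mono e) k)} (Monic-pochFin e e k e≥1) (Monic-powS k (Monic-1-q e≥1))

  facinv : ℕ → Carrier
  facinv k = Φ (invS (facS k))

  facinv-inverse : ∀ k → facinv k * fac R n k ≈ 1#
  facinv-inverse k = trans (*-comm _ _) (trans (*-congʳ (sym (Φ-fac k))) (Φ-inverse (facS k) (cong₂ ℤ._*_ (Monic-facS k) (Monic-facS k))))

  open Truncation R n 1-t-cancel facinv facinv-inverse using (vinv; normalised)

  -- The power q^min(a,b) cancelled in `hlFactor` is restored by `z s`, and the factor E 2 = q^(1/2)
  -- leads from q^a to X_a; the quotient is unaffected by both.
  Φ-hlFactor : ∀ {a b} → a ≢ b → Φ (hlFactor e a b) ≈ ff′ a b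
  Φ-hlFactor {a} {b} a≢b = Φ-⊘′ (trans (sym (unscale (Φ N))) (trans (*-congˡ scaled) (unscale _)))
   where
   open ≈-Reasoning
   s : ℕ
   s = a ⊓ b
   N D : Series
   N = mono (a ∸ s) ⊖ mono ((b ℕ.+ e) ∸ s)
   D = mono (a ∸ s) ⊖ mono (b ∸ s)
   q⁻ : Carrier
   q⁻ = E (ℤ.- + (s ℕ.+ s ℕ.+ (s ℕ.+ s)))
   unscale : ∀ x → q⁻ * (z s * x) ≈ x
   unscale x = trans (sym (*-assoc _ _ _)) (trans (*-congʳ (solve Λ 0 1 (λ a → :E (⊟ a) :* :E a := :1) (+ (s ℕ.+ s ℕ.+ (s ℕ.+ s))))) (*-identityˡ x))
   Φ-mono-s : ∀ {k} → s ≤ k → z s * Φ (mono (k ∸ s)) ≈ z k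
   Φ-mono-s {k} l = trans (*-congˡ (Φ-mono (k ∸ s))) (trans (sym (qp-+ R n s (k ∸ s))) (reflexive (cong z (m+[n∸m]≡n l))))
   X≈ : ∀ k → X R n k ≈ E (+ 2) * z k
   X≈ k = trans (reflexive (cong (λ d → E ((+ 1 ℤ.+ + d) ℤ.+ (+ 1 ℤ.+ + d))) (dbl≡ k))) (solve Λ 0 2 (λ k o → :X (o ⊞ (k ⊞ k)) := :E (o ⊞ o) :* :E (k ⊞ k ⊞ (k ⊞ k))) (+ k) (+ 1))
   scaled : z s * Φ N ≈ z s * (ff′ a b * Φ D)
   scaled = begin
    z s * Φ N
     ≈⟨ trans (*-congˡ (Φ-⊖ (mono (a ∸ s)) _)) (trans (solve Λ 3 0 (λ a b c → a :* (b :- c) := a :* b :- a :* c) _ _ _) (+-cong (Φ-mono-s (m⊓n≤m a b)) (-‿cong (trans (Φ-mono-s (≤-trans (m⊓n≤n a b) (m≤m+n b e))) (qp-+ R n b e))))) ⟩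
    z a - z b * t′
     ≈⟨ solve Λ 3 1 (λ a b t c → a :- b :* t := :E (⊟ c) :* (:E c :* a :- t :* (:E c :* b))) (z a) (z b) t′ (+ 2) ⟩
    E (ℤ.- + 2) * (E (+ 2) * z a - t′ * (E (+ 2) * z b))
     ≈⟨ *-congˡ (trans (+-cong (sym (X≈ a)) (-‿cong (*-congˡ (sym (X≈ b))))) (trans (sym (ff-clear R n a≢b)) (*-congˡ (+-cong (X≈ a) (-‿cong (X≈ b)))))) ⟩
    E (ℤ.- + 2) * (ff′ a b * (E (+ 2) * z a - E (+ 2) * z b))
     ≈⟨ solve Λ 3 1 (λ a b f c → :E (⊟ c) :* (f :* (:E c :* a :- :E c :* b)) := f :* (a :- b)) (z a) (z b) (ff′ a b) (+ 2) ⟩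
    ff′ a b * (z a - z b)
     ≈⟨ *-congˡ (+-cong (sym (Φ-mono-s (m⊓n≤m a b))) (-‿cong (sym (Φ-mono-s (m⊓n≤n a b))))) ⟩
    ff′ a b * (z s * Φ (mono (a ∸ s)) - z s * Φ (mono (b ∸ s)))
     ≈⟨ trans (solve Λ 4 0 (λ f s x y → f :* (s :* x :- s :* y) := s :* (f :* (x :- y))) (ff′ a b) (z s) _ _) (*-congˡ (*-congˡ (sym (Φ-⊖ (mono (a ∸ s)) (mono (b ∸ s)))))) ⟩
    z s * (ff′ a b * Φ D) ∎
   D-unit : D 0 ℤ.* D 0 ≡ + 1
   D-unit with <-cmp a b
   ... | tri< l _ _ rewrite m≤n⇒m⊓n≡m (<⇒≤ l) | n∸n≡0 a = cong (λ z → (+ 1 ℤ.- z) ℤ.* (+ 1 ℤ.- z)) (mono-low (m<n⇒0<n∸m l))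
   ... | tri≈ _ eq _ = ⊥-elim (a≢b eq)
   ... | tri> _ _ l rewrite m≥n⇒m⊓n≡n (<⇒≤ l) | n∸n≡0 b = cong (λ z → (z ℤ.- + 1) ℤ.* (z ℤ.- + 1)) (mono-low (m<n⇒0<n∸m l))
   Φ-⊘′ : ∀ {y} → Φ N ≈ y * Φ D → Φ (N ⊘ D) ≈ y
   Φ-⊘′ eq = trans (Φ-⊗ N (invS D)) (trans (*-congʳ eq) (trans (*-assoc _ _ _) (trans (*-congˡ (Φ-inverse D D-unit)) (*-identityʳ _))))

  Φ-hlTerm : ∀ μ w → Distinct w → length μ ≡ length w → Φ (hlTerm e μ w) ≈ arranged R n μ w
  Φ-hlTerm μ w d eq = trans (Φ-⊗ (mono (sumℕ (zipWith ℕ._*_ μ w))) (hlProd e w)) (trans (*-congʳ (Φ-mono (sumℕ (zipWith ℕ._*_ μ w)))) (go μ w d eq))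
   where
   row : ∀ {a} w → All (a ≢_) w → Φ (prodS (map (hlFactor e a) w)) ≈ Π′ (ff′ a) w
   row [] [] = Φ-1
   row {a} (b ∷ w) (p ∷ ps) = trans (Φ-⊗ (hlFactor e a b) _) (*-cong (Φ-hlFactor p) (row w ps))
   go : ∀ μ w → Distinct w → length μ ≡ length w → z (sumℕ (zipWith ℕ._*_ μ w)) * Φ (hlProd e w) ≈ arranged R n μ w
   go [] [] d eq = trans (*-cong E-0 Φ-1) (*-identityˡ _)
   go (k ∷ μ) (a ∷ w) (h ∷ d) eq = trans (*-cong (qp-+ R n (k ℕ.* a) _) (trans (Φ-⊗ (prodS (map (hlFactor e a) w)) (hlProd e w)) (*-congʳ (row w h))))
    (trans (*-interchange _ _ _ _) (*-congˡ (go μ w d (suc-injective eq))))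

  Φ-sumS : ∀ {B : Set} (G : B → Series) l → Φ (sumS (map G l)) ≈ listSum (λ b → Φ (G b)) l
  Φ-sumS G []      = Φ-0
  Φ-sumS G (b ∷ l) = trans (Φ-⊕ (G b) _) (+-congˡ (Φ-sumS G l))

  Φ-numerator : ∀ μ V → Distinct V → length μ ≡ length V → Φ (sumS (map (hlTerm e μ) (perms V))) ≈ Pt R n μ V
  Φ-numerator μ V d eq = trans (Φ-sumS (hlTerm e μ) (perms V)) (trans (listSum-cong (All.map (λ {w} p → Φ-hlTerm μ w (distinct-resp-↭ (↭-sym p) d) (≡.trans eq (≡.sym (Permₚ.↭-length p)))) (perms-↭ V)))
   (permSum≈Pt R n μ V eq))

  private
   facs : List ℕ → ℕ → Carrier
   facs l i = fac R n (count i l)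

  -- Sizes above the largest part have multiplicity 0 and contribute 1, so the range may be extended
  -- to a bound common to all partitions.
  Φ-vFactor : ∀ b l → All (_≤ b) l → Φ (vFactor e l) ≈ Π< R (suc b) (facs l)
  Φ-vFactor b l h = trans (Φ-prodS (λ i → facS (count i l)) (λ i → i) (suc (maxL l))) (trans (Π<-cong R (suc (maxL l)) λ i _ → Φ-fac (count i l))
   (trans (sym (extend (b ∸ maxL l))) (reflexive (cong (λ k → Π< R k (facs l)) (≡.trans (+-suc (b ∸ maxL l) (maxL l)) (cong suc (m∸n+n≡m (maxL-≤ l h))))))))
   where
   extend : ∀ k → Π< R (k ℕ.+ suc (maxL l)) (facs l) ≈ Π< R (suc (maxL l)) (facs l)
   extend zero = refl
   extend (suc k) = trans (*-cong (reflexive (cong (fac R n) (maxL-absent l (m≤n+m (suc (maxL l)) k)))) (extend k)) (*-identityˡ _)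

  module _ (m : ℕ) where
   private
    vfac : ℕ → List ℕ → Carrier
    vfac zero    l = 1#
    vfac (suc k) l = fac R n (count (suc k) l) * vfac k l

    vinv-vfac : ∀ k l → vinv k l * vfac k l ≈ 1#
    vinv-vfac zero l = *-identityˡ _
    vinv-vfac (suc k) l = trans (*-interchange _ _ _ _) (trans (*-cong (facinv-inverse (count (suc k) l)) (vinv-vfac k l)) (*-identityˡ _))

    -- In 2λ the odd sizes do not occur and the size 2j has the multiplicity of j in λ; the padding
    -- by zeros gives `fac i`.
    Π<-vfac : ∀ i l k → All (1 ≤_) l → Π< R (suc (2 ℕ.* k)) (facs (double l ++ replicate i 0)) ≈ fac R n i * vfac k l
    Π<-vfac i l zero h = *-congʳ (reflexive (cong (fac R n) (≡.trans (count-++ 0 (double l) _) (cong₂ ℕ._+_ (count-absent (double l) (Allₚ.map⁺ (All.map (λ { (s≤s _) () }) h)))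
     (≡.trans (cong (count 0) (≡.sym (Listₚ.++-identityʳ (replicate i 0)))) (≡.trans (count-replicate 0 i []) (ℕₚ.+-identityʳ i)))))))
    Π<-vfac i l (suc k) h = trans (reflexive (cong (λ j → Π< R (suc j) f) (*-suc 2 k)))
     (trans (*-cong (reflexive (cong (fac R n) even)) (trans (*-cong (reflexive (cong (fac R n) odd)) (Π<-vfac i l k h)) (*-identityˡ _)))
      (x*yz≈y*xz _ _ _))
     where
     f : ℕ → Carrier
     f = facs (double l ++ replicate i 0)
     pad : ∀ j → count (suc j) (double l ++ replicate i 0) ≡ count (suc j) (double l)
     pad j = ≡.trans (count-++ (suc j) (double l) _) (≡.trans (cong (count (suc j) (double l) ℕ.+_) (count-absent _ (Allₚ.replicate⁺ i λ ()))) (ℕₚ.+-identityʳ _))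
     even : count (2 ℕ.+ 2 ℕ.* k) (double l ++ replicate i 0) ≡ count (suc k) l
     even = ≡.trans (pad (suc (2 ℕ.* k))) (≡.trans (cong (λ j → count j (double l)) (≡.sym (*-suc 2 k))) (count-double (suc k) l))
     odd : count (suc (2 ℕ.* k)) (double l ++ replicate i 0) ≡ 0
     odd = ≡.trans (pad (2 ℕ.* k)) (count-odd k l)

    Pt-long : ∀ μ V → length V < length μ → Pt R n μ V ≈ 0#
    Pt-long (k ∷ μ) [] l = refl
    Pt-long (k ∷ μ) (x ∷ V) (s≤s l) = PickSum.pickSum-0 Λ {H = λ a r → z (k ℕ.* a) * Π′ (ff′ a) r * Pt R n μ r} (x ∷ V)
     λ {a} {r} p → trans (*-congˡ (Pt-long μ r (subst (_< length μ) (suc-injective (Pick-length p)) l))) (zeroʳ _)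

    pad-length : ∀ {M} μ → length μ ≤ M → length (μ ++ replicate (M ∸ length μ) 0) ≡ M
    pad-length {M} μ h = ≡.trans (Listₚ.length-++ μ) (≡.trans (cong (length μ ℕ.+_) (Listₚ.length-replicate (M ∸ length μ))) (m+[n∸m]≡n h))

   -- The factor `fac i` of the zero parts occurs both in the sum over permutations and in v, and
   -- cancels. When there are too few variables, `Pt` is an empty sum, in agreement with the
   -- convention of the definition.
   Φ-HL : ∀ M l → PartsIn m l → Φ (HL M e (double l)) ≈ normalised m (upTo M) l
   Φ-HL M l h = cases (branch M (length (double l)) 0S (sumS (map (hlTerm e μ) (perms (upTo M))) ⊘ vFactor e μ))
    where
    open ≈-Reasoning
    i : ℕ
    i = M ∸ length (double l)
    μ : List ℕ
    μ = double l ++ replicate i 0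
    quotient : length (double l) ≤ M → Φ (sumS (map (hlTerm e μ) (perms (upTo M))) ⊘ vFactor e μ) ≈ vinv m l * Pt R n (double l) (upTo M)
    quotient short = Φ-⊘ (sumS (map (hlTerm e μ) (perms (upTo M)))) (vFactor e μ) (Monic-prodS (λ i → facS (count i μ)) (upTo (suc (maxL μ))) λ i → Monic-facS (count i μ)) (begin
     Φ (sumS (map (hlTerm e μ) (perms (upTo M))))
      ≈⟨ Φ-numerator μ (upTo M) (upTo⁺ M) (≡.trans (pad-length (double l) short) (≡.sym (Listₚ.length-upTo M))) ⟩
     Pt R n μ (upTo M)
      ≈⟨ Pt-zeros R n 1-t-cancel (double l) i (upTo M) (upTo⁺ M) (≡.trans (Listₚ.length-upTo M) (≡.sym (m+[n∸m]≡n short))) ⟩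
     fac R n i * Pt R n (double l) (upTo M)
      ≈⟨ sym (trans (*-congʳ (vinv-vfac m l)) (*-identityˡ _)) ⟩
     vinv m l * vfac m l * (fac R n i * Pt R n (double l) (upTo M))
      ≈⟨ solve Λ 4 0 (λ a b c d → (a :* b) :* (c :* d) := (a :* d) :* (c :* b)) _ _ _ _ ⟩
     vinv m l * Pt R n (double l) (upTo M) * (fac R n i * vfac m l)
      ≈⟨ *-congˡ (sym (trans (Φ-vFactor (2 ℕ.* m) μ (Allₚ.++⁺ (Allₚ.map⁺ (All.map (λ (_ , p) → *-monoʳ-≤ 2 p) h)) (Allₚ.replicate⁺ i z≤n))) (Π<-vfac i l m (All.map proj₁ h)))) ⟩
     vinv m l * Pt R n (double l) (upTo M) * Φ (vFactor e μ) ∎)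
    cases : ((HL M e (double l) ≡ 0S) × (M < length (double l))) ⊎ ((HL M e (double l) ≡ sumS (map (hlTerm e μ) (perms (upTo M))) ⊘ vFactor e μ) × (length (double l) ≤ M)) →
     Φ (HL M e (double l)) ≈ vinv m l * Pt R n (double l) (upTo M)
    cases (inj₁ (eq , long)) = trans (reflexive (cong Φ eq)) (trans Φ-0 (sym (trans (*-congˡ (Pt-long (double l) (upTo M) (subst (_< length (double l)) (≡.sym (Listₚ.length-upTo M)) long))) (zeroʳ _))))
    cases (inj₂ (eq , short)) = trans (reflexive (cong Φ eq)) (quotient short)

   private
    vinv-Val : ∀ k l → Val 0ℤ (vinv k l)
    vinv-Val zero l = Val-1
    vinv-Val (suc k) l = Val-* (Φ-Val _) (vinv-Val k l)

    All-upTo : ∀ M → All (_< M) (upTo M)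
    All-upTo M = Allₚ.applyUpTo⁺₁ (λ i → i) M (λ l → l)

   -- Passing from M to M + 1 variables changes the polynomial only from q^M on, and M > k.
   HL-stable : ∀ l → PartsIn m l → ∀ d k → HL (d ℕ.+ suc k) e (double l) k ≡ HLspec e (double l) k
   HL-stable l h zero k = ≡.refl
   HL-stable l h (suc d) k = ≡.trans (Val⇒agree {fourfold R n M} (Val-≈ (sym (trans (+-cong (Φ-HL (suc M) l h) (-‿cong (Φ-HL M l h))) (trans (+-congʳ (*-congˡ (reflexive (cong (Pt R n (double l)) (≡.sym (Listₚ.upTo-∷ʳ M))))))
     (solve Λ 3 0 (λ v a b → v :* a :- v :* b := v :* (a :- b)) _ _ _))))
    (Val-scale {0ℤ} {+ fourfold R n M} (ℤₚ.+-identityˡ _) (vinv-Val m l) (stable R n (double l) M (upTo M) (Allₚ.map⁺ (All.map (λ (p , _) → ≤-trans p (m≤m+n _ _)) h)) (upTo⁺ M) (All-upTo M)))) k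
     (≤-trans (s≤s (≤-reflexive (lem k))) (+-mono-<-≤ (+-mono-<-≤ k<M (<⇒≤ k<M)) (+-mono-≤ (<⇒≤ k<M) (<⇒≤ k<M))))) (HL-stable l h d k)
    where
    M : ℕ
    M = d ℕ.+ suc k
    k<M : k < M
    k<M = m≤n+m (suc k) d
    lem : ∀ k → k ℕ.* 4 ≡ k ℕ.+ k ℕ.+ (k ℕ.+ k)
    lem = ℕ-ring

-- The left-hand side as a limit of finite sums

module LeftSide where

 open Base
 open Limit
 open Littlewood using (F)
 open Evaluate using (_≋_; conv)
 open Laurent using (seriesExp; ⊗-congˡ; mono-+; module S)
 open Odds using (V; oddℤ)
 open Picks
 open Perms
 open Partitions
 open Transport
 open HallLittlewood
 open Solver
 open Defs

 -- Lets the lemmas on list sums be used for single coefficients.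
 intExp : ExpRing
 intExp = record { commRing = ℤₚ.+-*-commutativeRing ; E = λ _ → + 1 ; E-0 = ≡.refl ; E-+ = λ _ _ → ≡.refl }

 private
  module ZS = ListSum intExp
  module SS = ListSum seriesExp
  open Total seriesExp mono mono-+ using (Tot)

 sumℤ≡ : ∀ l → sumℤ l ≡ ZS.listSum (λ z → z) l
 sumℤ≡ []      = ≡.refl
 sumℤ≡ (z ∷ l) = cong (ℤ._+_ z) (sumℤ≡ l)

 listSum-at : ∀ {B : Set} (G : B → Series) l k → SS.listSum G l k ≡ ZS.listSum (λ b → G b k) l
 listSum-at G [] k      = ≡.refl
 listSum-at G (b ∷ l) k = cong (ℤ._+_ (G b k)) (listSum-at G l k)

 sum<-at : ∀ K (G : ℕ → Series) k → SS.sum< K G k ≡ ZS.sum< K (λ s → G s k)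
 sum<-at zero G k    = ≡.refl
 sum<-at (suc K) G k = cong (ℤ._+_ (G K k)) (sum<-at K G k)

 module _ (P : Realisation) (m n : ℕ) (n≥1 : 1 ≤ n) where
  open Realisation P
  open Transfer P

  private
   R = lring
   e : ℕ
   e = 2 ℕ.* n
   φ : ℕ → List ℕ → Series
   φ M l = HL M e (double l)
   module Trunc = Truncation R n (1-t-cancel P n n≥1) (facinv P n n≥1) (facinv-inverse P n n≥1)
   norm = Trunc.normalised m

  open Seq R
  open ListSum Λ
  module T = Total Λ (qp R n) (qp-+ R n)

  -- The definition of `HLspec` uses a different number of variables for each coefficient; by
  -- stability one common M > N serves all of them.
  LHS-truncated : ∀ N M → N < M → LHS m n N ≡ Tot m (suc N) (φ M) N
  LHS-truncated N M N<M = ≡.trans (sumℤ≡ (concatMap (λ s → map (term s) (partitionsBounded m s)) (upTo (suc N)))) (≡.trans (ZS.listSum-concatMap (λ z → z) (λ s → map (term s) (partitionsBounded m s)) (upTo (suc N)))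
   (≡.trans (ZS.listSum-applyUpTo (λ s → ZS.listSum (λ z → z) (map (term s) (partitionsBounded m s))) (λ i → i) (suc N))
    (≡.trans (ZS.sum<-cong (suc N) λ s _ → row s) (≡.sym (sum<-at (suc N) (λ s → mono s ⊗ partSum seriesExp m s (φ M)) N)))))
   where
   term : ℕ → List ℕ → ℤ
   term s l = (mono s ⊗ HLspec e (double l)) N
   row : ∀ s → ZS.listSum (λ z → z) (map (term s) (partitionsBounded m s)) ≡ (mono s ⊗ partSum seriesExp m s (φ M)) N
   row s = ≡.trans (ZS.listSum-map (λ z → z) (term s) (partitionsBounded m s)) (≡.trans
    (ZS.listSum-cong (All.map (λ {l} h → ⊗-local N {mono s} (λ _ _ → ≡.refl) λ k k≤N → ≡.sym (≡.trans (cong (λ M → HL M e (double l) k) (≡.sym (m∸n+n≡m (≤-<-trans k≤N N<M)))) (HL-stable P n n≥1 m l h (M ∸ suc k) k))) (partsF-bounded s m s)))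
    (≡.trans (≡.sym (listSum-at (λ l → mono s ⊗ φ M l) (partsF s m s) N)) (SS.listSum-* (mono s) (φ M) (partsF s m s) N)))

  Tot-longer : ∀ d N M → Tot m (d ℕ.+ suc N) (φ M) N ≡ Tot m (suc N) (φ M) N
  Tot-longer zero N M = ≡.refl
  Tot-longer (suc d) N M = ≡.trans (cong₂ ℤ._+_ (≡.trans (⊗-local N {g = p} (λ i i≤N → mono-low (≤-trans (s≤s i≤N) (m≤n+m (suc N) d))) (λ _ _ → ≡.refl)) (S.zeroˡ p N)) (Tot-longer d N M))
   (ℤₚ.+-identityˡ _)
   where
   p : Series
   p = partSum seriesExp m (d ℕ.+ suc N) (φ M)

  LHS-agrees : ∀ M k → k < M → LHS m n k ≡ Tot m M (φ M) k
  LHS-agrees M k k<M = ≡.trans (LHS-truncated k M k<M) (≡.trans (≡.sym (Tot-longer (M ∸ suc k) k M)) (cong (λ K → Tot m K (φ M) k) (m∸n+n≡m k<M)))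

  Φ-listSum : ∀ {B : Set} (G : B → Series) l → Φ (SS.listSum G l) ≈ listSum (λ b → Φ (G b)) l
  Φ-listSum G []      = Φ-0
  Φ-listSum G (b ∷ l) = trans (Φ-⊕ (G b) _) (+-congˡ (Φ-listSum G l))

  Φ-Tot : ∀ K M → Φ (Tot m K (φ M)) ≈ T.Tot m K (norm (upTo M))
  Φ-Tot zero M = Φ-0
  Φ-Tot (suc K) M = trans (Φ-⊕ (mono K ⊗ partSum seriesExp m K (φ M)) (Tot m K (φ M))) (+-cong (trans (Φ-⊗ (mono K) (partSum seriesExp m K (φ M)))
   (*-cong (Φ-mono K) (trans (Φ-listSum (φ M) (partsF K m K)) (listSum-cong (All.map (λ {l} h → Φ-HL P n n≥1 m M l h) (partsF-bounded K m K)))))) (Φ-Tot K M))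

  -- With M = 2nL variables there are two errors: omitting partitions of size at least M, and
  -- replacing the infinite specialisation by M variables. Both have order at least M.
  F-converges : _≋_ R (λ L → F qRing (+ (2 ℕ.* n) ℤ.+ + (2 ℕ.* n)) m (V R n L n≥1)) (λ _ → Φ (LHS m n))
  F-converges = conv (λ k → k , λ L k≤L → let M = 2 ℕ.* n ℕ.* L ; k≤M = ≤-trans k≤L (≤-trans (≤-reflexive (≡.sym (ℕₚ.*-identityˡ L))) (*-monoˡ-≤ L (≤-trans n≥1 (m≤m+n n _)))) in
    Val-≈ (sym (trans (+-congʳ (F≈ M)) (solve Λ 3 0 (λ a b c → a :- b := :- (c :- a) :+ (c :- b)) _ _ (T.Tot m M (norm (upTo M))))))
     (Val-+ (Val-neg (Val-≤ (ℤ.+≤+ (≤-trans k≤M (≤-trans (m≤m+n M M) (m≤m+n _ _)))) (Trunc.truncation m M (upTo M) (upTo⁺ M))))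
      (Val-≤ (ℤ.+≤+ k≤M) (Val-≈ (+-congʳ (Φ-Tot M M)) (agree⇒Val M λ k k<M → ≡.sym (LHS-agrees M k k<M))))))
   (λ L → Val-≈ (sym (F≈ (2 ℕ.* n ℕ.* L))) (Trunc.Val-Fℕ m (upTo (2 ℕ.* n ℕ.* L)) (upTo⁺ _)))
   (λ _ → Φ-Val (LHS m n))
   where
   F≈ : ∀ M → F qRing (+ (2 ℕ.* n) ℤ.+ + (2 ℕ.* n)) m (map oddℤ (upTo M)) ≈ Trunc.Fℕ m (upTo M)
   F≈ M = Trunc.F≈Fℕ m (upTo M)

-- The two products, by induction along constant κ

module RightSide where

 open Base
 open Solver
 open Limit
 open Evaluate
 open Laurent using (seriesExp; ⊗-congˡ; module S)
 open Pochhammer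
 open Odds using (V)
 open Transport
 open LeftSide
 open Defs

 module _ (P : Realisation) where
  open Realisation P
  open Transfer P
  open Seq lring

  private
   R = lring
   Π = Π< R

  Π<-++ : ∀ k l f → Π (k ℕ.+ l) f ≈ Π k (λ i → f (i ℕ.+ l)) * Π l f
  Π<-++ zero l f    = sym (*-identityˡ _)
  Π<-++ (suc k) l f = trans (*-congˡ (Π<-++ k l f)) (sym (*-assoc _ _ _))

  Π<-residues : ∀ r L f → Π (L ℕ.* r) f ≈ Π r (λ a → Π L (λ b → f (a ℕ.+ b ℕ.* r)))
  Π<-residues r zero f = sym (ones r)
   where
   ones : ∀ r → Π r (λ _ → 1#) ≈ 1#
   ones zero = refl
   ones (suc r) = trans (*-identityˡ _) (ones r)
  Π<-residues r (suc L) f = trans (Π<-++ r (L ℕ.* r) f) (trans (*-congˡ (Π<-residues r L f)) (sym (Π<-* R r _ _)))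

  -- The index is written as a + b r, which splits the progression into r progressions of step r d.
  inf-residues : ∀ r c d → 1 ≤ r → 1 ≤ c → 1 ≤ d → inf c d ≈ Π r (λ a → inf (c ℕ.+ a ℕ.* d) (r ℕ.* d))
  inf-residues r c d r≥1 c≥1 d≥1 = ~-constant (~-trans (~-sym (_≋_.close (limit c≥1 d≥1 (λ L → L ℕ.* r) λ L →
    ≤-trans (≤-reflexive (≡.sym (ℕₚ.*-identityʳ L))) (*-monoʳ-≤ L r≥1))))
   (~-trans (≈⇒~ λ L → trans (Π<-residues r L _) (Π<-cong R r λ a _ → Π<-cong R L λ b _ → U-≡ R (lem a b c d r)))
    (_≋_.close (Π-≋ R r _ _ λ a _ → limit (≤-trans c≥1 (m≤m+n c _)) (*-mono-≤ r≥1 d≥1) (λ L → L) λ _ → ≤-refl))))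
   where
   limit : ∀ {c d} → 1 ≤ c → 1 ≤ d → (f : ℕ → ℕ) → (∀ L → L ≤ f L) → _≋_ R (λ L → pk R c d (f L)) (λ _ → inf c d)
   limit = lim R inf (λ c d → Φ-Val (pochInf c d)) inf-lim
   lem : ∀ a b c d r → c ℕ.+ (a ℕ.+ b ℕ.* r) ℕ.* d ≡ c ℕ.+ a ℕ.* d ℕ.+ b ℕ.* (r ℕ.* d)
   lem = ℕ-ring

  inf-halves : ∀ c d {c₂ d₂} → 1 ≤ c → 1 ≤ d → c₂ ≡ c ℕ.+ d → d₂ ≡ d ℕ.+ d → inf c d ≈ inf c d₂ * inf c₂ d₂
  inf-halves c d {c₂} {d₂} c≥1 d≥1 e₁ e₂ = trans (inf-residues 2 c d (s≤s z≤n) c≥1 d≥1) (trans (*-congˡ (*-identityʳ _))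
   (trans (*-comm _ _) (*-cong (reflexive (cong₂ inf (ℕₚ.+-identityʳ c) (≡.trans two (≡.sym e₂))))
    (reflexive (cong₂ inf (≡.trans (cong (c ℕ.+_) (ℕₚ.+-identityʳ d)) (≡.sym e₁)) (≡.trans two (≡.sym e₂)))))))
   where
   two : 2 ℕ.* d ≡ d ℕ.+ d
   two = cong (d ℕ.+_) (ℕₚ.+-identityʳ d)

  θ : ℕ → ℕ → Carrier
  θ a d = inf a d * inf (d ∸ a) d

  inf-cancel : ∀ c d {x y} → 1 ≤ c → inf c d * x ≈ inf c d * y → x ≈ y
  inf-cancel c d h = Φ-cancel (pochInf c d) (Monic-pochFin c d 1 h)

  private
   one : Carrier
   one = inf 1 1

   powers : ℕ → Carrier
   powers k = Π k (λ _ → one)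

   powers-cancel : ∀ k {x y} → powers k * x ≈ powers k * y → x ≈ y
   powers-cancel zero e = trans (sym (*-identityˡ _)) (trans e (*-identityˡ _))
   powers-cancel (suc k) e = powers-cancel k (inf-cancel 1 1 (s≤s z≤n) (trans (sym (*-assoc _ _ _)) (trans e (*-assoc _ _ _))))

  module _ (h : ℕ) where
   κ : ℕ
   κ = 2 ℕ.* h

   row₁ row₂ num₁ num₂ : ℕ → Carrier
   row₁ k = Π k (λ i → θ (k ∸ i) κ * θ (k ℕ.+ i ℕ.+ 2) κ)
   row₂ k = Π k (λ i → θ (k ∸ i) κ * θ (k ℕ.+ i ℕ.+ 3) κ)
   num₁ n = inf h κ * Π n (λ k → θ (suc k) h * inf κ κ * row₁ k)
   num₂ m = Π m (λ k → inf κ κ * θ (suc (suc k)) κ * row₂ k)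

   Θ : ℕ → Carrier
   Θ k = Π k (λ i → θ (suc i) κ)

   Θ-split : ∀ b k → κ ≡ b ℕ.+ suc k → Θ k ≈ prodFrom R (λ a → inf a κ) 1 k * prodFrom R (λ a → inf a κ) (suc b) k
   Θ-split b k e = trans (Π<-* R k _ _) (*-cong (sym (prodFrom≈Π< R _ 1 k)) (trans (Π<-cong R k λ i i<k → reflexive (cong (λ a → inf a κ) (≡.trans (cong (_∸ suc i) e) (+-∸-assoc b (m<n⇒m<1+n i<k)))))
    (trans (Π<-reverse R k (λ i → inf (b ℕ.+ i) κ)) (trans (prodFrom≈Π< R _ 1 k) (trans (Π<-cong R k λ i _ → reflexive (cong (λ a → inf a κ) (+-suc b i))) (sym (prodFrom≈Π< R _ (suc b) k)))))))

   -- `Θ k` covers the residues 1, ..., k and their negatives modulo κ, `Θ l` likewise. As k + l = κ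
   -- - 1, the positive ones of either together with the negative ones of the other exhaust the
   -- nonzero residues.
   Θ-Θ : ∀ k l → κ ≡ k ℕ.+ suc l → inf κ κ * Θ k * (inf κ κ * Θ l) ≈ one * one
   Θ-Θ k l e = begin
    inf κ κ * Θ k * (inf κ κ * Θ l)
     ≈⟨ *-cong (*-congˡ (Θ-split l k (≡.trans e (≡.trans (+-suc k l) (≡.trans (cong suc (ℕₚ.+-comm k l)) (≡.sym (+-suc l k))))))) (*-congˡ (Θ-split k l e)) ⟩
    inf κ κ * (g 1 k * g (suc l) k) * (inf κ κ * (g 1 l * g (suc k) l))
     ≈⟨ solve Λ 5 0 (λ i a b c d → i :* (a :* b) :* (i :* (c :* d)) := i :* (a :* d) :* (i :* (c :* b))) _ _ _ _ _ ⟩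
    inf κ κ * (g 1 k * g (suc k) l) * (inf κ κ * (g 1 l * g (suc l) k))
     ≈⟨ *-cong (whole k l e) (whole l k (≡.trans e (≡.trans (+-suc k l) (≡.trans (cong suc (ℕₚ.+-comm k l)) (≡.sym (+-suc l k)))))) ⟩
    one * one ∎
    where
    open ≈-Reasoning
    g : ℕ → ℕ → Carrier
    g = prodFrom R (λ a → inf a κ)
    whole : ∀ k l → κ ≡ k ℕ.+ suc l → inf κ κ * (g 1 k * g (suc k) l) ≈ one
    whole k l e = sym (trans (inf-residues (suc (k ℕ.+ l)) 1 1 (s≤s z≤n) (s≤s z≤n) (s≤s z≤n)) (*-cong
     (reflexive (cong₂ inf (≡.trans (cong suc (ℕₚ.*-identityʳ _)) κ≡) (≡.trans (ℕₚ.*-identityʳ _) κ≡)))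
     (trans (Π<-cong R (k ℕ.+ l) λ i _ → reflexive (cong₂ (λ a d → inf (suc a) d) (ℕₚ.*-identityʳ i) (≡.trans (ℕₚ.*-identityʳ _) κ≡)))
      (trans (sym (prodFrom≈Π< R (λ a → inf a κ) 1 (k ℕ.+ l))) (prodFrom-++ R (λ a → inf a κ) 1 k l)))))
     where
     κ≡ : suc (k ℕ.+ l) ≡ κ
     κ≡ = ≡.trans (≡.sym (+-suc k l)) (≡.sym e)

   -- the factors of a row, next to those with indices between its halves
   row-Θ : ∀ k j → Π k (λ i → θ (k ∸ i) κ * θ (k ℕ.+ i ℕ.+ suc j) κ) * Π j (λ i → θ (suc (i ℕ.+ k)) κ) ≈ Θ (k ℕ.+ (j ℕ.+ k))
   row-Θ k j = begin
    Π k (λ i → θ (k ∸ i) κ * θ (k ℕ.+ i ℕ.+ suc j) κ) * Π j (λ i → θ (suc (i ℕ.+ k)) κ)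
     ≈⟨ *-congʳ (trans (Π<-* R k _ _) (*-cong (trans (Π<-reverse R k (λ i → θ i κ)) (prodFrom≈Π< R _ 1 k)) (Π<-cong R k λ i _ → reflexive (cong (λ a → θ a κ) (lem i j k))))) ⟩
    Θ k * Π k (λ i → θ (suc (i ℕ.+ (j ℕ.+ k))) κ) * Π j (λ i → θ (suc (i ℕ.+ k)) κ)
     ≈⟨ solve Λ 3 0 (λ a b c → a :* b :* c := b :* (c :* a)) _ _ _ ⟩
    Π k (λ i → θ (suc (i ℕ.+ (j ℕ.+ k))) κ) * (Π j (λ i → θ (suc (i ℕ.+ k)) κ) * Θ k)
     ≈⟨ trans (*-congˡ (sym (Π<-++ j k _))) (sym (Π<-++ k (j ℕ.+ k) _)) ⟩
    Θ (k ℕ.+ (j ℕ.+ k)) ∎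
    where
    open ≈-Reasoning
    lem : ∀ i j k → k ℕ.+ i ℕ.+ suc j ≡ suc (i ℕ.+ (j ℕ.+ k))
    lem = ℕ-ring

   -- The product of what the first formula gains from n to n + 1 and the second from m to m + 1. As
   -- h = (m + 1) + (n + 1), the theta function of base q^h splits into those of q^(n+1) and q^(m+1)
   -- of base q^κ; the former fills the gap in `row₁`, the latter one of the two gaps in `row₂`.
   rows : ∀ m n → h ≡ m ℕ.+ suc (suc n) → (θ (suc n) h * inf κ κ * row₁ n) * (inf κ κ * θ (suc (suc m)) κ * row₂ m) ≈ one * one
   rows m n e = begin
    (θ (suc n) h * inf κ κ * row₁ n) * (inf κ κ * θ (suc (suc m)) κ * row₂ m)
     ≈⟨ *-congʳ (*-congʳ (*-congʳ θ-halves)) ⟩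
    ((θ (suc n) κ * θ (suc m) κ) * inf κ κ * row₁ n) * (inf κ κ * θ (suc (suc m)) κ * row₂ m)
     ≈⟨ solve Λ 6 0 (λ a b i r c s → ((a :* b) :* i :* r) :* (i :* c :* s) := (i :* (r :* (a :* :1))) :* (i :* (s :* (c :* (b :* :1))))) _ _ _ _ _ _ ⟩
    (inf κ κ * (row₁ n * (θ (suc n) κ * 1#))) * (inf κ κ * (row₂ m * (θ (suc (suc m)) κ * (θ (suc m) κ * 1#))))
     ≈⟨ *-cong (*-congˡ (row-Θ n 1)) (*-congˡ (row-Θ m 2)) ⟩
    (inf κ κ * Θ (n ℕ.+ suc n)) * (inf κ κ * Θ (m ℕ.+ suc (suc m)))
     ≈⟨ Θ-Θ (n ℕ.+ suc n) (m ℕ.+ suc (suc m)) (≡.trans (cong (2 ℕ.*_) e) (lem m n)) ⟩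
    one * one ∎
    where
    open ≈-Reasoning
    lem : ∀ m n → 2 ℕ.* (m ℕ.+ suc (suc n)) ≡ n ℕ.+ suc n ℕ.+ suc (m ℕ.+ suc (suc m))
    lem = ℕ-ring
    h-n : h ∸ suc n ≡ suc m
    h-n = ≡.trans (cong (_∸ suc n) (≡.trans e (+-suc m (suc n)))) (m+n∸n≡m (suc m) (suc n))
    h≥1 : 1 ≤ h
    h≥1 = subst (1 ≤_) (≡.sym e) (≤-trans (s≤s z≤n) (m≤n+m (suc (suc n)) m))
    κ-n : κ ∸ suc n ≡ suc m ℕ.+ h
    κ-n = ≡.trans (cong (_∸ suc n) (≡.trans (cong (λ z → z ℕ.+ (h ℕ.+ 0)) e) (≡.trans (lem₁ m n (h ℕ.+ 0)) (cong (λ z → suc m ℕ.+ z ℕ.+ suc n) (ℕₚ.+-identityʳ h))))) (m+n∸n≡m (suc m ℕ.+ h) (suc n))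
     where
     lem₁ : ∀ m n h → m ℕ.+ suc (suc n) ℕ.+ h ≡ suc m ℕ.+ h ℕ.+ suc n
     lem₁ = ℕ-ring
    κ-m : κ ∸ suc m ≡ suc n ℕ.+ h
    κ-m = ≡.trans (cong (_∸ suc m) (≡.trans (cong (λ z → z ℕ.+ (h ℕ.+ 0)) e) (≡.trans (lem₁ m n (h ℕ.+ 0)) (cong (λ z → suc n ℕ.+ z ℕ.+ suc m) (ℕₚ.+-identityʳ h))))) (m+n∸n≡m (suc n ℕ.+ h) (suc m))
     where
     lem₁ : ∀ m n h → m ℕ.+ suc (suc n) ℕ.+ h ≡ suc n ℕ.+ h ℕ.+ suc m
     lem₁ = ℕ-ring
    κ≡ : κ ≡ h ℕ.+ h
    κ≡ = cong (h ℕ.+_) (ℕₚ.+-identityʳ h)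
    θ-halves : θ (suc n) h ≈ θ (suc n) κ * θ (suc m) κ
    θ-halves = trans (*-cong (inf-halves (suc n) h (s≤s z≤n) h≥1 κ-m κ≡) (trans (reflexive (cong (λ a → inf a h) h-n)) (inf-halves (suc m) h (s≤s z≤n) h≥1 κ-n κ≡)))
     (solve Λ 4 0 (λ a b c d → (a :* b) :* (c :* d) := (a :* d) :* (c :* b)) _ _ _ _)

  -- The first product with its denominators cleared; (q; q²)_∞ stands for (q; q)_∞ / (q²; q²)_∞.
  first : ∀ m n → 1 ≤ n → Φ (LHS m n) * (inf 1 2 * powers n) ≈ num₁ (m ℕ.+ suc n) n
  first m n n≥1 = trans (F-limit R inf (λ c d → Φ-Val (pochInf c d)) inf-lim m n n≥1 (Φ (LHS m n)) (F-converges P m n n≥1))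
   (*-congˡ (Π<-cong R n λ k _ → *-cong (*-congʳ (*-comm _ _)) (Π<-cong R k λ i _ →
    solve Λ 4 0 (λ a b c d → (a :* b) :* (c :* d) := (c :* b) :* (d :* a)) _ _ _ _)))

  -- The pairs (m + 1, n) and (m, n + 1) have the same h, so comparing `first` for both gives L₀ c =
  -- L₁ (q; q)_∞. With c d = (q; q)_∞², which is `rows`, this becomes the step of the second product
  -- by d. For m = 0 every finite sum is already 1.
  second : ∀ m n → 1 ≤ n → Φ (LHS m n) * powers m ≈ num₂ (m ℕ.+ suc n) m
  second zero n n≥1 = trans (*-identityʳ _) (sym (~-constant (_≋_.close (F-converges P 0 n n≥1))))
  second (suc m) n n≥1 = inf-cancel 1 1 (s≤s z≤n) (begin
   one * (L₀ * (one * powers m))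
    ≈⟨ solve Λ 3 0 (λ o l p → o :* (l :* (o :* p)) := l :* (o :* o) :* p) _ _ _ ⟩
   L₀ * (one * one) * powers m
    ≈⟨ *-congʳ (*-congˡ (sym (rows h m n (≡.sym h≡)))) ⟩
   L₀ * (c * d) * powers m
    ≈⟨ solve Λ 4 0 (λ l c d p → l :* (c :* d) :* p := (l :* c) :* (d :* p)) _ _ _ _ ⟩
   (L₀ * c) * (d * powers m)
    ≈⟨ *-congʳ step ⟩
   (L₁ * one) * (d * powers m)
    ≈⟨ solve Λ 4 0 (λ l o d p → (l :* o) :* (d :* p) := o :* (d :* (l :* p))) _ _ _ _ ⟩
   one * (d * (L₁ * powers m))
    ≈⟨ *-congˡ (*-congˡ (trans (second m (suc n) (s≤s z≤n)) (reflexive (cong (λ h → num₂ h m) h≡)))) ⟩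
   one * num₂ h (suc m) ∎)
   where
   open ≈-Reasoning
   h : ℕ
   h = suc m ℕ.+ suc n
   h≡ : m ℕ.+ suc (suc n) ≡ h
   h≡ = +-suc m (suc n)
   L₀ L₁ c d : Carrier
   L₀ = Φ (LHS (suc m) n)
   L₁ = Φ (LHS m (suc n))
   c = θ (suc n) h * inf (κ h) (κ h) * row₁ h n
   d = inf (κ h) (κ h) * θ (suc (suc m)) (κ h) * row₂ h m
   step : L₀ * c ≈ L₁ * one
   step = inf-cancel 1 2 (s≤s z≤n) (powers-cancel n (begin
    powers n * (inf 1 2 * (L₀ * c))
     ≈⟨ solve Λ 4 0 (λ p i l c → p :* (i :* (l :* c)) := c :* (l :* (i :* p))) _ _ _ _ ⟩
    c * (L₀ * (inf 1 2 * powers n))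
     ≈⟨ *-congˡ (first (suc m) n n≥1) ⟩
    c * num₁ h n
     ≈⟨ x*yz≈y*xz _ _ _ ⟩
    num₁ h (suc n)
     ≈⟨ sym (trans (first m (suc n) (s≤s z≤n)) (reflexive (cong (λ h → num₁ h (suc n)) h≡))) ⟩
    L₁ * (inf 1 2 * (one * powers n))
     ≈⟨ solve Λ 4 0 (λ p i l o → l :* (i :* (o :* p)) := p :* (i :* (l :* o))) _ _ _ _ ⟩
    powers n * (inf 1 2 * (L₁ * one)) ∎))

-- Comparison with the products as stated

module Formula where

 open Base
 open Solver
 open Pochhammer
 open Laurent using (⊗-congˡ; module S)
 open Transport
 open RightSide
 open Defs

 module _ (P : Realisation) where
  open Realisation P
  open Transfer P

  private
   R = lring
   Π = Π< R

  Φ-prod-from1 : ∀ (g : ℕ → Series) k → Φ (prodS (map g (from1 k))) ≈ Π k (λ i → Φ (g (suc i)))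
  Φ-prod-from1 g k = trans (reflexive (cong (λ l → Φ (prodS l)) (≡.sym (Listₚ.map-∘ (upTo k))))) (Φ-prodS (λ i → g (suc i)) (λ i → i) k)

  Φ-prod-pairs : ∀ (g : ℕ × ℕ → Series) n → Φ (prodS (map g (pairs n))) ≈ Π n (λ k → Π k (λ i → Φ (g (suc i , suc k))))
  Φ-prod-pairs g n = trans (flatten (from1 n)) (trans (Φ-prod-from1 (λ j → prodS (map g (row j))) n) (Π<-cong R n λ k _ →
   trans (reflexive (cong (λ l → Φ (prodS l)) (≡.sym (Listₚ.map-∘ (from1 k))))) (Φ-prod-from1 (λ i → g (i , suc k)) k)))
   where
   row : ℕ → List (ℕ × ℕ)
   row j = map (λ i → (i , j)) (from1 (j ∸ 1))
   prodS-++ : ∀ l l′ → Φ (prodS (map g (l ++ l′))) ≈ Φ (prodS (map g l)) * Φ (prodS (map g l′))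
   prodS-++ [] l′ = sym (trans (*-congʳ Φ-1) (*-identityˡ _))
   prodS-++ (p ∷ l) l′ = trans (Φ-⊗ (g p) (prodS (map g (l ++ l′)))) (trans (*-congˡ (prodS-++ l l′)) (trans (sym (*-assoc _ _ _)) (*-congʳ (sym (Φ-⊗ (g p) (prodS (map g l)))))))
   flatten : ∀ l → Φ (prodS (map g (concatMap row l))) ≈ Φ (prodS (map (λ j → prodS (map g (row j))) l))
   flatten [] = refl
   flatten (j ∷ l) = trans (prodS-++ (row j) (concatMap row l)) (trans (*-congˡ (flatten l)) (sym (Φ-⊗ (prodS (map g (row j))) _)))

  Φ-theta : ∀ a d → Φ (theta a d) ≈ θ P a d
  Φ-theta a d = Φ-⊗ (pochInf a d) (pochInf (d ∸ a) d)

  private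
   Π-θ : ∀ n (f g : ℕ → ℕ → ℕ) d → Π n (λ k → Π k (λ i → Φ (theta (f k i) d ⊗ theta (g k i) d))) ≈ Π n (λ k → Π k (λ i → θ P (f k i) d * θ P (g k i) d))
   Π-θ n f g d = Π<-cong R n λ k _ → Π<-cong R k λ i _ → trans (Φ-⊗ (theta (f k i) d) (theta (g k i) d)) (*-cong (Φ-theta (f k i) d) (Φ-theta (g k i) d))

   κ≡ : ∀ m n → 2 ℕ.* m ℕ.+ 2 ℕ.* n ℕ.+ 2 ≡ 2 ℕ.* (m ℕ.+ suc n)
   κ≡ = ℕ-ring

   h≡ : ∀ m n → m ℕ.+ n ℕ.+ 1 ≡ m ℕ.+ suc n
   h≡ = ℕ-ring

  module _ (m n : ℕ) (n≥1 : 1 ≤ n) where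
   private
    h₀ k₀ : ℕ
    h₀ = m ℕ.+ n ℕ.+ 1
    k₀ = kappa m n
    h : ℕ
    h = m ℕ.+ suc n
    K : ℕ
    K = κ P h
    one : Carrier
    one = inf 1 1
    h≥1 : 1 ≤ h
    h≥1 = ≤-trans (s≤s z≤n) (m≤n+m (suc n) m)
    Monic-inf : ∀ c d → 1 ≤ c → Monic (pochInf c d)
    Monic-inf c d = Monic-pochFin c d 1

   LHS≈RHS2 : LHS m n ≈S RHS2 m n
   LHS≈RHS2 = Φ-inj (sym (begin
    Φ (A ⊘ B ⊗ C ⊗ D)
     ≈⟨ trans (Φ-⊗ (A ⊘ B ⊗ C) D) (*-congʳ (Φ-⊗ (A ⊘ B) C)) ⟩
    Φ (A ⊘ B) * Φ C * Φ D
     ≈⟨ *-congʳ (*-congʳ (Φ-⊗ A (invS B))) ⟩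
    Φ A * Φ (invS B) * Φ C * Φ D
     ≈⟨ solve Λ 4 0 (λ a b c d → a :* b :* c :* d := (a :* c :* d) :* b) _ _ _ _ ⟩
    Φ A * Φ C * Φ D * Φ (invS B)
     ≈⟨ *-congʳ (trans numerator (trans (sym (second P m n n≥1)) (*-congˡ (sym (Φ-powS (pochInf 1 1) m))))) ⟩
    Φ (LHS m n) * Φ B * Φ (invS B)
     ≈⟨ trans (*-assoc _ _ _) (trans (*-congˡ (Φ-inverse B (cong₂ ℤ._*_ B-monic B-monic))) (*-identityʳ _)) ⟩
    Φ (LHS m n) ∎))
    where

    open ≈-Reasoning
    A B C D : Series
    A = powS (pochInf k₀ k₀) m
    B = powS (pochInf 1 1) m
    C = prodS (map (λ i → theta (suc i) k₀) (from1 m))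
    D = prodS (map (λ (i , j) → theta (j ∸ i) k₀ ⊗ theta (suc (i ℕ.+ j)) k₀) (pairs m))
    B-monic : Monic B
    B-monic = Monic-powS {pochInf 1 1} m (Monic-inf 1 1 (s≤s z≤n))
    numerator : Φ A * Φ C * Φ D ≈ num₂ P h m
    numerator = begin
     Φ A * Φ C * Φ D
      ≈⟨ *-cong (*-cong (Φ-powS (pochInf k₀ k₀) m) (trans (Φ-prod-from1 (λ i → theta (suc i) k₀) m) (Π<-cong R m λ i _ → Φ-theta (suc (suc i)) k₀)))
        (trans (Φ-prod-pairs (λ (i , j) → theta (j ∸ i) k₀ ⊗ theta (suc (i ℕ.+ j)) k₀) m) (Π-θ m (λ k i → suc k ∸ suc i) (λ k i → suc (suc i ℕ.+ suc k)) k₀)) ⟩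
     Π m (λ _ → inf k₀ k₀) * Π m (λ i → θ P (suc (suc i)) k₀) * Π m (λ k → Π k (λ i → θ P (k ∸ i) k₀ * θ P (suc (suc i ℕ.+ suc k)) k₀))
      ≈⟨ trans (*-congʳ (sym (Π<-* R m _ _))) (sym (Π<-* R m _ _)) ⟩
     Π m (λ k → inf k₀ k₀ * θ P (suc (suc k)) k₀ * Π k (λ i → θ P (k ∸ i) k₀ * θ P (suc (suc i ℕ.+ suc k)) k₀))
      ≈⟨ reflexive (cong (λ d → Π m (λ k → inf d d * θ P (suc (suc k)) d * Π k (λ i → θ P (k ∸ i) d * θ P (suc (suc i ℕ.+ suc k)) d))) (κ≡ m n)) ⟩
     Π m (λ k → inf K K * θ P (suc (suc k)) K * Π k (λ i → θ P (k ∸ i) K * θ P (suc (suc i ℕ.+ suc k)) K))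
      ≈⟨ (Π<-cong R m λ k _ → *-congˡ (Π<-cong R k λ i _ → *-congˡ (reflexive (cong (λ a → θ P a K) (lem i k))))) ⟩
     num₂ P h m ∎
     where
     lem : ∀ i k → suc (suc i ℕ.+ suc k) ≡ k ℕ.+ i ℕ.+ 3
     lem = ℕ-ring

   LHS≈RHS1 : LHS m n ≈S RHS1 m n
   LHS≈RHS1 = Φ-inj (sym (Φ-⊘ N D (Monic-powS {pochInf 1 1} (suc n) (Monic-inf 1 1 (s≤s z≤n))) (begin
    Φ N
     ≈⟨ trans (Φ-⊗ (A ⊗ B ⊗ C ⊗ G) J) (*-congʳ (trans (Φ-⊗ (A ⊗ B ⊗ C) G) (*-congʳ (trans (Φ-⊗ (A ⊗ B) C) (*-congʳ (Φ-⊗ A B)))))) ⟩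
    Φ A * Φ B * Φ C * Φ G * Φ J
     ≈⟨ *-cong (*-cong (*-cong (*-congˡ half) (refl)) (trans (Φ-prod-from1 (λ i → theta i h₀) n) (Π<-cong R n λ i _ → Φ-theta (suc i) h₀)))
       (trans (Φ-prod-pairs (λ (i , j) → theta (j ∸ i) k₀ ⊗ theta (i ℕ.+ j) k₀) n) (Π-θ n (λ k i → suc k ∸ suc i) (λ k i → suc i ℕ.+ suc k) k₀)) ⟩
    inf 2 2 * (inf h₀ k₀ * inf k₀ k₀) * Φ C * Π n (λ i → θ P (suc i) h₀) * Π n (λ k → Π k (λ i → θ P (k ∸ i) k₀ * θ P (suc i ℕ.+ suc k) k₀))
     ≈⟨ solve Λ 6 0 (λ a h k c g j → a :* (h :* k) :* c :* g :* j := a :* (h :* (g :* (k :* c) :* j))) _ _ _ _ _ _ ⟩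
    inf 2 2 * (inf h₀ k₀ * (Π n (λ i → θ P (suc i) h₀) * (inf k₀ k₀ * Φ C) * Π n (λ k → Π k (λ i → θ P (k ∸ i) k₀ * θ P (suc i ℕ.+ suc k) k₀))))
     ≈⟨ *-congˡ (*-congˡ (trans (*-congʳ (trans (*-congˡ (last n n≥1)) (sym (Π<-* R n _ _)))) (sym (Π<-* R n _ _)))) ⟩
    inf 2 2 * (inf h₀ k₀ * Π n (λ k → θ P (suc k) h₀ * inf k₀ k₀ * Π k (λ i → θ P (k ∸ i) k₀ * θ P (suc i ℕ.+ suc k) k₀)))
     ≈⟨ *-congˡ (reflexive (cong₂ (λ h d → inf h d * Π n (λ k → θ P (suc k) h * inf d d * Π k (λ i → θ P (k ∸ i) d * θ P (suc i ℕ.+ suc k) d))) (h≡ m n) (κ≡ m n))) ⟩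
    inf 2 2 * (inf h K * Π n (λ k → θ P (suc k) h * inf K K * Π k (λ i → θ P (k ∸ i) K * θ P (suc i ℕ.+ suc k) K)))
     ≈⟨ *-congˡ (*-congˡ (Π<-cong R n λ k _ → *-congˡ (Π<-cong R k λ i _ → *-congˡ (reflexive (cong (λ a → θ P a K) (lem i k)))))) ⟩
    inf 2 2 * num₁ P h n
     ≈⟨ *-congˡ (sym (first P m n n≥1)) ⟩
    inf 2 2 * (Φ (LHS m n) * (inf 1 2 * Π n (λ _ → one)))
     ≈⟨ solve Λ 4 0 (λ a l b p → a :* (l :* (b :* p)) := l :* ((b :* a) :* p)) _ _ _ _ ⟩
    Φ (LHS m n) * ((inf 1 2 * inf 2 2) * Π n (λ _ → one))
     -- Since (q; q²)_∞ (q²; q²)_∞ = (q; q)_∞, the denominator has the power n + 1.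
     ≈⟨ *-congˡ (trans (*-congʳ (sym (inf-halves P 1 1 (s≤s z≤n) (s≤s z≤n) ≡.refl ≡.refl))) (sym (Φ-powS (pochInf 1 1) (suc n)))) ⟩
    Φ (LHS m n) * Φ D ∎)))
    where
    open ≈-Reasoning
    A B C G J N D : Series
    A = pochInf 2 2
    B = pochInf h₀ h₀
    C = powS (pochInf k₀ k₀) (n ∸ 1)
    G = prodS (map (λ i → theta i h₀) (from1 n))
    J = prodS (map (λ (i , j) → theta (j ∸ i) k₀ ⊗ theta (i ℕ.+ j) k₀) (pairs n))
    N = A ⊗ B ⊗ C ⊗ G ⊗ J
    D = powS (pochInf 1 1) (suc n)
    -- Supplies the n-th factor (q^κ; q^κ)_∞ beside the stated power n - 1.
    half : inf h₀ h₀ ≈ inf h₀ k₀ * inf k₀ k₀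
    half = inf-halves P h₀ h₀ (m≤n+m 1 (m ℕ.+ n)) (m≤n+m 1 (m ℕ.+ n)) (κh m n) (κh m n)
     where
     κh : ∀ m n → 2 ℕ.* m ℕ.+ 2 ℕ.* n ℕ.+ 2 ≡ (m ℕ.+ n ℕ.+ 1) ℕ.+ (m ℕ.+ n ℕ.+ 1)
     κh = ℕ-ring
    last : ∀ n → 1 ≤ n → inf k₀ k₀ * Φ (powS (pochInf k₀ k₀) (n ∸ 1)) ≈ Π n (λ _ → inf k₀ k₀)
    last (suc n) _ = *-congˡ (Φ-powS (pochInf k₀ k₀) n)
    lem : ∀ i k → suc i ℕ.+ suc k ≡ k ℕ.+ i ℕ.+ 2
    lem = ℕ-ring

open import Defs
open import Data.Nat using (ℕ; _≤_)
open import Data.Product using (_×_; _,_)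

theorem1p2 : (m n : ℕ) → 1 ≤ m → 1 ≤ n →
  (LHS m n ≈S RHS1 m n) × (LHS m n ≈S RHS2 m n)
theorem1p2 m n _ n≥1 = Formula.LHS≈RHS1 Transport.inLaurent m n n≥1 , Formula.LHS≈RHS2 Transport.inLaurent m n n≥1
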